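{- Let $(a_1,\dots,a_n)\in\mathcal J^n$, $n\ge1$, be an admissible sequence such that the cylinder set $\langle a_1,\dots,a_n\rangle$ is not full. Then, up to a set of Lebesgue measure $0$, $T^n(\langle a_1,\dots,a_n\rangle)$ is equal to one of the sets $U_{k,\ell}$, $1\le k\le5$, $1\le\ell\le6$, and it is, up to a set of Lebesgue measure $0$, a finite union of elements of $\mathcal V=\{V_{k,\ell}:1\le k,\ell\le 6\}$. Hence $T$ has a finite range structure, i.e. the family $$\{(T^n(\langle a_1,\dots,a_n\rangle))^\circ : (a_1,\dots,a_n)\text{ admissible},\ n\ge1\}$$ is a finite set.
   Context: Let $\zeta=\frac{1+\sqrt{ -3}}2$, $\eta=\frac{3+\sqrt{ -3}}2$, $\mathfrak o(\sqrt{ -3})=\mathbb Z+\mathbb Z\zeta$, $\mathcal J=\eta\cdot\mathfrak o(\sqrt{ -3})$. $U$ is the fundamental domain of $\mathbb C/\mathcal J$ consisting of the open regular hexagon with vertices $\zeta^k$ ($0\le k\le 5$), together with the three open sides $\{t\zeta+(1-t)(-\overline\zeta):0<t<1\}$, $\{t(-\zeta)+(1-t)(-1):0<t<1\}$, $\{t+(1-t)\overline\zeta:0<t<1\}$ and the two vertices $-\zeta,\overline\zeta$. For $z\in\mathbb C$, $[z]$ is the unique $a\in\mathcal J$ with $z\in a+U$. The map $T:U\to U$ is $T(z)=\frac1z-[\frac1z]$ for $z\ne0$, $T(0)=0$; $b_n(z)=[1/T^{n-1}(z)]$ (with $b_n(z)=\infty$ if $T^{n-1}(z)=0$). For $(a_1,\dots,a_n)\in\mathcal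 J^n$, the cylinder set is $\langle a_1,\dots,a_n\rangle=\{z\in U: b_1(z)=a_1,\dots,b_n(z)=a_n\}$. The sequence is admissible if its cylinder set has an interior point. $A^\circ$ denotes the interior of $A$. A cylinder set is full if $(T^n(\langle a_1,\dots,a_n\rangle))^\circ=U_0$, where $U_0:=U^\circ$. Write $z=x+yi$ and $r=\frac{\sqrt3}3$. Put $U_{1,1}=U_0\cap\{|z+\frac23\eta|>r\}$, $U_{2,1}=U_0\cap\{|z+\frac13\eta|>r\}$, $U_{3,1}=U_0\cap\{y>\sqrt3x\}$, $U_{4,1}=U_{1,1}\cap\{y>\sqrt3x\}$, $U_{5,1}=(\zeta U_{1,1})\cap\{y<\sqrt3x\}$, and $U_{k,\ell}=\zeta^{\ell-1}U_{k,1}$ for $1\le k\le5$, $1\le\ell\le6$. Put $V_{1,1}=\{z\in U:|z-\frac13\overline\eta|<r,\ |z-\frac13\sqrt{ -3}|<r\}$, $V_{2,1}=\{z\in U:|z-\frac23\eta|>r,\ |z-\frac13\sqrt{ -3}|>r,\ x>0,\ y>0\}$, $V_{3,1}=\{z\in U:|z-\frac23\eta|>r,\ |z-\frac13\overline\eta|>r,\ y>0,\ y<\sqrt3x\}$, $V_{4,1}=\{z\in U:|z-\frac13\overline\eta|<r,\ |z-\frac23\eta|<r\}$, $V_{5,1}=\{z\in U:|z-\frac23\eta|<r,\ |z-\frac13\sqrt{ -3}|<r\}$, $V_{6,1}=\{z\in U:|z-\frac13\overline\eta|>r,\ |z-\frac13\sqrt{ -3}|>r,\ x>0,\ y>0\}$,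 and $V_{k,\ell}=\zeta^{\ell-1}V_{k,1}$ for $1\le k,\ell\le6$. -}

module Defs where

open import Algebra.Bundles using (CommutativeRing)
open import Data.Fin.Base using (Fin; toℕ)
open import Data.Fin.Patterns using (0F; 1F; 2F; 3F; 4F; 5F)
open import Data.Integer.Base as ℤ using (ℤ; +_; +[1+_])
import Data.Integer.Properties as ℤ
open import Data.List.Base using (List)
open import Data.List.Relation.Unary.Any using (Any)
open import Data.Nat.Base as ℕ using (ℕ; zero; suc)
import Data.Nat.Properties as ℕ
open import Data.Product.Base using (Σ-syntax; ∃-syntax; _×_; _,_; proj₁; proj₂)
open import Data.Rational.Base as ℚ using (ℚ; mkℚ; 0ℚ; 1ℚ; ½; Positive)
import Data.Rational.Properties as ℚ
open import Algebra.Properties.CommutativeSemigroup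
  (CommutativeRing.+-commutativeSemigroup ℚ.+-*-commutativeRing) using (interchange)
open import Algebra.Properties.Group (CommutativeRing.+-group ℚ.+-*-commutativeRing)
  using (⁻¹-involutive)
import Data.Rational.Unnormalised.Base as ℚᵘ
import Data.Rational.Unnormalised.Properties as ℚᵘ
open import Data.Sum.Base using (_⊎_; inj₁; inj₂)
open import Data.Vec.Functional using (Vector)
open import Function.Bundles using (_⇔_)
open import Level using (0ℓ)
open import Relation.Binary.PropositionalEquality
  using (_≡_; refl; sym; trans; cong; cong₂; subst; module ≡-Reasoning)
open import Relation.Nullary using (¬_; yes; no; contradiction)
open import Relation.Unary
  using (Pred; _∈_; _≐_; _∩_; _∪_; _∖_; Satisfiable)

-- Reals are Cauchy sequences of rationals, with _≈_ as their equality.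

IsCauchy : (ℕ → ℚ) → Set
IsCauchy s = ∀ ε → 0ℚ ℚ.< ε →
  ∃[ N ] ∀ m n → N ℕ.≤ m → N ℕ.≤ n → ℚ.∣ s m ℚ.- s n ∣ ℚ.< ε

record ℝ : Set where
  constructor mkℝ
  field
    seq    : ℕ → ℚ
    cauchy : IsCauchy seq
open ℝ public

infix 4 _≈_ _<_ _≤_

record _≈_ (x y : ℝ) : Set where
  constructor mk≈
  field
    close : ∀ ε → 0ℚ ℚ.< ε → ∃[ N ] ∀ n → N ℕ.≤ n → ℚ.∣ seq x n ℚ.- seq y n ∣ ℚ.< ε

record _<_ (x y : ℝ) : Set where
  constructor mk<
  field
    gap      : ℚ
    gap-pos  : 0ℚ ℚ.< gap
    from     : ℕ
    separate : ∀ n → from ℕ.≤ n → seq x n ℚ.+ gap ℚ.< seq y n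

_≤_ : ℝ → ℝ → Set
x ≤ y = ¬ (y < x)

private
  half+half : ∀ ε → ½ ℚ.* ε ℚ.+ ½ ℚ.* ε ≡ ε
  half+half ε = trans (sym (ℚ.*-distribʳ-+ ε ½ ½)) (ℚ.*-identityˡ ε)

  sub-add : ∀ a b → (a ℚ.- b) ℚ.+ b ≡ a
  sub-add a b = trans (ℚ.+-assoc a (ℚ.- b) b)
    (trans (cong (a ℚ.+_) (ℚ.+-inverseˡ b)) (ℚ.+-identityʳ a))

  add-sub : ∀ a b → (a ℚ.+ b) ℚ.- a ≡ b
  add-sub a b = trans (cong (ℚ._- a) (ℚ.+-comm a b))
    (trans (ℚ.+-assoc b a (ℚ.- a)) (trans (cong (b ℚ.+_) (ℚ.+-inverseʳ a)) (ℚ.+-identityʳ b)))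

  sub+sub : ∀ a b c → (a ℚ.- b) ℚ.+ (b ℚ.- c) ≡ a ℚ.- c
  sub+sub a b c = trans (sym (ℚ.+-assoc (a ℚ.- b) b (ℚ.- c))) (cong (ℚ._- c) (sub-add a b))

  neg-neg : ∀ a → ℚ.- (ℚ.- a) ≡ a
  neg-neg = ⁻¹-involutive

  neg-sub : ∀ a b → ℚ.- (a ℚ.- b) ≡ b ℚ.- a
  neg-sub a b = trans (ℚ.neg-distrib-+ a (ℚ.- b))
    (trans (cong (ℚ.- a ℚ.+_) (neg-neg b)) (ℚ.+-comm (ℚ.- a) b))

  *-distribˡ-sub : ∀ a b c → a ℚ.* (b ℚ.- c) ≡ a ℚ.* b ℚ.- a ℚ.* c
  *-distribˡ-sub a b c = trans (ℚ.*-distribˡ-+ a b (ℚ.- c))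
    (cong (a ℚ.* b ℚ.+_) (sym (ℚ.neg-distribʳ-* a c)))

  sum-diff : ∀ a b c d → (a ℚ.+ b) ℚ.- (c ℚ.+ d) ≡ (a ℚ.- c) ℚ.+ (b ℚ.- d)
  sum-diff a b c d = trans (cong ((a ℚ.+ b) ℚ.+_) (ℚ.neg-distrib-+ c d))
    (interchange a b (ℚ.- c) (ℚ.- d))

  prod-diff : ∀ a b c d → a ℚ.* b ℚ.- c ℚ.* d ≡ a ℚ.* (b ℚ.- d) ℚ.+ d ℚ.* (a ℚ.- c)
  prod-diff a b c d = sym (trans
    (cong₂ ℚ._+_ (*-distribˡ-sub a b d)
      (trans (*-distribˡ-sub d a c) (cong₂ ℚ._-_ (ℚ.*-comm d a) (ℚ.*-comm d c))))
    (sub+sub (a ℚ.* b) (a ℚ.* d) (c ℚ.* d)))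

  square-sum : ∀ a k → (a ℚ.+ k) ℚ.* (a ℚ.+ k) ≡ a ℚ.* a ℚ.+ (a ℚ.+ a ℚ.+ k) ℚ.* k
  square-sum a k = begin
    (a ℚ.+ k) ℚ.* (a ℚ.+ k)                        ≡⟨ ℚ.*-distribˡ-+ (a ℚ.+ k) a k ⟩
    (a ℚ.+ k) ℚ.* a ℚ.+ (a ℚ.+ k) ℚ.* k            ≡⟨ cong (ℚ._+ (a ℚ.+ k) ℚ.* k) (ℚ.*-distribʳ-+ a a k) ⟩
    a ℚ.* a ℚ.+ k ℚ.* a ℚ.+ (a ℚ.+ k) ℚ.* k        ≡⟨ ℚ.+-assoc (a ℚ.* a) (k ℚ.* a) _ ⟩
    a ℚ.* a ℚ.+ (k ℚ.* a ℚ.+ (a ℚ.+ k) ℚ.* k)      ≡⟨ cong (λ t → a ℚ.* a ℚ.+ (t ℚ.+ (a ℚ.+ k) ℚ.* k)) (ℚ.*-comm k a) ⟩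
    a ℚ.* a ℚ.+ (a ℚ.* k ℚ.+ (a ℚ.+ k) ℚ.* k)      ≡⟨ cong (a ℚ.* a ℚ.+_) (sym (ℚ.*-distribʳ-+ k a (a ℚ.+ k))) ⟩
    a ℚ.* a ℚ.+ (a ℚ.+ (a ℚ.+ k)) ℚ.* k            ≡⟨ cong (λ t → a ℚ.* a ℚ.+ t ℚ.* k) (sym (ℚ.+-assoc a a k)) ⟩
    a ℚ.* a ℚ.+ (a ℚ.+ a ℚ.+ k) ℚ.* k ∎
    where open ≡-Reasoning

  half-pos : ∀ {ε} → 0ℚ ℚ.< ε → 0ℚ ℚ.< ½ ℚ.* ε
  half-pos {ε} 0<ε =
    ℚ.positive⁻¹ _ {{ℚ.pos*pos⇒pos ½ ε {{ℚ.positive 0<ε}}}}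

  const-cauchy : ∀ q → IsCauchy (λ _ → q)
  const-cauchy q ε 0<ε = 0 , λ _ _ _ _ →
    subst (ℚ._< ε) (cong ℚ.∣_∣ (sym (ℚ.+-inverseʳ q))) 0<ε

  +-cauchy : ∀ s t → IsCauchy s → IsCauchy t → IsCauchy (λ n → s n ℚ.+ t n)
  +-cauchy s t cs ct ε 0<ε
    with cs (½ ℚ.* ε) (half-pos 0<ε) | ct (½ ℚ.* ε) (half-pos 0<ε)
  ... | M , p | N , q = M ℕ.⊔ N , λ m n hm hn →
    let open ℚ.≤-Reasoning in begin-strict
    ℚ.∣ (s m ℚ.+ t m) ℚ.- (s n ℚ.+ t n) ∣
      ≡⟨ cong ℚ.∣_∣ (sum-diff (s m) (t m) (s n) (t n)) ⟩
    ℚ.∣ (s m ℚ.- s n) ℚ.+ (t m ℚ.- t n) ∣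
      ≤⟨ ℚ.∣p+q∣≤∣p∣+∣q∣ (s m ℚ.- s n) (t m ℚ.- t n) ⟩
    ℚ.∣ s m ℚ.- s n ∣ ℚ.+ ℚ.∣ t m ℚ.- t n ∣
      <⟨ ℚ.+-mono-< (p m n (ℕ.m⊔n≤o⇒m≤o M N hm) (ℕ.m⊔n≤o⇒m≤o M N hn))
                    (q m n (ℕ.m⊔n≤o⇒n≤o M N hm) (ℕ.m⊔n≤o⇒n≤o M N hn)) ⟩
    ½ ℚ.* ε ℚ.+ ½ ℚ.* ε ≡⟨ half+half ε ⟩
    ε ∎

  neg-cauchy : ∀ s → IsCauchy s → IsCauchy (λ n → ℚ.- s n)
  neg-cauchy s cs ε 0<ε with cs ε 0<ε
  ... | N , p = N , λ m n hm hn → subst (ℚ._< ε)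
    (trans (sym (ℚ.∣-p∣≡∣p∣ (s m ℚ.- s n)))
           (cong ℚ.∣_∣ (ℚ.neg-distrib-+ (s m) (ℚ.- s n))))
    (p m n hm hn)

  eventually-bounded : ∀ s → IsCauchy s →
    ∃[ N ] ∃[ B ] 0ℚ ℚ.< B × (∀ n → N ℕ.≤ n → ℚ.∣ s n ∣ ℚ.≤ B)
  eventually-bounded s cs with cs 1ℚ (ℚ.positive⁻¹ 1ℚ)
  ... | N , p = N , 1ℚ ℚ.+ ℚ.∣ s N ∣ ,
    ℚ.+-mono-<-≤ (ℚ.positive⁻¹ 1ℚ) (ℚ.0≤∣p∣ (s N)) , λ n hn →
    let open ℚ.≤-Reasoning in begin
    ℚ.∣ s n ∣                          ≡⟨ cong ℚ.∣_∣ (sym (sub-add (s n) (s N))) ⟩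
    ℚ.∣ (s n ℚ.- s N) ℚ.+ s N ∣        ≤⟨ ℚ.∣p+q∣≤∣p∣+∣q∣ (s n ℚ.- s N) (s N) ⟩
    ℚ.∣ s n ℚ.- s N ∣ ℚ.+ ℚ.∣ s N ∣    ≤⟨ ℚ.+-monoˡ-≤ ℚ.∣ s N ∣ (ℚ.<⇒≤ (p n N hn ℕ.≤-refl)) ⟩
    1ℚ ℚ.+ ℚ.∣ s N ∣ ∎

  share : ∀ {B ε} → 0ℚ ℚ.< B → 0ℚ ℚ.< ε → ∃[ δ ] 0ℚ ℚ.< δ × B ℚ.* δ ≡ ½ ℚ.* ε
  share {B} {ε} 0<B 0<ε = δ , 0<δ , eq
    where
    instance
      posB : Positive B
      posB = ℚ.positive 0<B
      nzB : ℚ.NonZero B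
      nzB = ℚ.pos⇒nonZero B
    δ : ℚ
    δ = (ℚ.1/ B) ℚ.* (½ ℚ.* ε)
    0<δ : 0ℚ ℚ.< δ
    0<δ = ℚ.positive⁻¹ _ {{ℚ.pos*pos⇒pos (ℚ.1/ B) {{ℚ.1/pos⇒pos B}} (½ ℚ.* ε) {{ℚ.positive (half-pos 0<ε)}}}}
    eq : B ℚ.* δ ≡ ½ ℚ.* ε
    eq = trans (sym (ℚ.*-assoc B (ℚ.1/ B) (½ ℚ.* ε)))
           (trans (cong (ℚ._* (½ ℚ.* ε)) (ℚ.*-inverseʳ B)) (ℚ.*-identityˡ (½ ℚ.* ε)))

  ∣*∣-bound : ∀ {B δ} a b → 0ℚ ℚ.< B → ℚ.∣ a ∣ ℚ.≤ B → ℚ.∣ b ∣ ℚ.< δ →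
              ℚ.∣ a ℚ.* b ∣ ℚ.< B ℚ.* δ
  ∣*∣-bound {B} {δ} a b 0<B ha hb = let open ℚ.≤-Reasoning in begin-strict
    ℚ.∣ a ℚ.* b ∣          ≡⟨ ℚ.∣p*q∣≡∣p∣*∣q∣ a b ⟩
    ℚ.∣ a ∣ ℚ.* ℚ.∣ b ∣    ≤⟨ ℚ.*-monoʳ-≤-nonNeg ℚ.∣ b ∣ {{ℚ.∣-∣-nonNeg b}} ha ⟩
    B ℚ.* ℚ.∣ b ∣          <⟨ ℚ.*-monoʳ-<-pos B {{ℚ.positive 0<B}} hb ⟩
    B ℚ.* δ ∎

  *-cauchy : ∀ s t → IsCauchy s → IsCauchy t → IsCauchy (λ n → s n ℚ.* t n)
  *-cauchy s t cs ct ε 0<ε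
    with eventually-bounded s cs | eventually-bounded t ct
  ... | N₁ , B , 0<B , s≤B | N₂ , C , 0<C , t≤C
    with share 0<B 0<ε | share 0<C 0<ε
  ... | δ , 0<δ , Bδ | γ , 0<γ , Cγ
    with ct δ 0<δ | cs γ 0<γ
  ... | N₃ , p | N₄ , q = K , λ m n hm hn →
    let open ℚ.≤-Reasoning in begin-strict
    ℚ.∣ s m ℚ.* t m ℚ.- s n ℚ.* t n ∣
      ≡⟨ cong ℚ.∣_∣ (prod-diff (s m) (t m) (s n) (t n)) ⟩
    ℚ.∣ s m ℚ.* (t m ℚ.- t n) ℚ.+ t n ℚ.* (s m ℚ.- s n) ∣
      ≤⟨ ℚ.∣p+q∣≤∣p∣+∣q∣ (s m ℚ.* (t m ℚ.- t n)) (t n ℚ.* (s m ℚ.- s n)) ⟩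
    ℚ.∣ s m ℚ.* (t m ℚ.- t n) ∣ ℚ.+ ℚ.∣ t n ℚ.* (s m ℚ.- s n) ∣
      <⟨ ℚ.+-mono-<
           (∣*∣-bound (s m) (t m ℚ.- t n) 0<B (s≤B m (k₁ hm)) (p m n (k₃ hm) (k₃ hn)))
           (∣*∣-bound (t n) (s m ℚ.- s n) 0<C (t≤C n (k₂ hn)) (q m n (k₄ hm) (k₄ hn))) ⟩
    B ℚ.* δ ℚ.+ C ℚ.* γ     ≡⟨ cong₂ ℚ._+_ Bδ Cγ ⟩
    ½ ℚ.* ε ℚ.+ ½ ℚ.* ε     ≡⟨ half+half ε ⟩
    ε ∎
    where
    K = (N₁ ℕ.⊔ N₂) ℕ.⊔ (N₃ ℕ.⊔ N₄)
    k₁₂ : ∀ {n} → K ℕ.≤ n → N₁ ℕ.⊔ N₂ ℕ.≤ n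
    k₁₂ = ℕ.m⊔n≤o⇒m≤o (N₁ ℕ.⊔ N₂) (N₃ ℕ.⊔ N₄)
    k₃₄ : ∀ {n} → K ℕ.≤ n → N₃ ℕ.⊔ N₄ ℕ.≤ n
    k₃₄ = ℕ.m⊔n≤o⇒n≤o (N₁ ℕ.⊔ N₂) (N₃ ℕ.⊔ N₄)
    k₁ : ∀ {n} → K ℕ.≤ n → N₁ ℕ.≤ n
    k₁ h = ℕ.m⊔n≤o⇒m≤o N₁ N₂ (k₁₂ h)
    k₂ : ∀ {n} → K ℕ.≤ n → N₂ ℕ.≤ n
    k₂ h = ℕ.m⊔n≤o⇒n≤o N₁ N₂ (k₁₂ h)
    k₃ : ∀ {n} → K ℕ.≤ n → N₃ ℕ.≤ n
    k₃ h = ℕ.m⊔n≤o⇒m≤o N₃ N₄ (k₃₄ h)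
    k₄ : ∀ {n} → K ℕ.≤ n → N₄ ℕ.≤ n
    k₄ h = ℕ.m⊔n≤o⇒n≤o N₃ N₄ (k₃₄ h)

fromℚ : ℚ → ℝ
fromℚ q = mkℝ (λ _ → q) (const-cauchy q)

0ℝ 1ℝ : ℝ
0ℝ = fromℚ 0ℚ
1ℝ = fromℚ 1ℚ

infixl 7 _*_
infixl 6 _+_ _-_
infix  8 -_

_+_ : ℝ → ℝ → ℝ
x + y = mkℝ (λ n → seq x n ℚ.+ seq y n) (+-cauchy (seq x) (seq y) (cauchy x) (cauchy y))

-_ : ℝ → ℝ
- x = mkℝ (λ n → ℚ.- seq x n) (neg-cauchy (seq x) (cauchy x))

_-_ : ℝ → ℝ → ℝ
x - y = x + - y

_*_ : ℝ → ℝ → ℝ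
x * y = mkℝ (λ n → seq x n ℚ.* seq y n) (*-cauchy (seq x) (seq y) (cauchy x) (cauchy y))

private
  3ℚ : ℚ
  3ℚ = + 3 ℚ./ 1

½^ : ℕ → ℚ
½^ zero    = 1ℚ
½^ (suc n) = ½ ℚ.* ½^ n

-- Bisection for √3 from below: √3-seq n ≤ √3 < √3-seq n + ½^ n.
√3-seq : ℕ → ℚ
√3-seq zero    = 1ℚ
√3-seq (suc n) with (√3-seq n ℚ.+ ½^ (suc n)) ℚ.* (√3-seq n ℚ.+ ½^ (suc n)) ℚ.≤? + 3 ℚ./ 1
... | yes _ = √3-seq n ℚ.+ ½^ (suc n)
... | no  _ = √3-seq n

private
  ½^-pos : ∀ n → 0ℚ ℚ.< ½^ n
  ½^-pos zero    = ℚ.positive⁻¹ 1ℚ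
  ½^-pos (suc n) = half-pos (½^-pos n)

  ½^≤1 : ∀ n → ½^ n ℚ.≤ 1ℚ
  ½^≤1 zero    = ℚ.≤-refl
  ½^≤1 (suc n) = ℚ.≤-trans (ℚ.*-monoˡ-≤-nonNeg ½ (½^≤1 n)) (ℚ.*≤* (ℤ.+≤+ (ℕ.s≤s ℕ.z≤n)))

  sq : ℚ → ℚ
  sq q = q ℚ.* q

  Bracket : ℕ → ℚ → Set
  Bracket n q = 1ℚ ℚ.≤ q × sq q ℚ.≤ 3ℚ × 3ℚ ℚ.< sq (q ℚ.+ ½^ n)

  bracket : ∀ n → Bracket n (√3-seq n)
  bracket zero = ℚ.≤-refl , ℚ.*≤* (ℤ.+≤+ (ℕ.s≤s ℕ.z≤n)) , ℚ.*<* (ℤ.+<+ (ℕ.s≤s (ℕ.s≤s (ℕ.s≤s (ℕ.s≤s ℕ.z≤n)))))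
  bracket (suc n) with bracket n
                  | sq (√3-seq n ℚ.+ ½^ (suc n)) ℚ.≤? 3ℚ
  ... | 1≤q , lo , hi | yes le =
        ℚ.≤-trans 1≤q (subst (ℚ._≤ √3-seq n ℚ.+ ½^ (suc n)) (ℚ.+-identityʳ (√3-seq n))
                        (ℚ.+-monoʳ-≤ (√3-seq n) (ℚ.<⇒≤ (½^-pos (suc n)))))
      , le
      , subst (λ q → 3ℚ ℚ.< sq q)
          (sym (trans (ℚ.+-assoc (√3-seq n) (½^ (suc n)) (½^ (suc n)))
                      (cong (√3-seq n ℚ.+_) (half+half (½^ n))))) hi
  ... | 1≤q , lo , hi | no ≰ = 1≤q , lo , ℚ.≰⇒> ≰

  0≤√3-seq : ∀ n → 0ℚ ℚ.≤ √3-seq n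
  0≤√3-seq n = ℚ.≤-trans (ℚ.<⇒≤ (ℚ.positive⁻¹ 1ℚ)) (proj₁ (bracket n))

  sq-mono-≤ : ∀ {p q} → 0ℚ ℚ.≤ p → p ℚ.≤ q → sq p ℚ.≤ sq q
  sq-mono-≤ {p} {q} 0≤p p≤q = ℚ.≤-trans
    (ℚ.*-monoʳ-≤-nonNeg p {{ℚ.nonNegative 0≤p}} p≤q)
    (ℚ.*-monoˡ-≤-nonNeg q {{ℚ.nonNegative (ℚ.≤-trans 0≤p p≤q)}} p≤q)

  √3-seq-close : ∀ m n → √3-seq m ℚ.- √3-seq n ℚ.< ½^ n
  √3-seq-close m n with √3-seq m ℚ.<? √3-seq n ℚ.+ ½^ n
  ... | yes lt = subst (√3-seq m ℚ.- √3-seq n ℚ.<_)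
        (add-sub (√3-seq n) (½^ n))
        (ℚ.+-monoˡ-< (ℚ.- √3-seq n) lt)
  ... | no ≮ = contradiction
        (ℚ.<-≤-trans (proj₂ (proj₂ (bracket n)))
          (ℚ.≤-trans (sq-mono-≤ 0≤ (ℚ.≮⇒≥ ≮)) (proj₁ (proj₂ (bracket m)))))
        (ℚ.<-irrefl refl)
    where
    0≤ : 0ℚ ℚ.≤ √3-seq n ℚ.+ ½^ n
    0≤ = ℚ.+-mono-≤ (0≤√3-seq n) (ℚ.<⇒≤ (½^-pos n))

  ι : ℕ → ℚ
  ι zero    = 0ℚ
  ι (suc n) = 1ℚ ℚ.+ ι n

  toℚᵘ-ι : ∀ n → ℚ.toℚᵘ (ι n) ℚᵘ.≃ ℚᵘ.mkℚᵘ (+ n) 0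
  toℚᵘ-ι zero    = ℚᵘ.≃-refl
  toℚᵘ-ι (suc n) = ℚᵘ.≃-trans (ℚ.toℚᵘ-homo-+ 1ℚ (ι n))
    (ℚᵘ.≃-trans (ℚᵘ.+-congʳ (ℚ.toℚᵘ 1ℚ) (toℚᵘ-ι n))
      (ℚᵘ.*≡* (cong (λ k → (+ 1 ℤ.+ k) ℤ.* + 1) (ℤ.*-identityʳ (+ n)))))

  archimedean : ∀ ε → 0ℚ ℚ.< ε → ∃[ N ] 1ℚ ℚ.≤ ι N ℚ.* ε
  archimedean ε 0<ε with ε | ℚ.positive 0<ε
  ... | e@(mkℚ +[1+ p ] d _) | _ = suc d , ℚ.toℚᵘ-cancel-≤ (begin
    ℚ.toℚᵘ 1ℚ                                  ≤⟨ ℚᵘ.*≤* (ℤ.+≤+ le) ⟩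
    ℚᵘ.mkℚᵘ (+ suc d) 0 ℚᵘ.* ℚ.toℚᵘ e          ≃⟨ ℚᵘ.*-congʳ {ℚ.toℚᵘ e} (ℚᵘ.≃-sym (toℚᵘ-ι (suc d))) ⟩
    ℚ.toℚᵘ (ι (suc d)) ℚᵘ.* ℚ.toℚᵘ e           ≃⟨ ℚᵘ.≃-sym (ℚ.toℚᵘ-homo-* (ι (suc d)) e) ⟩
    ℚ.toℚᵘ (ι (suc d) ℚ.* e) ∎)
    where
    open ℚᵘ.≤-Reasoning
    le : 1 ℕ.* (1 ℕ.* suc d) ℕ.≤ suc d ℕ.* suc p ℕ.* 1
    le = subst (λ k → k ℕ.≤ suc d ℕ.* suc p ℕ.* 1)
           (sym (trans (ℕ.*-identityˡ _) (ℕ.*-identityˡ _)))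
           (subst (suc d ℕ.≤_) (sym (ℕ.*-identityʳ _)) (ℕ.m≤m*n (suc d) (suc p)))

  0≤ι : ∀ n → 0ℚ ℚ.≤ ι n
  0≤ι zero    = ℚ.≤-refl
  0≤ι (suc n) = ℚ.+-mono-≤ (ℚ.<⇒≤ (ℚ.positive⁻¹ 1ℚ)) (0≤ι n)

  ι*½^<1 : ∀ n → ι n ℚ.* ½^ n ℚ.< 1ℚ
  ι*½^<1 zero    = ℚ.positive⁻¹ 1ℚ
  ι*½^<1 (suc n) = let open ℚ.≤-Reasoning in begin-strict
    (1ℚ ℚ.+ ι n) ℚ.* (½ ℚ.* ½^ n)
      ≡⟨ ℚ.*-distribʳ-+ (½ ℚ.* ½^ n) 1ℚ (ι n) ⟩
    1ℚ ℚ.* (½ ℚ.* ½^ n) ℚ.+ ι n ℚ.* (½ ℚ.* ½^ n)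
      ≡⟨ cong₂ ℚ._+_ (ℚ.*-identityˡ (½ ℚ.* ½^ n))
           (trans (sym (ℚ.*-assoc (ι n) ½ (½^ n)))
             (trans (cong (ℚ._* ½^ n) (ℚ.*-comm (ι n) ½)) (ℚ.*-assoc ½ (ι n) (½^ n)))) ⟩
    ½ ℚ.* ½^ n ℚ.+ ½ ℚ.* (ι n ℚ.* ½^ n)
      <⟨ ℚ.+-mono-≤-< (ℚ.*-monoˡ-≤-nonNeg ½ (½^≤1 n)) (ℚ.*-monoʳ-<-pos ½ (ι*½^<1 n)) ⟩
    ½ ℚ.* 1ℚ ℚ.+ ½ ℚ.* 1ℚ ≡⟨ refl ⟩
    1ℚ ∎

  ι-mono : ∀ {m n} → m ℕ.≤ n → ι m ℚ.≤ ι n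
  ι-mono {n = n} ℕ.z≤n = 0≤ι n
  ι-mono (ℕ.s≤s h)     = ℚ.+-monoʳ-≤ 1ℚ (ι-mono h)

½^→0 : ∀ ε → 0ℚ ℚ.< ε → ∃[ N ] ∀ n → N ℕ.≤ n → ½^ n ℚ.< ε
½^→0 ε 0<ε with archimedean ε 0<ε
... | N , 1≤Nε = N , λ n N≤n →
  ℚ.*-cancelˡ-<-nonNeg (ι n) {{ℚ.nonNegative (0≤ι n)}}
    (ℚ.<-≤-trans (ι*½^<1 n) (ℚ.≤-trans 1≤Nε
      (ℚ.*-monoʳ-≤-nonNeg ε {{ℚ.nonNegative (ℚ.<⇒≤ 0<ε)}} (ι-mono N≤n))))

private
  ∣∣<-intro : ∀ {p ε} → p ℚ.< ε → ℚ.- p ℚ.< ε → ℚ.∣ p ∣ ℚ.< ε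
  ∣∣<-intro {p} {ε} h₁ h₂ with ℚ.∣p∣≡p∨∣p∣≡-p p
  ... | inj₁ e = subst (ℚ._< ε) (sym e) h₁
  ... | inj₂ e = subst (ℚ._< ε) (sym e) h₂

  √3-seq-cauchy : IsCauchy √3-seq
  √3-seq-cauchy ε 0<ε with ½^→0 ε 0<ε
  ... | N , h = N , λ m n hm hn → ∣∣<-intro
    (ℚ.<-trans (√3-seq-close m n) (h n hn))
    (subst (ℚ._< ε) (sym (neg-sub (√3-seq m) (√3-seq n)))
      (ℚ.<-trans (√3-seq-close n m) (h m hm)))

private
  √3-seq-square : ∀ ε → 0ℚ ℚ.< ε →
    ∃[ N ] ∀ n → N ℕ.≤ n → ℚ.∣ sq (√3-seq n) ℚ.- 3ℚ ∣ ℚ.< ε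
  √3-seq-square ε 0<ε with share {+ 5 ℚ./ 1} (ℚ.positive⁻¹ (+ 5 ℚ./ 1)) 0<ε
  ... | δ , 0<δ , eq with ½^→0 δ 0<δ
  ... | N , h = N , λ n hn → ∣∣<-intro
      (ℚ.≤-<-trans (nonpos n) 0<ε)
      (let open ℚ.≤-Reasoning in begin-strict
       ℚ.- (sq (s n) ℚ.- 3ℚ)
         ≡⟨ neg-sub (sq (s n)) 3ℚ ⟩
       3ℚ ℚ.- sq (s n)
         <⟨ ℚ.+-monoˡ-< (ℚ.- sq (s n)) (proj₂ (proj₂ (bracket n))) ⟩
       sq (s n ℚ.+ ½^ n) ℚ.- sq (s n)
         ≡⟨ trans (cong (ℚ._- sq (s n)) (square-sum (s n) (½^ n)))
                  (add-sub (sq (s n)) ((s n ℚ.+ s n ℚ.+ ½^ n) ℚ.* ½^ n)) ⟩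
       (s n ℚ.+ s n ℚ.+ ½^ n) ℚ.* ½^ n
         ≤⟨ ℚ.*-monoʳ-≤-nonNeg (½^ n) {{ℚ.nonNegative (ℚ.<⇒≤ (½^-pos n))}}
              (ℚ.+-mono-≤ (ℚ.+-mono-≤ (s≤2 n) (s≤2 n)) (½^≤1 n)) ⟩
       (+ 5 ℚ./ 1) ℚ.* ½^ n
         <⟨ ℚ.*-monoʳ-<-pos (+ 5 ℚ./ 1) (h n hn) ⟩
       (+ 5 ℚ./ 1) ℚ.* δ   ≡⟨ eq ⟩
       ½ ℚ.* ε             ≤⟨ ℚ.<⇒≤ half< ⟩
       ε ∎)
    where
    s : ℕ → ℚ
    s = √3-seq
    half< : ½ ℚ.* ε ℚ.< ε
    half< = subst (½ ℚ.* ε ℚ.<_) (half+half ε)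
      (subst (ℚ._< ½ ℚ.* ε ℚ.+ ½ ℚ.* ε) (ℚ.+-identityʳ (½ ℚ.* ε))
        (ℚ.+-monoʳ-< (½ ℚ.* ε) (half-pos 0<ε)))
    nonpos : ∀ n → sq (s n) ℚ.- 3ℚ ℚ.≤ 0ℚ
    nonpos n = subst (sq (s n) ℚ.- 3ℚ ℚ.≤_) (ℚ.+-inverseʳ 3ℚ)
      (ℚ.+-monoˡ-≤ (ℚ.- 3ℚ) (proj₁ (proj₂ (bracket n))))
    s≤2 : ∀ n → s n ℚ.≤ + 2 ℚ./ 1
    s≤2 n = subst (ℚ._≤ + 2 ℚ./ 1)
      (sub-add (s n) 1ℚ)
      (ℚ.+-monoˡ-≤ 1ℚ (ℚ.<⇒≤ (√3-seq-close n 0)))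

√3 : ℝ
√3 = mkℝ √3-seq √3-seq-cauchy

0<√3 : 0ℝ < √3
0<√3 = mk< ½ (ℚ.positive⁻¹ ½) 0 λ n _ →
  ℚ.<-≤-trans (ℚ.*<* (ℤ.+<+ (ℕ.s≤s (ℕ.s≤s ℕ.z≤n)))) (proj₁ (bracket n))

√3*√3≈3 : √3 * √3 ≈ fromℚ (+ 3 ℚ./ 1)
√3*√3≈3 = mk≈ √3-seq-square

infix  4 _≈ᶜ_
infixl 7 _*ᶜ_ _•_
infixl 6 _+ᶜ_ _-ᶜ_
infix  8 -ᶜ_
infixr 9 _^ᶜ_

record ℂ : Set where
  constructor mkℂ
  field
    re im : ℝ
open ℂ public

_≈ᶜ_ : ℂ → ℂ → Set
z ≈ᶜ w = (re z ≈ re w) × (im z ≈ im w)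

fromℝ : ℝ → ℂ
fromℝ x = mkℂ x 0ℝ

0ᶜ 1ᶜ : ℂ
0ᶜ = fromℝ 0ℝ
1ᶜ = fromℝ 1ℝ

_+ᶜ_ _-ᶜ_ _*ᶜ_ : ℂ → ℂ → ℂ
z +ᶜ w = mkℂ (re z + re w) (im z + im w)
z -ᶜ w = mkℂ (re z - re w) (im z - im w)
z *ᶜ w = mkℂ (re z * re w - im z * im w) (re z * im w + im z * re w)

-ᶜ_ : ℂ → ℂ
-ᶜ z = mkℂ (- re z) (- im z)

_•_ : ℝ → ℂ → ℂ
t • z = mkℂ (t * re z) (t * im z)

conj : ℂ → ℂ
conj z = mkℂ (re z) (- im z)

_^ᶜ_ : ℂ → ℕ → ℂ
z ^ᶜ zero  = 1ᶜ
z ^ᶜ suc n = z *ᶜ z ^ᶜ n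

normSq : ℂ → ℝ
normSq z = re z * re z + im z * im z

-- The comparison of |z| with r, valid for r ≥ 0 (the only case used).
∣_∣<_ ∣_∣>_ : ℂ → ℝ → Set
∣ z ∣< r = normSq z < r * r
∣ z ∣> r = r * r < normSq z

Region : Set₁
Region = Pred ℂ 0ℓ

_·_ : ℂ → Region → Region
(c · A) z = ∃[ w ] w ∈ A × z ≈ᶜ c *ᶜ w

_⊕_ : ℂ → Region → Region
(a ⊕ A) z = ∃[ w ] w ∈ A × z ≈ᶜ a +ᶜ w

Interior : Region → Region
Interior A z = ∃[ ε ] 0ℝ < ε × (∀ w → ∣ w -ᶜ z ∣< ε → w ∈ A)

record Box : Set where
  field
    left right bottom top : ℝ
    left≤right : left ≤ right
    bottom≤top : bottom ≤ top

  area : ℝ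
  area = (right - left) * (top - bottom)

  inside : Region
  inside z = (left < re z × re z < right) × (bottom < im z × im z < top)
open Box public

∑< : ℕ → (ℕ → ℝ) → ℝ
∑< zero    f = 0ℝ
∑< (suc n) f = ∑< n f + f n

Null : Region → Set
Null A = ∀ ε → 0ℝ < ε → Σ[ B ∈ (ℕ → Box) ]
  (∀ z → z ∈ A → ∃[ j ] z ∈ inside (B j)) ×
  (∀ n → ∑< n (λ j → area (B j)) ≤ ε)

infix 4 _≐ᵃᵉ_

_≐ᵃᵉ_ : Region → Region → Set
A ≐ᵃᵉ B = Null ((A ∖ B) ∪ (B ∖ A))

½ℝ ⅓ ⅔ 3ℝ : ℝ
½ℝ = fromℚ ½
⅓  = fromℚ (+ 1 ℚ./ 3)
⅔  = fromℚ (+ 2 ℚ./ 3)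
3ℝ = fromℚ (+ 3 ℚ./ 1)

√-3 ζ η : ℂ
√-3 = mkℂ 0ℝ √3
ζ   = ½ℝ • (1ᶜ +ᶜ √-3)
η   = ½ℝ • (fromℝ 3ℝ +ᶜ √-3)

fromℤ : ℤ → ℝ
fromℤ m = fromℚ (m ℚ./ 1)

𝔬 : Region
𝔬 z = ∃[ m ] ∃[ n ] z ≈ᶜ fromℝ (fromℤ m) +ᶜ fromℤ n • ζ

𝒥 : Region
𝒥 = η · 𝔬

-- Positive exactly when the rotation from u to v is counterclockwise.
cross : ℂ → ℂ → ℝ
cross u v = re u * im v - im u * re v

-- The convex polygon with vertices ζ^0, …, ζ^5 in counterclockwise order, as
-- the set of points strictly to the left of every oriented edge.
Hexagon : Region
Hexagon z = ∀ (k : Fin 6) → let p = ζ ^ᶜ toℕ k; q = ζ ^ᶜ suc (toℕ k) in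
  0ℝ < cross (q -ᶜ p) (z -ᶜ p)

OpenSegment : ℂ → ℂ → Region
OpenSegment p q z = ∃[ t ] 0ℝ < t × t < 1ℝ × z ≈ᶜ t • p +ᶜ (1ℝ - t) • q

U : Region
U = Hexagon
  ∪ OpenSegment ζ (-ᶜ conj ζ)
  ∪ OpenSegment (-ᶜ ζ) (-ᶜ 1ᶜ)
  ∪ OpenSegment 1ᶜ (conj ζ)
  ∪ (λ z → z ≈ᶜ -ᶜ ζ)
  ∪ (λ z → z ≈ᶜ conj ζ)

U₀ : Region
U₀ = Interior U

-- The bracket is discontinuous, so it cannot be a function on ℂ here; it, T
-- and the iterates of T are given by their graphs.

[_]≡_ : ℂ → ℂ → Set
[ z ]≡ a = a ∈ 𝒥 × z ∈ a ⊕ U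

_IsReciprocalOf_ : ℂ → ℂ → Set
v IsReciprocalOf z = z *ᶜ v ≈ᶜ 1ᶜ

T : ℂ → ℂ → Set
T z w = (z ≈ᶜ 0ᶜ × w ≈ᶜ 0ᶜ)
      ⊎ (∃[ v ] ∃[ a ] v IsReciprocalOf z × [ v ]≡ a × w ≈ᶜ v -ᶜ a)

T^ : ℕ → ℂ → ℂ → Set
T^ zero    z w = w ≈ᶜ z
T^ (suc n) z w = ∃[ u ] T^ n z u × T u w

-- b i z a means b_{i+1}(z) = a; it fails for every a when T^i(z) = 0, which is
-- the case b_{i+1}(z) = ∞.
b : ℕ → ℂ → ℂ → Set
b i z a = ∃[ u ] ∃[ v ] T^ i z u × v IsReciprocalOf u × [ v ]≡ a

Cylinder : ∀ {n} → Vector ℂ n → Region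
Cylinder a z = z ∈ U × (∀ i → b (toℕ i) z (a i))

Admissible : ∀ {n} → Vector ℂ n → Set
Admissible a = Satisfiable (Interior (Cylinder a))

-- T^n⟨a₁, …, aₙ⟩
Range : ∀ {n} → Vector ℂ n → Region
Range {n} a w = ∃[ z ] z ∈ Cylinder a × T^ n z w

Full : ∀ {n} → Vector ℂ n → Set
Full a = Interior (Range a) ≐ U₀

r : ℝ
r = ⅓ * √3

Above Below : Region
Above z = √3 * re z < im z
Below z = im z < √3 * re z

-- Index 0 of U-base, V-base and of ℓ below stands for the customary index 1.
U-base : Fin 5 → Region
U-base 0F = U₀ ∩ (λ z → ∣ z +ᶜ ⅔ • η ∣> r)
U-base 1F = U₀ ∩ (λ z → ∣ z +ᶜ ⅓ • η ∣> r)
U-base 2F = U₀ ∩ Above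
U-base 3F = U-base 0F ∩ Above
U-base 4F = (ζ · U-base 0F) ∩ Below

U[_,_] : Fin 5 → Fin 6 → Region
U[ k , ℓ ] = (ζ ^ᶜ toℕ ℓ) · U-base k

Near Far : ℂ → Region
Near c z = ∣ z -ᶜ c ∣< r
Far  c z = ∣ z -ᶜ c ∣> r

FirstQuadrant : Region
FirstQuadrant z = 0ℝ < re z × 0ℝ < im z

V-base : Fin 6 → Region
V-base 0F = U ∩ Near (⅓ • conj η) ∩ Near (⅓ • √-3)
V-base 1F = U ∩ Far (⅔ • η) ∩ Far (⅓ • √-3) ∩ FirstQuadrant
V-base 2F = U ∩ Far (⅔ • η) ∩ Far (⅓ • conj η) ∩ (λ z → 0ℝ < im z) ∩ Below
V-base 3F = U ∩ Near (⅓ • conj η) ∩ Near (⅔ • η)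
V-base 4F = U ∩ Near (⅔ • η) ∩ Near (⅓ • √-3)
V-base 5F = U ∩ Far (⅓ • conj η) ∩ Far (⅓ • √-3) ∩ FirstQuadrant

V[_,_] : Fin 6 → Fin 6 → Region
V[ k , ℓ ] = (ζ ^ᶜ toℕ ℓ) · V-base k

⋃V : List (Fin 6 × Fin 6) → Region
⋃V L z = Any (λ (k , ℓ) → z ∈ V[ k , ℓ ]) L

RangeFamily : Pred Region 0ℓ
RangeFamily S = ∃[ n ] Σ[ a ∈ Vector ℂ n ]
  1 ℕ.≤ n × (∀ i → a i ∈ 𝒥) × Admissible a × S ≐ Interior (Range a)

-- A family of sets, taken up to extensional equality, that can be listed.
FiniteFamily : Pred Region 0ℓ → Set₁
FiniteFamily F = Σ[ L ∈ List Region ] (∀ S → S ∈ F ⇔ Any (S ≐_) L)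

-- With λ_k the linear functional equal to 1 on the k-th side of the hexagon and
-- N z = |z|², inversion z = 1/v turns the line λ_k = 1 into the circle N = λ_k,
-- fixes the circle N + 1 = 2 λ_k and the line λ_k = 0 up to reflection, and a
-- translation by one of the six lattice points nearest to 0 exchanges the two
-- kinds of circles where they meet the hexagon; all other lattice points are so
-- far away that only lines matter.  Hence T maps the interior of a set cut out of
-- the hexagon by at most two of these conditions, restricted to the points with a
-- given bracket, onto another such set, and starting from the hexagon only 31
-- sets occur: the hexagon and the U_{k,ℓ}.
-- The range of a cylinder lies between such an open set and its closure.  The
-- difference, like that between U_{k,ℓ} and the union of the V_{k,ℓ} it contains,
-- lies on finitely many lines and circles, which small rectangles cover.
module Submission where

-- The inequalities are between constructive reals, where neither x < y nor x = y can be decided, so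
-- a point cannot simply be assigned to a cell of a partition. Three devices replace such case
-- distinctions. Lattice points are given by integers, so the state of a range is computed by a
-- finite automaton whose transitions are checked by evaluation. Strict and weak forms of the
-- conditions are carried separately: interior points of a range satisfy the strict ones, all its
-- points the weak ones, and the strict ones suffice for membership. Where signs must be known, a
-- point is either apart from all 24 curves or within δ of one of them, and the points of the second
-- kind are covered. The coordinates (x , y) of x + y√-3 turn every λ_k and N into polynomials with
-- integer coefficients; √3 enters only in the passage from `ℂ`. With a = λ_k and b = λ_(k+1) one
-- has N = a² - ab + b² for every k, so one computation serves all six directions. Square roots are
-- avoided as well: distances are compared through squares, and circles are covered with the help of
-- approximate roots on a grid.

open import Algebra.Bundles using (CommutativeRing)
open import Algebra.Structures using (IsCommutativeRing)
open import Data.Bool.Base using (Bool; true; false; _∧_; _∨_) renaming (T to IsTrue)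
open import Data.Bool.ListAction using (all)
open import Data.Bool.Properties using (T-∧; T-∨) renaming (T? to isTrue?)
open import Data.Empty using (⊥; ⊥-elim)
open import Data.Fin.Base using (Fin; toℕ; opposite)
open import Data.Fin.Patterns using (0F; 1F; 2F; 3F; 4F; 5F)
open import Data.Fin.Properties as Fin using (all?)
open import Data.Integer.Base as ℤ using (ℤ; +_; +[1+_]; -[1+_])
import Data.Integer.Properties as ℤ
open import Data.List.Base using (List; []; _∷_; _++_; map; length; filter; cartesianProduct)
open import Data.List.Membership.Propositional renaming (_∈_ to _∈ˡ_)
open import Data.List.Membership.Propositional.Properties using (∈-filter⁺; ∈-filter⁻; ∈-cartesianProduct⁺)
open import Data.List.Properties using (length-++)
open import Data.List.Relation.Unary.All as All using (All; []; _∷_)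
import Data.List.Relation.Unary.All.Properties as All
open import Data.List.Relation.Unary.Any as Any using (Any; here; there)
import Data.List.Relation.Unary.Any.Properties as Any
open import Data.Maybe.Base using (Maybe; just; nothing)
open import Data.Nat.Base as ℕ using (ℕ; zero; suc)
import Data.Nat.Properties as ℕ
open import Data.Product.Base using (_×_; _,_; proj₁; proj₂; ∃-syntax; Σ-syntax)
open import Data.Sum.Base using (_⊎_; inj₁; inj₂; [_,_]′)
open import Data.Unit.Base using (⊤; tt)
open import Data.Vec.Base as Vec using (Vec)
open import Data.Vec.N-ary using (N-ary; Eq; _$ⁿ_; curryⁿ; curryⁿ-cong)
open import Function.Bundles using (Equivalence)
open import Level using (0ℓ)
open import Relation.Binary.PropositionalEquality as ≡ using (_≡_)
open import Relation.Nullary using (¬_; yes; no; does)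
open import Relation.Nullary.Decidable using (toWitness)

-- Equalities of the ring are decided on closed normal forms with integer
-- coefficients, so that checking a proof never evaluates the ring operations.
module RingSolver {c ℓ} (R : CommutativeRing c ℓ) where
  open CommutativeRing R renaming (ring to underlyingRing)
  open import Algebra.Properties.Ring underlyingRing
    using (-‿distribˡ-*; -‿distribʳ-*; -‿involutive; -0#≈0#)
  open import Algebra.Properties.Group +-group using (x∙y⁻¹≈ε⇒x≈y)
  open import Algebra.Properties.AbelianGroup +-abelianGroup using (⁻¹-∙-comm)
  import Algebra.Properties.Semiring.Mult.TCOptimised semiring as Mult
  open import Tactic.RingSolver.Core.Polynomial.Parameters
  open import Tactic.RingSolver.Core.Expression public
    renaming (_⊕_ to _:+_; _⊗_ to _:*_; ⊝_ to :-_; _⊛_ to _:^_; Κ to con; Ι to var)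
  import Tactic.RingSolver.Core.AlmostCommutativeRing as ACR
  open import Relation.Binary.Reasoning.Setoid setoid

  ⟦_⟧ℤ : ℤ → Carrier
  ⟦ + n ⟧ℤ      = n Mult.× 1#
  ⟦ -[1+ n ] ⟧ℤ = - (suc n Mult.× 1#)

  neg-homo : ∀ i → ⟦ ℤ.- i ⟧ℤ ≈ - ⟦ i ⟧ℤ
  neg-homo (+ zero) = sym -0#≈0#
  neg-homo +[1+ n ] = refl
  neg-homo -[1+ n ] = sym (-‿involutive _)

  ⊖-homo : ∀ m n → ⟦ m ℤ.⊖ n ⟧ℤ ≈ ⟦ + m ⟧ℤ - ⟦ + n ⟧ℤ
  ⊖-homo m zero = sym (trans (+-congˡ -0#≈0#) (+-identityʳ _))
  ⊖-homo zero (suc n) = sym (+-identityˡ _)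
  ⊖-homo (suc m) (suc n) = begin
    ⟦ suc m ℤ.⊖ suc n ⟧ℤ              ≡⟨ ≡.cong ⟦_⟧ℤ (ℤ.[1+m]⊖[1+n]≡m⊖n m n) ⟩
    ⟦ m ℤ.⊖ n ⟧ℤ                      ≈⟨ ⊖-homo m n ⟩
    m Mult.× 1# - n Mult.× 1#         ≈⟨ +-congʳ (sym (trans (+-congʳ (+-comm 1# _)) (trans (+-assoc _ 1# (- 1#)) (trans (+-congˡ (-‿inverseʳ 1#)) (+-identityʳ _))))) ⟩
    1# + m Mult.× 1# - 1# - n Mult.× 1# ≈⟨ +-assoc _ _ _ ⟩
    1# + m Mult.× 1# + (- 1# - n Mult.× 1#) ≈⟨ +-congˡ (⁻¹-∙-comm 1# _) ⟩
    1# + m Mult.× 1# - (1# + n Mult.× 1#) ≈⟨ +-cong (sym (Mult.1+× m 1#)) (-‿cong (sym (Mult.1+× n 1#))) ⟩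
    suc m Mult.× 1# - suc n Mult.× 1# ∎

  +-homo : ∀ i j → ⟦ i ℤ.+ j ⟧ℤ ≈ ⟦ i ⟧ℤ + ⟦ j ⟧ℤ
  +-homo (+ m)    (+ n)    = Mult.×-homo-+ 1# m n
  +-homo (+ m)    -[1+ n ] = ⊖-homo m (suc n)
  +-homo -[1+ m ] (+ n)    = trans (⊖-homo n (suc m)) (+-comm _ _)
  +-homo -[1+ m ] -[1+ n ] = begin
    - (suc (suc (m ℕ.+ n)) Mult.× 1#)       ≡⟨ ≡.cong (λ k → - (suc k Mult.× 1#)) (ℕ.+-suc m n) ⟨
    - ((suc m ℕ.+ suc n) Mult.× 1#)         ≈⟨ -‿cong (Mult.×-homo-+ 1# (suc m) (suc n)) ⟩
    - (suc m Mult.× 1# + suc n Mult.× 1#)   ≈⟨ ⁻¹-∙-comm _ _ ⟨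
    - (suc m Mult.× 1#) - suc n Mult.× 1#   ∎

  *-homo : ∀ i j → ⟦ i ℤ.* j ⟧ℤ ≈ ⟦ i ⟧ℤ * ⟦ j ⟧ℤ
  *-homo (+ m) (+ n) = trans (reflexive (≡.cong ⟦_⟧ℤ (≡.sym (ℤ.pos-* m n)))) (Mult.×1-homo-* m n)
  *-homo (+ m) -[1+ n ] = begin
    ⟦ + m ℤ.* -[1+ n ] ⟧ℤ           ≡⟨ ≡.cong ⟦_⟧ℤ (ℤ.neg-distribʳ-* (+ m) (+ suc n)) ⟨
    ⟦ ℤ.- (+ m ℤ.* + suc n) ⟧ℤ      ≈⟨ neg-homo (+ m ℤ.* + suc n) ⟩
    - ⟦ + m ℤ.* + suc n ⟧ℤ          ≈⟨ -‿cong (*-homo (+ m) (+ suc n)) ⟩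
    - (⟦ + m ⟧ℤ * ⟦ + suc n ⟧ℤ)     ≈⟨ -‿distribʳ-* _ _ ⟩
    ⟦ + m ⟧ℤ * ⟦ -[1+ n ] ⟧ℤ        ∎
  *-homo -[1+ m ] j = begin
    ⟦ -[1+ m ] ℤ.* j ⟧ℤ             ≡⟨ ≡.cong ⟦_⟧ℤ (ℤ.neg-distribˡ-* (+ suc m) j) ⟨
    ⟦ ℤ.- (+ suc m ℤ.* j) ⟧ℤ        ≈⟨ neg-homo (+ suc m ℤ.* j) ⟩
    - ⟦ + suc m ℤ.* j ⟧ℤ            ≈⟨ -‿cong (*-homo⁺ j) ⟩
    - (⟦ + suc m ⟧ℤ * ⟦ j ⟧ℤ)       ≈⟨ -‿distribˡ-* _ _ ⟩
    ⟦ -[1+ m ] ⟧ℤ * ⟦ j ⟧ℤ          ∎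
    where
    *-homo⁺ : ∀ j → ⟦ + suc m ℤ.* j ⟧ℤ ≈ ⟦ + suc m ⟧ℤ * ⟦ j ⟧ℤ
    *-homo⁺ (+ n) = trans (reflexive (≡.cong ⟦_⟧ℤ (≡.sym (ℤ.pos-* (suc m) n)))) (Mult.×1-homo-* (suc m) n)
    *-homo⁺ -[1+ n ] = begin
      ⟦ + suc m ℤ.* -[1+ n ] ⟧ℤ           ≡⟨ ≡.cong ⟦_⟧ℤ (ℤ.neg-distribʳ-* (+ suc m) (+ suc n)) ⟨
      ⟦ ℤ.- (+ suc m ℤ.* + suc n) ⟧ℤ      ≈⟨ neg-homo (+ suc m ℤ.* + suc n) ⟩
      - ⟦ + suc m ℤ.* + suc n ⟧ℤ          ≈⟨ -‿cong (*-homo⁺ (+ suc n)) ⟩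
      - (⟦ + suc m ⟧ℤ * ⟦ + suc n ⟧ℤ)     ≈⟨ -‿distribʳ-* _ _ ⟩
      ⟦ + suc m ⟧ℤ * ⟦ -[1+ n ] ⟧ℤ        ∎

  isZero : ℤ → Bool
  isZero (+ zero) = true
  isZero _        = false

  homo : Homomorphism _ _ _ _
  homo = record
    { from = record { rawRing = ℤ.+-*-rawRing ; isZero = isZero }
    ; to = ACR.fromCommutativeRing R (λ _ → Data.Maybe.Base.nothing)
    ; morphism = record
      { ⟦_⟧ = ⟦_⟧ℤ ; +-homo = +-homo ; *-homo = *-homo ; -‿homo = neg-homo
      ; 0-homo = refl ; 1-homo = refl }
    ; Zero-C⟶Zero-R = λ { (+ zero) _ → refl } }
    where import Data.Maybe.Base

  open Eval rawRing ⟦_⟧ℤ public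
  open import Tactic.RingSolver.Core.Polynomial.Base (Homomorphism.from homo) hiding (NonZero)
  open import Tactic.RingSolver.Core.Polynomial.Semantics homo renaming (⟦_⟧ to ⟦_⟧ₚ)
  open import Tactic.RingSolver.Core.Polynomial.Homomorphism homo
  open import Algebra.Properties.Semiring.Exp.TCOptimised semiring using (^-congˡ)

  normalise : ∀ {n} → Expr ℤ n → Poly n
  normalise (con x)   = κ x
  normalise (var x)   = ι x
  normalise (x :+ y) = normalise x ⊞ normalise y
  normalise (x :* y) = normalise x ⊠ normalise y
  normalise (:- x)   = ⊟ normalise x
  normalise (x :^ i) = normalise x ⊡ i

  correct : ∀ {n} (e : Expr ℤ n) ρ → ⟦ normalise e ⟧ₚ ρ ≈ ⟦ e ⟧ ρ
  correct (con x)   ρ = κ-hom x ρ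
  correct (var x)   ρ = ι-hom x ρ
  correct (x :+ y) ρ = trans (⊞-hom (normalise x) (normalise y) ρ) (+-cong (correct x ρ) (correct y ρ))
  correct (x :* y) ρ = trans (⊠-hom (normalise x) (normalise y) ρ) (*-cong (correct x ρ) (correct y ρ))
  correct (:- x)   ρ = trans (⊟-hom (normalise x) ρ) (-‿cong (correct x ρ))
  correct (x :^ i) ρ = trans (⊡-hom (normalise x) i ρ) (^-congˡ i (correct x ρ))

  isZeroPoly : ∀ {n} → Poly n → Bool
  isZeroPoly (Κ (+ zero) ⊐ _) = true
  isZeroPoly _                = false

  isZeroPoly-sound : ∀ {n} (p : Poly n) → IsTrue (isZeroPoly p) → ∀ ρ → ⟦ p ⟧ₚ ρ ≈ 0#
  isZeroPoly-sound (Κ (+ zero) ⊐ _) _ ρ = refl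

  prove : ∀ {n} (e f : Expr ℤ n) → IsTrue (isZeroPoly (normalise (e :+ :- f))) → ∀ ρ → ⟦ e ⟧ ρ ≈ ⟦ f ⟧ ρ
  prove e f h ρ = x∙y⁻¹≈ε⇒x≈y _ _ (trans (sym (correct (e :+ :- f) ρ)) (isZeroPoly-sound (normalise (e :+ :- f)) h ρ))

  infix 4 _:=_
  infixl 6 _:-_

  _:=_ : ∀ {n} → Expr ℤ n → Expr ℤ n → Expr ℤ n × Expr ℤ n
  _:=_ = _,_

  _:-_ : ∀ {n} → Expr ℤ n → Expr ℤ n → Expr ℤ n
  e :- f = e :+ :- f

  κ0 κ1 κ2 κ3 κ4 : ∀ {n} → Expr ℤ n
  κ0 = con (+ 0)
  κ1 = con (+ 1)
  κ2 = con (+ 2)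
  κ3 = con (+ 3)
  κ4 = con (+ 4)

  close : ∀ n → N-ary n (Expr ℤ n) (Expr ℤ n × Expr ℤ n) → Expr ℤ n × Expr ℤ n
  close n f = f $ⁿ Vec.map var (Vec.allFin n)

  -- The implicit argument computes to the unit type exactly when the difference of both sides
  -- normalises to zero. It is then filled in by η, while a false identity does not type-check.
  ring : ∀ n (f : N-ary n (Expr ℤ n) (Expr ℤ n × Expr ℤ n)) →
         {_ : IsTrue (isZeroPoly (normalise (proj₁ (close n f) :+ :- proj₂ (close n f))))} →
         Eq n _≈_ (curryⁿ ⟦ proj₁ (close n f) ⟧) (curryⁿ ⟦ proj₂ (close n f) ⟧)
  ring n f {h} = curryⁿ-cong _≈_ ⟦ proj₁ (close n f) ⟧ ⟦ proj₂ (close n f) ⟧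
    (prove (proj₁ (close n f)) (proj₂ (close n f)) h)

-- Archimedean ordered fields with an undecidable order

record OrderedField : Set₁ where
  infix 4 _<_
  field
    commutativeRing : CommutativeRing 0ℓ 0ℓ
  open CommutativeRing commutativeRing public
    using (Carrier; _≈_; _+_; _*_; -_; 0#; 1#)
  field
    _<_         : Carrier → Carrier → Set
    <-irrefl    : ∀ {x y} → x ≈ y → ¬ x < y
    <-trans     : ∀ {x y z} → x < y → y < z → x < z
    <-resp-≈    : ∀ {x x′ y y′} → x ≈ x′ → y ≈ y′ → x < y → x′ < y′
    -- The constructive substitute for trichotomy: of two overlapping alternatives one can always be
    -- chosen.
    <-cotrans   : ∀ {x y} → x < y → ∀ z → x < z ⊎ z < y
    +-monoˡ-<   : ∀ {x y} z → x < y → x + z < y + z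
    *-0<        : ∀ {x y} → 0# < x → 0# < y → 0# < x * y
    0≤square    : ∀ x → ¬ x * x < 0#
    0<1         : 0# < 1#
    archimedean : ∀ x → ∃[ n ] x < RingSolver.⟦_⟧ℤ commutativeRing (+ n)
    reciprocal  : ∀ {x} → 0# < x → ∃[ y ] 0# < y × x * y ≈ 1#

-- The Cauchy reals as an ordered field

module RealField where
  open import Defs
  open import Data.Rational.Base as ℚ using (ℚ; mkℚ; 0ℚ; 1ℚ; ½)
  import Data.Rational.Properties as ℚ
  open import Relation.Binary.PropositionalEquality
    using (refl; sym; trans; cong; cong₂; subst; subst₂)
  open import Relation.Nullary using (contradiction)

  Eventually : (ℕ → Set) → Set
  Eventually Φ = ∃[ N ] ∀ n → N ℕ.≤ n → Φ n

  eventually-zip : ∀ {Φ Ψ Θ : ℕ → Set} → (∀ n → Φ n → Ψ n → Θ n) →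
                   Eventually Φ → Eventually Ψ → Eventually Θ
  eventually-zip f (M , p) (N , q) = M ℕ.⊔ N , λ n h →
    f n (p n (ℕ.m⊔n≤o⇒m≤o M N h)) (q n (ℕ.m⊔n≤o⇒n≤o M N h))

  eventually-map : ∀ {Φ Ψ : ℕ → Set} → (∀ n → Φ n → Ψ n) → Eventually Φ → Eventually Ψ
  eventually-map f (M , p) = M , λ n h → f n (p n h)

  -- The operations are parameters: with those of ℚ in their place, comparing two
  -- instances of these inequalities would unfold the arithmetic of fractions.
  module LinearInequalities
    (_+_ _*_ : ℚ → ℚ → ℚ) (-_ : ℚ → ℚ)
    (isCommutativeRing : IsCommutativeRing _≡_ _+_ _*_ -_ 0ℚ 1ℚ)
    (+-monoˡ-< : ∀ z {a b} → a ℚ.< b → (a + z) ℚ.< (b + z))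
    (*-pos : ∀ {a b} → 0ℚ ℚ.< a → 0ℚ ℚ.< b → 0ℚ ℚ.< (a * b))
    where

    parameterRing : CommutativeRing 0ℓ 0ℓ
    parameterRing = record { isCommutativeRing = isCommutativeRing }
    open RingSolver parameterRing

    0<⇒< : ∀ {p q} → 0ℚ ℚ.< (q + (- p)) → p ℚ.< q
    0<⇒< {p} {q} h = subst₂ ℚ._<_ (ring 1 (λ p → κ0 :+ p := p) p)
      (ring 2 (λ p q → (q :- p) :+ p := q) p q) (+-monoˡ-< p h)

    <⇒0< : ∀ {p q} → p ℚ.< q → 0ℚ ℚ.< (q + (- p))
    <⇒0< {p} {q} h = subst (ℚ._< q + (- p)) (ring 1 (λ p → p :- p := κ0) p) (+-monoˡ-< (- p) h)

    +-pos : ∀ {a b} → 0ℚ ℚ.< a → 0ℚ ℚ.< b → 0ℚ ℚ.< (a + b)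
    +-pos {a} {b} h k = ℚ.<-trans k (subst (ℚ._< (a + b)) (ring 1 (λ b → κ0 :+ b := b) b) (+-monoˡ-< b h))

    chain : ∀ x y z δ → x ℚ.< (y + δ) → y ℚ.< (z + δ) → x ℚ.< (z + (δ + δ))
    chain x y z δ h k = 0<⇒< (subst (0ℚ ℚ.<_) (ring 4 (λ x y z δ →
      ((y :+ δ) :- x) :+ ((z :+ δ) :- y) := (z :+ (δ :+ δ)) :- x) x y z δ) (+-pos (<⇒0< h) (<⇒0< k)))

    +-chain : ∀ x x′ y y′ δ → x ℚ.< (x′ + δ) → y ℚ.< (y′ + δ) → (x + y) ℚ.< ((x′ + y′) + (δ + δ))
    +-chain x x′ y y′ δ h k = 0<⇒< (subst (0ℚ ℚ.<_) (ring 5 (λ x x′ y y′ δ →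
      ((x′ :+ δ) :- x) :+ ((y′ :+ δ) :- y) := ((x′ :+ y′) :+ (δ :+ δ)) :- (x :+ y)) x x′ y y′ δ)
      (+-pos (<⇒0< h) (<⇒0< k)))

    -- Of a gap of 4e, replacing either end costs at most e, so 2e survives.
    replace : ∀ x x′ y y′ e → x′ ℚ.< (x + e) → y ℚ.< (y′ + e) →
              (x + ((e + e) + (e + e))) ℚ.< y → (x′ + (e + e)) ℚ.< y′
    replace x x′ y y′ e h k l = 0<⇒< (subst (0ℚ ℚ.<_) (ring 5 (λ x x′ y y′ e →
      ((x :+ e) :- x′) :+ (((y′ :+ e) :- y) :+ (y :- (x :+ ((e :+ e) :+ (e :+ e))))) :=
      y′ :- (x′ :+ (e :+ e))) x x′ y y′ e) (+-pos (<⇒0< h) (+-pos (<⇒0< k) (<⇒0< l))))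

    -- The two halves of cotransitivity for a gap of 8e, tested at the midpoint x₀ + 4e. Moving from
    -- the sampled index to a later one costs e for each of the two sequences compared, and a margin
    -- of e has to remain as the new gap.
    above : ∀ x x₀ z z₀ e → 0ℚ ℚ.< e → x ℚ.< (x₀ + e) → z₀ ℚ.< (z + e) →
            (x₀ + ((e + e) + (e + e))) ℚ.< z₀ → (x + e) ℚ.< z
    above x x₀ z z₀ e 0<e h k l = 0<⇒< (subst (0ℚ ℚ.<_) (ring 5 (λ x x₀ z z₀ e →
      (((x₀ :+ e) :- x) :+ ((z :+ e) :- z₀) :+ e) :+ (z₀ :- (x₀ :+ ((e :+ e) :+ (e :+ e)))) := z :- (x :+ e))
      x x₀ z z₀ e) (+-pos (+-pos (+-pos (<⇒0< h) (<⇒0< k)) 0<e) (<⇒0< l)))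

    below : ∀ x₀ y y₀ z z₀ e → 0ℚ ℚ.< e → y₀ ℚ.< (y + e) → z ℚ.< (z₀ + e) →
            (x₀ + (((e + e) + (e + e)) + ((e + e) + (e + e)))) ℚ.< y₀ →
            z₀ ℚ.< ((x₀ + ((e + e) + (e + e))) + e) → (z + e) ℚ.< y
    below x₀ y y₀ z z₀ e 0<e h k l m = 0<⇒< (subst (0ℚ ℚ.<_) (ring 6 (λ x₀ y y₀ z z₀ e →
      let f = (e :+ e) :+ (e :+ e) in
      (((y₀ :- (x₀ :+ (f :+ f))) :+ ((x₀ :+ f :+ e) :- z₀)) :+ (((y :+ e) :- y₀) :+ ((z₀ :+ e) :- z)))
        := y :- (z :+ e)) x₀ y y₀ z z₀ e)
      (+-pos (+-pos (<⇒0< l) (<⇒0< m)) (+-pos (<⇒0< h) (<⇒0< k))))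

    shift : ∀ x y z g → (x + g) ℚ.< y → ((x + z) + g) ℚ.< (y + z)
    shift x y z g h = subst (ℚ._< (y + z))
      (ring 3 (λ x z g → x :+ g :+ z := x :+ z :+ g) x z g) (+-monoˡ-< z h)

    *-gap : ∀ x y g h → 0ℚ ℚ.< g → 0ℚ ℚ.< h → (0ℚ + g) ℚ.< x → (0ℚ + h) ℚ.< y → (0ℚ + (g * h)) ℚ.< (x * y)
    *-gap x y g h 0<g 0<h a b = 0<⇒< (subst (0ℚ ℚ.<_) (ring 4 (λ x y g h →
      (x :- (κ0 :+ g)) :* (y :- (κ0 :+ h)) :+ (g :* (y :- (κ0 :+ h)) :+ h :* (x :- (κ0 :+ g)))
        := x :* y :- (κ0 :+ g :* h)) x y g h)
      (+-pos (*-pos (<⇒0< a) (<⇒0< b)) (+-pos (*-pos 0<g (<⇒0< b)) (*-pos 0<h (<⇒0< a)))))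

    -- The tolerance e g² stems from |1/x - 1/y| = |x - y| / (xy) with x, y > g. With ax = by = 1,
    -- the difference b + e - a equals ab(x + eg² - y) + e(a(x - g) + ag·b(y - g)), a sum of
    -- positive terms.
    reciprocal-close : ∀ x y a b g e → (a * x) ≡ 1ℚ → (b * y) ≡ 1ℚ → 0ℚ ℚ.< a → 0ℚ ℚ.< b →
      0ℚ ℚ.< g → 0ℚ ℚ.< e → (0ℚ + g) ℚ.< x → (0ℚ + g) ℚ.< y → y ℚ.< (x + (e * (g * g))) → a ℚ.< (b + e)
    reciprocal-close x y a b g e ax≡1 by≡1 0<a 0<b 0<g 0<e g<x g<y h = 0<⇒< (subst (0ℚ ℚ.<_)
      (trans (ring 6 (λ x y a b g e →
          (a :* b) :* ((x :+ e :* (g :* g)) :- y)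
            :+ e :* (a :* (x :- (κ0 :+ g)) :+ (a :* g) :* (b :* (y :- (κ0 :+ g))))
          := b :* (a :* x) :- a :* (b :* y) :+ a :* b :* (e :* (g :* g)) :+ e :* (a :* x) :- e :* a :* g
            :+ e :* a :* g :* (b :* y) :- e :* a :* g :* b :* g) x y a b g e)
        (trans (cong₂ (λ u w → ((((((b * u) + (- (a * w))) + ((a * b) * (e * (g * g)))) + (e * u)) + (- ((e * a) * g)))
            + (((e * a) * g) * w)) + (- ((((e * a) * g) * b) * g))) ax≡1 by≡1)
          (ring 4 (λ a b g e → b :* κ1 :- a :* κ1 :+ a :* b :* (e :* (g :* g)) :+ e :* κ1 :- e :* a :* g
            :+ e :* a :* g :* κ1 :- e :* a :* g :* b :* g := (b :+ e) :- a) a b g e)))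
      (+-pos (*-pos (*-pos 0<a 0<b) (<⇒0< h)) (*-pos 0<e (+-pos (*-pos 0<a (<⇒0< g<x))
        (*-pos (*-pos 0<a 0<g) (*-pos 0<b (<⇒0< g<y)))))))

    reciprocal-bound : ∀ x a B δ → (a * x) ≡ 1ℚ → (B * δ) ≡ 1ℚ → 0ℚ ℚ.< a → 0ℚ ℚ.< δ → x ℚ.< B →
      (0ℚ + δ) ℚ.< a
    reciprocal-bound x a B δ ax≡1 Bδ≡1 0<a 0<δ h = 0<⇒< (subst (0ℚ ℚ.<_)
      (trans (ring 4 (λ x a B δ → (a :* δ) :* (B :- x) := a :* (B :* δ) :- δ :* (a :* x)) x a B δ)
        (trans (cong₂ (λ u w → ((a * u) + (- (δ * w)))) Bδ≡1 ax≡1)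
          (ring 2 (λ a δ → a :* κ1 :- δ :* κ1 := a :- (κ0 :+ δ)) a δ)))
      (*-pos (*-pos 0<a 0<δ) (<⇒0< h)))

    0<difference : ∀ {p q} → p ℚ.< q → ∃[ d ] 0ℚ ℚ.< d × (p + d) ≡ q
    0<difference {p} {q} h = (q + (- p)) , <⇒0< h , ring 2 (λ p q → p :+ (q :- p) := q) p q

    +-<ʳ : ∀ p {ε} → 0ℚ ℚ.< ε → p ℚ.< (p + ε)
    +-<ʳ p {ε} h = subst₂ ℚ._<_ (ring 1 (λ p → κ0 :+ p := p) p)
      (ring 2 (λ p ε → ε :+ p := p :+ ε) p ε) (+-monoˡ-< p h)

    0+ : ∀ p → (0ℚ + p) ≡ p
    0+ = ring 1 (λ p → κ0 :+ p := p)

    minus-plus : ∀ p q → (q + (p + (- q))) ≡ p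
    minus-plus = ring 2 (λ p q → q :+ (p :- q) := p)

    neg-minus : ∀ p q → (- (p + (- q))) ≡ (q + (- p))
    neg-minus = ring 2 (λ p q → :- (p :- q) := q :- p)

    neg*neg : ∀ p → ((- p) * (- p)) ≡ (p * p)
    neg*neg = ring 1 (λ p → :- p :* :- p := p :* p)

    move : ∀ p q ε → p ℚ.< (q + ε) → (p + (- q)) ℚ.< ε
    move p q ε h = 0<⇒< (subst (0ℚ ℚ.<_)
      (ring 3 (λ p q ε → (q :+ ε) :- p := ε :- (p :- q)) p q ε) (<⇒0< h))

  module ℚ-order where

    *-pos : ∀ {p q} → 0ℚ ℚ.< p → 0ℚ ℚ.< q → 0ℚ ℚ.< p ℚ.* q
    *-pos {p} {q} h k = ℚ.positive⁻¹ _ {{ℚ.pos*pos⇒pos p {{ℚ.positive h}} q {{ℚ.positive k}}}}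

    open LinearInequalities ℚ._+_ ℚ._*_ ℚ.-_ ℚ.+-*-isCommutativeRing (λ z → ℚ.+-monoˡ-< z) *-pos public

    -- Every tolerance is of the form δ + δ. Estimates can thus be stated with sums of equal parts,
    -- and halves never occur in them.
    split : ∀ {Φ : ℚ → Set} → (∀ δ → 0ℚ ℚ.< δ → Φ (δ ℚ.+ δ)) → ∀ ε → 0ℚ ℚ.< ε → Φ ε
    split {Φ} f ε 0<ε = subst Φ
      (trans (sym (ℚ.*-distribʳ-+ ε ½ ½)) (ℚ.*-identityˡ ε)) (f (½ ℚ.* ε) (*-pos (ℚ.positive⁻¹ ½) 0<ε))

    p≤∣p∣ : ∀ p → p ℚ.≤ ℚ.∣ p ∣
    p≤∣p∣ p with ℚ.≤-total 0ℚ p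
    ... | inj₁ 0≤p = ℚ.≤-reflexive (sym (ℚ.0≤p⇒∣p∣≡p 0≤p))
    ... | inj₂ p≤0 = ℚ.≤-trans p≤0 (ℚ.0≤∣p∣ p)

    ∣∣<⇒< : ∀ {p q ε} → ℚ.∣ p ℚ.- q ∣ ℚ.< ε → p ℚ.< q ℚ.+ ε
    ∣∣<⇒< {p} {q} {ε} h = subst (ℚ._< q ℚ.+ ε) (minus-plus p q)
      (ℚ.+-monoʳ-< q (ℚ.≤-<-trans (p≤∣p∣ (p ℚ.- q)) h))

    ∣∣-swap : ∀ p q → ℚ.∣ p ℚ.- q ∣ ≡ ℚ.∣ q ℚ.- p ∣
    ∣∣-swap p q = trans (sym (ℚ.∣-p∣≡∣p∣ (p ℚ.- q))) (cong ℚ.∣_∣ (neg-minus p q))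

    ∣∣<⇒>  : ∀ {p q ε} → ℚ.∣ p ℚ.- q ∣ ℚ.< ε → q ℚ.< p ℚ.+ ε
    ∣∣<⇒> {p} {q} {ε} h = ∣∣<⇒< (subst (ℚ._< ε) (∣∣-swap p q) h)

    <<⇒∣∣< : ∀ {p q ε} → p ℚ.< q ℚ.+ ε → q ℚ.< p ℚ.+ ε → ℚ.∣ p ℚ.- q ∣ ℚ.< ε
    <<⇒∣∣< {p} {q} {ε} h k with ℚ.∣p∣≡p∨∣p∣≡-p (p ℚ.- q)
    ... | inj₁ e = subst (ℚ._< ε) (sym e) (move p q ε h)
    ... | inj₂ e = subst (ℚ._< ε) (sym (trans e (neg-minus p q))) (move q p ε k)

    *-distribˡ-sub : ∀ x y y′ → x ℚ.* (y ℚ.- y′) ≡ x ℚ.* y ℚ.- x ℚ.* y′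
    *-distribˡ-sub x y y′ = trans (ℚ.*-distribˡ-+ x y (ℚ.- y′))
      (cong (λ t → x ℚ.* y ℚ.+ t) (sym (ℚ.neg-distribʳ-* x y′)))

    *-close : ∀ B δ x y y′ → 0ℚ ℚ.< B → ℚ.∣ x ∣ ℚ.< B → ℚ.∣ y ℚ.- y′ ∣ ℚ.< δ →
              ℚ.∣ x ℚ.* y ℚ.- x ℚ.* y′ ∣ ℚ.< B ℚ.* δ
    *-close B δ x y y′ 0<B p q = subst (λ t → ℚ.∣ t ∣ ℚ.< B ℚ.* δ) (*-distribˡ-sub x y y′)
      (subst (ℚ._< B ℚ.* δ) (sym (ℚ.∣p*q∣≡∣p∣*∣q∣ x (y ℚ.- y′)))
        (ℚ.≤-<-trans (ℚ.*-monoʳ-≤-nonNeg ℚ.∣ y ℚ.- y′ ∣ {{ℚ.∣-∣-nonNeg (y ℚ.- y′)}} (ℚ.<⇒≤ p))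
          (ℚ.*-monoʳ-<-pos B {{ℚ.positive 0<B}} q)))

    ∣∣-bound : ∀ p q {ε} → ℚ.∣ p ℚ.- q ∣ ℚ.< ε → ℚ.∣ p ∣ ℚ.< ℚ.∣ q ∣ ℚ.+ ε
    ∣∣-bound p q {ε} h = subst (λ t → ℚ.∣ t ∣ ℚ.< ℚ.∣ q ∣ ℚ.+ ε) (minus-plus p q)
      (ℚ.≤-<-trans (ℚ.∣p+q∣≤∣p∣+∣q∣ q (p ℚ.- q)) (ℚ.+-monoʳ-< ℚ.∣ q ∣ h))

    ∣∣<⇒+< : ∀ p B e → ℚ.∣ p ∣ ℚ.< B → p ℚ.+ e ℚ.< B ℚ.+ e
    ∣∣<⇒+< p B e h = ℚ.+-monoˡ-< e (ℚ.≤-<-trans (p≤∣p∣ p) h)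

    +-double-< : ∀ p δ → 0ℚ ℚ.< δ → p ℚ.+ δ ℚ.< p ℚ.+ (δ ℚ.+ δ)
    +-double-< p δ 0<δ = ℚ.+-monoʳ-< p (+-<ʳ δ 0<δ)

    divide : ∀ B → 0ℚ ℚ.< B → ∀ ε → 0ℚ ℚ.< ε → ∃[ δ ] 0ℚ ℚ.< δ × B ℚ.* δ ≡ ε
    divide B 0<B ε 0<ε = ℚ.1/ B ℚ.* ε ,
      *-pos (ℚ.positive⁻¹ (ℚ.1/ B) {{ℚ.1/pos⇒pos B {{ℚ.positive 0<B}}}}) 0<ε ,
      trans (sym (ℚ.*-assoc B (ℚ.1/ B) ε)) (trans (cong (ℚ._* ε) (ℚ.*-inverseʳ B)) (ℚ.*-identityˡ ε))
      where
      instance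
        nonZeroB : ℚ.NonZero B
        nonZeroB = ℚ.pos⇒nonZero B {{ℚ.positive 0<B}}

    -- The value at 0 is arbitrary and makes the function total. A sequence bounded below by a
    -- positive gap eventually avoids it, but its first terms may vanish.
    inverse : ℚ → ℚ
    inverse q with q ℚ.≟ 0ℚ
    ... | yes _  = 0ℚ
    ... | no q≢0 = (ℚ.1/ q) {{ℚ.≢-nonZero q≢0}}

    inverse-pos : ∀ q → 0ℚ ℚ.< q → 0ℚ ℚ.< inverse q × inverse q ℚ.* q ≡ 1ℚ
    inverse-pos q 0<q with q ℚ.≟ 0ℚ
    ... | yes refl = contradiction 0<q (ℚ.<-irrefl refl)
    ... | no q≢0   = ℚ.positive⁻¹ _ {{ℚ.1/pos⇒pos q {{ℚ.positive 0<q}}}}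
                   , ℚ.*-inverseˡ q {{ℚ.≢-nonZero q≢0}}

    0<gap : ∀ x g → 0ℚ ℚ.< g → 0ℚ ℚ.+ g ℚ.< x → 0ℚ ℚ.< x
    0<gap x g 0<g h = ℚ.<-trans 0<g (subst (ℚ._< x) (0+ g) h)

    inverse-close : ∀ x y g e → 0ℚ ℚ.< g → 0ℚ ℚ.< e → 0ℚ ℚ.+ g ℚ.< x → 0ℚ ℚ.+ g ℚ.< y →
      ℚ.∣ x ℚ.- y ∣ ℚ.< e ℚ.* (g ℚ.* g) → ℚ.∣ inverse x ℚ.- inverse y ∣ ℚ.< e
    inverse-close x y g e 0<g 0<e g<x g<y h =
      helper (inverse x) (inverse y) (inverse-pos x (0<gap x g 0<g g<x)) (inverse-pos y (0<gap y g 0<g g<y))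
      where
      helper : ∀ a b → 0ℚ ℚ.< a × a ℚ.* x ≡ 1ℚ → 0ℚ ℚ.< b × b ℚ.* y ≡ 1ℚ → ℚ.∣ a ℚ.- b ∣ ℚ.< e
      helper a b (0<a , ax≡1) (0<b , by≡1) = <<⇒∣∣< {a} {b}
        (reciprocal-close x y a b g e ax≡1 by≡1 0<a 0<b 0<g 0<e g<x g<y (∣∣<⇒> {x} {y} h))
        (reciprocal-close y x b a g e by≡1 ax≡1 0<b 0<a 0<g 0<e g<y g<x (∣∣<⇒< {x} {y} h))

    suc-homo : ∀ n → (+ suc n) ℚ./ 1 ≡ ((+ n) ℚ./ 1) ℚ.+ 1ℚ
    suc-homo n = ℚ.toℚᵘ-injective (begin
      ℚ.toℚᵘ ((+ suc n) ℚ./ 1)                       ≈⟨ ℚ.toℚᵘ-fromℚᵘ (ℚᵘ.mkℚᵘ (+ suc n) 0) ⟩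
      ℚᵘ.mkℚᵘ (+ suc n) 0                            ≈⟨ ℚᵘ.*≡* (cong (ℤ._* + 1) (trans (cong (+_) (ℕ.+-comm 1 n))
                                                          (cong (ℤ._+ + 1) (sym (ℤ.*-identityʳ (+ n)))))) ⟩
      ℚᵘ.mkℚᵘ (+ n) 0 ℚᵘ.+ ℚ.toℚᵘ 1ℚ                 ≈⟨ ℚᵘ.+-congˡ (ℚ.toℚᵘ 1ℚ) (ℚᵘ.≃-sym (ℚ.toℚᵘ-fromℚᵘ (ℚᵘ.mkℚᵘ (+ n) 0))) ⟩
      ℚ.toℚᵘ ((+ n) ℚ./ 1) ℚᵘ.+ ℚ.toℚᵘ 1ℚ            ≈⟨ ℚᵘ.≃-sym (ℚ.toℚᵘ-homo-+ ((+ n) ℚ./ 1) 1ℚ) ⟩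
      ℚ.toℚᵘ (((+ n) ℚ./ 1) ℚ.+ 1ℚ)                  ∎)
      where
      import Data.Rational.Unnormalised.Base as ℚᵘ
      import Data.Rational.Unnormalised.Properties as ℚᵘ
      open ℚᵘ.≃-Reasoning

    bound-above : ∀ p → ∃[ n ] p ℚ.< (+ n) ℚ./ 1
    bound-above p@(mkℚ n d _) = suc ℤ.∣ n ∣ , ℚ.toℚᵘ-cancel-< (let open ℚᵘ.≤-Reasoning in begin-strict
        ℚ.toℚᵘ p <⟨ ℚᵘ.*<* (ℤ.≤-<-trans (ℤ.≤-reflexive (ℤ.*-identityʳ n))
            (ℤ.≤-<-trans (n≤∣n∣ n) (ℤ.+<+ (ℕ.m≤m*n (suc ℤ.∣ n ∣) (suc d))) )) ⟩
        ℚᵘ.mkℚᵘ (+ suc ℤ.∣ n ∣) 0 ≃⟨ ℚᵘ.≃-sym (ℚ.toℚᵘ-fromℚᵘ (ℚᵘ.mkℚᵘ (+ suc ℤ.∣ n ∣) 0)) ⟩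
        ℚ.toℚᵘ ((+ suc ℤ.∣ n ∣) ℚ./ 1) ∎)
      where
      import Data.Rational.Unnormalised.Base as ℚᵘ
      import Data.Rational.Unnormalised.Properties as ℚᵘ
      n≤∣n∣ : ∀ n → n ℤ.≤ + ℤ.∣ n ∣
      n≤∣n∣ (+ n)    = ℤ.≤-refl
      n≤∣n∣ -[1+ n ] = ℤ.-≤+

  open ℚ-order 

  -- Stated for mkℝ, so that the terms of a sum or product appear unfolded once.
  close⇒≈ : ∀ {s t cs ct} →
    (∀ ε → 0ℚ ℚ.< ε → Eventually (λ n → ℚ.∣ s n ℚ.- t n ∣ ℚ.< ε)) → mkℝ s cs ≈ mkℝ t ct
  close⇒≈ c = mk≈ c

  gap⇒< : ∀ {s t cs ct} g → 0ℚ ℚ.< g → Eventually (λ n → (s n ℚ.+ g) ℚ.< t n) → mkℝ s cs < mkℝ t ct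
  gap⇒< g 0<g (N , p) = mk< g 0<g N p

  pointwise : ∀ {s t cs ct} → (∀ n → s n ≡ t n) → mkℝ s cs ≈ mkℝ t ct
  pointwise {s} {t} e = mk≈ λ ε 0<ε → 0 , λ n _ → subst (λ p → ℚ.∣ s n ℚ.- p ∣ ℚ.< ε) (e n)
    (subst (ℚ._< ε) (cong ℚ.∣_∣ (sym (ℚ.+-inverseʳ (s n)))) 0<ε)

  ≈-refl : ∀ {x} → x ≈ x
  ≈-refl = pointwise λ _ → refl

  ≈-sym : ∀ {x y} → x ≈ y → y ≈ x
  ≈-sym {x} {y} (mk≈ c) = mk≈ λ ε 0<ε →
    eventually-map (λ n → subst (ℚ._< ε) (∣∣-swap (seq x n) (seq y n))) (c ε 0<ε)

  ≈-trans : ∀ {x y z} → x ≈ y → y ≈ z → x ≈ z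
  ≈-trans {x} {y} {z} (mk≈ c) (mk≈ d) = mk≈ (split λ δ 0<δ →
    eventually-zip (λ n p q → <<⇒∣∣<
        (chain (seq x n) (seq y n) (seq z n) δ (∣∣<⇒< {seq x n} p) (∣∣<⇒< {seq y n} q))
        (chain (seq z n) (seq y n) (seq x n) δ (∣∣<⇒> {seq y n} q) (∣∣<⇒> {seq x n} p)))
      (c δ 0<δ) (d δ 0<δ))

  +-cong : ∀ {x x′ y y′} → x ≈ x′ → y ≈ y′ → x + y ≈ x′ + y′
  +-cong {x} {x′} {y} {y′} (mk≈ c) (mk≈ d) = close⇒≈ (split λ δ 0<δ →
    eventually-zip (λ n p q → <<⇒∣∣<
        (+-chain (seq x n) (seq x′ n) (seq y n) (seq y′ n) δ (∣∣<⇒< {seq x n} p) (∣∣<⇒< {seq y n} q))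
        (+-chain (seq x′ n) (seq x n) (seq y′ n) (seq y n) δ (∣∣<⇒> {seq x n} p) (∣∣<⇒> {seq y n} q)))
      (c δ 0<δ) (d δ 0<δ))

  -‿cong : ∀ {x y} → x ≈ y → - x ≈ - y
  -‿cong {x} {y} (mk≈ c) = close⇒≈ λ ε 0<ε →
    eventually-map (λ n → subst (ℚ._< ε) (trans (sym (ℚ.∣-p∣≡∣p∣ (seq x n ℚ.- seq y n)))
      (cong ℚ.∣_∣ (ℚ.neg-distrib-+ (seq x n) (ℚ.- seq y n))))) (c ε 0<ε)

  bounded : ∀ x → ∃[ B ] 0ℚ ℚ.< B × Eventually (λ n → ℚ.∣ seq x n ∣ ℚ.< B)
  bounded x with cauchy x 1ℚ (ℚ.positive⁻¹ 1ℚ)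
  ... | N , p = ℚ.∣ seq x N ∣ ℚ.+ 1ℚ , ℚ.+-mono-≤-< (ℚ.0≤∣p∣ (seq x N)) (ℚ.positive⁻¹ 1ℚ) , N , λ n h →
    ∣∣-bound (seq x n) (seq x N) (p n N h ℕ.≤-refl)

  *-congʳ : ∀ {x y y′} → y ≈ y′ → x * y ≈ x * y′
  *-congʳ {x} {y} {y′} (mk≈ c) = close⇒≈ λ ε 0<ε → helper ε 0<ε (bounded x)
    where
    helper : ∀ ε → 0ℚ ℚ.< ε → ∃[ B ] 0ℚ ℚ.< B × Eventually (λ n → ℚ.∣ seq x n ∣ ℚ.< B) →
      Eventually (λ n → ℚ.∣ seq x n ℚ.* seq y n ℚ.- seq x n ℚ.* seq y′ n ∣ ℚ.< ε)
    helper ε 0<ε (B , 0<B , b) with divide B 0<B ε 0<ε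
    ... | δ , 0<δ , refl = eventually-zip (λ n → *-close B δ (seq x n) (seq y n) (seq y′ n) 0<B) b (c δ 0<δ)

  *-comm : ∀ x y → x * y ≈ y * x
  *-comm x y = pointwise λ n → ℚ.*-comm (seq x n) (seq y n)

  *-cong : ∀ {x x′ y y′} → x ≈ x′ → y ≈ y′ → x * y ≈ x′ * y′
  *-cong {x} {x′} {y} {y′} e f = ≈-trans {x * y} {x * y′} {x′ * y′} (*-congʳ {x} {y} {y′} f)
    (≈-trans {x * y′} {y′ * x} {x′ * y′} (*-comm x y′)
      (≈-trans {y′ * x} {y′ * x′} {x′ * y′} (*-congʳ {y′} {x} {x′} e) (*-comm y′ x′)))

  ℝ-commutativeRing : CommutativeRing 0ℓ 0ℓ
  ℝ-commutativeRing = record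
    { Carrier = ℝ ; _≈_ = _≈_ ; _+_ = _+_ ; _*_ = _*_ ; -_ = -_ ; 0# = 0ℝ ; 1# = 1ℝ
    ; isCommutativeRing = record
      { isRing = record
        { +-isAbelianGroup = record
          { isGroup = record
            { isMonoid = record
              { isSemigroup = record
                { isMagma = record
                  { isEquivalence = record { refl = ≈-refl ; sym = ≈-sym ; trans = ≈-trans }
                  ; ∙-cong = +-cong }
                ; assoc = λ x y z → pointwise λ n → ℚ.+-assoc (seq x n) (seq y n) (seq z n) }
              ; identity = (λ x → pointwise λ n → ℚ.+-identityˡ (seq x n))
                         , (λ x → pointwise λ n → ℚ.+-identityʳ (seq x n)) }
            ; inverse = (λ x → pointwise λ n → ℚ.+-inverseˡ (seq x n))
                      , (λ x → pointwise λ n → ℚ.+-inverseʳ (seq x n))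
            ; ⁻¹-cong = -‿cong }
          ; comm = λ x y → pointwise λ n → ℚ.+-comm (seq x n) (seq y n) }
        ; *-cong = *-cong
        ; *-assoc = λ x y z → pointwise λ n → ℚ.*-assoc (seq x n) (seq y n) (seq z n)
        ; *-identity = (λ x → pointwise λ n → ℚ.*-identityˡ (seq x n))
                     , (λ x → pointwise λ n → ℚ.*-identityʳ (seq x n))
        ; distrib = (λ x y z → pointwise λ n → ℚ.*-distribˡ-+ (seq x n) (seq y n) (seq z n))
                  , (λ x y z → pointwise λ n → ℚ.*-distribʳ-+ (seq x n) (seq y n) (seq z n)) }
      ; *-comm = *-comm } }

  <-irrefl : ∀ {x y} → x ≈ y → ¬ x < y
  <-irrefl {x} {y} (mk≈ c) (mk< g 0<g N s) with c g 0<g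
  ... | M , p = ℚ.<-irrefl refl (ℚ.<-trans
    (s (N ℕ.⊔ M) (ℕ.m≤m⊔n N M)) (∣∣<⇒> {seq x (N ℕ.⊔ M)} (p (N ℕ.⊔ M) (ℕ.m≤n⊔m N M))))

  <-trans : ∀ {x y z} → x < y → y < z → x < z
  <-trans {x} {y} {z} (mk< g 0<g M p) (mk< h 0<h N q) = mk< g 0<g (M ℕ.⊔ N) λ n k →
    ℚ.<-trans (p n (ℕ.m⊔n≤o⇒m≤o M N k)) (ℚ.≤-<-trans
      (ℚ.≤-trans (ℚ.≤-reflexive (sym (ℚ.+-identityʳ (seq y n)))) (ℚ.+-monoʳ-≤ (seq y n) (ℚ.<⇒≤ 0<h)))
      (q n (ℕ.m⊔n≤o⇒n≤o M N k)))

  eventually⇒< : ∀ {x y} g → 0ℚ ℚ.< g → Eventually (λ n → seq x n ℚ.+ g ℚ.< seq y n) → x < y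
  eventually⇒< g 0<g (N , p) = mk< g 0<g N p

  <-resp-≈ : ∀ {x x′ y y′} → x ≈ x′ → y ≈ y′ → x < y → x′ < y′
  <-resp-≈ {x} {x′} {y} {y′} (mk≈ c) (mk≈ d) (mk< g 0<g N s) =
    split {λ g → Eventually (λ n → seq x n ℚ.+ g ℚ.< seq y n) → x′ < y′}
      (λ δ 0<δ → split {λ δ → Eventually (λ n → seq x n ℚ.+ (δ ℚ.+ δ) ℚ.< seq y n) → x′ < y′}
        (λ e 0<e ev → eventually⇒< (e ℚ.+ e) (ℚ.+-mono-< 0<e 0<e)
          (eventually-zip {Θ = λ n → seq x′ n ℚ.+ (e ℚ.+ e) ℚ.< seq y′ n}
            (λ n p (q , r) → replace (seq x n) (seq x′ n) (seq y n) (seq y′ n) e (∣∣<⇒> {seq x n} p) (∣∣<⇒< {seq y n} q) r)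
            (c e 0<e) (eventually-zip (λ n → _,_) (d e 0<e) ev)))
        δ 0<δ)
      g 0<g (N , s)

  -- The gap is cut into eight parts e. Past an index M from which all three sequences vary by less
  -- than e, a single decidable comparison of rationals, z at M against x at M plus 4e, settles the
  -- alternative.
  <-cotrans : ∀ {x y} → x < y → ∀ z → x < z ⊎ z < y
  <-cotrans {x} {y} (mk< g 0<g N s) z =
    split {λ g → (∀ n → N ℕ.≤ n → seq x n ℚ.+ g ℚ.< seq y n) → x < z ⊎ z < y}
      (λ δ 0<δ → split {λ δ → (∀ n → N ℕ.≤ n → seq x n ℚ.+ (δ ℚ.+ δ) ℚ.< seq y n) → x < z ⊎ z < y}
        (λ δ 0<δ → split {λ δ → (∀ n → N ℕ.≤ n → seq x n ℚ.+ ((δ ℚ.+ δ) ℚ.+ (δ ℚ.+ δ)) ℚ.< seq y n) → x < z ⊎ z < y}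
          compare δ 0<δ) δ 0<δ) g 0<g s
    where
    compare : ∀ e → 0ℚ ℚ.< e →
      (∀ n → N ℕ.≤ n → seq x n ℚ.+ (((e ℚ.+ e) ℚ.+ (e ℚ.+ e)) ℚ.+ ((e ℚ.+ e) ℚ.+ (e ℚ.+ e))) ℚ.< seq y n) →
      x < z ⊎ z < y
    compare e 0<e s = go (seq x M ℚ.+ ((e ℚ.+ e) ℚ.+ (e ℚ.+ e)) ℚ.<? seq z M)
      where
      cx = cauchy x e 0<e
      cy = cauchy y e 0<e
      cz = cauchy z e 0<e
      M₁ = proj₁ cx
      M₂ = proj₁ cy
      M₃ = proj₁ cz
      M = (N ℕ.⊔ M₁) ℕ.⊔ (M₂ ℕ.⊔ M₃)
      N≤ : N ℕ.≤ M
      N≤ = ℕ.≤-trans (ℕ.m≤m⊔n N M₁) (ℕ.m≤m⊔n _ _)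
      M₁≤ : M₁ ℕ.≤ M
      M₁≤ = ℕ.≤-trans (ℕ.m≤n⊔m N M₁) (ℕ.m≤m⊔n _ _)
      M₂≤ : M₂ ℕ.≤ M
      M₂≤ = ℕ.≤-trans (ℕ.m≤m⊔n M₂ M₃) (ℕ.m≤n⊔m (N ℕ.⊔ M₁) _)
      M₃≤ : M₃ ℕ.≤ M
      M₃≤ = ℕ.≤-trans (ℕ.m≤n⊔m M₂ M₃) (ℕ.m≤n⊔m (N ℕ.⊔ M₁) _)
      go : _ → x < z ⊎ z < y
      go (yes h) = inj₁ (mk< e 0<e M λ n k → above (seq x n) (seq x M) (seq z n) (seq z M) e 0<e
        (∣∣<⇒< {seq x n} (proj₂ cx n M (ℕ.≤-trans M₁≤ k) M₁≤))
        (∣∣<⇒> {seq z n} (proj₂ cz n M (ℕ.≤-trans M₃≤ k) M₃≤)) h)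
      go (no h) = inj₂ (mk< e 0<e M λ n k → below (seq x M) (seq y n) (seq y M) (seq z n) (seq z M) e 0<e
        (∣∣<⇒> {seq y n} (proj₂ cy n M (ℕ.≤-trans M₂≤ k) M₂≤))
        (∣∣<⇒< {seq z n} (proj₂ cz n M (ℕ.≤-trans M₃≤ k) M₃≤))
        (s M N≤) (ℚ.≤-<-trans (ℚ.≮⇒≥ h) (+-<ʳ _ 0<e)))

  +-monoˡ-< : ∀ {x y} z → x < y → x + z < y + z
  +-monoˡ-< {x} {y} z (mk< g 0<g N s) = gap⇒< g 0<g (N , λ n k → shift (seq x n) (seq y n) (seq z n) g (s n k))

  *-0< : ∀ {x y} → 0ℝ < x → 0ℝ < y → 0ℝ < x * y
  *-0< {x} {y} (mk< g 0<g M p) (mk< h 0<h N q) = gap⇒< (g ℚ.* h) (*-pos 0<g 0<h)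
    (eventually-zip {Θ = λ n → 0ℚ ℚ.+ g ℚ.* h ℚ.< seq x n ℚ.* seq y n}
      (λ n → *-gap (seq x n) (seq y n) g h 0<g 0<h) (M , p) (N , q))

  0≤square : ∀ x → 0ℝ ≤ x * x
  0≤square x (mk< g 0<g N s) = ℚ.<-irrefl refl (ℚ.<-trans (s N ℕ.≤-refl)
    (subst (0ℚ ℚ.<_) (ℚ.+-comm g (x′ ℚ.* x′)) (ℚ.+-mono-<-≤ 0<g (0≤p*p x′))))
    where
    x′ = seq x N
    ∣p∣*∣p∣ : ∀ p → ℚ.∣ p ∣ ℚ.* ℚ.∣ p ∣ ≡ p ℚ.* p
    ∣p∣*∣p∣ p with ℚ.∣p∣≡p∨∣p∣≡-p p
    ... | inj₁ e = cong₂ ℚ._*_ e e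
    ... | inj₂ e = trans (cong₂ ℚ._*_ e e) (neg*neg p)
    0≤p*p : ∀ p → 0ℚ ℚ.≤ p ℚ.* p
    0≤p*p p = subst (0ℚ ℚ.≤_) (∣p∣*∣p∣ p) (ℚ.nonNegative⁻¹ _
      {{ℚ.nonNeg*nonNeg⇒nonNeg ℚ.∣ p ∣ {{ℚ.∣-∣-nonNeg p}} ℚ.∣ p ∣ {{ℚ.∣-∣-nonNeg p}}}})

  fromℚ-+-< : ∀ p d → 0ℚ ℚ.< d → fromℚ p < fromℚ (p ℚ.+ d)
  fromℚ-+-< p = split {λ d → fromℚ p < fromℚ (p ℚ.+ d)}
    λ δ 0<δ → gap⇒< {λ _ → p} {λ _ → p ℚ.+ (δ ℚ.+ δ)} δ 0<δ (0 , λ _ _ → +-double-< p δ 0<δ)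

  fromℚ-mono-< : ∀ {p q} → p ℚ.< q → fromℚ p < fromℚ q
  fromℚ-mono-< {p} {q} h = helper (0<difference {p} {q} h)
    where
    helper : ∃[ d ] 0ℚ ℚ.< d × p ℚ.+ d ≡ q → fromℚ p < fromℚ q
    helper (d , 0<d , e) = subst (λ q → fromℚ p < fromℚ q) e (fromℚ-+-< p d 0<d)

  archimedean : ∀ x → ∃[ n ] x < fromℤ (+ n)
  archimedean x = helper (bounded x)
    where
    helper : ∃[ B ] 0ℚ ℚ.< B × Eventually (λ n → ℚ.∣ seq x n ∣ ℚ.< B) → ∃[ n ] x < fromℤ (+ n)
    helper (B , _ , N , b) = proj₁ B<n , gap⇒< {seq x} {λ _ → (+ proj₁ B<n) ℚ./ 1} 1ℚ (ℚ.positive⁻¹ 1ℚ)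
      (N , λ m k → ℚ.<-trans {seq x m ℚ.+ 1ℚ} {B ℚ.+ 1ℚ} (∣∣<⇒+< (seq x m) B 1ℚ (b m k)) (proj₂ B<n))
      where B<n = bound-above (B ℚ.+ 1ℚ)

  reciprocal : ∀ {x} → 0ℝ < x → ∃[ y ] 0ℝ < y × x * y ≈ 1ℝ
  reciprocal {x} (mk< g 0<g N s) = mkℝ (λ n → inverse (seq x n)) inverse-cauchy ,
    positive (bounded x) ,
    close⇒≈ λ ε 0<ε → N , λ n k → subst (λ q → ℚ.∣ q ℚ.- 1ℚ ∣ ℚ.< ε) (sym (x*inverse n k)) 0<ε
    where
    inverse-cauchy : IsCauchy (λ n → inverse (seq x n))
    inverse-cauchy ε 0<ε = helper (ε ℚ.* (g ℚ.* g)) (*-pos 0<ε (*-pos 0<g 0<g)) refl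
      where
      helper : ∀ δ → 0ℚ ℚ.< δ → δ ≡ ε ℚ.* (g ℚ.* g) → ∃[ M ] ∀ m n → M ℕ.≤ m → M ℕ.≤ n →
        ℚ.∣ inverse (seq x m) ℚ.- inverse (seq x n) ∣ ℚ.< ε
      helper δ 0<δ e with cauchy x δ 0<δ
      ... | M , c = N ℕ.⊔ M , λ m n hm hn → inverse-close (seq x m) (seq x n) g ε 0<g 0<ε
        (s m (ℕ.m⊔n≤o⇒m≤o N M hm)) (s n (ℕ.m⊔n≤o⇒m≤o N M hn))
        (subst (ℚ.∣ seq x m ℚ.- seq x n ∣ ℚ.<_) e (c m n (ℕ.m⊔n≤o⇒n≤o N M hm) (ℕ.m⊔n≤o⇒n≤o N M hn)))
    positive : ∃[ B ] 0ℚ ℚ.< B × Eventually (λ n → ℚ.∣ seq x n ∣ ℚ.< B) →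
      0ℝ < mkℝ (λ n → inverse (seq x n)) inverse-cauchy
    positive (B , 0<B , M , b) = helper (divide B 0<B 1ℚ (ℚ.positive⁻¹ 1ℚ))
      where
      helper : ∃[ δ ] 0ℚ ℚ.< δ × B ℚ.* δ ≡ 1ℚ → 0ℝ < mkℝ (λ n → inverse (seq x n)) inverse-cauchy
      helper (δ , 0<δ , Bδ≡1) = gap⇒< {λ _ → 0ℚ} {λ n → inverse (seq x n)} δ 0<δ
        (eventually-zip {Θ = λ n → 0ℚ ℚ.+ δ ℚ.< inverse (seq x n)} (λ n g<x x<B →
            let i = inverse-pos (seq x n) (0<gap (seq x n) g 0<g g<x) in
            reciprocal-bound (seq x n) (inverse (seq x n)) B δ (proj₂ i) Bδ≡1 (proj₁ i) 0<δ
              (ℚ.≤-<-trans (p≤∣p∣ (seq x n)) x<B))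
          (N , s) (M , b))
    x*inverse : ∀ n → N ℕ.≤ n → seq x n ℚ.* inverse (seq x n) ≡ 1ℚ
    x*inverse n k = trans (ℚ.*-comm (seq x n) (inverse (seq x n)))
      (proj₂ (inverse-pos (seq x n) (0<gap (seq x n) g 0<g (s n k))))

  -- The clause for 1 is separate because the optimised multiple of `1ℝ` by 1 is `1ℝ` itself and not
  -- `0ℝ + 1ℝ`.
  fromℤ≈ : ∀ n → fromℤ (+ n) ≈ RingSolver.⟦_⟧ℤ ℝ-commutativeRing (+ n)
  fromℤ≈ zero = ≈-refl
  fromℤ≈ (suc zero) = ≈-refl
  fromℤ≈ (suc (suc n)) = ≈-trans {fromℤ (+ suc (suc n))} {fromℤ (+ suc n) + 1ℝ}
    (pointwise λ _ → suc-homo (suc n)) (+-cong {fromℤ (+ suc n)} {x′} {1ℝ} {1ℝ} (fromℤ≈ (suc n)) ≈-refl)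
    where
    x′ = RingSolver.⟦_⟧ℤ ℝ-commutativeRing (+ suc n)

  ℝ-orderedField : OrderedField
  ℝ-orderedField = record
    { commutativeRing = ℝ-commutativeRing ; _<_ = _<_ ; <-irrefl = <-irrefl ; <-trans = <-trans
    ; <-resp-≈ = <-resp-≈ ; <-cotrans = <-cotrans ; +-monoˡ-< = +-monoˡ-< ; *-0< = *-0<
    ; 0≤square = 0≤square ; 0<1 = fromℚ-mono-< (ℚ.positive⁻¹ 1ℚ)
    ; archimedean = λ x → proj₁ (archimedean x) ,
        <-resp-≈ {x} ≈-refl (fromℤ≈ (proj₁ (archimedean x))) (proj₂ (archimedean x))
    ; reciprocal = reciprocal }

  √3*√3≈3# : √3 * √3 ≈ RingSolver.⟦_⟧ℤ ℝ-commutativeRing (+ 3)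
  √3*√3≈3# = ≈-trans {√3 * √3} {fromℚ (+ 3 ℚ./ 1)} √3*√3≈3 (pointwise λ _ → refl)

-- The finite automaton: indices modulo 6, conditions, states and transitions

next prev opp : Fin 6 → Fin 6
next 0F = 1F
next 1F = 2F
next 2F = 3F
next 3F = 4F
next 4F = 5F
next 5F = 0F
prev 0F = 5F
prev 1F = 0F
prev 2F = 1F
prev 3F = 2F
prev 4F = 3F
prev 5F = 4F
opp 0F = 3F
opp 1F = 4F
opp 2F = 5F
opp 3F = 0F
opp 4F = 1F
opp 5F = 2F

-- Since λ_(k-1) = λ_k - λ_(k+1), all six functionals are, up to sign, λ_j, λ_(j+1) and their
-- difference. A condition with index k therefore depends on j only through this relative position.
data Relative (j : Fin 6) : Fin 6 → Set where
  same     : Relative j j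
  next¹    : Relative j (next j)
  prev¹    : Relative j (prev j)
  opp-prev : Relative j (opp (prev j))
  opp-next : Relative j (opp (next j))
  opp⁰     : Relative j (opp j)

relative : ∀ j k → Relative j k
relative 0F 0F = same
relative 0F 1F = next¹
relative 0F 2F = opp-prev
relative 0F 3F = opp⁰
relative 0F 4F = opp-next
relative 0F 5F = prev¹
relative 1F 0F = prev¹
relative 1F 1F = same
relative 1F 2F = next¹
relative 1F 3F = opp-prev
relative 1F 4F = opp⁰
relative 1F 5F = opp-next
relative 2F 0F = opp-next
relative 2F 1F = prev¹
relative 2F 2F = same
relative 2F 3F = next¹
relative 2F 4F = opp-prev
relative 2F 5F = opp⁰
relative 3F 0F = opp⁰
relative 3F 1F = opp-next
relative 3F 2F = prev¹
relative 3F 3F = same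
relative 3F 4F = next¹
relative 3F 5F = opp-prev
relative 4F 0F = opp-prev
relative 4F 1F = opp⁰
relative 4F 2F = opp-next
relative 4F 3F = prev¹
relative 4F 4F = same
relative 4F 5F = next¹
relative 5F 0F = next¹
relative 5F 1F = opp-prev
relative 5F 2F = opp⁰
relative 5F 3F = opp-next
relative 5F 4F = prev¹
relative 5F 5F = same

-- A functional λ_k takes the value 1 on the k-th edge of the hexagon.  The
-- conditions are λ_k < 1, λ_k < N, 2 λ_k < N + 1 and 0 < λ_k, where N z = |z|².
-- C k says that z lies outside the circle with centre ζᵏη/3, O k that it lies
-- outside the circle with centre 2ζᵏη/3.
data Condition : Set where
  H C O P : Fin 6 → Condition

-- The condition on 1/z equivalent to a given one on z.
conjugate : Condition → Condition
conjugate (H k) = C (opposite k)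
conjugate (C k) = H (opposite k)
conjugate (O k) = O (opposite k)
conjugate (P k) = P (opposite k)

-- In the notation of the theorem, up to the shift of ℓ by one: cut₁ k is
-- U_{1,k-3}, cut₂ k is U_{2,k-3}, half k is U_{3,k-2}, half⁺ k is U_{4,k-2} and
-- half⁻ k is U_{5,k-5}.
data State : Set where
  whole : State
  cut₁ cut₂ half half⁺ half⁻ : Fin 6 → State

extras : State → List Condition
extras whole     = []
extras (cut₁ k)  = O k ∷ []
extras (cut₂ k)  = C k ∷ []
extras (half k)  = P k ∷ []
extras (half⁺ k) = P k ∷ O (next k) ∷ []
extras (half⁻ k) = P k ∷ O (prev k) ∷ []

-- What a condition on a + w says about w.
data Outcome : Set where
  always never : Outcome
  becomes      : Condition → Outcome

-- Here a is the j-th of the six lattice points nearest to 0.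
translateNear : Fin 6 → Condition → Outcome
translateNear j (H k) with relative j k
... | same     = never
... | next¹    = becomes (P (opp k))
... | prev¹    = becomes (P (opp k))
... | opp-prev = always
... | opp-next = always
... | opp⁰     = always
translateNear j (C k) with relative j k
... | same = becomes (O (opp j))
... | _    = always
translateNear j (O k) with relative j k
... | same = becomes (C (opp j))
... | _    = always
translateNear j (P k) with relative j k
... | same     = always
... | next¹    = always
... | prev¹    = always
... | opp-prev = never
... | opp-next = never
... | opp⁰     = never

private
  stepCut₁ stepCut₂ stepHalf stepHalf⁺ stepHalf⁻ : ∀ j {k} → Relative j k → Maybe State
  stepCut₁ j same = just (cut₂ (opp j))
  stepCut₁ j _    = just (cut₁ (opp j))
  stepCut₂ j same  = nothing
  stepCut₂ j next¹ = just (half⁻ (opp (next j)))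
  stepCut₂ j prev¹ = just (half⁺ (opp (prev j)))
  stepCut₂ j _     = just (cut₁ (opp j))
  stepHalf j same  = just (cut₁ (opp j))
  stepHalf j next¹ = just (cut₁ (opp j))
  stepHalf j prev¹ = just (cut₁ (opp j))
  stepHalf j _     = nothing
  stepHalf⁺ j same  = just (cut₁ (opp j))
  stepHalf⁺ j next¹ = just (cut₂ (opp j))
  stepHalf⁺ j prev¹ = just (cut₁ (opp j))
  stepHalf⁺ j _     = nothing
  stepHalf⁻ j same  = just (cut₁ (opp j))
  stepHalf⁻ j next¹ = just (cut₁ (opp j))
  stepHalf⁻ j prev¹ = just (cut₂ (opp j))
  stepHalf⁻ j _     = nothing

-- The reflection `opposite` is the one in `conjugate`, caused by the inversion that precedes the
-- translation. The value `nothing` means that no interior is reached.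
stepNear : Fin 6 → State → Maybe State
stepNear j whole     = just (cut₁ (opp j))
stepNear j (cut₁ k)  = stepCut₁ j (relative j (opposite k))
stepNear j (cut₂ k)  = stepCut₂ j (relative j (opposite k))
stepNear j (half k)  = stepHalf j (relative j (opposite k))
stepNear j (half⁺ k) = stepHalf⁺ j (relative j (opposite k))
stepNear j (half⁻ k) = stepHalf⁻ j (relative j (opposite k))

-- Here `A k` is the value of λ_k at the lattice point. As |λ_k| < 1 in the hexagon, this integer
-- alone decides a condition on a line, except for one borderline value: 1 for `H` and 0 for `P`.
-- Circles stay away from these translates, because N > 3 there.
translateFar : (Fin 6 → ℤ) → Condition → Outcome
translateFar A (H k) with A k
... | -[1+ _ ]        = always
... | + 0             = always
... | + 1             = becomes (P (opp k))
... | + suc (suc _)   = never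
translateFar A (P k) with A k
... | -[1+ _ ]        = never
... | + 0             = becomes (P k)
... | + suc _         = always
translateFar A (C k) = always
translateFar A (O k) = always

-- The last clause serves `always`; the only conditions produced by a far translation are of the
-- form `P k`.
outcome-state : Outcome → Maybe State
outcome-state (becomes (P k)) = just (half k)
outcome-state never           = nothing
outcome-state _               = just whole

stepFar : (Fin 6 → ℤ) → State → Maybe State
stepFar A whole     = just whole
stepFar A (cut₁ k)  = just whole
stepFar A (cut₂ k)  = outcome-state (translateFar A (H (opposite k)))
stepFar A (half k)  = outcome-state (translateFar A (P (opposite k)))
stepFar A (half⁺ k) = outcome-state (translateFar A (P (opposite k)))
stepFar A (half⁻ k) = outcome-state (translateFar A (P (opposite k)))

_==_ : Fin 6 → Fin 6 → Bool
j == k = does (j Fin.≟ k)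

==-sound : ∀ j k → IsTrue (j == k) → j ≡ k
==-sound j k h with yes e ← j Fin.≟ k = e

-- Within the hexagon, lying outside the inner circle implies lying outside the
-- outer one.
_⊢_ : Outcome → Condition → Bool
becomes (H j) ⊢ H k = j == k
becomes (C j) ⊢ C k = j == k
becomes (O j) ⊢ O k = j == k
becomes (P j) ⊢ P k = j == k
becomes (C j) ⊢ O k = j == k
_             ⊢ _   = false

someEntails : List Outcome → Condition → Bool
someEntails []       c = false
someEntails (o ∷ os) c = (o ⊢ c) ∨ someEntails os c

allEntailed : List Outcome → List Condition → Bool
allEntailed os []       = true
allEntailed os (c ∷ cs) = someEntails os c ∧ allEntailed os cs

entailsOutcome : List Condition → Outcome → Bool
entailsOutcome cs always      = true
entailsOutcome cs never       = false
entailsOutcome cs (becomes c) = someEntails (map becomes cs) c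

entailsAll : List Condition → List Outcome → Bool
entailsAll cs []       = true
entailsAll cs (o ∷ os) = entailsOutcome cs o ∧ entailsAll cs os

hasNever : List Outcome → Bool
hasNever []           = false
hasNever (never ∷ os) = true
hasNever (_ ∷ os)     = hasNever os

-- Equality of two solution sets is reduced to syntactic entailment in both directions, and
-- emptiness to the presence of a `never`. This is a sufficient criterion, and it succeeds for all
-- transitions of the table.
agree : List Outcome → Maybe State → Bool
agree os nothing  = hasNever os
agree os (just s) = allEntailed os (extras s) ∧ entailsAll (extras s) os

-- The sides of the hexagon invert to the six circles of the conditions `C k`. On the translate with
-- index j, the one with k = j becomes `O (opp j)`, and that condition implies the other five; hence
-- the single extra entry at the head.
outcomesNear : Fin 6 → State → List Outcome
outcomesNear j s = becomes (O (opp j)) ∷ map (λ c → translateNear j (conjugate c)) (extras s)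

-- A finite check by evaluation, at most 36 pairs of indices in each clause.
stepNear-agrees : ∀ j s → IsTrue (agree (outcomesNear j s) (stepNear j s))
stepNear-agrees j whole = toWitness {a? = all? λ j → isTrue? (agree (outcomesNear j whole) (stepNear j whole))} tt j
stepNear-agrees j (cut₁ k) =
  toWitness {a? = all? λ j → all? λ k → isTrue? (agree (outcomesNear j (cut₁ k)) (stepNear j (cut₁ k)))} tt j k
stepNear-agrees j (cut₂ k) =
  toWitness {a? = all? λ j → all? λ k → isTrue? (agree (outcomesNear j (cut₂ k)) (stepNear j (cut₂ k)))} tt j k
stepNear-agrees j (half k) =
  toWitness {a? = all? λ j → all? λ k → isTrue? (agree (outcomesNear j (half k)) (stepNear j (half k)))} tt j k
stepNear-agrees j (half⁺ k) =
  toWitness {a? = all? λ j → all? λ k → isTrue? (agree (outcomesNear j (half⁺ k)) (stepNear j (half⁺ k)))} tt j k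
stepNear-agrees j (half⁻ k) =
  toWitness {a? = all? λ j → all? λ k → isTrue? (agree (outcomesNear j (half⁻ k)) (stepNear j (half⁻ k)))} tt j k

opposite-involutive : ∀ (k : Fin 6) → opposite (opposite k) ≡ k
opposite-involutive = Fin.opposite-involutive

-- The values of the functionals at the lattice point η (m + n ζ).
latticeValue : ℤ → ℤ → Fin 6 → ℤ
latticeValue m n 0F = m ℤ.+ m ℤ.+ n
latticeValue m n 1F = m ℤ.+ (n ℤ.+ n)
latticeValue m n 2F = n ℤ.- m
latticeValue m n 3F = ℤ.- (m ℤ.+ m ℤ.+ n)
latticeValue m n 4F = ℤ.- (m ℤ.+ (n ℤ.+ n))
latticeValue m n 5F = m ℤ.- n

-- Classification of the lattice points by their values

data Place (A : Fin 6 → ℤ) : Set where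
  zero : (∀ k → A k ≡ + 0) → Place A
  -- These two values determine the remaining four: they are 2, 1, -1, -2, -1, 1 in cyclic order
  -- from j.
  near : ∀ j → A j ≡ + 2 → A (next j) ≡ + 1 → Place A
  far  : ∀ k n → A k ≡ + (3 ℕ.+ n) → Place A

step : ∀ {A} → Place A → State → Maybe State
step (zero _)         s = nothing
step (near j _ _)     s = stepNear j s
step {A} (far _ _ _)  s = stepFar A s

Distinct : ∀ {j k} → Relative j k → Set
Distinct same = ⊥
Distinct _    = ⊤

module LatticePlace where
  open RingSolver ℤ.+-*-commutativeRing using (ring; _:=_; _:+_; _:-_; :-_)

  large? : ∀ i → (∃[ n ] i ≡ + (3 ℕ.+ n)) ⊎ i ℤ.≤ + 2
  large? (+ 0) = inj₂ (ℤ.+≤+ ℕ.z≤n)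
  large? (+ 1) = inj₂ (ℤ.+≤+ (ℕ.s≤s ℕ.z≤n))
  large? (+ 2) = inj₂ (ℤ.+≤+ (ℕ.s≤s (ℕ.s≤s ℕ.z≤n)))
  large? (+ suc (suc (suc n))) = inj₁ (n , ≡.refl)
  large? -[1+ n ] = inj₂ ℤ.-≤+

  data Small : ℤ → Set where
    minus : Small -[1+ 0 ]
    null  : Small (+ 0)
    plus  : Small (+ 1)

  small : ∀ m → m ℤ.+ m ℤ.+ m ℤ.≤ + 4 → ℤ.- (m ℤ.+ m ℤ.+ m) ℤ.≤ + 4 → Small m
  small (+ 0) h k = null
  small (+ 1) h k = plus
  small -[1+ 0 ] h k = minus
  small (+ suc (suc i)) (ℤ.+≤+ h) k = ⊥-elim (ℕ.<-irrefl ≡.refl (ℕ.≤-trans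
    (ℕ.≤-trans (ℕ.s≤s (ℕ.s≤s (ℕ.s≤s (ℕ.s≤s (ℕ.s≤s ℕ.z≤n)))))
      (ℕ.+-mono-≤ (ℕ.+-mono-≤ 2≤ 2≤) 2≤)) h))
    where
    2≤ : 2 ℕ.≤ suc (suc i)
    2≤ = ℕ.s≤s (ℕ.s≤s ℕ.z≤n)
  small -[1+ suc i ] h (ℤ.+≤+ k) = ⊥-elim (ℕ.<-irrefl ≡.refl (ℕ.≤-trans
    (ℕ.s≤s (ℕ.s≤s (ℕ.s≤s (ℕ.s≤s (ℕ.≤-trans (ℕ.s≤s ℕ.z≤n) (ℕ.m≤n+m (suc i) (i ℕ.+ suc i))))))) k))

  place : ∀ m n → Place (latticeValue m n)
  place m n with large? (latticeValue m n 0F) | large? (latticeValue m n 1F) | large? (latticeValue m n 2F)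
               | large? (latticeValue m n 3F) | large? (latticeValue m n 4F) | large? (latticeValue m n 5F)
  ... | inj₁ (t , e) | _ | _ | _ | _ | _ = far 0F t e
  ... | inj₂ _ | inj₁ (t , e) | _ | _ | _ | _ = far 1F t e
  ... | inj₂ _ | inj₂ _ | inj₁ (t , e) | _ | _ | _ = far 2F t e
  ... | inj₂ _ | inj₂ _ | inj₂ _ | inj₁ (t , e) | _ | _ = far 3F t e
  ... | inj₂ _ | inj₂ _ | inj₂ _ | inj₂ _ | inj₁ (t , e) | _ = far 4F t e
  ... | inj₂ _ | inj₂ _ | inj₂ _ | inj₂ _ | inj₂ _ | inj₁ (t , e) = far 5F t e
  ... | inj₂ a | inj₂ b | inj₂ c | inj₂ d | inj₂ e | inj₂ f = cases
    (small m (≡.subst (ℤ._≤ + 4) (ring 2 (λ m n → (m :+ m :+ n) :+ (m :- n) := m :+ m :+ m) m n) (ℤ.+-mono-≤ a f))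
      (≡.subst (ℤ._≤ + 4) (ring 2 (λ m n → :- (m :+ m :+ n) :+ (n :- m) := :- (m :+ m :+ m)) m n) (ℤ.+-mono-≤ d c)))
    (small n (≡.subst (ℤ._≤ + 4) (ring 2 (λ m n → (m :+ (n :+ n)) :+ (n :- m) := n :+ n :+ n) m n) (ℤ.+-mono-≤ b c))
      (≡.subst (ℤ._≤ + 4) (ring 2 (λ m n → :- (m :+ (n :+ n)) :+ (m :- n) := :- (n :+ n :+ n)) m n) (ℤ.+-mono-≤ e f)))
    where
    cases : ∀ {m n} → Small m → Small n → Place (latticeValue m n)
    cases minus minus = far 3F 0 ≡.refl
    cases minus null  = near 3F ≡.refl ≡.refl
    cases minus plus  = near 2F ≡.refl ≡.refl
    cases null  minus = near 4F ≡.refl ≡.refl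
    cases null  null  = zero λ { 0F → ≡.refl ; 1F → ≡.refl ; 2F → ≡.refl ; 3F → ≡.refl ; 4F → ≡.refl ; 5F → ≡.refl }
    cases null  plus  = near 1F ≡.refl ≡.refl
    cases plus  minus = near 5F ≡.refl ≡.refl
    cases plus  null  = near 0F ≡.refl ≡.refl
    cases plus  plus  = far 0F 0 ≡.refl

outcomesFar : (Fin 6 → ℤ) → State → List Outcome
outcomesFar A s = map (λ c → translateFar A (conjugate c)) (extras s)

==-refl : ∀ j → IsTrue (j == j)
==-refl j with j Fin.≟ j
... | yes _ = tt
... | no ¬p = ¬p ≡.refl

stepFar-agrees : ∀ A s → IsTrue (agree (outcomesFar A s) (stepFar A s))
stepFar-agrees A whole    = tt
stepFar-agrees A (cut₁ k) = tt
stepFar-agrees A (cut₂ k) with A (opposite k)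
... | -[1+ _ ]      = tt
... | + 0           = tt
... | + 1           = Equivalence.from T-∧ (Equivalence.from T-∧ (Equivalence.from T-∨ (inj₁ (==-refl (opp (opposite k)))) , tt) ,
                        Equivalence.from T-∧ (Equivalence.from T-∨ (inj₁ (==-refl (opp (opposite k)))) , tt))
... | + suc (suc _) = tt
stepFar-agrees A (half k) with A (opposite k)
... | -[1+ _ ] = tt
... | + 0      = Equivalence.from T-∧ (Equivalence.from T-∧ (Equivalence.from T-∨ (inj₁ (==-refl (opposite k))) , tt) ,
                   Equivalence.from T-∧ (Equivalence.from T-∨ (inj₁ (==-refl (opposite k))) , tt))
... | + suc _  = tt
stepFar-agrees A (half⁺ k) with A (opposite k)
... | -[1+ _ ] = tt
... | + 0      = Equivalence.from T-∧ (Equivalence.from T-∧ (Equivalence.from T-∨ (inj₁ (==-refl (opposite k))) , tt) ,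
                   Equivalence.from T-∧ (Equivalence.from T-∨ (inj₁ (==-refl (opposite k))) , tt))
... | + suc _  = tt
stepFar-agrees A (half⁻ k) with A (opposite k)
... | -[1+ _ ] = tt
... | + 0      = Equivalence.from T-∧ (Equivalence.from T-∧ (Equivalence.from T-∨ (inj₁ (==-refl (opposite k))) , tt) ,
                   Equivalence.from T-∧ (Equivalence.from T-∨ (inj₁ (==-refl (opposite k))) , tt))
... | + suc _  = tt

-- `Q` and `R` are parameters so that one induction serves both the strict and the weak reading of
-- conditions.
module Entailment {Q : Outcome → Set} {R : Condition → Set} (entails : ∀ o c → IsTrue (o ⊢ c) → Q o → R c) where

  someEntails-sound : ∀ os c → All Q os → IsTrue (someEntails os c) → R c
  someEntails-sound (o ∷ os) c (q ∷ qs) t with Equivalence.to (T-∨ {o ⊢ c}) t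
  ... | inj₁ h = entails o c h q
  ... | inj₂ h = someEntails-sound os c qs h

  allEntailed-sound : ∀ os cs → All Q os → IsTrue (allEntailed os cs) → All R cs
  allEntailed-sound os []       qs t = []
  allEntailed-sound os (c ∷ cs) qs t with Equivalence.to (T-∧ {someEntails os c}) t
  ... | h , k = someEntails-sound os c qs h ∷ allEntailed-sound os cs qs k

-- Enumerations, rotations by ζ, and the pieces in a triangle

indices : List (Fin 6)
indices = 0F ∷ 1F ∷ 2F ∷ 3F ∷ 4F ∷ 5F ∷ []

conditions : List Condition
conditions = map H indices ++ map C indices ++ map O indices ++ map P indices

∈-indices : ∀ k → k ∈ˡ indices
∈-indices 0F = here ≡.refl
∈-indices 1F = there (here ≡.refl)
∈-indices 2F = there (there (here ≡.refl))
∈-indices 3F = there (there (there (here ≡.refl)))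
∈-indices 4F = there (there (there (there (here ≡.refl))))
∈-indices 5F = there (there (there (there (there (here ≡.refl)))))

∈-conditions : ∀ c → c ∈ˡ conditions
∈-conditions (H k) = Any.++⁺ˡ (Any.map⁺ (Any.map (≡.cong H) (∈-indices k)))
∈-conditions (C k) = Any.++⁺ʳ (map H indices) (Any.++⁺ˡ (Any.map⁺ (Any.map (≡.cong C) (∈-indices k))))
∈-conditions (O k) = Any.++⁺ʳ (map H indices) (Any.++⁺ʳ (map C indices) (Any.++⁺ˡ (Any.map⁺ (Any.map (≡.cong O) (∈-indices k)))))
∈-conditions (P k) = Any.++⁺ʳ (map H indices) (Any.++⁺ʳ (map C indices) (Any.++⁺ʳ (map O indices) (Any.map⁺ (Any.map (≡.cong P) (∈-indices k)))))

onIndex : (Fin 6 → Fin 6) → Condition → Condition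
onIndex f (H k) = H (f k)
onIndex f (C k) = C (f k)
onIndex f (O k) = O (f k)
onIndex f (P k) = P (f k)

-- The condition on w equivalent to a given one on ζⁿ w, and conversely.
back forth : ℕ → Condition → Condition
back zero    c = c
back (suc n) c = back n (onIndex prev c)
forth zero    c = c
forth (suc n) c = onIndex next (forth n c)

prev-next : ∀ k → prev (next k) ≡ k
prev-next 0F = ≡.refl
prev-next 1F = ≡.refl
prev-next 2F = ≡.refl
prev-next 3F = ≡.refl
prev-next 4F = ≡.refl
prev-next 5F = ≡.refl

onIndex-prev-next : ∀ c → onIndex prev (onIndex next c) ≡ c
onIndex-prev-next (H k) = ≡.cong H (prev-next k)
onIndex-prev-next (C k) = ≡.cong C (prev-next k)
onIndex-prev-next (O k) = ≡.cong O (prev-next k)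
onIndex-prev-next (P k) = ≡.cong P (prev-next k)

back-forth : ∀ n c → back n (forth n c) ≡ c
back-forth zero    c = ≡.refl
back-forth (suc n) c = ≡.trans (≡.cong (back n) (onIndex-prev-next (forth n c))) (back-forth n c)

-- The six pieces of the triangle 0, 1, ζ, numbered as V_{1,1}, …, V_{6,1}, are
-- told apart by the sides of the circles on which they lie.
C1-holds C5-holds O0-holds : Fin 6 → Bool
C1-holds 0F = false
C1-holds 1F = true
C1-holds 2F = false
C1-holds 3F = true
C1-holds 4F = false
C1-holds 5F = true
C5-holds 0F = false
C5-holds 1F = false
C5-holds 2F = true
C5-holds 3F = false
C5-holds 4F = true
C5-holds 5F = true
O0-holds 0F = true
O0-holds 1F = true
O0-holds 2F = true
O0-holds 3F = false
O0-holds 4F = false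
O0-holds 5F = false

-- Of the 24 curves only those of `C 1F`, `C 5F` and `O 0F` cut the open triangle 0, 1, ζ; every
-- other condition has a constant sign on it. The six pieces realise the sign patterns of these
-- three conditions other than the two constant ones.
holdsOnPiece : Fin 6 → Condition → Bool
holdsOnPiece k (H _)  = true
holdsOnPiece k (C 0F) = false
holdsOnPiece k (C 1F) = C1-holds k
holdsOnPiece k (C 5F) = C5-holds k
holdsOnPiece k (C _)  = true
holdsOnPiece k (O 0F) = O0-holds k
holdsOnPiece k (O _)  = true
holdsOnPiece k (P 2F) = false
holdsOnPiece k (P 3F) = false
holdsOnPiece k (P 4F) = false
holdsOnPiece k (P _)  = true

holdsOn : State → Fin 6 × Fin 6 → Bool
holdsOn s (k , ℓ) = all (λ c → holdsOnPiece k (back (toℕ ℓ) c)) (extras s)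

pieces : State → List (Fin 6 × Fin 6)
pieces s = filter (λ kℓ → isTrue? (holdsOn s kℓ)) (cartesianProduct indices indices)

∈-pieces⁺ : ∀ s k ℓ → IsTrue (holdsOn s (k , ℓ)) → (k , ℓ) ∈ˡ pieces s
∈-pieces⁺ s k ℓ h = ∈-filter⁺ (λ kℓ → isTrue? (holdsOn s kℓ)) (∈-cartesianProduct⁺ (∈-indices k) (∈-indices ℓ)) h

∈-pieces⁻ : ∀ s k ℓ → (k , ℓ) ∈ˡ pieces s → IsTrue (holdsOn s (k , ℓ))
∈-pieces⁻ s k ℓ i = proj₂ (∈-filter⁻ (λ kℓ → isTrue? (holdsOn s kℓ)) {xs = cartesianProduct indices indices} i)

-- The sides of the closed hexagon on which a point of U lies.
data Boundary : Set where
  interior edge₁ edge₃ edge₅ vertex₄ vertex₅ : Boundary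

on : Boundary → Fin 6 → Bool
on edge₁   1F = true
on edge₃   3F = true
on edge₅   5F = true
on vertex₄ 3F = true
on vertex₄ 4F = true
on vertex₅ 4F = true
on vertex₅ 5F = true
on _       _  = false

baseState : Fin 5 → State
baseState 0F = cut₁ 3F
baseState 1F = cut₂ 3F
baseState 2F = half 2F
baseState 3F = half⁺ 2F
baseState 4F = half⁻ 5F

turnState : State → State
turnState whole     = whole
turnState (cut₁ k)  = cut₁ (next k)
turnState (cut₂ k)  = cut₂ (next k)
turnState (half k)  = half (next k)
turnState (half⁺ k) = half⁺ (next k)
turnState (half⁻ k) = half⁻ (next k)

turnStateBy : ℕ → State → State
turnStateBy zero    s = s
turnStateBy (suc n) s = turnState (turnStateBy n s)

stateOf : Fin 5 → Fin 6 → State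
stateOf k ℓ = turnStateBy (toℕ ℓ) (baseState k)

extras-turn : ∀ s → extras (turnState s) ≡ map (onIndex next) (extras s)
extras-turn whole      = ≡.refl
extras-turn (cut₁ k)   = ≡.refl
extras-turn (cut₂ k)   = ≡.refl
extras-turn (half k)   = ≡.refl
extras-turn (half⁺ k)  = ≡.refl
-- The second condition here is `O (prev k)`, and `prev (next k)` agrees with `next (prev k)` by
-- computation only once k is known.
extras-turn (half⁻ 0F) = ≡.refl
extras-turn (half⁻ 1F) = ≡.refl
extras-turn (half⁻ 2F) = ≡.refl
extras-turn (half⁻ 3F) = ≡.refl
extras-turn (half⁻ 4F) = ≡.refl
extras-turn (half⁻ 5F) = ≡.refl

state-cases : ∀ s → s ≡ whole ⊎ ∃[ k ] ∃[ ℓ ] s ≡ stateOf k ℓ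
state-cases whole = inj₁ ≡.refl
state-cases (cut₁ 0F) = inj₂ (0F , 3F , ≡.refl)
state-cases (cut₁ 1F) = inj₂ (0F , 4F , ≡.refl)
state-cases (cut₁ 2F) = inj₂ (0F , 5F , ≡.refl)
state-cases (cut₁ 3F) = inj₂ (0F , 0F , ≡.refl)
state-cases (cut₁ 4F) = inj₂ (0F , 1F , ≡.refl)
state-cases (cut₁ 5F) = inj₂ (0F , 2F , ≡.refl)
state-cases (cut₂ 0F) = inj₂ (1F , 3F , ≡.refl)
state-cases (cut₂ 1F) = inj₂ (1F , 4F , ≡.refl)
state-cases (cut₂ 2F) = inj₂ (1F , 5F , ≡.refl)
state-cases (cut₂ 3F) = inj₂ (1F , 0F , ≡.refl)
state-cases (cut₂ 4F) = inj₂ (1F , 1F , ≡.refl)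
state-cases (cut₂ 5F) = inj₂ (1F , 2F , ≡.refl)
state-cases (half 0F) = inj₂ (2F , 4F , ≡.refl)
state-cases (half 1F) = inj₂ (2F , 5F , ≡.refl)
state-cases (half 2F) = inj₂ (2F , 0F , ≡.refl)
state-cases (half 3F) = inj₂ (2F , 1F , ≡.refl)
state-cases (half 4F) = inj₂ (2F , 2F , ≡.refl)
state-cases (half 5F) = inj₂ (2F , 3F , ≡.refl)
state-cases (half⁺ 0F) = inj₂ (3F , 4F , ≡.refl)
state-cases (half⁺ 1F) = inj₂ (3F , 5F , ≡.refl)
state-cases (half⁺ 2F) = inj₂ (3F , 0F , ≡.refl)
state-cases (half⁺ 3F) = inj₂ (3F , 1F , ≡.refl)
state-cases (half⁺ 4F) = inj₂ (3F , 2F , ≡.refl)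
state-cases (half⁺ 5F) = inj₂ (3F , 3F , ≡.refl)
state-cases (half⁻ 0F) = inj₂ (4F , 1F , ≡.refl)
state-cases (half⁻ 1F) = inj₂ (4F , 2F , ≡.refl)
state-cases (half⁻ 2F) = inj₂ (4F , 3F , ≡.refl)
state-cases (half⁻ 3F) = inj₂ (4F , 4F , ≡.refl)
state-cases (half⁻ 4F) = inj₂ (4F , 5F , ≡.refl)
state-cases (half⁻ 5F) = inj₂ (4F , 0F , ≡.refl)

latticeValue-difference : ∀ m n m′ n′ k →
  latticeValue (m ℤ.- m′) (n ℤ.- n′) k ≡ latticeValue m n k ℤ.- latticeValue m′ n′ k
latticeValue-difference m n m′ n′ = values
  where
  open RingSolver ℤ.+-*-commutativeRing
  values : ∀ k → latticeValue (m ℤ.- m′) (n ℤ.- n′) k ≡ latticeValue m n k ℤ.- latticeValue m′ n′ k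
  values 0F = ring 4 (λ m n m′ n′ → (m :- m′) :+ (m :- m′) :+ (n :- n′) := (m :+ m :+ n) :- (m′ :+ m′ :+ n′)) m n m′ n′
  values 1F = ring 4 (λ m n m′ n′ → (m :- m′) :+ ((n :- n′) :+ (n :- n′)) := (m :+ (n :+ n)) :- (m′ :+ (n′ :+ n′))) m n m′ n′
  values 2F = ring 4 (λ m n m′ n′ → (n :- n′) :- (m :- m′) := (n :- m) :- (n′ :- m′)) m n m′ n′
  values 3F = ring 4 (λ m n m′ n′ → :- ((m :- m′) :+ (m :- m′) :+ (n :- n′)) := :- (m :+ m :+ n) :- :- (m′ :+ m′ :+ n′)) m n m′ n′
  values 4F = ring 4 (λ m n m′ n′ → :- ((m :- m′) :+ ((n :- n′) :+ (n :- n′))) := :- (m :+ (n :+ n)) :- :- (m′ :+ (n′ :+ n′))) m n m′ n′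
  values 5F = ring 4 (λ m n m′ n′ → (m :- m′) :- (n :- n′) := (m :- n) :- (m′ :- n′)) m n m′ n′

import Defs

opaque
  ℝ-field : OrderedField
  ℝ-field = RealField.ℝ-orderedField

-- Plane geometry over the ordered field

module Plane where
  open OrderedField ℝ-field hiding (_≈_; _+_; _*_; -_; 0#; 1#; Carrier) public
  open CommutativeRing (OrderedField.commutativeRing ℝ-field) public
    using (Carrier; _≈_; _+_; _*_; -_; _-_; 0#; 1#; refl; sym; trans; reflexive; setoid; +-cong; *-cong; -‿cong;
           +-congˡ; +-congʳ; *-congˡ; *-congʳ; *-identityʳ; *-identityˡ; +-identityʳ; +-identityˡ; *-comm; +-comm; *-assoc)
  open RingSolver (OrderedField.commutativeRing ℝ-field) public
    using (ring; _:=_; _:+_; _:*_; _:-_; :-_; con; κ0; κ1; κ2; κ3; κ4; ⟦_⟧ℤ; +-homo; neg-homo; *-homo)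

  infix 4 _≤_
  _≤_ : Carrier → Carrier → Set
  x ≤ y = ¬ y < x

  2# 3# : Carrier
  2# = ⟦ + 2 ⟧ℤ
  3# = ⟦ + 3 ⟧ℤ

  <-respʳ : ∀ {x y y′} → y ≈ y′ → x < y → x < y′
  <-respʳ = <-resp-≈ refl

  <-respˡ : ∀ {x x′ y} → x ≈ x′ → x < y → x′ < y
  <-respˡ e = <-resp-≈ e refl

  ≤-resp-≈ : ∀ {x x′ y y′} → x ≈ x′ → y ≈ y′ → x ≤ y → x′ ≤ y′
  ≤-resp-≈ e f h k = h (<-resp-≈ (sym f) (sym e) k)

  ≤-respʳ : ∀ {x y y′} → y ≈ y′ → x ≤ y → x ≤ y′
  ≤-respʳ = ≤-resp-≈ refl

  <⇒≤ : ∀ {x y} → x < y → x ≤ y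
  <⇒≤ h k = <-irrefl refl (<-trans h k)

  ≤-reflexive : ∀ {x y} → x ≈ y → x ≤ y
  ≤-reflexive e = <-irrefl (sym e)

  ≤-<-trans : ∀ {x y z} → x ≤ y → y < z → x < z
  ≤-<-trans {x = x} h k with <-cotrans k x
  ... | inj₁ l with () ← h l
  ... | inj₂ l = l

  ≤-trans : ∀ {x y z} → x ≤ y → y ≤ z → x ≤ z
  ≤-trans h k l = h (≤-<-trans k l)

  0<⇒< : ∀ {x y} → 0# < y - x → x < y
  0<⇒< {x} {y} h = <-resp-≈ (ring 1 (λ x → κ0 :+ x := x) x) (ring 2 (λ x y → y :- x :+ x := y) x y)
    (+-monoˡ-< x h)

  <⇒0< : ∀ {x y} → x < y → 0# < y - x
  <⇒0< {x} {y} h = <-respˡ (ring 1 (λ x → x :- x := κ0) x) (+-monoˡ-< (- x) h)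

  0≤⇒≤ : ∀ {x y} → 0# ≤ y - x → x ≤ y
  0≤⇒≤ {x} {y} h k = h (<-respʳ (ring 1 (λ x → x :- x := κ0) x) (+-monoˡ-< (- x) k))

  ≤⇒0≤ : ∀ {x y} → x ≤ y → 0# ≤ y - x
  ≤⇒0≤ {x} {y} h k = h (<-resp-≈ (ring 2 (λ x y → y :- x :+ x := y) x y) (ring 1 (λ x → κ0 :+ x := x) x)
    (+-monoˡ-< x k))

  +-0< : ∀ {x y} → 0# < x → 0# < y → 0# < x + y
  +-0< {x} {y} h k = <-trans k (<-respˡ (ring 1 (λ y → κ0 :+ y := y) y) (+-monoˡ-< y h))

  +-0≤-0< : ∀ {x y} → 0# ≤ x → 0# < y → 0# < x + y
  +-0≤-0< {x} {y} h k with <-cotrans (<-resp-≈ (ring 1 (λ x → κ0 :+ x := x) x)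
                               (ring 2 (λ x y → y :+ x := x :+ y) x y) (+-monoˡ-< x k)) 0#
  ... | inj₁ l with () ← h l
  ... | inj₂ l = l

  neg-0< : ∀ {x} → x < 0# → 0# < - x
  neg-0< {x} h = <-respʳ (ring 1 (λ x → κ0 :- x := :- x) x) (<⇒0< h)

  0<-neg : ∀ {x} → 0# < - x → x < 0#
  0<-neg {x} h = 0<⇒< (<-respʳ (ring 1 (λ x → :- x := κ0 :- x) x) h)

  +-0≤ : ∀ {x y} → 0# ≤ x → 0# ≤ y → 0# ≤ x + y
  +-0≤ {x} {y} h k l = h (0<-neg (<-respʳ (ring 2 (λ x y → y :+ :- (x :+ y) := :- x) x y)
    (+-0≤-0< k (neg-0< l))))

  +-mono-< : ∀ {x x′ y y′} → x < x′ → y < y′ → x + y < x′ + y′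
  +-mono-< {x} {x′} {y} {y′} h k = 0<⇒< (<-respʳ
    (ring 4 (λ x x′ y y′ → (x′ :- x) :+ (y′ :- y) := (x′ :+ y′) :- (x :+ y)) x x′ y y′) (+-0< (<⇒0< h) (<⇒0< k)))

  +-mono-≤ : ∀ {x x′ y y′} → x ≤ x′ → y ≤ y′ → x + y ≤ x′ + y′
  +-mono-≤ {x} {x′} {y} {y′} h k = 0≤⇒≤ (≤-respʳ
    (ring 4 (λ x x′ y y′ → (x′ :- x) :+ (y′ :- y) := (x′ :+ y′) :- (x :+ y)) x x′ y y′) (+-0≤ (≤⇒0≤ h) (≤⇒0≤ k)))

  *-cancel-0< : ∀ {c x} → 0# < c → 0# < c * x → 0# < x
  *-cancel-0< {c} {x} h k with reciprocal h
  ... | d , 0<d , cd≈1 = <-respʳ (trans (ring 3 (λ c d x → d :* (c :* x) := c :* d :* x) c d x)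
    (trans (*-congʳ cd≈1) (ring 1 (λ x → κ1 :* x := x) x))) (*-0< 0<d k)

  *-0<-0≤ : ∀ {c x} → 0# < c → 0# ≤ x → 0# ≤ c * x
  *-0<-0≤ {c} {x} h k l = k (0<-neg (*-cancel-0< h
    (<-respʳ (ring 2 (λ c x → :- (c :* x) := c :* :- x) c x) (neg-0< l))))

  0<ℕ : ∀ n → 0# < ⟦ +[1+ n ] ⟧ℤ
  0<ℕ zero    = 0<1
  0<ℕ (suc n) = +-0< (0<ℕ n) 0<1

  0≤ℕ : ∀ n → 0# ≤ ⟦ + n ⟧ℤ
  0≤ℕ zero    = <-irrefl refl
  0≤ℕ (suc n) = <⇒≤ (0<ℕ n)

  0<2 : 0# < 2#
  0<2 = 0<ℕ 1

  -- Positive reals below two given ones: xy / (x + y).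
  ∃-below : ∀ {x y} → 0# < x → 0# < y → ∃[ z ] 0# < z × z < x × z < y
  ∃-below {x} {y} 0<x 0<y with reciprocal (+-0< 0<x 0<y)
  ... | d , 0<d , e = x * y * d , *-0< (*-0< 0<x 0<y) 0<d ,
    0<⇒< (<-respʳ (trans (ring 3 (λ x y d → x :* x :* d := x :* ((x :+ y) :* d) :- x :* y :* d) x y d)
      (+-congʳ (trans (*-congˡ e) (*-identityʳ x)))) (*-0< (*-0< 0<x 0<x) 0<d)) ,
    0<⇒< (<-respʳ (trans (ring 3 (λ x y d → y :* y :* d := y :* ((x :+ y) :* d) :- x :* y :* d) x y d)
      (+-congʳ (trans (*-congˡ e) (*-identityʳ y)))) (*-0< (*-0< 0<y 0<y) 0<d))

  -- Of a sum of three squares with coefficients 1, 1, 1 only half is needed.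
  0≤quadratic : ∀ a b → 0# ≤ a * a - a * b + b * b
  0≤quadratic a b h = +-0≤ (+-0≤ (0≤square a) (0≤square b)) (0≤square (a - b))
    (<-resp-≈ (ring 2 (λ a b → (a :* a :- a :* b :+ b :* b) :+ (a :* a :- a :* b :+ b :* b)
        := a :* a :+ b :* b :+ (a :- b) :* (a :- b)) a b) (ring 0 (κ0 :+ κ0 := κ0)) (+-mono-< h h))

  -- (x , y) stands for x + y√-3.
  Point : Set
  Point = Carrier × Carrier

  infix 4 _≈ₚ_
  infixr 4 _,_
  infixl 6 _+ₚ_ _-ₚ_
  infixl 7 _*ₚ_

  -- A record rather than a product of two equations, so that both points can be recovered from the
  -- type.
  record _≈ₚ_ (z w : Point) : Set where
    constructor _,_
    field
      ≈-first  : proj₁ z ≈ proj₁ w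
      ≈-second : proj₂ z ≈ proj₂ w
  open _≈ₚ_ public

  _+ₚ_ _-ₚ_ _*ₚ_ : Point → Point → Point
  (x , y) +ₚ (x′ , y′) = x + x′ , y + y′
  (x , y) -ₚ (x′ , y′) = x - x′ , y - y′
  (x , y) *ₚ (x′ , y′) = x * x′ - 3# * (y * y′) , x * y′ + y * x′

  1ₚ : Point
  1ₚ = 1# , 0#

  -- The six functionals, the norm, and inversion

  functional : Fin 6 → Point → Carrier
  functional 0F (x , y) = x + y
  functional 1F (x , y) = y + y
  functional 2F (x , y) = y - x
  functional 3F (x , y) = - (x + y)
  functional 4F (x , y) = - (y + y)
  functional 5F (x , y) = x - y

  norm : Point → Carrier
  norm (x , y) = x * x + 3# * (y * y)

  quadratic : Carrier → Carrier → Carrier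
  quadratic a b = a * a - a * b + b * b

  quadratic-cong : ∀ {a a′ b b′} → a ≈ a′ → b ≈ b′ → quadratic a b ≈ quadratic a′ b′
  quadratic-cong e f = +-cong (+-cong (*-cong e e) (-‿cong (*-cong e f))) (*-cong f f)

  functional-prev : ∀ k z → functional (prev k) z ≈ functional k z - functional (next k) z
  functional-prev 0F (x , y) = ring 2 (λ x y → x :- y := (x :+ y) :- (y :+ y)) x y
  functional-prev 1F (x , y) = ring 2 (λ x y → x :+ y := (y :+ y) :- (y :- x)) x y
  functional-prev 2F (x , y) = ring 2 (λ x y → y :+ y := (y :- x) :- :- (x :+ y)) x y
  functional-prev 3F (x , y) = ring 2 (λ x y → y :- x := :- (x :+ y) :- :- (y :+ y)) x y
  functional-prev 4F (x , y) = ring 2 (λ x y → :- (x :+ y) := :- (y :+ y) :- (x :- y)) x y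
  functional-prev 5F (x , y) = ring 2 (λ x y → :- (y :+ y) := (x :- y) :- (x :+ y)) x y

  functional-opp : ∀ k z → functional (opp k) z ≈ - functional k z
  functional-opp 0F (x , y) = refl
  functional-opp 1F (x , y) = refl
  functional-opp 2F (x , y) = ring 2 (λ x y → x :- y := :- (y :- x)) x y
  functional-opp 3F (x , y) = ring 2 (λ x y → x :+ y := :- :- (x :+ y)) x y
  functional-opp 4F (x , y) = ring 1 (λ y → y :+ y := :- :- (y :+ y)) y
  functional-opp 5F (x , y) = ring 2 (λ x y → y :- x := :- (x :- y)) x y

  -- Two neighbouring functionals form a coordinate system in which the norm looks the same for all
  -- k. Later computations are therefore made once, with a = λ_j and b = λ_(j+1).
  norm-functional : ∀ k z → norm z ≈ quadratic (functional k z) (functional (next k) z)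
  norm-functional 0F (x , y) = ring 2 (λ x y → let a = x :+ y; b = y :+ y in
    x :* x :+ κ3 :* (y :* y) := a :* a :- a :* b :+ b :* b) x y
  norm-functional 1F (x , y) = ring 2 (λ x y → let a = y :+ y; b = y :- x in
    x :* x :+ κ3 :* (y :* y) := a :* a :- a :* b :+ b :* b) x y
  norm-functional 2F (x , y) = ring 2 (λ x y → let a = y :- x; b = :- (x :+ y) in
    x :* x :+ κ3 :* (y :* y) := a :* a :- a :* b :+ b :* b) x y
  norm-functional 3F (x , y) = ring 2 (λ x y → let a = :- (x :+ y); b = :- (y :+ y) in
    x :* x :+ κ3 :* (y :* y) := a :* a :- a :* b :+ b :* b) x y
  norm-functional 4F (x , y) = ring 2 (λ x y → let a = :- (y :+ y); b = x :- y in
    x :* x :+ κ3 :* (y :* y) := a :* a :- a :* b :+ b :* b) x y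
  norm-functional 5F (x , y) = ring 2 (λ x y → let a = x :- y; b = x :+ y in
    x :* x :+ κ3 :* (y :* y) := a :* a :- a :* b :+ b :* b) x y

  functional-cong : ∀ k {z w} → z ≈ₚ w → functional k z ≈ functional k w
  functional-cong 0F (e , f) = +-cong e f
  functional-cong 1F (e , f) = +-cong f f
  functional-cong 2F (e , f) = +-cong f (-‿cong e)
  functional-cong 3F (e , f) = -‿cong (+-cong e f)
  functional-cong 4F (e , f) = -‿cong (+-cong f f)
  functional-cong 5F (e , f) = +-cong e (-‿cong f)

  norm-cong : ∀ {z w} → z ≈ₚ w → norm z ≈ norm w
  norm-cong (e , f) = +-cong (*-cong e e) (*-congˡ (*-cong f f))

  functional-+ : ∀ k z w → functional k (z +ₚ w) ≈ functional k z + functional k w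
  functional-+ 0F (x , y) (x′ , y′) = ring 4 (λ x y x′ y′ → (x :+ x′) :+ (y :+ y′) := (x :+ y) :+ (x′ :+ y′)) x y x′ y′
  functional-+ 1F (x , y) (x′ , y′) = ring 2 (λ y y′ → (y :+ y′) :+ (y :+ y′) := (y :+ y) :+ (y′ :+ y′)) y y′
  functional-+ 2F (x , y) (x′ , y′) = ring 4 (λ x y x′ y′ → (y :+ y′) :- (x :+ x′) := (y :- x) :+ (y′ :- x′)) x y x′ y′
  functional-+ 3F (x , y) (x′ , y′) = ring 4 (λ x y x′ y′ → :- ((x :+ x′) :+ (y :+ y′)) := :- (x :+ y) :+ :- (x′ :+ y′)) x y x′ y′
  functional-+ 4F (x , y) (x′ , y′) = ring 2 (λ y y′ → :- ((y :+ y′) :+ (y :+ y′)) := :- (y :+ y) :+ :- (y′ :+ y′)) y y′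
  functional-+ 5F (x , y) (x′ , y′) = ring 4 (λ x y x′ y′ → (x :+ x′) :- (y :+ y′) := (x :- y) :+ (x′ :- y′)) x y x′ y′

  norm-* : ∀ z w → norm (z *ₚ w) ≈ norm z * norm w
  norm-* (x , y) (x′ , y′) = ring 4 (λ x y x′ y′ →
    let u = x :* x′ :- κ3 :* (y :* y′); v = x :* y′ :+ y :* x′ in
    u :* u :+ κ3 :* (v :* v) := (x :* x :+ κ3 :* (y :* y)) :* (x′ :* x′ :+ κ3 :* (y′ :* y′))) x y x′ y′

  -- Complex conjugation carries λ_k to λ_(5-k), which is what `opposite` expresses.
  functional-reciprocal : ∀ k u v → u *ₚ v ≈ₚ 1ₚ →
    functional k u * norm v ≈ functional (opposite k) v
  functional-reciprocal k u@(x , y) v@(x′ , y′) (e , f) = trans (rationalise k) (conj k)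
    where
    -- u |v|² = (u v) v̄ = v̄
    reX : x * norm v ≈ x′
    reX = trans (ring 4 (λ x y x′ y′ → x :* (x′ :* x′ :+ κ3 :* (y′ :* y′)) :=
        x′ :* (x :* x′ :- κ3 :* (y :* y′)) :+ κ3 :* (y′ :* (x :* y′ :+ y :* x′))) x y x′ y′)
      (trans (+-cong (*-congˡ e) (*-congˡ (*-congˡ f))) (ring 2 (λ x′ y′ → x′ :* κ1 :+ κ3 :* (y′ :* κ0) := x′) x′ y′))
    imY : y * norm v ≈ - y′
    imY = trans (ring 4 (λ x y x′ y′ → y :* (x′ :* x′ :+ κ3 :* (y′ :* y′)) :=
        x′ :* (x :* y′ :+ y :* x′) :- y′ :* (x :* x′ :- κ3 :* (y :* y′))) x y x′ y′)
      (trans (+-cong (*-congˡ f) (-‿cong (*-congˡ e))) (ring 2 (λ x′ y′ → x′ :* κ0 :- y′ :* κ1 := :- y′) x′ y′))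
    rationalise : ∀ k → functional k u * norm v ≈ functional k (x * norm v , y * norm v)
    rationalise 0F = ring 3 (λ x y n → (x :+ y) :* n := x :* n :+ y :* n) x y (norm v)
    rationalise 1F = ring 3 (λ x y n → (y :+ y) :* n := y :* n :+ y :* n) x y (norm v)
    rationalise 2F = ring 3 (λ x y n → (y :- x) :* n := y :* n :- x :* n) x y (norm v)
    rationalise 3F = ring 3 (λ x y n → :- (x :+ y) :* n := :- (x :* n :+ y :* n)) x y (norm v)
    rationalise 4F = ring 3 (λ x y n → :- (y :+ y) :* n := :- (y :* n :+ y :* n)) x y (norm v)
    rationalise 5F = ring 3 (λ x y n → (x :- y) :* n := x :* n :- y :* n) x y (norm v)
    conj : ∀ k → functional k (x * norm v , y * norm v) ≈ functional (opposite k) v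
    conj k = trans (functional-cong k (reX , imY)) (flip k)
      where
      flip : ∀ k → functional k (x′ , - y′) ≈ functional (opposite k) v
      flip 0F = refl
      flip 1F = ring 1 (λ y → :- y :+ :- y := :- (y :+ y)) y′
      flip 2F = ring 2 (λ x y → :- y :- x := :- (x :+ y)) x′ y′
      flip 3F = ring 2 (λ x y → :- (x :- y) := y :- x) x′ y′
      flip 4F = ring 1 (λ y → :- (:- y :+ :- y) := y :+ y) y′
      flip 5F = ring 2 (λ x y → x :- :- y := x :+ y) x′ y′

  norm-reciprocal : ∀ u v → u *ₚ v ≈ₚ 1ₚ → norm u * norm v ≈ 1#
  norm-reciprocal u v e = trans (sym (norm-* u v)) (trans (norm-cong e)
    (ring 0 (κ1 :* κ1 :+ κ3 :* (κ0 :* κ0) := κ1)))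

  0≤norm : ∀ z → 0# ≤ norm z
  0≤norm z = ≤-respʳ (sym (norm-functional 0F z)) (0≤quadratic _ _)

  product-bound : ∀ m k n d → k * m ≈ 1# → n * d ≈ 1# → n * (d - m) ≈ - ((n - k) * m)
  product-bound m k n d km≈1 nd≈1 = trans
    (ring 4 (λ n d m k → n :* (d :- m) := (n :* d :- k :* m) :- (n :- k) :* m) n d m k)
    (trans (+-congʳ (+-cong nd≈1 (-‿cong km≈1)))
      (ring 3 (λ n m k → (κ1 :- κ1) :- (n :- k) :* m := :- ((n :- k) :* m)) n m k))

  -- Being nonnegative and nonzero does not yet give a positive lower bound; the bound comes from
  -- the other factor. Choose an integer n > k and let d = 1/n. Either m > 0, or m < d, and then 0 <
  -- n(d - m) = -(n - k)m ≤ 0.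
  0<-factor : ∀ m k → 0# ≤ m → 0# ≤ k → k * m ≈ 1# → 0# < m
  0<-factor m k 0≤m 0≤k km≈1 = invert (proj₁ above) (proj₂ above) (reciprocal (≤-<-trans 0≤k (proj₂ above)))
    where
    above : ∃[ n ] k < n
    above = ⟦ + proj₁ (archimedean k) ⟧ℤ , proj₂ (archimedean k)
    invert : ∀ n → k < n → ∃[ d ] 0# < d × n * d ≈ 1# → 0# < m
    invert n k<n (d , 0<d , nd≈1) = choose (<-cotrans 0<d m)
      where
      choose : 0# < m ⊎ m < d → 0# < m
      choose (inj₁ h) = h
      choose (inj₂ h) = ⊥-elim (*-0<-0≤ (<⇒0< k<n) 0≤m (0<-neg
        (<-respʳ (product-bound m k n d km≈1 nd≈1) (*-0< (≤-<-trans 0≤k k<n) (<⇒0< h)))))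

  0<norm : ∀ u v → u *ₚ v ≈ₚ 1ₚ → 0# < norm v
  0<norm u v e = 0<-factor (norm v) (norm u) (0≤norm v) (0≤norm u) (norm-reciprocal u v e)

  -- Conditions as inequalities, under inversion and translation

  slack : Condition → Point → Carrier
  slack (H k) z = 1# - functional k z
  slack (C k) z = norm z - functional k z
  slack (O k) z = norm z + 1# - (functional k z + functional k z)
  slack (P k) z = functional k z

  slack-cong : ∀ c {z w} → z ≈ₚ w → slack c z ≈ slack c w
  slack-cong (H k) e = +-congˡ (-‿cong (functional-cong k e))
  slack-cong (C k) e = +-cong (norm-cong e) (-‿cong (functional-cong k e))
  slack-cong (O k) e = +-cong (+-congʳ (norm-cong e)) (-‿cong (+-cong (functional-cong k e) (functional-cong k e)))
  slack-cong (P k) e = functional-cong k e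

  -- Multiplication by N(v) = 1/N(u) exchanges the terms N and 1 of a slack and conjugates its
  -- functional. So lines `H` and circles `C` are interchanged, while `O` and `P` keep their shape.
  slack-reciprocal : ∀ c u v → u *ₚ v ≈ₚ 1ₚ → slack c u * norm v ≈ slack (conjugate c) v
  slack-reciprocal (H k) u v e = trans (ring 2 (λ f n → (κ1 :- f) :* n := n :- f :* n) (functional k u) (norm v))
    (+-congˡ (-‿cong (functional-reciprocal k u v e)))
  slack-reciprocal (C k) u v e = trans
    (ring 3 (λ m f n → (m :- f) :* n := m :* n :- f :* n) (norm u) (functional k u) (norm v))
    (+-cong (norm-reciprocal u v e) (-‿cong (functional-reciprocal k u v e)))
  slack-reciprocal (O k) u v e = trans
    (ring 3 (λ m f n → (m :+ κ1 :- (f :+ f)) :* n := n :+ m :* n :- (f :* n :+ f :* n)) (norm u) (functional k u) (norm v))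
    (+-cong (+-congˡ (norm-reciprocal u v e))
      (-‿cong (+-cong (functional-reciprocal k u v e) (functional-reciprocal k u v e))))
  slack-reciprocal (P k) u v e = functional-reciprocal k u v e

  InHexagon : Point → Set
  InHexagon w = ∀ k → 0# < slack (H k) w

  Holds WeaklyHolds : Condition → Point → Set
  Holds c w       = 0# < slack c w
  WeaklyHolds c w = 0# ≤ slack c w

  HoldsAt : Point → Outcome → Set
  HoldsAt w always      = ⊤
  HoldsAt w never       = ⊥
  HoldsAt w (becomes c) = Holds c w

  Shift : (Fin 6 → ℤ) → Point → Point → Set
  Shift A w v = ∀ k → functional k v ≈ ⟦ A k ⟧ℤ + functional k w

  1+functional : ∀ {w} k → InHexagon w → 0# < 1# + functional k w
  1+functional {w} k h = <-respʳ (trans (+-congˡ (-‿cong (functional-opp k w)))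
    (ring 1 (λ f → κ1 :- :- f := κ1 :+ f) (functional k w))) (h (opp k))

  0<2-term : ∀ {x y z} → x + y ≈ z → 0# < x → 0# < y → 0# < z
  0<2-term e h k = <-respʳ e (+-0< h k)

  <0-absurd : ∀ {x} → 0# < x → x < 0# → ⊥
  <0-absurd h k = <-irrefl refl (<-trans h k)

  -- Equalities of slacks hold without any assumption on w.
  Exact Sound : Point → Point → Outcome → Condition → Set
  Exact v w (becomes c′) c = slack c v ≈ slack c′ w
  Exact v w _            c = ⊤
  Sound v w always      c = Holds c v
  Sound v w never       c = ¬ Holds c v
  Sound v w (becomes _) c = ⊤

  -- Kept apart from `Near` because nothing is assumed of w here; these equalities therefore also
  -- transport weak inequalities on the closed hexagon.
  module NearValues {j w v}
    (e₀ : functional j v ≈ 2# + functional j w)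
    (e₁ : functional (next j) v ≈ 1# + functional (next j) w) where

    a = functional j w
    b = functional (next j) w

    0≤q : 0# ≤ quadratic a b
    0≤q = 0≤quadratic a b

    value : ∀ {k} → Relative j k → Carrier
    value same     = 2# + a
    value next¹    = 1# + b
    value prev¹    = (2# + a) - (1# + b)
    value opp-prev = - ((2# + a) - (1# + b))
    value opp-next = - (1# + b)
    value opp⁰     = - (2# + a)

    value-prev : functional (prev j) v ≈ (2# + a) - (1# + b)
    value-prev = trans (functional-prev j v) (+-cong e₀ (-‿cong e₁))

    value-correct : ∀ {k} (r : Relative j k) → functional k v ≈ value r
    value-correct same     = e₀
    value-correct next¹    = e₁
    value-correct prev¹    = value-prev
    value-correct opp-prev = trans (functional-opp (prev j) v) (-‿cong value-prev)
    value-correct opp-next = trans (functional-opp (next j) v) (-‿cong e₁)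
    value-correct opp⁰     = trans (functional-opp j v) (-‿cong e₀)

    value-norm : norm v ≈ quadratic (2# + a) (1# + b)
    value-norm = trans (norm-functional j v) (quadratic-cong e₀ e₁)

    slack-C : ∀ {k} (r : Relative j k) → slack (C k) v ≈ quadratic (2# + a) (1# + b) - value r
    slack-C r = +-cong value-norm (-‿cong (value-correct r))

    slack-O : ∀ {k} (r : Relative j k) → slack (O k) v ≈ quadratic (2# + a) (1# + b) + 1# - (value r + value r)
    slack-O r = +-cong (+-congʳ value-norm) (-‿cong (+-cong (value-correct r) (value-correct r)))

    slack-O-opp : slack (O (opp j)) w ≈ quadratic a b + 1# - (- a + - a)
    slack-O-opp = +-cong (+-congʳ (norm-functional j w)) (-‿cong (+-cong (functional-opp j w) (functional-opp j w)))

    -- N(v) = N(w) + 3 + 3λ_j(w). Subtracting λ_j(v) = 2 + λ_j(w) leaves N(w) + 1 + 2λ_j(w), the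
    -- slack of `O (opp j)`. In the same way N(v) + 1 - 2λ_j(v) is N(w) + λ_j(w).
    C-same : slack (C j) v ≈ slack (O (opp j)) w
    C-same = trans (slack-C same) (trans (ring 2 (λ a b → let c = κ2 :+ a; d = κ1 :+ b in
      (c :* c :- c :* d :+ d :* d) :- c := (a :* a :- a :* b :+ b :* b) :+ κ1 :- (:- a :+ :- a)) a b) (sym slack-O-opp))

    O-same : slack (O j) v ≈ slack (C (opp j)) w
    O-same = trans (slack-O same) (trans (ring 2 (λ a b → let c = κ2 :+ a; d = κ1 :+ b in
      (c :* c :- c :* d :+ d :* d) :+ κ1 :- (c :+ c) := (a :* a :- a :* b :+ b :* b) :- :- a) a b)
      (sym (+-cong (norm-functional j w) (-‿cong (functional-opp j w)))))

    near-exact : ∀ c → Exact v w (translateNear j c) c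
    near-exact (H k) with relative j k
    ... | same     = tt
    ... | next¹    = trans (+-congˡ (-‿cong e₁)) (trans (ring 1 (λ b → κ1 :- (κ1 :+ b) := :- b) b) (sym (functional-opp (next j) w)))
    ... | prev¹    = trans (+-congˡ (-‿cong value-prev)) (trans (ring 2 (λ a b → κ1 :- ((κ2 :+ a) :- (κ1 :+ b)) := :- (a :- b)) a b)
                       (sym (trans (functional-opp (prev j) w) (-‿cong (functional-prev j w)))))
    ... | opp-prev = tt
    ... | opp-next = tt
    ... | opp⁰     = tt
    near-exact (C k) with relative j k
    ... | same     = C-same
    ... | next¹    = tt
    ... | prev¹    = tt
    ... | opp-prev = tt
    ... | opp-next = tt
    ... | opp⁰     = tt
    near-exact (O k) with relative j k
    ... | same     = O-same
    ... | next¹    = tt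
    ... | prev¹    = tt
    ... | opp-prev = tt
    ... | opp-next = tt
    ... | opp⁰     = tt
    near-exact (P k) with relative j k
    ... | same     = tt
    ... | next¹    = tt
    ... | prev¹    = tt
    ... | opp-prev = tt
    ... | opp-next = tt
    ... | opp⁰     = tt

  module Near {j w v} (h : InHexagon w)
    (e₀ : functional j v ≈ 2# + functional j w)
    (e₁ : functional (next j) v ≈ 1# + functional (next j) w) where

    open NearValues {j} {w} {v} e₀ e₁ public

    private
      0<1+a : 0# < 1# + a
      0<1+a = 1+functional j h

      0<1+b : 0# < 1# + b
      0<1+b = 1+functional (next j) h

      0<1+a-b : 0# < 1# + (a - b)
      0<1+a-b = <-respʳ (+-congˡ (functional-prev j w)) (1+functional (prev j) h)

    -- The slacks of `C k` and `C j` at v differ by λ_j(v) - λ_k(v), and λ_j is the largest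
    -- functional on the j-th translated hexagon.
    C-all : Holds (O (opp j)) w → ∀ k → Holds (C k) v
    C-all o k = <-respʳ (sym (slack-C (relative j k))) (positive (relative j k))
      where
      o′ : 0# < quadratic a b + 1# - (- a + - a)
      o′ = <-respʳ slack-O-opp o
      positive : ∀ {k} (r : Relative j k) → 0# < quadratic (2# + a) (1# + b) - value r
      positive same = <-respʳ (ring 2 (λ a b → let c = κ2 :+ a; d = κ1 :+ b in
        (a :* a :- a :* b :+ b :* b) :+ κ1 :- (:- a :+ :- a) := (c :* c :- c :* d :+ d :* d) :- c) a b) o′
      positive next¹ = 0<2-term (ring 2 (λ a b → let c = κ2 :+ a; d = κ1 :+ b in
        ((a :* a :- a :* b :+ b :* b) :+ κ1 :- (:- a :+ :- a)) :+ (κ1 :+ (a :- b)) :=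
        (c :* c :- c :* d :+ d :* d) :- d) a b) o′ 0<1+a-b
      positive prev¹ = 0<2-term (ring 2 (λ a b → let c = κ2 :+ a; d = κ1 :+ b in
        ((a :* a :- a :* b :+ b :* b) :+ κ1 :- (:- a :+ :- a)) :+ (κ1 :+ b) :=
        (c :* c :- c :* d :+ d :* d) :- (c :- d)) a b) o′ 0<1+b
      positive opp-prev = 0<2-term (ring 2 (λ a b → let c = κ2 :+ a; d = κ1 :+ b in
        ((a :* a :- a :* b :+ b :* b) :+ κ1 :- (:- a :+ :- a)) :+ ((κ1 :+ a) :+ (κ1 :+ (a :- b)) :+ κ1) :=
        (c :* c :- c :* d :+ d :* d) :- :- (c :- d)) a b) o′ (+-0< (+-0< 0<1+a 0<1+a-b) 0<1)
      positive opp-next = 0<2-term (ring 2 (λ a b → let c = κ2 :+ a; d = κ1 :+ b in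
        ((a :* a :- a :* b :+ b :* b) :+ κ1 :- (:- a :+ :- a)) :+ ((κ1 :+ a) :+ (κ1 :+ b) :+ κ1) :=
        (c :* c :- c :* d :+ d :* d) :- :- d) a b) o′ (+-0< (+-0< 0<1+a 0<1+b) 0<1)
      positive opp⁰ = 0<2-term (ring 2 (λ a b → let c = κ2 :+ a; d = κ1 :+ b in
        ((a :* a :- a :* b :+ b :* b) :+ κ1 :- (:- a :+ :- a)) :+ ((κ1 :+ a) :+ (κ1 :+ a) :+ κ2) :=
        (c :* c :- c :* d :+ d :* d) :- :- c) a b) o′ (+-0< (+-0< 0<1+a 0<1+a) 0<2)

    O-other : ∀ {k} (r : Relative j k) → Distinct r → Holds (O k) v
    O-other r d = <-respʳ (sym (slack-O r)) (positive r d)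
      where
      -- Near a common tangent of two circles the slack is x² − xy + y² + y.
      tangent : ∀ x y → 0# < x → 0# < y → 0# < (y - x) * (y - x) + (x * y + y)
      tangent x y h k = +-0≤-0< (0≤square (y - x)) (+-0< (*-0< h k) k)
      positive : ∀ {k} (r : Relative j k) → Distinct r → 0# < quadratic (2# + a) (1# + b) + 1# - (value r + value r)
      positive next¹ _ = <-respʳ (ring 2 (λ a b → let c = κ2 :+ a; d = κ1 :+ b; x = κ1 :+ a; y = κ1 :+ (a :- b) in
        (y :- x) :* (y :- x) :+ (x :* y :+ y) := (c :* c :- c :* d :+ d :* d) :+ κ1 :- (d :+ d)) a b)
        (tangent (1# + a) (1# + (a - b)) 0<1+a 0<1+a-b)
      positive prev¹ _ = <-respʳ (ring 2 (λ a b → let c = κ2 :+ a; d = κ1 :+ b; x = κ1 :+ a; y = κ1 :+ b in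
        (y :- x) :* (y :- x) :+ (x :* y :+ y) := (c :* c :- c :* d :+ d :* d) :+ κ1 :- ((c :- d) :+ (c :- d))) a b)
        (tangent (1# + a) (1# + b) 0<1+a 0<1+b)
      positive opp-prev _ = <-respʳ (ring 2 (λ a b → let c = κ2 :+ a; d = κ1 :+ b; x = κ1 :+ a; y = κ1 :+ (a :- b) in
        (a :* a :- a :* b :+ b :* b) :+ (x :+ x :+ x :+ (y :+ y) :+ κ1)
          := (c :* c :- c :* d :+ d :* d) :+ κ1 :- (:- (c :- d) :+ :- (c :- d))) a b)
        (+-0≤-0< 0≤q (+-0< (+-0< (+-0< (+-0< 0<1+a 0<1+a) 0<1+a) (+-0< 0<1+a-b 0<1+a-b)) 0<1))
      positive opp-next _ = <-respʳ (ring 2 (λ a b → let c = κ2 :+ a; d = κ1 :+ b; x = κ1 :+ a; y = κ1 :+ b in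
        (a :* a :- a :* b :+ b :* b) :+ (x :+ x :+ x :+ (y :+ y) :+ κ1)
          := (c :* c :- c :* d :+ d :* d) :+ κ1 :- (:- d :+ :- d)) a b)
        (+-0≤-0< 0≤q (+-0< (+-0< (+-0< (+-0< 0<1+a 0<1+a) 0<1+a) (+-0< 0<1+b 0<1+b)) 0<1))
      positive opp⁰ _ = <-respʳ (ring 2 (λ a b → let c = κ2 :+ a; d = κ1 :+ b; x = κ1 :+ a in
        (a :* a :- a :* b :+ b :* b) :+ (x :+ x :+ x :+ (x :+ x) :+ κ3)
          := (c :* c :- c :* d :+ d :* d) :+ κ1 :- (:- c :+ :- c)) a b)
        (+-0≤-0< 0≤q (+-0< (+-0< (+-0< (+-0< 0<1+a 0<1+a) 0<1+a) (+-0< 0<1+a 0<1+a)) (0<ℕ 2)))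

    0<norm-near : 0# < norm v
    0<norm-near = <-respʳ (sym (trans value-norm (ring 2 (λ a b → let c = κ2 :+ a; d = κ1 :+ b; x = κ1 :+ a in
        c :* c :- c :* d :+ d :* d := (a :* a :- a :* b :+ b :* b) :+ (x :+ x :+ x)) a b)))
      (+-0≤-0< 0≤q (+-0< (+-0< 0<1+a 0<1+a) 0<1+a))

    private
      v<0 : ∀ {k} (r : Relative j k) → 0# < - value r → functional k v < 0#
      v<0 r h = 0<-neg (<-respʳ (-‿cong (sym (value-correct r))) h)
      0<v : ∀ {k} (r : Relative j k) → 0# < value r → 0# < functional k v
      0<v r h = <-respʳ (sym (value-correct r)) h
      0<1-v : ∀ {k} (r : Relative j k) → 0# < 1# - value r → 0# < slack (H k) v
      0<1-v r h = <-respʳ (+-congˡ (-‿cong (sym (value-correct r)))) h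

      2+a : 0# < 2# + a
      2+a = 0<2-term (ring 1 (λ a → κ1 :+ (κ1 :+ a) := κ2 :+ a) a) 0<1 0<1+a

    near-sound : Holds (O (opp j)) w → ∀ c → Sound v w (translateNear j c) c
    near-sound o (H k) with relative j k
    ... | same     = λ l → <0-absurd l (0<-neg (<-respʳ (sym (trans (-‿cong (+-congˡ (-‿cong e₀)))
                       (ring 1 (λ a → :- (κ1 :- (κ2 :+ a)) := κ1 :+ a) a))) 0<1+a))
    ... | next¹    = tt
    ... | prev¹    = tt
    ... | opp-prev = 0<1-v opp-prev (0<2-term (ring 2 (λ a b → κ1 :+ (κ1 :+ (a :- b)) := κ1 :- :- ((κ2 :+ a) :- (κ1 :+ b))) a b) 0<1 0<1+a-b)
    ... | opp-next = 0<1-v opp-next (0<2-term (ring 1 (λ b → κ1 :+ (κ1 :+ b) := κ1 :- :- (κ1 :+ b)) b) 0<1 0<1+b)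
    ... | opp⁰     = 0<1-v opp⁰ (0<2-term (ring 1 (λ a → κ1 :+ (κ2 :+ a) := κ1 :- :- (κ2 :+ a)) a) 0<1 2+a)
    near-sound o (C k) with relative j k | C-all o k
    ... | same     | _ = tt
    ... | next¹    | h = h
    ... | prev¹    | h = h
    ... | opp-prev | h = h
    ... | opp-next | h = h
    ... | opp⁰     | h = h
    near-sound o (O k) with relative j k
    ... | same     = tt
    ... | next¹    = O-other next¹ tt
    ... | prev¹    = O-other prev¹ tt
    ... | opp-prev = O-other opp-prev tt
    ... | opp-next = O-other opp-next tt
    ... | opp⁰     = O-other opp⁰ tt
    near-sound o (P k) with relative j k
    ... | same     = 0<v same 2+a
    ... | next¹    = 0<v next¹ 0<1+b
    ... | prev¹    = 0<v prev¹ (<-respʳ (ring 2 (λ a b → κ1 :+ (a :- b) := (κ2 :+ a) :- (κ1 :+ b)) a b) 0<1+a-b)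
    ... | opp-prev = λ l → <0-absurd l (v<0 opp-prev (<-respʳ (ring 2 (λ a b → κ1 :+ (a :- b) := :- :- ((κ2 :+ a) :- (κ1 :+ b))) a b) 0<1+a-b))
    ... | opp-next = λ l → <0-absurd l (v<0 opp-next (<-respʳ (ring 1 (λ b → κ1 :+ b := :- :- (κ1 :+ b)) b) 0<1+b))
    ... | opp⁰     = λ l → <0-absurd l (v<0 opp⁰ (<-respʳ (ring 1 (λ a → κ2 :+ a := :- :- (κ2 :+ a)) a) 2+a))

  ⟦3+⟧ : ∀ n → ⟦ + (3 ℕ.+ n) ⟧ℤ ≈ 3# + ⟦ + n ⟧ℤ
  ⟦3+⟧ n = +-homo (+ 3) (+ n)

  module Far {A w v} (h : InHexagon w) (sh : Shift A w v) {k₀ t} (large : A k₀ ≡ + (3 ℕ.+ t)) where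

    private
      f = functional k₀ v

      0<f-2 : 0# < f - 2#
      0<f-2 = <-respʳ (trans (ring 2 (λ n a → n :+ (κ1 :+ a) := (κ3 :+ n) :+ a :- κ2) ⟦ + t ⟧ℤ (functional k₀ w))
          (sym (+-congʳ (trans (sh k₀) (+-congʳ (trans (reflexive (≡.cong ⟦_⟧ℤ large)) (⟦3+⟧ t)))))))
        (+-0≤-0< (0≤ℕ t) (1+functional k₀ h))

      -- 4N - 3λ_k² = (2λ_(k+1) - λ_k)². Geometrically, the line λ_k = c has distance c√3/2 from 0.
      excess : ∀ k → 0# ≤ (norm v + norm v + norm v + norm v) - (functional k v * functional k v + functional k v * functional k v + functional k v * functional k v)
      excess k = ≤-respʳ (trans (ring 2 (λ a b → (b :+ b :- a) :* (b :+ b :- a) := let n = a :* a :- a :* b :+ b :* b in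
          (n :+ n :+ n :+ n) :- (a :* a :+ a :* a :+ a :* a)) (functional k v) (functional (next k) v))
        (+-congʳ (sym (+-cong (+-cong (+-cong e e) e) e)))) (0≤square _)
        where
        e = norm-functional k v

    -- A value at least 3 at the lattice point leaves f = λ(v) > 2 after a shift within the hexagon,
    -- and N ≥ 3f²/4. Written out, 4(N - 3) = (4N - 3f²) + 3(f - 2)² + 12(f - 2).
    3<norm : 0# < norm v - 3#
    3<norm = *-cancel-0< (0<ℕ 3) (<-respʳ
      (ring 2 (λ n f → ((n :+ n :+ n :+ n) :- (f :* f :+ f :* f :+ f :* f)) :+
          (con (+ 3) :* ((f :- κ2) :* (f :- κ2)) :+ con (+ 12) :* (f :- κ2)) := κ4 :* (n :- κ3)) (norm v) f)
      (+-0≤-0< (excess k₀) (+-0< (*-0< (0<ℕ 2) (*-0< 0<f-2 0<f-2)) (*-0< (0<ℕ 11) 0<f-2))))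

    0<norm-far : 0# < norm v
    0<norm-far = 0<2-term (ring 1 (λ n → (n :- κ3) :+ κ3 := n) (norm v)) 3<norm (0<ℕ 2)

    -- From N > 3 and 4N ≥ 3f² by completing the square: 48(N - f) = 6(4N - 3f²) + 2(3f - 4)² + 24(N
    -- - 3) + 40.
    C-far : ∀ k → Holds (C k) v
    C-far k = *-cancel-0< 0<2 (*-cancel-0< (0<ℕ 23) (<-respʳ
      (ring 2 (λ n f → (con (+ 3) :* (κ2 :* ((n :+ n :+ n :+ n) :- (f :* f :+ f :* f :+ f :* f)))
            :+ (con (+ 3) :* f :- κ4) :* (con (+ 3) :* f :- κ4) :* κ2) :+ (con (+ 24) :* (n :- κ3) :+ con (+ 40))
          := con (+ 24) :* (κ2 :* (n :- f))) (norm v) (functional k v))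
      (+-0≤-0< (+-0≤ (*-0<-0≤ (0<ℕ 2) (*-0<-0≤ 0<2 (excess k)))
          (≤-respʳ (*-comm _ _) (*-0<-0≤ 0<2 (0≤square _)))) (+-0< (*-0< (0<ℕ 23) 3<norm) (0<ℕ 39)))))

    -- 6(N + 1 - 2f) = (4N - 3f²) + 3(f - 2)² + 2(N - 3).
    O-far : ∀ k → Holds (O k) v
    O-far k = *-cancel-0< (0<ℕ 5) (<-respʳ
      (ring 2 (λ n f → (((n :+ n :+ n :+ n) :- (f :* f :+ f :* f :+ f :* f)) :+ κ3 :* ((f :- κ2) :* (f :- κ2)))
          :+ κ2 :* (n :- κ3) := con (+ 6) :* (n :+ κ1 :- (f :+ f))) (norm v) (functional k v))
      (+-0≤-0< (+-0≤ (excess k) (*-0<-0≤ (0<ℕ 2) (0≤square _))) (*-0< 0<2 3<norm)))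

  module Sign {A w v} (sh : Shift A w v) where

    value : ∀ k {i} → A k ≡ i → functional k v ≈ ⟦ i ⟧ℤ + functional k w
    value k e = trans (sh k) (+-congʳ (reflexive (≡.cong ⟦_⟧ℤ e)))

    far-exact : ∀ c → Exact v w (translateFar A c) c
    far-exact (H k) with A k in e
    ... | -[1+ _ ]      = tt
    ... | + 0           = tt
    ... | + 1           = trans (+-congˡ (-‿cong (value k e))) (trans (ring 1 (λ f → κ1 :- (κ1 :+ f) := :- f) (functional k w))
                            (sym (functional-opp k w)))
    ... | + suc (suc _) = tt
    far-exact (P k) with A k in e
    ... | -[1+ _ ]      = tt
    ... | + 0           = trans (value k e) (ring 1 (λ f → κ0 :+ f := f) (functional k w))
    ... | + suc _       = tt
    far-exact (C k) = tt
    far-exact (O k) = tt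

    far-sound : InHexagon w → (∀ k → Holds (C k) v) → (∀ k → Holds (O k) v) → ∀ c → Sound v w (translateFar A c) c
    far-sound h cs os (C k) = cs k
    far-sound h cs os (O k) = os k
    far-sound h cs os (H k) with A k in e
    ... | -[1+ n ] = <-respʳ (sym (trans (+-congˡ (-‿cong (value k e)))
        (ring 2 (λ i f → κ1 :- (:- i :+ f) := (κ1 :- f) :+ i) ⟦ + suc n ⟧ℤ (functional k w)))) (+-0< (h k) (0<ℕ n))
    ... | + 0 = <-respʳ (sym (trans (+-congˡ (-‿cong (value k e)))
        (ring 1 (λ f → κ1 :- (κ0 :+ f) := κ1 :- f) (functional k w)))) (h k)
    ... | + 1 = tt
    ... | + suc (suc n) = λ l → <0-absurd l (0<-neg (<-respʳ (sym (trans (-‿cong (+-congˡ (-‿cong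
          (trans (value k e) (+-congʳ (+-homo (+ 1) (+ suc n)))))))
        (ring 2 (λ i f → :- (κ1 :- ((κ1 :+ i) :+ f)) := i :+ f) ⟦ + suc n ⟧ℤ (functional k w))))
        (<-respʳ (trans (ring 2 (λ i f → i :+ (κ1 :+ f) := (κ1 :+ i) :+ f) ⟦ + n ⟧ℤ (functional k w))
            (+-congʳ (sym (+-homo (+ 1) (+ n)))))
          (+-0≤-0< (0≤ℕ n) (1+functional k h)))))
    far-sound h cs os (P k) with A k in e
    ... | -[1+ n ] = λ l → <0-absurd l (0<-neg (<-respʳ (sym (trans (-‿cong (trans (value k e) (+-congʳ (-‿cong (+-homo (+ 1) (+ n))))))
        (ring 2 (λ i f → :- (:- (κ1 :+ i) :+ f) := i :+ (κ1 :- f)) ⟦ + n ⟧ℤ (functional k w)))) (+-0≤-0< (0≤ℕ n) (h k))))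
    ... | + 0 = tt
    ... | + suc n = <-respʳ (sym (trans (trans (value k e) (+-congʳ (+-homo (+ 1) (+ n))))
        (ring 2 (λ i f → (κ1 :+ i) :+ f := i :+ (κ1 :+ f)) ⟦ + n ⟧ℤ (functional k w)))) (+-0≤-0< (0≤ℕ n) (1+functional k h))

  -- Regions of states and one step of the map

  InClosedHexagon : Point → Set
  InClosedHexagon w = ∀ k → 0# ≤ slack (H k) w

  Region WeakRegion : State → Point → Set
  Region s z     = InHexagon z × All (λ c → Holds c z) (extras s)
  WeakRegion s z = InClosedHexagon z × All (λ c → WeaklyHolds c z) (extras s)

  RegionOf WeakRegionOf : Maybe State → Point → Set
  RegionOf nothing      _ = ⊥
  RegionOf (just s)     = Region s
  -- A `never` refutes strict inequalities only, so points on boundary curves are not ruled out and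
  -- no claim is made.
  WeakRegionOf nothing  _ = ⊤
  WeakRegionOf (just s) = WeakRegion s

  WeaklyHoldsAt : Point → Outcome → Set
  WeaklyHoldsAt w (becomes c) = WeaklyHolds c w
  WeaklyHoldsAt w _           = ⊤

  O-from-C : ∀ k z → slack (C k) z + slack (H k) z ≈ slack (O k) z
  O-from-C k z = ring 2 (λ n f → (n :- f) :+ (κ1 :- f) := n :+ κ1 :- (f :+ f)) (norm z) (functional k z)

  ⊢-sound : ∀ {w} → InHexagon w → ∀ o c → IsTrue (o ⊢ c) → HoldsAt w o → Holds c w
  ⊢-sound h (becomes (H j)) (H k) t q with ≡.refl ← ==-sound j k t = q
  ⊢-sound h (becomes (C j)) (C k) t q with ≡.refl ← ==-sound j k t = q
  ⊢-sound h (becomes (O j)) (O k) t q with ≡.refl ← ==-sound j k t = q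
  ⊢-sound h (becomes (P j)) (P k) t q with ≡.refl ← ==-sound j k t = q
  ⊢-sound {w} h (becomes (C j)) (O k) t q with ≡.refl ← ==-sound j k t = 0<2-term (O-from-C j w) q (h j)

  ⊢-weak : ∀ {w} → InClosedHexagon w → ∀ o c → IsTrue (o ⊢ c) → WeaklyHoldsAt w o → WeaklyHolds c w
  ⊢-weak h (becomes (H j)) (H k) t q with ≡.refl ← ==-sound j k t = q
  ⊢-weak h (becomes (C j)) (C k) t q with ≡.refl ← ==-sound j k t = q
  ⊢-weak h (becomes (O j)) (O k) t q with ≡.refl ← ==-sound j k t = q
  ⊢-weak h (becomes (P j)) (P k) t q with ≡.refl ← ==-sound j k t = q
  ⊢-weak {w} h (becomes (C j)) (O k) t q with ≡.refl ← ==-sound j k t = ≤-respʳ (O-from-C j w) (+-0≤ q (h j))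

  hasNever-absurd : ∀ {w} os → All (HoldsAt w) os → IsTrue (hasNever os) → ⊥
  hasNever-absurd (always ∷ os)    (_ ∷ qs) t = hasNever-absurd os qs t
  hasNever-absurd (becomes _ ∷ os) (_ ∷ qs) t = hasNever-absurd os qs t

  map-becomes : ∀ {w} {cs} → All (λ c → Holds c w) cs → All (HoldsAt w) (map becomes cs)
  map-becomes []       = []
  map-becomes (h ∷ hs) = h ∷ map-becomes hs

  entailsAll-sound : ∀ {w} → InHexagon w → ∀ cs os → All (λ c → Holds c w) cs → IsTrue (entailsAll cs os) → All (HoldsAt w) os
  entailsAll-sound h cs [] hs t = []
  entailsAll-sound h cs (o ∷ os) hs t with Equivalence.to (T-∧ {entailsOutcome cs o}) t
  ... | u , v = entailed o u ∷ entailsAll-sound h cs os hs v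
    where
    entailed : ∀ o → IsTrue (entailsOutcome cs o) → HoldsAt _ o
    entailed always _      = tt
    entailed (becomes c) u = Entailment.someEntails-sound (⊢-sound h) (map becomes cs) c (map-becomes hs) u

  agree-⇒ : ∀ {w} os m → IsTrue (agree os m) → InHexagon w → All (HoldsAt w) os → RegionOf m w
  agree-⇒ os nothing  t h qs = hasNever-absurd os qs t
  agree-⇒ os (just s) t h qs =
    h , Entailment.allEntailed-sound (⊢-sound h) os (extras s) qs (proj₁ (Equivalence.to (T-∧ {allEntailed os (extras s)}) t))

  agree-⇐ : ∀ {w} os m → IsTrue (agree os m) → RegionOf m w → InHexagon w × All (HoldsAt w) os
  agree-⇐ os (just s) t (h , hs) =
    h , entailsAll-sound h (extras s) os hs (proj₂ (Equivalence.to (T-∧ {allEntailed os (extras s)}) t))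

  agree-weak : ∀ {w} os m → IsTrue (agree os m) → InClosedHexagon w → All (WeaklyHoldsAt w) os → WeakRegionOf m w
  agree-weak os nothing  t h qs = tt
  agree-weak os (just s) t h qs =
    h , Entailment.allEntailed-sound (⊢-weak h) os (extras s) qs (proj₁ (Equivalence.to (T-∧ {allEntailed os (extras s)}) t))

  forward : ∀ {v w} o c → Exact v w o c → Sound v w o c → Holds c v → HoldsAt w o
  forward always      c e s h = tt
  forward never       c e s h = s h
  forward (becomes _) c e s h = <-respʳ e h

  backward : ∀ {v w} o c → Exact v w o c → Sound v w o c → HoldsAt w o → Holds c v
  backward always      c e s h = s
  backward (becomes _) c e s h = <-respʳ (sym e) h

  weakly : ∀ {v w} o c → Exact v w o c → WeaklyHolds c v → WeaklyHoldsAt w o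
  weakly always      c e h = tt
  weakly never       c e h = tt
  weakly (becomes _) c e h = ≤-respʳ e h

  -- With p, q and p + q the values of three functionals: p q, - p (p + q) and
  -- - q (p + q) would all have to be negative.
  no-small-reciprocal : ∀ {z} → InHexagon z → (∀ k → Holds (C k) z) → ⊥
  -- As the goal is absurdity, N need not be compared with 1: the case N > 1 is refuted with m = 1,
  -- and the remaining N ≤ 1 with m = N.
  no-small-reciprocal {z@(x , y)} h c = impossible (λ 1<n → signs (<⇒0< 1<n) (squares h h′))
    where
    n = norm z
    p = x - y
    q = y + y
    s = x + y
    c′ : ∀ k → 0# < n + functional k z
    c′ k = <-respʳ (trans (+-congˡ (-‿cong (functional-opp k z))) (ring 2 (λ n f → n :- :- f := n :+ f) n (functional k z))) (c (opp k))
    h′ : ∀ k → 0# < 1# + functional k z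
    h′ k = 1+functional k h
    squares : ∀ {m} → (∀ k → 0# < m - functional k z) → (∀ k → 0# < m + functional k z) →
              ∀ k → 0# < m * m - functional k z * functional k z
    squares {m} a b k = <-respʳ (ring 2 (λ m f → (m :- f) :* (m :+ f) := m :* m :- f :* f) m (functional k z)) (*-0< (a k) (b k))
    contradiction : p * q < 0# → 0# < p * s → 0# < q * s → ⊥
    contradiction a b d = 0≤square (p * q * s) (0<-neg (<-respʳ
      (ring 3 (λ p q s → :- (p :* q) :* ((p :* s) :* (q :* s)) := :- ((p :* q :* s) :* (p :* q :* s))) p q s)
      (*-0< (neg-0< a) (*-0< b d))))
    -- Here m is 1 or N, and e is N - m².
    conclude : ∀ {m} → 0# ≤ n - m * m → (∀ k → 0# < m * m - functional k z * functional k z) → ⊥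
    conclude {m} e f = contradiction
      (0<-neg (<-respʳ (ring 3 (λ x y m → let n = x :* x :+ κ3 :* (y :* y); s = x :+ y in
        (n :- m :* m) :+ (m :* m :- s :* s) := :- ((x :- y) :* (y :+ y))) x y m) (+-0≤-0< e (f 0F))))
      (<-respʳ (ring 3 (λ x y m → let n = x :* x :+ κ3 :* (y :* y); q = y :+ y in
        (n :- m :* m) :+ (m :* m :- q :* q) := (x :- y) :* (x :+ y)) x y m) (+-0≤-0< e (f 1F)))
      (<-respʳ (ring 3 (λ x y m → let n = x :* x :+ κ3 :* (y :* y); p = x :- y in
        (n :- m :* m) :+ (m :* m :- p :* p) := (y :+ y) :* (x :+ y)) x y m) (+-0≤-0< e (f 5F)))
    signs : 0# < n - 1# → (∀ k → 0# < 1# * 1# - functional k z * functional k z) → ⊥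
    signs 1<n = conclude (<⇒≤ (<-respʳ (ring 1 (λ n → n :- κ1 := n :- κ1 :* κ1) n) 1<n))
    0<n : 0# < n
    0<n = *-cancel-0< 0<2 (<-respʳ (ring 2 (λ n f → (n :- f) :+ (n :+ f) := κ2 :* n) n s) (+-0< (c 0F) (c′ 0F)))
    impossible : ¬ (1# < n) → ⊥
    impossible n≤1 = conclude (≤-respʳ (ring 1 (λ n → n :* (κ1 :- n) := n :- n :* n) n) (*-0<-0≤ 0<n (≤⇒0≤ n≤1)))
      (squares c c′)

  -- w = v - a with a ∈ 𝒥 at the given place, and u = 1/v.
  module _ {A} (pl : Place A) {u v w} (sh : Shift A w v) (uv : u *ₚ v ≈ₚ 1ₚ) where

    private
      shift-near : ∀ {k} i → A k ≡ i → functional k v ≈ ⟦ i ⟧ℤ + functional k w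
      shift-near {k} i e = trans (sh k) (+-congʳ (reflexive (≡.cong ⟦_⟧ℤ e)))

      to-v : ∀ c → Holds c u → Holds (conjugate c) v
      to-v c h = <-respʳ (trans (*-comm (norm v) (slack c u)) (slack-reciprocal c u v uv)) (*-0< (0<norm u v uv) h)

      to-v-weak : ∀ c → WeaklyHolds c u → WeaklyHolds (conjugate c) v
      to-v-weak c h = ≤-respʳ (trans (*-comm (norm v) (slack c u)) (slack-reciprocal c u v uv)) (*-0<-0≤ (0<norm u v uv) h)

      from-v : ∀ c → Holds (conjugate c) v → Holds c u
      from-v c h = *-cancel-0< (0<norm u v uv)
        (<-respʳ (sym (trans (*-comm (norm v) (slack c u)) (slack-reciprocal c u v uv))) h)

      C-v : InHexagon u → ∀ k → Holds (C k) v
      C-v h k = ≡.subst (λ k → Holds (C k) v) (opposite-involutive k) (to-v (H (opposite k)) (h (opposite k)))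

      C-v-weak : InClosedHexagon u → ∀ k → WeaklyHolds (C k) v
      C-v-weak h k = ≡.subst (λ k → WeaklyHolds (C k) v) (opposite-involutive k) (to-v-weak (H (opposite k)) (h (opposite k)))

      H-u : (∀ k → Holds (C k) v) → InHexagon u
      H-u h k = from-v (H k) (h (opposite k))

      map⇒ : ∀ (f : Condition → Outcome) cs → (∀ c → Exact v w (f c) c) → (∀ c → Sound v w (f c) c) →
        All (λ c → Holds c u) cs → All (HoldsAt w) (map (λ c → f (conjugate c)) cs)
      map⇒ f []       e s []       = []
      map⇒ f (c ∷ cs) e s (h ∷ hs) = forward {v} {w} (f (conjugate c)) (conjugate c) (e (conjugate c)) (s (conjugate c)) (to-v c h) ∷ map⇒ f cs e s hs

      map⇐ : ∀ (f : Condition → Outcome) cs → (∀ c → Exact v w (f c) c) → (∀ c → Sound v w (f c) c) →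
        All (HoldsAt w) (map (λ c → f (conjugate c)) cs) → All (λ c → Holds c u) cs
      map⇐ f []       e s []       = []
      map⇐ f (c ∷ cs) e s (h ∷ hs) = from-v c (backward {v} {w} (f (conjugate c)) (conjugate c) (e (conjugate c)) (s (conjugate c)) h) ∷ map⇐ f cs e s hs

      map-weak : ∀ (f : Condition → Outcome) cs → (∀ c → Exact v w (f c) c) →
        All (λ c → WeaklyHolds c u) cs → All (WeaklyHoldsAt w) (map (λ c → f (conjugate c)) cs)
      map-weak f []       e []       = []
      map-weak f (c ∷ cs) e (h ∷ hs) = weakly {v} {w} (f (conjugate c)) (conjugate c) (e (conjugate c)) (to-v-weak c h) ∷ map-weak f cs e hs

    -- At the place `zero` the point w coincides with v = 1/u, so w and its reciprocal would both
    -- lie in the open hexagon. At the other places the curve bounding the inverted hexagon comes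
    -- first, since the soundness of the near outcomes rests on it.
    step-⇒ : ∀ s → InHexagon w → Region s u → RegionOf (step pl s) w
    step-⇒ s h (hu , hs) = go pl
      where
      go : ∀ (pl : Place A) → RegionOf (step pl s) w
      go (zero e) = no-small-reciprocal h λ k → <-respʳ
        (+-cong norm-eq (-‿cong (functional-eq k))) (C-v hu k)
        where
        functional-eq : ∀ k → functional k v ≈ functional k w
        functional-eq k = trans (shift-near (+ 0) (e k)) (+-identityˡ _)
        norm-eq : norm v ≈ norm w
        norm-eq = trans (norm-functional 0F v) (trans (quadratic-cong (functional-eq 0F) (functional-eq 1F)) (sym (norm-functional 0F w)))
      go (near j e₀ e₁) = agree-⇒ (outcomesNear j s) (stepNear j s) (stepNear-agrees j s) h
        (o ∷ map⇒ (translateNear j) (extras s) N.near-exact (N.near-sound o) hs)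
        where
        module N = Near {j} {w} {v} h (shift-near (+ 2) e₀) (shift-near (+ 1) e₁)
        o : Holds (O (opp j)) w
        o = <-respʳ N.C-same (C-v hu j)
      go (far k t e) = agree-⇒ (outcomesFar A s) (stepFar A s) (stepFar-agrees A s) h
        (map⇒ (translateFar A) (extras s) (Sign.far-exact {A} {w} {v} sh) (Sign.far-sound {A} {w} {v} sh h (Far.C-far {A} {w} {v} h sh {k} {t} e) (Far.O-far {A} {w} {v} h sh {k} {t} e)) hs)

    step-⇐ : ∀ s → RegionOf (step pl s) w → Region s u
    step-⇐ s = go pl
      where
      go : ∀ (pl : Place A) → RegionOf (step pl s) w → Region s u
      go (near j e₀ e₁) r with agree-⇐ (outcomesNear j s) (stepNear j s) (stepNear-agrees j s) r
      ... | h , o ∷ os = H-u (N.C-all o) , map⇐ (translateNear j) (extras s) N.near-exact (N.near-sound o) os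
        where
        module N = Near {j} {w} {v} h (shift-near (+ 2) e₀) (shift-near (+ 1) e₁)
      go (far k t e) r with agree-⇐ (outcomesFar A s) (stepFar A s) (stepFar-agrees A s) r
      ... | h , os = H-u (Far.C-far {A} {w} {v} h sh {k} {t} e) ,
        map⇐ (translateFar A) (extras s) (Sign.far-exact {A} {w} {v} sh) (Sign.far-sound {A} {w} {v} sh h (Far.C-far {A} {w} {v} h sh {k} {t} e) (Far.O-far {A} {w} {v} h sh {k} {t} e)) os

    -- Points of U may lie on sides, so strictness is lost. What survives is the part given by
    -- equalities of slacks, and this is all that a state asks for.
    step-weak : ∀ s → InClosedHexagon w → WeakRegion s u → WeakRegionOf (step pl s) w
    step-weak s h (hu , hs) = go pl
      where
      go : ∀ (pl : Place A) → WeakRegionOf (step pl s) w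
      go (zero e) = tt
      go (near j e₀ e₁) = agree-weak (outcomesNear j s) (stepNear j s) (stepNear-agrees j s) h
        (≤-respʳ N.C-same (C-v-weak hu j) ∷ map-weak (translateNear j) (extras s) N.near-exact hs)
        where module N = NearValues {j} {w} {v} (shift-near (+ 2) e₀) (shift-near (+ 1) e₁)
      go (far k t e) = agree-weak (outcomesFar A s) (stepFar A s) (stepFar-agrees A s) h
        (map-weak (translateFar A) (extras s) (Sign.far-exact {A} {w} {v} sh) hs)

  0<norm-shift : ∀ {A} (pl : Place A) {v w} → Shift A w v → ∀ s → RegionOf (step pl s) w → 0# < norm v
  0<norm-shift {A} (near j e₀ e₁) {v} {w} sh s r = Near.0<norm-near {j} {w} {v}
    (proj₁ (agree-⇐ (outcomesNear j s) (stepNear j s) (stepNear-agrees j s) r))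
    (trans (sh j) (+-congʳ (reflexive (≡.cong ⟦_⟧ℤ e₀)))) (trans (sh (next j)) (+-congʳ (reflexive (≡.cong ⟦_⟧ℤ e₁))))
  0<norm-shift {A} (far k t e) {v} {w} sh s r =
    Far.0<norm-far {A} {w} {v} (proj₁ (agree-⇐ (outcomesFar A s) (stepFar A s) (stepFar-agrees A s) r)) sh {k} {t} e

  -- Open conditions and continuity of inversion

  Near : Point → (Point → Set) → Set
  Near z A = ∃[ ρ ] 0# < ρ × (∀ w → norm (w -ₚ z) < ρ → A w)

  Near-∩ : ∀ {z A B} → Near z A → Near z B → Near z (λ w → A w × B w)
  Near-∩ {z} {A} {B} (ρ , 0<ρ , f) (σ , 0<σ , g) = both (∃-below 0<ρ 0<σ)
    where
    both : ∃[ τ ] 0# < τ × τ < ρ × τ < σ → Near z (λ w → A w × B w)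
    both (τ , 0<τ , τ<ρ , τ<σ) = τ , 0<τ , λ w h → f w (<-trans h τ<ρ) , g w (<-trans h τ<σ)

  Near-map : ∀ {z A B} → (∀ w → A w → B w) → Near z A → Near z B
  Near-map f (ρ , 0<ρ , g) = ρ , 0<ρ , λ w h → f w (g w h)

  0<-from-squares : ∀ {x y} → 0# < x → 0# < x * x - y * y → 0# < x + y
  0<-from-squares {x} {y} 0<x h = choose (<-cotrans 0<x (x + y))
    where
    choose : 0# < x + y ⊎ x + y < x → 0# < x + y
    choose (inj₁ k) = k
    choose (inj₂ k) = *-cancel-0< 0<x-y (<-respʳ (ring 2 (λ x y → x :* x :- y :* y := (x :- y) :* (x :+ y)) x y) h)
      where
      0<x-y : 0# < x - y
      0<x-y = <-respʳ (ring 2 (λ x y → (x :- (x :+ y)) :+ x := x :- y) x y) (+-0< (<⇒0< k) 0<x)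

  -- By Cauchy–Schwarz, (αx + βy)² ≤ (α² + β²)(x² + y²) ≤ (α² + β²) N.
  linear-bound : ∀ α β z → 0# ≤ (α * α + β * β) * norm z - (α * proj₁ z + β * proj₂ z) * (α * proj₁ z + β * proj₂ z)
  linear-bound α β (x , y) = ≤-respʳ (ring 4 (λ α β x y →
      (α :* y :- β :* x) :* (α :* y :- β :* x) :+ ((α :* y) :* (α :* y) :+ (β :* y) :* (β :* y)
        :+ ((α :* y) :* (α :* y) :+ (β :* y) :* (β :* y)))
      := (α :* α :+ β :* β) :* (x :* x :+ κ3 :* (y :* y)) :- (α :* x :+ β :* y) :* (α :* x :+ β :* y)) α β x y)
    (+-0≤ (0≤square _) (+-0≤ (+-0≤ (0≤square _) (0≤square _)) (+-0≤ (0≤square _) (0≤square _))))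

  perturbation : ∀ σ α β → 0# < σ → ∃[ ρ ] 0# < ρ ×
    (∀ z → norm z < ρ → 0# < σ + (α * proj₁ z + β * proj₂ z))
  perturbation σ α β 0<σ = helper (reciprocal 0<M)
    where
    -- By Cauchy-Schwarz, N(z) < σ²/M keeps the linear term below σ in absolute value. The added 1
    -- keeps M invertible when both coefficients vanish.
    M = α * α + β * β + 1#
    0<M : 0# < M
    0<M = +-0≤-0< (+-0≤ (0≤square α) (0≤square β)) 0<1
    helper : ∃[ d ] 0# < d × M * d ≈ 1# → ∃[ ρ ] 0# < ρ × (∀ z → norm z < ρ → 0# < σ + (α * proj₁ z + β * proj₂ z))
    helper (d , 0<d , Md≈1) = σ * σ * d , *-0< (*-0< 0<σ 0<σ) 0<d , λ z h → 0<-from-squares 0<σ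
      (<-respʳ (trans (ring 6 (λ s l a b n d → let M = a :* a :+ b :* b :+ κ1 in
            (n :+ ((a :* a :+ b :* b) :* n :- l :* l)) :+ M :* (s :* s :* d :- n) := (M :* d) :* (s :* s) :- l :* l)
            σ (α * proj₁ z + β * proj₂ z) α β (norm z) d)
          (+-congʳ (trans (*-congʳ Md≈1) (*-identityˡ _))))
        (+-0≤-0< (+-0≤ (0≤norm z) (linear-bound α β z)) (*-0< 0<M (<⇒0< h))))

  coefficients : Fin 6 → Carrier × Carrier
  coefficients 0F = 1# , 1#
  coefficients 1F = 0# , 2#
  coefficients 2F = - 1# , 1#
  coefficients 3F = - 1# , - 1#
  coefficients 4F = 0# , - 2#
  coefficients 5F = 1# , - 1#

  functional-linear : ∀ k z → functional k z ≈ proj₁ (coefficients k) * proj₁ z + proj₂ (coefficients k) * proj₂ z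
  functional-linear 0F (x , y) = ring 2 (λ x y → x :+ y := κ1 :* x :+ κ1 :* y) x y
  functional-linear 1F (x , y) = ring 2 (λ x y → y :+ y := κ0 :* x :+ κ2 :* y) x y
  functional-linear 2F (x , y) = ring 2 (λ x y → y :- x := :- κ1 :* x :+ κ1 :* y) x y
  functional-linear 3F (x , y) = ring 2 (λ x y → :- (x :+ y) := :- κ1 :* x :+ :- κ1 :* y) x y
  functional-linear 4F (x , y) = ring 2 (λ x y → :- (y :+ y) := κ0 :* x :+ :- κ2 :* y) x y
  functional-linear 5F (x , y) = ring 2 (λ x y → x :- y := κ1 :* x :+ :- κ1 :* y) x y

  functional-shift : ∀ k z w → functional k w ≈ functional k z
    + (proj₁ (coefficients k) * proj₁ (w -ₚ z) + proj₂ (coefficients k) * proj₂ (w -ₚ z))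
  functional-shift k z w = trans (functional-cong k
      (ring 2 (λ x x′ → x′ := x :+ (x′ :- x)) (proj₁ z) (proj₁ w) , ring 2 (λ x x′ → x′ := x :+ (x′ :- x)) (proj₂ z) (proj₂ w)))
    (trans (functional-+ k z (w -ₚ z)) (+-congˡ (functional-linear k (w -ₚ z))))

  norm-shift : ∀ z w → norm w ≈ norm z
    + ((2# * proj₁ z) * proj₁ (w -ₚ z) + (⟦ + 6 ⟧ℤ * proj₂ z) * proj₂ (w -ₚ z)) + norm (w -ₚ z)
  norm-shift (x , y) (x′ , y′) = ring 4 (λ x y x′ y′ → x′ :* x′ :+ κ3 :* (y′ :* y′) :=
    x :* x :+ κ3 :* (y :* y) :+ ((κ2 :* x) :* (x′ :- x) :+ (con (+ 6) :* y) :* (y′ :- y))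
      :+ ((x′ :- x) :* (x′ :- x) :+ κ3 :* ((y′ :- y) :* (y′ :- y)))) x y x′ y′

  -- As a function of w - z each slack is affine, up to the term N(w - z) of the circles, which is
  -- nonnegative and can only enlarge it. So every case comes from `perturbation`.
  holds-open : ∀ c z → Holds c z → Near z (Holds c)
  holds-open (H k) z h = helper (coefficients k) (functional-shift k z)
    where
    helper : ∀ ((α , β) : Carrier × Carrier) →
      (∀ w → functional k w ≈ functional k z + (α * proj₁ (w -ₚ z) + β * proj₂ (w -ₚ z))) → Near z (Holds (H k))
    helper (α , β) e = conclude (perturbation (slack (H k) z) (- α) (- β) h)
      where
      conclude : ∃[ ρ ] 0# < ρ × _ → Near z (Holds (H k))
      conclude (ρ , 0<ρ , g) = ρ , 0<ρ , λ w l → <-respʳ (trans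
        (ring 5 (λ f a b x y → (κ1 :- f) :+ (:- a :* x :+ :- b :* y) := κ1 :- (f :+ (a :* x :+ b :* y)))
        (functional k z) α β (proj₁ (w -ₚ z)) (proj₂ (w -ₚ z))) (+-congˡ (-‿cong (sym (e w))))) (g (w -ₚ z) l)
  holds-open (P k) z h = helper (coefficients k) (functional-shift k z)
    where
    helper : ∀ ((α , β) : Carrier × Carrier) →
      (∀ w → functional k w ≈ functional k z + (α * proj₁ (w -ₚ z) + β * proj₂ (w -ₚ z))) → Near z (Holds (P k))
    helper (α , β) e = conclude (perturbation (slack (P k) z) α β h)
      where
      conclude : ∃[ ρ ] 0# < ρ × _ → Near z (Holds (P k))
      conclude (ρ , 0<ρ , g) = ρ , 0<ρ , λ w l → <-respʳ (sym (e w)) (g (w -ₚ z) l)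
  holds-open (C k) z h = helper (coefficients k) (functional-shift k z)
    where
    helper : ∀ ((α , β) : Carrier × Carrier) →
      (∀ w → functional k w ≈ functional k z + (α * proj₁ (w -ₚ z) + β * proj₂ (w -ₚ z))) → Near z (Holds (C k))
    helper (α , β) e = conclude (perturbation (slack (C k) z) (2# * proj₁ z - α) (⟦ + 6 ⟧ℤ * proj₂ z - β) h)
      where
      conclude : ∃[ ρ ] 0# < ρ × _ → Near z (Holds (C k))
      conclude (ρ , 0<ρ , g) = ρ , 0<ρ , λ w l → <-respʳ (trans
        (ring 9 (λ n f a b p q x y m → m :+ ((n :- f) :+ ((κ2 :* p :- a) :* x :+ (con (+ 6) :* q :- b) :* y)) :=
          n :+ ((κ2 :* p) :* x :+ (con (+ 6) :* q) :* y) :+ m :- (f :+ (a :* x :+ b :* y)))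
        (norm z) (functional k z) α β (proj₁ z) (proj₂ z) (proj₁ (w -ₚ z)) (proj₂ (w -ₚ z)) (norm (w -ₚ z)))
        (+-cong (sym (norm-shift z w)) (-‿cong (sym (e w))))) (+-0≤-0< (0≤norm (w -ₚ z)) (g (w -ₚ z) l))
  holds-open (O k) z h = helper (coefficients k) (functional-shift k z)
    where
    helper : ∀ ((α , β) : Carrier × Carrier) →
      (∀ w → functional k w ≈ functional k z + (α * proj₁ (w -ₚ z) + β * proj₂ (w -ₚ z))) → Near z (Holds (O k))
    helper (α , β) e = conclude (perturbation (slack (O k) z) (2# * proj₁ z - (α + α)) (⟦ + 6 ⟧ℤ * proj₂ z - (β + β)) h)
      where
      conclude : ∃[ ρ ] 0# < ρ × _ → Near z (Holds (O k))
      conclude (ρ , 0<ρ , g) = ρ , 0<ρ , λ w l → <-respʳ (trans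
        (ring 9 (λ n f a b p q x y m → m :+ ((n :+ κ1 :- (f :+ f)) :+ ((κ2 :* p :- (a :+ a)) :* x :+ (con (+ 6) :* q :- (b :+ b)) :* y)) :=
          n :+ ((κ2 :* p) :* x :+ (con (+ 6) :* q) :* y) :+ m :+ κ1 :- ((f :+ (a :* x :+ b :* y)) :+ (f :+ (a :* x :+ b :* y))))
        (norm z) (functional k z) α β (proj₁ z) (proj₂ z) (proj₁ (w -ₚ z)) (proj₂ (w -ₚ z)) (norm (w -ₚ z)))
        (+-cong (+-congʳ (sym (norm-shift z w))) (-‿cong (+-cong (sym (e w)) (sym (e w)))))) (+-0≤-0< (0≤norm (w -ₚ z)) (g (w -ₚ z) l))

  all-open : ∀ cs z → All (λ c → Holds c z) cs → Near z (λ w → All (λ c → Holds c w) cs)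
  all-open [] z [] = 1# , 0<1 , λ _ _ → []
  all-open (c ∷ cs) z (h ∷ hs) = Near-map (λ _ → λ { (k , ks) → k ∷ ks }) (Near-∩ (holds-open c z h) (all-open cs z hs))

  hexagon-open : ∀ z → InHexagon z → Near z InHexagon
  hexagon-open z h = Near-map
    (λ { w (a ∷ b ∷ c ∷ d ∷ e ∷ f ∷ []) → λ { 0F → a ; 1F → b ; 2F → c ; 3F → d ; 4F → e ; 5F → f } })
    (all-open (H 0F ∷ H 1F ∷ H 2F ∷ H 3F ∷ H 4F ∷ H 5F ∷ []) z (h 0F ∷ h 1F ∷ h 2F ∷ h 3F ∷ h 4F ∷ h 5F ∷ []))

  region-open : ∀ s z → Region s z → Near z (Region s)
  region-open s z (h , hs) = Near-∩ (hexagon-open z h) (all-open (extras s) z hs)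

  reciprocal-exists : ∀ v → 0# < norm v → ∃[ u ] u *ₚ v ≈ₚ 1ₚ
  reciprocal-exists v@(x , y) h = helper (reciprocal h)
    where
    helper : ∃[ d ] 0# < d × norm v * d ≈ 1# → ∃[ u ] u *ₚ v ≈ₚ 1ₚ
    helper (d , _ , e) = (x * d , - y * d) ,
      trans (ring 3 (λ x y d → (x :* d) :* x :- κ3 :* ((:- y :* d) :* y) := (x :* x :+ κ3 :* (y :* y)) :* d) x y d) e ,
      ring 3 (λ x y d → (x :* d) :* y :+ (:- y :* d) :* x := κ0) x y d

  *ₚ-cong : ∀ {u u′ v v′} → u ≈ₚ u′ → v ≈ₚ v′ → u *ₚ v ≈ₚ u′ *ₚ v′
  *ₚ-cong (a , b) (c , d) = +-cong (*-cong a c) (-‿cong (*-congˡ (*-cong b d))) , +-cong (*-cong a d) (*-cong b c)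

  -ₚ-cong : ∀ {u u′ v v′} → u ≈ₚ u′ → v ≈ₚ v′ → u -ₚ v ≈ₚ u′ -ₚ v′
  -ₚ-cong (a , b) (c , d) = +-cong a (-‿cong c) , +-cong b (-‿cong d)

  +ₚ-cong : ∀ {u u′ v v′} → u ≈ₚ u′ → v ≈ₚ v′ → u +ₚ v ≈ₚ u′ +ₚ v′
  +ₚ-cong (a , b) (c , d) = +-cong a c , +-cong b d

  ≈ₚ-refl : ∀ {u} → u ≈ₚ u
  ≈ₚ-refl = refl , refl

  ≈ₚ-sym : ∀ {u v} → u ≈ₚ v → v ≈ₚ u
  ≈ₚ-sym (a , b) = sym a , sym b

  ≈ₚ-trans : ∀ {u v w} → u ≈ₚ v → v ≈ₚ w → u ≈ₚ w
  ≈ₚ-trans (a , b) (c , d) = trans a c , trans b d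

  *ₚ-exchange : ∀ u u′ v → u *ₚ (u′ *ₚ v) ≈ₚ u′ *ₚ (u *ₚ v)
  *ₚ-exchange (x , y) (x′ , y′) (a , b) =
    ring 6 (λ x y x′ y′ a b →
      x :* (x′ :* a :- κ3 :* (y′ :* b)) :- κ3 :* (y :* (x′ :* b :+ y′ :* a)) :=
      x′ :* (x :* a :- κ3 :* (y :* b)) :- κ3 :* (y′ :* (x :* b :+ y :* a))) x y x′ y′ a b ,
    ring 6 (λ x y x′ y′ a b →
      x :* (x′ :* b :+ y′ :* a) :+ y :* (x′ :* a :- κ3 :* (y′ :* b)) :=
      x′ :* (x :* b :+ y :* a) :+ y′ :* (x :* a :- κ3 :* (y :* b))) x y x′ y′ a b

  *ₚ-identityʳ : ∀ u → u *ₚ 1ₚ ≈ₚ u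
  *ₚ-identityʳ (x , y) = ring 2 (λ x y → x :* κ1 :- κ3 :* (y :* κ0) := x) x y , ring 2 (λ x y → x :* κ0 :+ y :* κ1 := y) x y

  reciprocal-unique : ∀ u u′ v → u *ₚ v ≈ₚ 1ₚ → u′ *ₚ v ≈ₚ 1ₚ → u ≈ₚ u′
  reciprocal-unique u u′ v e e′ = ≈ₚ-trans (≈ₚ-sym (*ₚ-identityʳ u)) (≈ₚ-trans (*ₚ-cong ≈ₚ-refl (≈ₚ-sym e′))
    (≈ₚ-trans (*ₚ-exchange u u′ v) (≈ₚ-trans (*ₚ-cong ≈ₚ-refl e) (*ₚ-identityʳ u′))))

  reciprocal-difference : ∀ {u v u′ v′} → u *ₚ v ≈ₚ 1ₚ → u′ *ₚ v′ ≈ₚ 1ₚ →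
    u′ -ₚ u ≈ₚ (v -ₚ v′) *ₚ (u *ₚ u′)
  reciprocal-difference {u} {v} {u′} {v′} e e′ = ≈ₚ-sym (≈ₚ-trans (expand u v u′ v′)
    (-ₚ-cong (≈ₚ-trans (*ₚ-cong ≈ₚ-refl e) (*ₚ-identityʳ u′)) (≈ₚ-trans (*ₚ-cong ≈ₚ-refl e′) (*ₚ-identityʳ u))))
    where
    expand : ∀ u v u′ v′ → (v -ₚ v′) *ₚ (u *ₚ u′) ≈ₚ u′ *ₚ (u *ₚ v) -ₚ u *ₚ (u′ *ₚ v′)
    expand (x , y) (a , b) (x′ , y′) (a′ , b′) =
      ring 8 (λ x y a b x′ y′ a′ b′ →
        (a :- a′) :* (x :* x′ :- κ3 :* (y :* y′)) :- κ3 :* ((b :- b′) :* (x :* y′ :+ y :* x′)) :=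
        (x′ :* (x :* a :- κ3 :* (y :* b)) :- κ3 :* (y′ :* (x :* b :+ y :* a))) :-
        (x :* (x′ :* a′ :- κ3 :* (y′ :* b′)) :- κ3 :* (y :* (x′ :* b′ :+ y′ :* a′)))) x y a b x′ y′ a′ b′ ,
      ring 8 (λ x y a b x′ y′ a′ b′ →
        (a :- a′) :* (x :* y′ :+ y :* x′) :+ (b :- b′) :* (x :* x′ :- κ3 :* (y :* y′)) :=
        (x′ :* (x :* b :+ y :* a) :+ y′ :* (x :* a :- κ3 :* (y :* b))) :-
        (x :* (x′ :* b′ :+ y′ :* a′) :+ y :* (x′ :* a′ :- κ3 :* (y′ :* b′)))) x y a b x′ y′ a′ b′

  norm-flip : ∀ v w → norm (v -ₚ w) ≈ norm (w -ₚ v)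
  norm-flip (x , y) (x′ , y′) = ring 4 (λ x y x′ y′ → (x :- x′) :* (x :- x′) :+ κ3 :* ((y :- y′) :* (y :- y′)) :=
    (x′ :- x) :* (x′ :- x) :+ κ3 :* ((y′ :- y) :* (y′ :- y))) x y x′ y′

  4# : Carrier
  4# = ⟦ + 4 ⟧ℤ

  -- The triangle inequality |w| ≥ |v| - |w - v| > |v|/2 without roots: 4N(w) - N(v) = 2N(2w - v) -
  -- 4N(w - v) + N(v).
  norm-lower-bound : ∀ v w σ → norm (w -ₚ v) < σ → 4# * σ < norm v → norm v < 4# * norm w
  norm-lower-bound v@(x , y) w@(x′ , y′) σ h k = 0<⇒< (<-respʳ
    (ring 5 (λ x y x′ y′ s → let n = λ x y → x :* x :+ κ3 :* (y :* y); d = n (x′ :- x) (y′ :- y); e = n (x′ :+ x′ :- x) (y′ :+ y′ :- y) in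
      (e :+ e) :+ (κ4 :* (s :- d) :+ (n x y :- κ4 :* s)) := κ4 :* n x′ y′ :- n x y) x y x′ y′ σ)
    (+-0≤-0< (+-0≤ nonneg nonneg) (+-0< (*-0< (0<ℕ 3) (<⇒0< h)) (<⇒0< k))))
    where
    nonneg : 0# ≤ norm (x′ + x′ - x , y′ + y′ - y)
    nonneg = 0≤norm (x′ + x′ - x , y′ + y′ - y)

  -- N(u′ - u) = N(v′ - v) N(u) N(u′). Within N(v)/4 of v one has N(u′) < 4N(u), so a radius below ρ
  -- / (4N(u)² + 1) is small enough.
  reciprocal-continuous : ∀ u v → u *ₚ v ≈ₚ 1ₚ → ∀ ρ → 0# < ρ →
    Near v (λ v′ → ∃[ u′ ] u′ *ₚ v′ ≈ₚ 1ₚ × norm (u′ -ₚ u) < ρ)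
  reciprocal-continuous u v e ρ 0<ρ = choose (reciprocal (0<ℕ 3)) (reciprocal 0<M)
    where
    nu = norm u
    M = 4# * (nu * nu) + 1#
    0<M : 0# < M
    0<M = +-0≤-0< (*-0<-0≤ (0<ℕ 3) (0≤square nu)) 0<1
    0<nu : 0# < nu
    0<nu = 0<-factor nu (norm v) (0≤norm u) (0≤norm v) (trans (*-comm (norm v) nu) (norm-reciprocal u v e))
    choose : ∃[ q ] 0# < q × 4# * q ≈ 1# → ∃[ d ] 0# < d × M * d ≈ 1# →
      Near v (λ v′ → ∃[ u′ ] u′ *ₚ v′ ≈ₚ 1ₚ × norm (u′ -ₚ u) < ρ)
    choose (q , 0<q , 4q≈1) (d , 0<d , Md≈1) = finish (∃-below (*-0< (0<norm u v e) 0<q) (*-0< 0<ρ 0<d))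
      where
      finish : ∃[ σ ] 0# < σ × σ < norm v * q × σ < ρ * d →
        Near v (λ v′ → ∃[ u′ ] u′ *ₚ v′ ≈ₚ 1ₚ × norm (u′ -ₚ u) < ρ)
      finish (σ , 0<σ , σ<nq , σ<ρd) = σ , 0<σ , λ v′ h → at v′ h (norm-lower-bound v v′ σ h 4σ<n)
        where
        4σ<n : 4# * σ < norm v
        4σ<n = 0<⇒< (<-respʳ (trans (ring 3 (λ n q s → κ4 :* (n :* q :- s) := (κ4 :* q) :* n :- κ4 :* s) (norm v) q σ)
          (+-congʳ (trans (*-congʳ 4q≈1) (*-identityˡ (norm v))))) (*-0< (0<ℕ 3) (<⇒0< σ<nq)))
        at : ∀ v′ → norm (v′ -ₚ v) < σ → norm v < 4# * norm v′ → ∃[ u′ ] u′ *ₚ v′ ≈ₚ 1ₚ × norm (u′ -ₚ u) < ρ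
        at v′ h k = with-reciprocal (reciprocal-exists v′ (*-cancel-0< (0<ℕ 3) (<-trans (0<norm u v e) k)))
          where
          with-reciprocal : ∃[ u′ ] u′ *ₚ v′ ≈ₚ 1ₚ → ∃[ u′ ] u′ *ₚ v′ ≈ₚ 1ₚ × norm (u′ -ₚ u) < ρ
          with-reciprocal (u′ , e′) = u′ , e′ , 0<⇒< (<-respʳ
            (trans (ring 5 (λ r d t n m → (((r :* d :- t) :* (κ4 :* (n :* n))) :+ t :* (n :* (κ4 :* n :- m))) :+ r :* d
                := r :* ((κ4 :* (n :* n) :+ κ1) :* d) :- t :* (n :* m)) ρ d τ nu nu′)
              (+-cong (trans (*-congˡ Md≈1) (*-identityʳ ρ)) (-‿cong (sym difference))))
            (+-0≤-0< (+-0≤ (≤-respʳ (*-comm (4# * (nu * nu)) (ρ * d - τ))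
                (*-0<-0≤ (*-0< (0<ℕ 3) (*-0< 0<nu 0<nu)) (<⇒≤ (<⇒0< (<-trans h σ<ρd)))))
                (≤-respʳ (ring 3 (λ n m t → (n :* (κ4 :* n :- m)) :* t := t :* (n :* (κ4 :* n :- m))) nu nu′ τ) (*-0<-0≤ (*-0< 0<nu (<⇒0< nu′<4nu)) (0≤norm (v′ -ₚ v)))))
              (*-0< 0<ρ 0<d)))
            where
            τ = norm (v′ -ₚ v)
            nu′ = norm u′
            difference : norm (u′ -ₚ u) ≈ τ * (nu * nu′)
            difference = trans (norm-cong (reciprocal-difference e e′)) (trans (norm-* (v -ₚ v′) (u *ₚ u′))
              (*-cong (norm-flip v v′) (norm-* u u′)))
            0<nu′ : 0# < nu′
            0<nu′ = 0<-factor nu′ (norm v′) (0≤norm u′) (0≤norm v′) (trans (*-comm (norm v′) nu′) (norm-reciprocal u′ v′ e′))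
            nu′<4nu : nu′ < 4# * nu
            nu′<4nu = 0<⇒< (<-respʳ (trans (ring 4 (λ n m a b → (n :* m) :* (κ4 :* b :- a) := κ4 :* n :* (m :* b) :- m :* (n :* a)) nu nu′ (norm v) (norm v′))
              (+-cong (trans (*-congˡ (norm-reciprocal u′ v′ e′)) (*-identityʳ _)) (-‿cong (trans (*-congˡ (norm-reciprocal u v e)) (*-identityʳ _)))))
              (*-0< (*-0< 0<nu 0<nu′) (<⇒0< k)))

  -- Covering the lines and circles by small rectangles

  record Within (x a : Carrier) : Set where
    constructor within
    field
      lower : 0# < a + x
      upper : 0# < a - x
  open Within public

  within-resp : ∀ {x y a} → x ≈ y → Within x a → Within y a
  within-resp e (within l u) = within (<-respʳ (+-congˡ e) l) (<-respʳ (+-congˡ (-‿cong e)) u)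

  within-mono : ∀ {x a b} → 0# ≤ b - a → Within x a → Within x b
  within-mono {x} {a} {b} h (within l u) = within
    (<-respʳ (ring 3 (λ x a b → (b :- a) :+ (a :+ x) := b :+ x) x a b) (+-0≤-0< h l))
    (<-respʳ (ring 3 (λ x a b → (b :- a) :+ (a :- x) := b :- x) x a b) (+-0≤-0< h u))

  within-+ : ∀ {x y a b} → Within x a → Within y b → Within (x + y) (a + b)
  within-+ {x} {y} {a} {b} (within l u) (within l′ u′) = within
    (<-respʳ (ring 4 (λ x y a b → (a :+ x) :+ (b :+ y) := (a :+ b) :+ (x :+ y)) x y a b) (+-0< l l′))
    (<-respʳ (ring 4 (λ x y a b → (a :- x) :+ (b :- y) := (a :+ b) :- (x :+ y)) x y a b) (+-0< u u′))

  within-neg : ∀ {x a} → Within x a → Within (- x) a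
  within-neg {x} {a} (within l u) = within u (<-respʳ (ring 2 (λ x a → a :+ x := a :- :- x) x a) l)

  -- 2(ab ± xy) is a sum of two products of positive factors a ± x and b ± y, so no case distinction
  -- on signs occurs.
  within-* : ∀ {x y a b} → Within x a → Within y b → Within (x * y) (a * b)
  within-* {x} {y} {a} {b} (within l u) (within l′ u′) = within
    (*-cancel-0< 0<2 (<-respʳ (ring 4 (λ x y a b → (a :+ x) :* (b :+ y) :+ (a :- x) :* (b :- y) := κ2 :* (a :* b :+ x :* y)) x y a b)
      (+-0< (*-0< l l′) (*-0< u u′))))
    (*-cancel-0< 0<2 (<-respʳ (ring 4 (λ x y a b → (a :- x) :* (b :+ y) :+ (a :+ x) :* (b :- y) := κ2 :* (a :* b :- x :* y)) x y a b)
      (+-0< (*-0< u l′) (*-0< l u′))))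

  within-integer : ∀ i n {a b} → + n ℤ.+ i ≡ +[1+ a ] → + n ℤ.- i ≡ +[1+ b ] → Within ⟦ i ⟧ℤ ⟦ + n ⟧ℤ
  within-integer i n {a} {b} e f = within
    (<-respʳ (trans (reflexive (≡.cong ⟦_⟧ℤ (≡.sym e))) (+-homo (+ n) i)) (0<ℕ a))
    (<-respʳ (trans (reflexive (≡.cong ⟦_⟧ℤ (≡.sym f))) (trans (+-homo (+ n) (ℤ.- i)) (+-congˡ (neg-homo i)))) (0<ℕ b))

  0<-width : ∀ {x a} → Within x a → 0# < a
  0<-width {x} {a} (within l u) = *-cancel-0< 0<2 (<-respʳ (ring 2 (λ x a → (a :+ x) :+ (a :- x) := κ2 :* a) x a) (+-0< l u))

  within-from-squares : ∀ {z s} → 0# < s → 0# < s * s - z * z → Within z s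
  within-from-squares {z} {s} 0<s h = within (0<-from-squares 0<s h)
    (0<-from-squares 0<s (<-respʳ (ring 2 (λ z s → s :* s :- z :* z := s :* s :- :- z :* :- z) z s) h))

  -- An approximate square root of t on the grid of mesh h.
  RootBracket : Carrier → Carrier → Set
  RootBracket t h = t < h * h ⊎ ∃[ k ]
    (⟦ + k ⟧ℤ * h) * (⟦ + k ⟧ℤ * h) < t × t < ((⟦ + k ⟧ℤ + 2#) * h) * ((⟦ + k ⟧ℤ + 2#) * h)

  ⟦suc⟧ : ∀ n → ⟦ + suc n ⟧ℤ ≈ 1# + ⟦ + n ⟧ℤ
  ⟦suc⟧ n = +-homo (+ 1) (+ n)

  -- Descent on n. Cotransitivity between the squares of nh and (n + 1)h leaves an overlap, so the
  -- root of t is caught only between nh and (n + 2)h; this is the 2 in the bracket.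
  root-search : ∀ t h → 0# < h → ∀ n → t < (⟦ + n ⟧ℤ * h) * (⟦ + n ⟧ℤ * h) → RootBracket t h
  root-search t h 0<h zero k = inj₁ (<-trans (<-respʳ (ring 1 (λ h → (κ0 :* h) :* (κ0 :* h) := κ0) h) k) (*-0< 0<h 0<h))
  root-search t h 0<h (suc zero) k = inj₁ (<-respʳ (ring 1 (λ h → (κ1 :* h) :* (κ1 :* h) := h :* h) h) k)
  root-search t h 0<h (suc (suc n)) k = choose (root-search t h 0<h (suc n)) (<-cotrans {lo} {hi} lo<hi t)
    where
    lo = (⟦ + n ⟧ℤ * h) * (⟦ + n ⟧ℤ * h)
    hi = (⟦ + suc n ⟧ℤ * h) * (⟦ + suc n ⟧ℤ * h)
    lo<hi : lo < hi
    lo<hi = 0<⇒< (<-respʳ (trans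
        (ring 2 (λ n h → (n :* (h :* h) :+ n :* (h :* h)) :+ h :* h := ((κ1 :+ n) :* h) :* ((κ1 :+ n) :* h) :- (n :* h) :* (n :* h)) ⟦ + n ⟧ℤ h)
        (+-congʳ (sym (*-cong (*-congʳ (⟦suc⟧ n)) (*-congʳ (⟦suc⟧ n))))))
      (+-0≤-0< (+-0≤ 0≤nhh 0≤nhh) (*-0< 0<h 0<h)))
      where
      0≤nhh : 0# ≤ ⟦ + n ⟧ℤ * (h * h)
      0≤nhh = ≤-respʳ (*-comm (h * h) ⟦ + n ⟧ℤ) (*-0<-0≤ (*-0< 0<h 0<h) (0≤ℕ n))
    choose : (t < hi → RootBracket t h) → lo < t ⊎ t < hi → RootBracket t h
    choose descend (inj₁ l) = inj₂ (n , l , <-respʳ (*-cong (*-congʳ e) (*-congʳ e)) k)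
      where
      e : ⟦ + suc (suc n) ⟧ℤ ≈ ⟦ + n ⟧ℤ + 2#
      e = trans (+-homo (+ 2) (+ n)) (+-comm 2# ⟦ + n ⟧ℤ)
    choose descend (inj₂ l) = descend l

  0≤n²-n : ∀ n → 0# ≤ ⟦ + n ⟧ℤ * ⟦ + n ⟧ℤ - ⟦ + n ⟧ℤ
  0≤n²-n zero    = ≤-reflexive (ring 0 (κ0 := κ0 :* κ0 :- κ0))
  0≤n²-n (suc n) = ≤-respʳ (trans (ring 1 (λ n → (κ1 :+ n) :* n := (κ1 :+ n) :* (κ1 :+ n) :- (κ1 :+ n)) ⟦ + n ⟧ℤ)
      (+-cong (*-cong (sym (⟦suc⟧ n)) (sym (⟦suc⟧ n))) (-‿cong (sym (⟦suc⟧ n)))))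
    (*-0<-0≤ (<-respʳ (⟦suc⟧ n) (0<ℕ n)) (0≤ℕ n))

  -- The descent starts at an integer n > t/h², which is large enough because n² ≥ n.
  root-bracket : ∀ t h → 0# < h → RootBracket t h
  root-bracket t h 0<h = with-inverse (reciprocal 0<h)
    where
    with-inverse : ∃[ d ] 0# < d × h * d ≈ 1# → RootBracket t h
    with-inverse (d , 0<d , hd≈1) = with-bound (archimedean (t * (d * d)))
      where
      with-bound : ∃[ n ] t * (d * d) < ⟦ + n ⟧ℤ → RootBracket t h
      with-bound (n , l) = root-search t h 0<h n (0<⇒< (<-respʳ
        (trans (ring 4 (λ t h d n → (n :* n :- n) :* (h :* h) :+ (n :- t :* (d :* d)) :* (h :* h)
            := (n :* h) :* (n :* h) :- t :* ((h :* d) :* (h :* d))) t h d ⟦ + n ⟧ℤ)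
          (+-congˡ (-‿cong (trans (*-congˡ (trans (*-cong hd≈1 hd≈1) (*-identityʳ 1#))) (*-identityʳ t)))))
        (+-0≤-0< (≤-respʳ (*-comm (h * h) _) (*-0<-0≤ (*-0< 0<h 0<h) (0≤n²-n n)))
          (*-0< (<⇒0< l) (*-0< 0<h 0<h)))))

  -- If Z² is close to t, then Z is close to one of ± the approximate root.
  approximate-root : ∀ K t h → 0# < h → ∃[ r ] (∀ z → Within (z * z - t) (⟦ + K ⟧ℤ * (h * h)) →
    Within (z - r) ((⟦ + K ⟧ℤ + ⟦ + K ⟧ℤ + 3#) * h) ⊎ Within (z - - r) ((⟦ + K ⟧ℤ + ⟦ + K ⟧ℤ + 3#) * h))
  approximate-root K t h 0<h = go (root-bracket t h 0<h)
    where
    κ = ⟦ + K ⟧ℤ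
    -- The width comes from brackets near 0: for k ≤ K + 1 the bound (k + 2 + K)h on |z| is at most
    -- (2K + 3)h.
    M = κ + κ + 3#
    0≤κ : 0# ≤ κ
    0≤κ = 0≤ℕ K
    0<hh : 0# < h * h
    0<hh = *-0< 0<h 0<h
    0≤*hh : ∀ {a} → 0# ≤ a → 0# ≤ a * (h * h)
    0≤*hh {a} p = ≤-respʳ (*-comm (h * h) a) (*-0<-0≤ 0<hh p)
    0≤*h : ∀ {a} → 0# ≤ a → 0# ≤ a * h
    0≤*h {a} p = ≤-respʳ (*-comm h a) (*-0<-0≤ 0<h p)
    0≤κκ : 0# ≤ κ * κ
    0≤κκ = 0≤square κ
    Result : Carrier → Set
    Result r = ∀ z → Within (z * z - t) (κ * (h * h)) → Within (z - r) (M * h) ⊎ Within (z - - r) (M * h)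
    zero-root : (∀ z → Within (z * z - t) (κ * (h * h)) → Within z (M * h)) → ∃[ r ] Result r
    zero-root f = 0# , λ z q → inj₁ (within-resp (ring 1 (λ z → z := z :- κ0) z) (f z q))
    -- Z² < (c h)² + K h² ≤ ((c + K) h)² when c ≥ 1.
    upper-bound : ∀ c z → 0# ≤ c - 1# → t < (c * h) * (c * h) → Within (z * z - t) (κ * (h * h)) → Within z ((c + κ) * h)
    upper-bound c z 1≤c l q = within-from-squares
      (*-0< (<-respʳ (ring 2 (λ c k → (c :- κ1) :+ k :+ κ1 := c :+ k) c κ) (+-0≤-0< (+-0≤ 1≤c 0≤κ) 0<1)) 0<h)
      (<-respʳ (ring 5 (λ c k h t z → ((k :* k :+ (k :* (c :- κ1) :+ k :* (c :- κ1) :+ k)) :* (h :* h)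
            :+ (k :* (h :* h) :- (z :* z :- t))) :+ ((c :* h) :* (c :* h) :- t)
            := ((c :+ k) :* h) :* ((c :+ k) :* h) :- z :* z) c κ h t z)
        (+-0< (+-0≤-0< (0≤*hh (+-0≤ 0≤κκ (+-0≤ (+-0≤ κ[c-1] κ[c-1]) 0≤κ))) (upper q)) (<⇒0< l)))
      where
      κ[c-1] : 0# ≤ κ * (c - 1#)
      κ[c-1] = 0≤ℕ* K
        where
        0≤ℕ* : ∀ n → 0# ≤ ⟦ + n ⟧ℤ * (c - 1#)
        0≤ℕ* zero    = ≤-reflexive (ring 1 (λ c → κ0 := κ0 :* c) (c - 1#))
        0≤ℕ* (suc n) = *-0<-0≤ (0<ℕ n) 1≤c
    small : ∀ {c} z → 0# ≤ M - (c + κ) → Within z ((c + κ) * h) → Within z (M * h)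
    small {c} z p = within-mono (≤-respʳ (ring 3 (λ a b h → (a :- b) :* h := a :* h :- b :* h) M (c + κ) h) (0≤*h p))
    -- Here t lies between (k h)² and ((k + 2) h)², where k = K + 1 + m.
    large-root : ∀ m → let k = (κ + 1#) + ⟦ + m ⟧ℤ in (k * h) * (k * h) < t → t < ((k + 2#) * h) * ((k + 2#) * h) → ∃[ r ] Result r
    large-root m lo hi = r , λ z q → choose z q (<-cotrans {(- h)} {h} (0<⇒< (<-respʳ (ring 1 (λ h → h :+ h := h :- :- h) h) (+-0< 0<h 0<h))) z)
      where
      μ = ⟦ + m ⟧ℤ
      k = (κ + 1#) + μ
      r = (k + 1#) * h
      0≤μ : 0# ≤ μ
      0≤μ = 0≤ℕ m
      1≤k+2 : 0# ≤ (k + 2#) - 1#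
      1≤k+2 = ≤-respʳ (ring 2 (λ a m → a :+ m :+ κ2 := (((a :+ κ1) :+ m) :+ κ2) :- κ1) κ μ) (+-0≤ (+-0≤ 0≤κ 0≤μ) (0≤ℕ 2))
      -- Z² > (k² - K) h² excludes |Z| < (m + 1) h.
      impossible : ∀ z → Within (z * z - t) (κ * (h * h)) → Within z ((μ + 1#) * h) → ⊥
      impossible z q (within a b) = <-irrefl refl (<-respʳ
        (ring 5 (λ k h t z m → let c = (k :+ κ1) :+ m in
          ((k :* k :+ k :+ (k :* m :+ k :* m)) :* (h :* h) :+ (k :* (h :* h) :+ (z :* z :- t)))
            :+ ((t :- (c :* h) :* (c :* h)) :+ ((m :+ κ1) :* h :+ z) :* ((m :+ κ1) :* h :- z)) := κ0) κ h t z μ)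
        (+-0< (+-0≤-0< (0≤*hh (+-0≤ (+-0≤ 0≤κκ 0≤κ) (+-0≤ κμ κμ))) (lower q)) (+-0< (<⇒0< lo) (*-0< a b))))
        where
        κμ : 0# ≤ κ * μ
        κμ = ≤-respʳ (*-homo (+ K) (+ m)) (≡.subst (λ i → 0# ≤ ⟦ i ⟧ℤ) (ℤ.pos-* K m) (0≤ℕ (K ℕ.* m)))
          where import Data.Integer.Properties as ℤ
      positive : ∀ z → Within (z * z - t) (κ * (h * h)) → - h < z → Within (z - r) (M * h)
      positive z q -h<z = within below above
        where
        ub : Within z ((k + 2# + κ) * h)
        ub = upper-bound (k + 2#) z 1≤k+2 hi q
        above : 0# < M * h - (z - r)
        above = <-respʳ (ring 4 (λ k m h z → let c = (k :+ κ1) :+ m in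
            (k :+ κ2) :* h :+ ((c :+ κ2 :+ k) :* h :- z) := (k :+ k :+ κ3) :* h :- (z :- (c :+ κ1) :* h)) κ μ h z)
          (+-0< (*-0< (+-0≤-0< 0≤κ 0<2) 0<h) (upper ub))
        below : 0# < M * h + (z - r)
        below = decide (<-cotrans {r - (κ + 2#) * h} {r - (κ + 1#) * h}
          (0<⇒< (<-respʳ (ring 3 (λ k r h → h := (r :- (k :+ κ1) :* h) :- (r :- (k :+ κ2) :* h)) κ r h) 0<h)) z)
          where
          decide : r - (κ + 2#) * h < z ⊎ z < r - (κ + 1#) * h → 0# < M * h + (z - r)
          decide (inj₁ p) = <-respʳ (ring 4 (λ k r h z → (k :+ κ1) :* h :+ (z :- (r :- (k :+ κ2) :* h)) := (k :+ k :+ κ3) :* h :+ (z :- r)) κ r h z)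
            (+-0< (*-0< (+-0≤-0< 0≤κ 0<1) 0<h) (<⇒0< p))
          decide (inj₂ p) = ⊥-elim (impossible z q (within
            (<-respʳ (ring 3 (λ m h z → m :* h :+ (z :- :- h) := (m :+ κ1) :* h :+ z) μ h z) (+-0≤-0< (0≤*h 0≤μ) (<⇒0< -h<z)))
            (<-respʳ (ring 4 (λ k m h z → (((k :+ κ1) :+ m :+ κ1) :* h :- (k :+ κ1) :* h) :- z := (m :+ κ1) :* h :- z) κ μ h z) (<⇒0< p))))
      choose : ∀ z → Within (z * z - t) (κ * (h * h)) → - h < z ⊎ z < h → Within (z - r) (M * h) ⊎ Within (z - - r) (M * h)
      choose z q (inj₁ p) = inj₁ (positive z q p)
      choose z q (inj₂ p) = inj₂ (within-resp (ring 2 (λ z r → :- (:- z :- r) := z :- :- r) z r)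
        (within-neg (positive (- z) (within-resp (ring 2 (λ z t → z :* z :- t := :- z :* :- z :- t) z t) q)
          (0<⇒< (<-respʳ (ring 2 (λ z h → h :- z := :- z :- :- h) z h) (<⇒0< p))))))
    go : RootBracket t h → ∃[ r ] Result r
    go (inj₁ l) = zero-root λ z q → small {1#} z
      (≤-respʳ (ring 1 (λ k → k :+ κ2 := (k :+ k :+ κ3) :- (κ1 :+ k)) κ) (+-0≤ 0≤κ (0≤ℕ 2)))
      (upper-bound 1# z (≤-reflexive (ring 0 (κ0 := κ1 :- κ1))) (<-respʳ (ring 1 (λ h → h :* h := (κ1 :* h) :* (κ1 :* h)) h) l) q)
    go (inj₂ (k , lo , hi)) = split (ℕ.≤-total k (suc K))
      where
      -- Near 0 the two roots cannot be told apart and 0 serves as centre for both. Otherwise |z| <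
      -- (m + 1)h is impossible, and the overlapping tests -h < z and z < h reveal the sign of z.
      split : k ℕ.≤ suc K ⊎ suc K ℕ.≤ k → ∃[ r ] Result r
      split (inj₁ k≤) = zero-root λ z q → small {⟦ + k ⟧ℤ + 2#} z
        (≤-respʳ (trans (ring 3 (λ k d a → d := (a :+ a :+ κ3) :- ((κ1 :+ a :- d) :+ κ2 :+ a)) ⟦ + k ⟧ℤ ⟦ + (suc K ℕ.∸ k) ⟧ℤ κ)
            (+-congˡ (-‿cong (+-congʳ (+-congʳ e))))) (0≤ℕ (suc K ℕ.∸ k)))
        (upper-bound (⟦ + k ⟧ℤ + 2#) z (≤-respʳ (ring 1 (λ k → k :+ κ1 := (k :+ κ2) :- κ1) ⟦ + k ⟧ℤ) (+-0≤ (0≤ℕ k) (<⇒≤ 0<1))) hi q)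
        where
        e : 1# + κ - ⟦ + (suc K ℕ.∸ k) ⟧ℤ ≈ ⟦ + k ⟧ℤ
        e = trans (+-congʳ (trans (sym (⟦suc⟧ K)) (trans (reflexive (≡.cong (λ n → ⟦ + n ⟧ℤ) (≡.sym (ℕ.m+[n∸m]≡n k≤))))
              (+-homo (+ k) (+ (suc K ℕ.∸ k))))))
            (ring 2 (λ a b → (a :+ b) :- b := a) ⟦ + k ⟧ℤ ⟦ + (suc K ℕ.∸ k) ⟧ℤ)
      split (inj₂ K<k) = large-root (k ℕ.∸ suc K)
        (<-respˡ (*-cong (*-congʳ e) (*-congʳ e)) lo)
        (<-respʳ (*-cong (*-congʳ (+-congʳ e)) (*-congʳ (+-congʳ e))) hi)
        where
        e : ⟦ + k ⟧ℤ ≈ (κ + 1#) + ⟦ + (k ℕ.∸ suc K) ⟧ℤ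
        e = trans (reflexive (≡.cong (λ n → ⟦ + n ⟧ℤ) (≡.sym (ℕ.m+[n∸m]≡n K<k))))
          (trans (+-homo (+ suc K) (+ (k ℕ.∸ suc K))) (+-congʳ (trans (⟦suc⟧ K) (+-comm 1# κ))))

  -- Solving αx + βy for y needs 1/β with β among ±1, ±2. Passing to 6y clears these denominators,
  -- and 6y is also what appears on completing the square for the circles, so one reciprocal of 6
  -- serves both.
  record LinearForm (f : Point → Carrier) : Set where
    -- D = 6 / β
    field
      α β D  : Carrier
      linear : ∀ z → f z ≈ α * proj₁ z + β * proj₂ z
      Dβ≈6   : D * β ≈ ⟦ + 6 ⟧ℤ
      ∣α∣<2  : Within α 2#
      ∣D∣<7  : Within D ⟦ + 7 ⟧ℤ

  linear-form : ∀ k → LinearForm (functional k)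
  linear-form 0F = record { linear = functional-linear 0F ; Dβ≈6 = *-identityʳ ⟦ + 6 ⟧ℤ
    ; ∣α∣<2 = within-integer (+ 1) 2 ≡.refl ≡.refl ; ∣D∣<7 = within-integer (+ 6) 7 ≡.refl ≡.refl }
  linear-form 1F = record { linear = functional-linear 1F ; Dβ≈6 = sym (*-homo (+ 3) (+ 2))
    ; ∣α∣<2 = within-integer (+ 0) 2 ≡.refl ≡.refl ; ∣D∣<7 = within-integer (+ 3) 7 ≡.refl ≡.refl }
  linear-form 2F = record { linear = functional-linear 2F ; Dβ≈6 = *-identityʳ ⟦ + 6 ⟧ℤ
    ; ∣α∣<2 = within-integer -[1+ 0 ] 2 ≡.refl ≡.refl ; ∣D∣<7 = within-integer (+ 6) 7 ≡.refl ≡.refl }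
  linear-form 3F = record { linear = functional-linear 3F ; Dβ≈6 = sym (*-homo -[1+ 5 ] -[1+ 0 ])
    ; ∣α∣<2 = within-integer -[1+ 0 ] 2 ≡.refl ≡.refl ; ∣D∣<7 = within-integer -[1+ 5 ] 7 ≡.refl ≡.refl }
  linear-form 4F = record { linear = functional-linear 4F ; Dβ≈6 = sym (*-homo -[1+ 2 ] -[1+ 1 ])
    ; ∣α∣<2 = within-integer (+ 0) 2 ≡.refl ≡.refl ; ∣D∣<7 = within-integer -[1+ 2 ] 7 ≡.refl ≡.refl }
  linear-form 5F = record { linear = functional-linear 5F ; Dβ≈6 = sym (*-homo -[1+ 5 ] -[1+ 0 ])
    ; ∣α∣<2 = within-integer (+ 1) 2 ≡.refl ≡.refl ; ∣D∣<7 = within-integer -[1+ 5 ] 7 ≡.refl ≡.refl }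

  record Rectangle : Set where
    field
      x₀ x₁ y₀ y₁ : Carrier
      x₀<x₁ : x₀ < x₁
      y₀<y₁ : y₀ < y₁
    extent : Carrier
    extent = (x₁ - x₀) * (y₁ - y₀)
  open Rectangle public

  Inside : Point → Rectangle → Set
  Inside (x , y) R = (x₀ R < x × x < x₁ R) × (y₀ R < y × y < y₁ R)

  -- Columns have half-width h² but rectangles have height of order h: near a vertical tangent of a
  -- circle an error h² in x moves y by the order of h. About h⁻² columns with areas of order h³
  -- still give a total of order h.
  module Mesh (sixth : Carrier) (6sixth : ⟦ + 6 ⟧ℤ * sixth ≈ 1#) (h : Carrier) (0<h : 0# < h) (h≤1 : 0# ≤ 1# - h) where

    W B : Carrier
    W = h * h
    -- The width 2K + 3 of `approximate-root` for K = 120; the circles require K ≥ 12(1 + 8) = 108.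
    B = (⟦ + 120 ⟧ℤ + ⟦ + 120 ⟧ℤ + 3#) * h

    0<W : 0# < W
    0<W = *-0< 0<h 0<h

    0<B : 0# < B
    0<B = *-0< (+-0< (+-0< (0<ℕ 119) (0<ℕ 119)) (0<ℕ 2)) 0<h

    within-sixth : ∀ {z a} → Within (⟦ + 6 ⟧ℤ * z) a → Within z a
    within-sixth {z} {a} q@(within l u) = within
      (*-cancel-0< (0<ℕ 5) (<-respʳ (ring 2 (λ z a → (a :+ con (+ 6) :* z) :+ con (+ 5) :* a := con (+ 6) :* (a :+ z)) z a)
        (+-0< l (*-0< (0<ℕ 4) (0<-width q)))))
      (*-cancel-0< (0<ℕ 5) (<-respʳ (ring 2 (λ z a → (a :- con (+ 6) :* z) :+ con (+ 5) :* a := con (+ 6) :* (a :- z)) z a)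
        (+-0< u (*-0< (0<ℕ 4) (0<-width q)))))

    6*sixth : ∀ a → ⟦ + 6 ⟧ℤ * (a * sixth) ≈ a
    6*sixth a = trans (ring 3 (λ n a s → n :* (a :* s) := (n :* s) :* a) ⟦ + 6 ⟧ℤ a sixth) (trans (*-congʳ 6sixth) (*-identityˡ a))

    -- In the column around x, the curve bounding the condition stays in two
    -- intervals with these centres.
    Column : Condition → Carrier → Set
    Column c x = ∃[ c₁ ] ∃[ c₂ ] (∀ x′ y → Within x′ 2# → Within (x′ - x) W → Within (slack c (x′ , y)) W →
      Within (y - c₁) B ⊎ Within (y - c₂) B)

    line-column : ∀ {f} (L : LinearForm f) (e σ : Carrier) → Within σ 2# → ∀ x → ∃[ c ]
      (∀ x′ y d → f (x′ , y) ≈ e + σ * d → Within (x′ - x) W → Within d W → Within (y - c) B)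
    line-column L e σ ∣σ∣<2 x = (D * (e - α * x)) * sixth , λ x′ y d p q r → within-sixth (within-resp
      (trans (ring 7 (λ α D e x x′ s d → D :* ((s :* d) :+ α :* :- (x′ :- x)) := D :* (e :+ s :* d) :- D :* (α :* x′) :- D :* (e :- α :* x)) α D e x x′ σ d)
        (trans (+-congʳ (+-congʳ (*-congˡ (trans (sym p) (linear (x′ , y))))))
          (trans (ring 6 (λ α β D x′ y c → (D :* (α :* x′ :+ β :* y) :- D :* (α :* x′)) :- c := (D :* β) :* y :- c) α β D x′ y (D * (e - α * x)))
            (trans (+-cong (*-congʳ Dβ≈6) (-‿cong (sym (6*sixth (D * (e - α * x))))))
              (ring 3 (λ n y c → n :* y :- n :* c := n :* (y :- c)) ⟦ + 6 ⟧ℤ y ((D * (e - α * x)) * sixth))))))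
      (within-mono (≤-respʳ (ring 1 (λ h → con (+ 28) :* (h :* (κ1 :- h)) :+ con (+ 215) :* h
            := (con (+ 120) :+ con (+ 120) :+ κ3) :* h :- con (+ 7) :* (κ2 :* (h :* h) :+ κ2 :* (h :* h))) h)
          (+-0≤ (*-0<-0≤ (0<ℕ 27) (*-0<-0≤ 0<h h≤1)) (<⇒≤ (*-0< (0<ℕ 214) 0<h))))
        (within-* ∣D∣<7 (within-+ (within-* ∣σ∣<2 r) (within-* ∣α∣<2 (within-neg q))))))
      where open LinearForm L

    -- Twelve times the slack is (6y - b)² - t, with t depending on the abscissa only. Replacing x′
    -- by the centre x of the column changes t by 12(a - x′ - x)(x′ - x), where the first factor is
    -- below 4 + 2 + 2.
    circle-column : ∀ a b e → Within a ⟦ + 4 ⟧ℤ → ∀ x → Within x 2# → ∃[ c₁ ] ∃[ c₂ ]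
      (∀ x′ y d → (x′ * x′ + 3# * (y * y)) + e - (a * x′ + b * y) ≈ d → Within x′ 2# → Within (x′ - x) W → Within d W →
        Within (y - c₁) B ⊎ Within (y - c₂) B)
    circle-column a b e ∣a∣<4 x ∣x∣<2 = go (approximate-root 120 t h 0<h)
      where
      n12 = ⟦ + 12 ⟧ℤ
      t = b * b - n12 * e - n12 * (x * x) + n12 * (a * x)
      go : ∃[ r ] (∀ z → Within (z * z - t) (⟦ + 120 ⟧ℤ * W) → Within (z - r) B ⊎ Within (z - - r) B) →
        ∃[ c₁ ] ∃[ c₂ ] (∀ x′ y d → (x′ * x′ + 3# * (y * y)) + e - (a * x′ + b * y) ≈ d → Within x′ 2# → Within (x′ - x) W → Within d W →
          Within (y - c₁) B ⊎ Within (y - c₂) B)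
      go (r , f) = (r + b) * sixth , (- r + b) * sixth , λ x′ y d p q u v → finish y (f (⟦ + 6 ⟧ℤ * y - b) (close x′ y d p q u v))
        where
        close : ∀ x′ y d → (x′ * x′ + 3# * (y * y)) + e - (a * x′ + b * y) ≈ d → Within x′ 2# → Within (x′ - x) W → Within d W →
          Within ((⟦ + 6 ⟧ℤ * y - b) * (⟦ + 6 ⟧ℤ * y - b) - t) (⟦ + 120 ⟧ℤ * W)
        close x′ y d p q u v = within-resp (trans
            (+-congʳ (*-congˡ (sym p)))
            (ring 6 (λ a b e x x′ y → let n = con (+ 12); z = con (+ 6) :* y :- b in
              n :* ((x′ :* x′ :+ κ3 :* (y :* y)) :+ e :- (a :* x′ :+ b :* y)) :+ n :* ((a :- (x′ :+ x)) :* (x′ :- x))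
              := z :* z :- (b :* b :- n :* e :- n :* (x :* x) :+ n :* (a :* x))) a b e x x′ y))
          (within-resp′ (within-+ (within-12 v) (within-12 (within-* (within-+ ∣a∣<4 (within-neg (within-+ q ∣x∣<2))) u))))
          where
          within-12 : ∀ {z w} → Within z w → Within (n12 * z) (n12 * w)
          within-12 {z} {w} (within l u) = within
            (<-respʳ (ring 3 (λ n z w → n :* (w :+ z) := n :* w :+ n :* z) n12 z w) (*-0< (0<ℕ 11) l))
            (<-respʳ (ring 3 (λ n z w → n :* (w :- z) := n :* w :- n :* z) n12 z w) (*-0< (0<ℕ 11) u))
          within-resp′ : ∀ {z} → Within z (n12 * W + n12 * ((⟦ + 4 ⟧ℤ + (2# + 2#)) * W)) → Within z (⟦ + 120 ⟧ℤ * W)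
          within-resp′ = within-mono (≤-respʳ (ring 1 (λ w → con (+ 12) :* w := con (+ 120) :* w :-
            (con (+ 12) :* w :+ con (+ 12) :* ((con (+ 4) :+ (κ2 :+ κ2)) :* w))) W) (<⇒≤ (*-0< (0<ℕ 11) 0<W)))
        finish : ∀ y → Within (⟦ + 6 ⟧ℤ * y - b - r) B ⊎ Within (⟦ + 6 ⟧ℤ * y - b - - r) B →
          Within (y - (r + b) * sixth) B ⊎ Within (y - (- r + b) * sixth) B
        finish y (inj₁ q) = inj₁ (within-sixth (within-resp (trans
          (ring 4 (λ n y b r → n :* y :- b :- r := n :* y :- (r :+ b)) ⟦ + 6 ⟧ℤ y b r)
          (trans (+-congˡ (-‿cong (sym (6*sixth (r + b))))) (ring 3 (λ n y c → n :* y :- n :* c := n :* (y :- c)) ⟦ + 6 ⟧ℤ y ((r + b) * sixth)))) q))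
        finish y (inj₂ q) = inj₂ (within-sixth (within-resp (trans
          (ring 4 (λ n y b r → n :* y :- b :- :- r := n :* y :- (:- r :+ b)) ⟦ + 6 ⟧ℤ y b r)
          (trans (+-congˡ (-‿cong (sym (6*sixth (- r + b))))) (ring 3 (λ n y c → n :* y :- n :* c := n :* (y :- c)) ⟦ + 6 ⟧ℤ y ((- r + b) * sixth)))) q))

    column : ∀ c x → Within x 2# → Column c x
    column (H k) x _ = helper (line-column (linear-form k) 1# (- 1#) (within-integer -[1+ 0 ] 2 ≡.refl ≡.refl) x)
      where
      helper : _ → Column (H k) x
      helper (c , f) = c , c , λ x′ y _ q r → inj₁ (f x′ y (slack (H k) (x′ , y))
        (ring 1 (λ f → f := κ1 :+ :- κ1 :* (κ1 :- f)) (functional k (x′ , y))) q r)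
    column (P k) x _ = helper (line-column (linear-form k) 0# 1# (within-integer (+ 1) 2 ≡.refl ≡.refl) x)
      where
      helper : _ → Column (P k) x
      helper (c , f) = c , c , λ x′ y _ q r → inj₁ (f x′ y (slack (P k) (x′ , y))
        (ring 1 (λ f → f := κ0 :+ κ1 :* f) (functional k (x′ , y))) q r)
    column (C k) x ∣x∣<2 = helper (linear-form k)
      where
      helper : LinearForm (functional k) → Column (C k) x
      helper L = conclude (circle-column α β 0# (within-mono (≤-respʳ (ring 0 (κ2 := κ4 :- κ2)) (<⇒≤ 0<2)) ∣α∣<2) x ∣x∣<2)
        where
        open LinearForm L
        conclude : _ → Column (C k) x
        conclude (c₁ , c₂ , f) = c₁ , c₂ , λ x′ y p q r → f x′ y (slack (C k) (x′ , y))
          (+-cong (+-identityʳ _) (-‿cong (sym (linear (x′ , y))))) p q r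
    column (O k) x ∣x∣<2 = helper (linear-form k)
      where
      helper : LinearForm (functional k) → Column (O k) x
      helper L = conclude (circle-column (α + α) (β + β) 1#
          (within-mono (≤-reflexive (ring 0 (κ0 := κ4 :- (κ2 :+ κ2)))) (within-+ ∣α∣<2 ∣α∣<2)) x ∣x∣<2)
        where
        open LinearForm L
        conclude : _ → Column (O k) x
        conclude (c₁ , c₂ , f) = c₁ , c₂ , λ x′ y p q r → f x′ y (slack (O k) (x′ , y))
          (+-congˡ (-‿cong (trans (ring 4 (λ a b x y → (a :+ a) :* x :+ (b :+ b) :* y := (a :* x :+ b :* y) :+ (a :* x :+ b :* y)) α β x′ y)
            (sym (+-cong (linear (x′ , y)) (linear (x′ , y))))))) p q r

  -- All rectangles have the same extent, so areas are summed by counting.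
  record CoverOf (ε : Carrier) : Set where
    field
      rectangles : List Rectangle
      size       : Carrier
      0<size     : 0# < size
      extents    : All (λ R → extent R ≈ size) rectangles
      total      : ⟦ + length rectangles ⟧ℤ * size < ε
      δ          : Carrier
      0<δ        : 0# < δ
      covers     : ∀ z → InClosedHexagon z → ∀ c → Within (slack c z) δ → Any (Inside z) rectangles

  0≤-double : ∀ {x} → 0# ≤ x + x → 0# ≤ x
  0≤-double h k = h (<-respʳ (+-identityʳ 0#) (+-mono-< k k))

  -- The list of conditions is a parameter known only by its length and its completeness, which
  -- keeps the concrete list from being unfolded.
  module Grid (sixth : Carrier) (6sixth : ⟦ + 6 ⟧ℤ * sixth ≈ 1#)
    (m : ℕ) (h : Carrier) (0<h : 0# < h) (mh≈1 : ⟦ + suc m ⟧ℤ * h ≈ 1#)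
    (cs₀ : List Condition) (24-conditions : length cs₀ ≡ 24) (∈-cs₀ : ∀ c → c ∈ˡ cs₀) where

    h≤1 : 0# ≤ 1# - h
    h≤1 = ≤-respʳ (trans (ring 2 (λ m h → m :* h := (κ1 :+ m) :* h :- h) ⟦ + m ⟧ℤ h)
        (+-congʳ (trans (*-congʳ (sym (⟦suc⟧ m))) mh≈1)))
      (≤-respʳ (*-comm h ⟦ + m ⟧ℤ) (*-0<-0≤ 0<h (0≤ℕ m)))

    open Mesh sixth 6sixth h 0<h h≤1

    -- With h = 1/(m + 1), exactly n steps of length h² lead from -1 to 1, the range of x on the
    -- closed hexagon.
    n : ℕ
    n = 2 ℕ.* (suc m ℕ.* suc m)

    nW≈2 : ⟦ + n ⟧ℤ * W ≈ 2#
    nW≈2 = trans (*-congʳ (trans (reflexive (≡.cong ⟦_⟧ℤ (ℤ.pos-* 2 (suc m ℕ.* suc m)))) (trans (*-homo (+ 2) (+ (suc m ℕ.* suc m)))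
        (*-congˡ (trans (reflexive (≡.cong ⟦_⟧ℤ (ℤ.pos-* (suc m) (suc m)))) (*-homo (+ suc m) (+ suc m)))))))
      (trans (ring 2 (λ s h → (κ2 :* (s :* s)) :* (h :* h) := κ2 :* ((s :* h) :* (s :* h))) ⟦ + suc m ⟧ℤ h)
        (trans (*-congˡ (*-cong mh≈1 mh≈1)) (ring 0 (κ2 :* (κ1 :* κ1) := κ2))))

    abscissa : ℕ → Carrier
    abscissa i = - 1# + ⟦ + i ⟧ℤ * W

    0≤*W : ∀ i → 0# ≤ ⟦ + i ⟧ℤ * W
    0≤*W i = ≤-respʳ (*-comm W ⟦ + i ⟧ℤ) (*-0<-0≤ 0<W (0≤ℕ i))

    ∣abscissa∣<2 : ∀ i → i ℕ.≤ n → Within (abscissa i) 2#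
    ∣abscissa∣<2 i i≤n = within
      (<-respʳ (ring 1 (λ t → t :+ κ1 := κ2 :+ (:- κ1 :+ t)) (⟦ + i ⟧ℤ * W)) (+-0≤-0< (0≤*W i) 0<1))
      (<-respʳ (trans (ring 2 (λ s t → s :+ κ1 := ((t :+ s) :+ κ1) :- t) (⟦ + (n ℕ.∸ i) ⟧ℤ * W) (⟦ + i ⟧ℤ * W))
          (trans (+-congʳ (+-congʳ (trans (ring 3 (λ a b w → a :* w :+ b :* w := (a :+ b) :* w) ⟦ + i ⟧ℤ ⟦ + (n ℕ.∸ i) ⟧ℤ W)
              (trans (*-congʳ (trans (sym (+-homo (+ i) (+ (n ℕ.∸ i)))) (reflexive (≡.cong (λ k → ⟦ + k ⟧ℤ) (ℕ.m+[n∸m]≡n i≤n))))) nW≈2))))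
            (ring 1 (λ t → (κ2 :+ κ1) :- t := κ2 :- (:- κ1 :+ t)) (⟦ + i ⟧ℤ * W))))
        (+-0≤-0< (0≤*W (n ℕ.∸ i)) 0<1))

    rectangle : Carrier → Carrier → Rectangle
    rectangle x y = record
      { x₀ = x - W ; x₁ = x + W ; y₀ = y - B ; y₁ = y + B
      ; x₀<x₁ = 0<⇒< (<-respʳ (ring 2 (λ x w → w :+ w := (x :+ w) :- (x :- w)) x W) (+-0< 0<W 0<W))
      ; y₀<y₁ = 0<⇒< (<-respʳ (ring 2 (λ x w → w :+ w := (x :+ w) :- (x :- w)) y B) (+-0< 0<B 0<B)) }

    A : Carrier
    A = (W + W) * (B + B)

    extent-rectangle : ∀ x y → extent (rectangle x y) ≈ A
    extent-rectangle x y = *-cong (ring 2 (λ x w → (x :+ w) :- (x :- w) := w :+ w) x W)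
      (ring 2 (λ x w → (x :+ w) :- (x :- w) := w :+ w) y B)

    inside-rectangle : ∀ {x y x′ y′} → Within (x′ - x) W → Within (y′ - y) B → Inside (x′ , y′) (rectangle x y)
    inside-rectangle {x} {y} {x′} {y′} p q = (lo p , hi p) , (lo q , hi q)
      where
      lo : ∀ {a b w} → Within (b - a) w → a - w < b
      lo {a} {b} {w} p = 0<⇒< (<-respʳ (ring 3 (λ a b w → w :+ (b :- a) := b :- (a :- w)) a b w) (lower p))
      hi : ∀ {a b w} → Within (b - a) w → b < a + w
      hi {a} {b} {w} p = 0<⇒< (<-respʳ (ring 3 (λ a b w → w :- (b :- a) := (a :+ w) :- b) a b w) (upper p))

    pair : ∀ c x → Column c x → List Rectangle
    pair c x (c₁ , c₂ , _) = rectangle x c₁ ∷ rectangle x c₂ ∷ []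

    strip : ∀ x → Within x 2# → List Condition → List Rectangle
    strip x ∣x∣<2 []       = []
    strip x ∣x∣<2 (c ∷ cs) = pair c x (column c x ∣x∣<2) ++ strip x ∣x∣<2 cs

    strip-extents : ∀ x ∣x∣<2 cs → All (λ R → extent R ≈ A) (strip x ∣x∣<2 cs)
    strip-extents x ∣x∣<2 []       = []
    strip-extents x ∣x∣<2 (c ∷ cs) = extent-rectangle x _ ∷ extent-rectangle x _ ∷ strip-extents x ∣x∣<2 cs

    strip-length : ∀ x ∣x∣<2 cs → length (strip x ∣x∣<2 cs) ≡ length cs ℕ.* 2
    strip-length x ∣x∣<2 []       = ≡.refl
    strip-length x ∣x∣<2 (c ∷ cs) = ≡.cong (λ k → suc (suc k)) (strip-length x ∣x∣<2 cs)

    strip-covers : ∀ x ∣x∣<2 x′ y → Within x′ 2# → Within (x′ - x) W → ∀ {c} cs → c ∈ˡ cs → Within (slack c (x′ , y)) W →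
      Any (Inside (x′ , y)) (strip x ∣x∣<2 cs)
    strip-covers x ∣x∣<2 x′ y p q (c ∷ cs) (here ≡.refl) r =
      [ (λ u → here (inside-rectangle q u)) , (λ u → there (here (inside-rectangle q u))) ]′
        (proj₂ (proj₂ (column c x ∣x∣<2)) x′ y p q r)
    strip-covers x ∣x∣<2 x′ y p q (c ∷ cs) (there i) r = there (there (strip-covers x ∣x∣<2 x′ y p q cs i r))

    48-rectangles : ∀ x ∣x∣<2 → length (strip x ∣x∣<2 cs₀) ≡ 48
    48-rectangles x ∣x∣<2 = ≡.trans (strip-length x ∣x∣<2 cs₀) (≡.cong (ℕ._* 2) 24-conditions)

    strips : ∀ i → i ℕ.≤ n → List Rectangle
    strips zero    i≤n = strip (abscissa zero) (∣abscissa∣<2 zero i≤n) cs₀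
    strips (suc i) i≤n = strip (abscissa (suc i)) (∣abscissa∣<2 (suc i) i≤n) cs₀ ++ strips i (ℕ.<⇒≤ i≤n)

    strips-extents : ∀ i i≤n → All (λ R → extent R ≈ A) (strips i i≤n)
    strips-extents zero    i≤n = strip-extents (abscissa zero) (∣abscissa∣<2 zero i≤n) cs₀
    strips-extents (suc i) i≤n = All.++⁺ (strip-extents (abscissa (suc i)) (∣abscissa∣<2 (suc i) i≤n) cs₀) (strips-extents i (ℕ.<⇒≤ i≤n))

    strips-length : ∀ i i≤n → length (strips i i≤n) ≡ suc i ℕ.* 48
    strips-length zero    i≤n = 48-rectangles (abscissa zero) (∣abscissa∣<2 zero i≤n)
    strips-length (suc i) i≤n = ≡.trans (length-++ (strip (abscissa (suc i)) (∣abscissa∣<2 (suc i) i≤n) cs₀))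
      (≡.cong₂ ℕ._+_ (48-rectangles (abscissa (suc i)) (∣abscissa∣<2 (suc i) i≤n)) (strips-length i (ℕ.<⇒≤ i≤n)))

    strips-cover : ∀ x′ y → Within x′ 2# → ∀ {c} → Within (slack c (x′ , y)) W → ∀ {j} i i≤n → j ℕ.≤ i →
      Within (x′ - abscissa j) W → Any (Inside (x′ , y)) (strips i i≤n)
    strips-cover x′ y p {c} r zero i≤n ℕ.z≤n q = strip-covers (abscissa zero) (∣abscissa∣<2 zero i≤n) x′ y p q {c} cs₀ (∈-cs₀ c) r
    strips-cover x′ y p {c} r {j} (suc i) i≤n j≤i q = choose (ℕ.m≤n⇒m<n∨m≡n j≤i)
      where
      choose : suc j ℕ.≤ suc i ⊎ j ≡ suc i → Any (Inside (x′ , y)) (strips (suc i) i≤n)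
      choose (inj₁ j<i) = Any.++⁺ʳ (strip (abscissa (suc i)) (∣abscissa∣<2 (suc i) i≤n) cs₀)
        (strips-cover x′ y p {c} r i (ℕ.<⇒≤ i≤n) (ℕ.s≤s⁻¹ j<i) q)
      choose (inj₂ j≡i) = Any.++⁺ˡ (strip-covers (abscissa (suc i)) (∣abscissa∣<2 (suc i) i≤n) x′ y p
        (≡.subst (λ k → Within (x′ - abscissa k) W) j≡i q) {c} cs₀ (∈-cs₀ c) r)

    -- The invariant of the search is x > `abscissa i` - W. Cotransitivity of `abscissa i` and
    -- `abscissa i` + W at x either moves one column to the right or stops; the overlap of
    -- neighbouring columns absorbs the undecidable cases.
    find-column : ∀ x → 0# ≤ 1# + x → 0# ≤ 1# - x → ∃[ i ] i ℕ.≤ n × Within (x - abscissa i) W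
    find-column x lo hi = search n 0 ≡.refl (<-respʳ
        (ring 2 (λ x w → (κ1 :+ x) :+ w := x :- (:- κ1 :+ κ0 :* w) :+ w) x W) (+-0≤-0< lo 0<W))
      where
      search : ∀ j i → i ℕ.+ j ≡ n → 0# < x - abscissa i + W → ∃[ i ] i ℕ.≤ n × Within (x - abscissa i) W
      search zero i e p = i , ℕ.≤-reflexive e′ , within (<-respʳ (+-comm _ W) p)
        (<-respʳ (trans (ring 2 (λ x w → (κ1 :- x) :+ w := w :- (x :- (:- κ1 :+ κ2))) x W)
            (+-congˡ (-‿cong (+-congˡ (-‿cong (+-congˡ (trans (sym nW≈2) (*-congʳ (reflexive (≡.cong (λ k → ⟦ + k ⟧ℤ) (≡.sym e′)))))))))))
          (+-0≤-0< hi 0<W))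
        where
        e′ : i ≡ n
        e′ = ≡.trans (≡.sym (ℕ.+-identityʳ i)) e
      search (suc j) i e p = choose (<-cotrans {abscissa i} {abscissa i + W}
          (0<⇒< (<-respʳ (ring 2 (λ a w → w := (a :+ w) :- a) (abscissa i) W) 0<W)) x)
        where
        choose : abscissa i < x ⊎ x < abscissa i + W → ∃[ i ] i ℕ.≤ n × Within (x - abscissa i) W
        choose (inj₁ q) = search j (suc i) (≡.trans (≡.sym (ℕ.+-suc i j)) e)
          (<-respʳ (trans (ring 3 (λ x i w → x :- (:- κ1 :+ i :* w) := x :- (:- κ1 :+ (κ1 :+ i) :* w) :+ w) x ⟦ + i ⟧ℤ W)
            (+-congʳ (+-congˡ (-‿cong (+-congˡ (*-congʳ (sym (⟦suc⟧ i)))))))) (<⇒0< q))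
        choose (inj₂ q) = i , ≡.subst (i ℕ.≤_) e (ℕ.m≤m+n i (suc j)) , within (<-respʳ (+-comm _ W) p)
          (<-respʳ (ring 3 (λ x a w → (a :+ w) :- x := w :- (x :- a)) x (abscissa i) W) (<⇒0< q))

    covers : ∀ z → InClosedHexagon z → ∀ c → Within (slack c z) W → Any (Inside z) (strips n ℕ.≤-refl)
    covers (x , y) hex c r = with-column (find-column x lo hi)
      where
      lo : 0# ≤ 1# + x
      lo = 0≤-double (≤-respʳ (ring 2 (λ x y → (κ1 :- (y :- x)) :+ (κ1 :- :- (x :+ y)) := (κ1 :+ x) :+ (κ1 :+ x)) x y) (+-0≤ (hex 2F) (hex 3F)))
      hi : 0# ≤ 1# - x
      hi = 0≤-double (≤-respʳ (ring 2 (λ x y → (κ1 :- (x :+ y)) :+ (κ1 :- (x :- y)) := (κ1 :- x) :+ (κ1 :- x)) x y) (+-0≤ (hex 0F) (hex 5F)))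
      with-column : ∃[ i ] i ℕ.≤ n × Within (x - abscissa i) W → Any (Inside (x , y)) (strips n ℕ.≤-refl)
      with-column (i , i≤n , q) = strips-cover x y (within
        (<-respʳ (ring 1 (λ x → (κ1 :+ x) :+ κ1 := κ2 :+ x) x) (+-0≤-0< lo 0<1))
        (<-respʳ (ring 1 (λ x → (κ1 :- x) :+ κ1 := κ2 :- x) x) (+-0≤-0< hi 0<1))) {c} r n ℕ.≤-refl i≤n q

    count : ⟦ + length (strips n ℕ.≤-refl) ⟧ℤ ≈ (1# + ⟦ + n ⟧ℤ) * ⟦ + 48 ⟧ℤ
    count = trans (reflexive (≡.cong (λ k → ⟦ + k ⟧ℤ) (strips-length n ℕ.≤-refl)))
      (trans (reflexive (≡.cong ⟦_⟧ℤ (ℤ.pos-* (suc n) 48))) (trans (*-homo (+ suc n) (+ 48)) (*-congʳ (⟦suc⟧ n))))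

    -- With 48 rectangles of size 2W by 2B in each of n + 1 columns and nW = 2, the total is 192(W +
    -- 2)B, and W ≤ 1 bounds it by 576B.
    total-below : ∀ ε → ⟦ + 576 ⟧ℤ * B < ε → ⟦ + length (strips n ℕ.≤-refl) ⟧ℤ * A < ε
    total-below ε l = <-respˡ (sym (*-congʳ count)) (0<⇒< (<-respʳ
      (trans (ring 5 (λ n h b e f → con (+ 192) :* ((κ1 :- h) :* b :+ (h :* (κ1 :- h)) :* b) :+ (e :- con (+ 576) :* b)
            := e :- (con (+ 192) :* (h :* h) :* b :+ con (+ 192) :* κ2 :* b)) ⟦ + n ⟧ℤ h B ε h)
        (trans (+-congˡ (-‿cong (+-congˡ (*-congʳ (*-congˡ (sym nW≈2))))))
          (ring 4 (λ n h b e → let w = h :* h in e :- (con (+ 192) :* w :* b :+ con (+ 192) :* (n :* w) :* b)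
            := e :- ((κ1 :+ n) :* con (+ 48)) :* ((w :+ w) :* (b :+ b))) ⟦ + n ⟧ℤ h B ε)))
      (+-0≤-0< (*-0<-0≤ (0<ℕ 191) (+-0≤ (≤-respʳ (*-comm B _) (*-0<-0≤ 0<B h≤1))
          (≤-respʳ (*-comm B _) (*-0<-0≤ 0<B (*-0<-0≤ 0<h h≤1))))) (<⇒0< l))))

    cover : ∀ ε → ⟦ + 576 ⟧ℤ * B < ε → CoverOf ε
    cover ε l = record
      { rectangles = strips n ℕ.≤-refl ; size = A ; 0<size = *-0< (+-0< 0<W 0<W) (+-0< 0<B 0<B)
      ; extents = strips-extents n ℕ.≤-refl ; total = total-below ε l ; δ = W ; 0<δ = 0<W ; covers = covers }

  curve-cover : ∀ ε → 0# < ε → CoverOf ε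
  curve-cover ε 0<ε = with-inverse (reciprocal 0<ε) (reciprocal (0<ℕ 5))
    where
    -- Since 576B = Mh, any h = 1/m with an integer m > M/ε will do.
    M = ⟦ + 576 ⟧ℤ * (⟦ + 120 ⟧ℤ + ⟦ + 120 ⟧ℤ + 3#)
    0<M : 0# < M
    0<M = *-0< (0<ℕ 575) (+-0< (+-0< (0<ℕ 119) (0<ℕ 119)) (0<ℕ 2))
    with-inverse : ∃[ e ] 0# < e × ε * e ≈ 1# → ∃[ s ] 0# < s × ⟦ + 6 ⟧ℤ * s ≈ 1# → CoverOf ε
    with-inverse (e , 0<e , εe≈1) (s , _ , 6s≈1) = with-bound (archimedean (M * e))
      where
      with-bound : ∃[ m ] M * e < ⟦ + m ⟧ℤ → CoverOf ε
      with-bound (zero  , l) = ⊥-elim (<-irrefl refl (<-trans (*-0< 0<M 0<e) l))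
      with-bound (suc m , l) = with-mesh (reciprocal (0<ℕ m))
        where
        with-mesh : ∃[ h ] 0# < h × ⟦ + suc m ⟧ℤ * h ≈ 1# → CoverOf ε
        with-mesh (h , 0<h , mh≈1) = Grid.cover s 6s≈1 m h 0<h mh≈1 conditions ≡.refl ∈-conditions ε (0<⇒< (<-respʳ
          (trans (ring 6 (λ n a e f m h → (f :* h) :* (m :- (n :* a) :* e) := f :* (m :* h) :- (n :* (a :* h)) :* (f :* e))
              ⟦ + 576 ⟧ℤ (⟦ + 120 ⟧ℤ + ⟦ + 120 ⟧ℤ + 3#) e ε ⟦ + suc m ⟧ℤ h)
            (+-cong (trans (*-congˡ mh≈1) (*-identityʳ ε)) (-‿cong (trans (*-congˡ εe≈1) (*-identityʳ _)))))
          (*-0< (*-0< 0<ε 0<h) (<⇒0< l))))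

  -- The pieces of the hexagon away from the boundary curves

  Generic : Point → Set
  Generic z = ∀ c → 0# < slack c z ⊎ slack c z < 0#

  Signed : Bool → Condition → Point → Set
  Signed true  c z = 0# < slack c z
  Signed false c z = slack c z < 0#

  Sector : Point → Set
  Sector w = 0# < slack (P 5F) w × 0# < slack (P 1F) w

  OnPiece : Fin 6 → Point → Set
  OnPiece k w = Sector w × Signed (C1-holds k) (C 1F) w × Signed (C5-holds k) (C 5F) w × Signed (O0-holds k) (O 0F) w

  -- The conditions that define V_{k+1,1} within U.
  Defining : Fin 6 → Point → Set
  Defining 0F w = slack (C 5F) w < 0# × slack (C 1F) w < 0#
  Defining 1F w = 0# < slack (O 0F) w × 0# < slack (C 1F) w × 0# < proj₁ w × 0# < slack (P 1F) w
  Defining 2F w = 0# < slack (O 0F) w × 0# < slack (C 5F) w × 0# < slack (P 1F) w × 0# < slack (P 5F) w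
  Defining 3F w = slack (C 5F) w < 0# × slack (O 0F) w < 0#
  Defining 4F w = slack (O 0F) w < 0# × slack (C 1F) w < 0#
  Defining 5F w = 0# < slack (C 5F) w × 0# < slack (C 1F) w × 0# < proj₁ w × 0# < slack (P 1F) w

  module _ {w : Point} (hex : InHexagon w) where
    private
      x y p q s c₁ c₅ o : Carrier
      x = proj₁ w
      y = proj₂ w
      p = x - y
      q = y + y
      s = 1# - (x + y)
      c₁ = slack (C 1F) w
      c₅ = slack (C 5F) w
      o = slack (O 0F) w

      0<s : 0# < s
      0<s = hex 0F

      -- With barycentric coordinates p, q, s the slacks are p² − qs, q² − ps, s² − pq.
      e₁ : p * p - q * s ≈ c₁
      e₁ = ring 2 (λ x y → let p = x :- y; q = y :+ y; s = κ1 :- (x :+ y) in p :* p :- q :* s := (x :* x :+ κ3 :* (y :* y)) :- (y :+ y)) x y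
      e₅ : q * q - p * s ≈ c₅
      e₅ = ring 2 (λ x y → let p = x :- y; q = y :+ y; s = κ1 :- (x :+ y) in q :* q :- p :* s := (x :* x :+ κ3 :* (y :* y)) :- (x :- y)) x y
      e₀ : s * s - p * q ≈ o
      e₀ = ring 2 (λ x y → let p = x :- y; q = y :+ y; s = κ1 :- (x :+ y) in s :* s :- p :* q := (x :* x :+ κ3 :* (y :* y)) :+ κ1 :- ((x :+ y) :+ (x :+ y))) x y

      product-< : ∀ {a b c d} → 0# < a → 0# < c → a < b → c < d → a * c < b * d
      product-< {a} {b} {c} {d} 0<a 0<c h k = 0<⇒< (<-respʳ
        (ring 4 (λ a b c d → (b :- a) :* c :+ (b :- a) :* (d :- c) :+ a :* (d :- c) := b :* d :- a :* c) a b c d)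
        (+-0< (+-0< (*-0< (<⇒0< h) 0<c) (*-0< (<⇒0< h) (<⇒0< k))) (*-0< 0<a (<⇒0< k))))

      -- The inequalities p² > qs, q² > ps and s² > pq multiply to p²q²s² > p²q²s². With all three
      -- reversed the same product gives `not-all-inside`.
      not-all-outside : Sector w → 0# < c₁ → 0# < c₅ → 0# < o → ⊥
      not-all-outside (0<p , 0<q) h₁ h₅ h₀ = <-irrefl
        (ring 3 (λ p q s → (q :* s) :* (p :* s) :* (p :* q) := (p :* p) :* (q :* q) :* (s :* s)) p q s)
        (product-< (*-0< (*-0< 0<q 0<s) (*-0< 0<p 0<s)) (*-0< 0<p 0<q)
          (product-< (*-0< 0<q 0<s) (*-0< 0<p 0<s) (0<⇒< (<-respʳ (sym e₁) h₁)) (0<⇒< (<-respʳ (sym e₅) h₅)))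
          (0<⇒< (<-respʳ (sym e₀) h₀)))

      below : ∀ {a b c} → a - b ≈ c → c < 0# → a < b
      below {a} {b} e h = 0<⇒< (<-respʳ (trans (-‿cong (sym e)) (ring 2 (λ a b → :- (a :- b) := b :- a) a b)) (neg-0< h))

      not-all-inside : Sector w → c₁ < 0# → c₅ < 0# → o < 0# → ⊥
      not-all-inside (0<p , 0<q) h₁ h₅ h₀ = <-irrefl
        (ring 3 (λ p q s → (p :* p) :* (q :* q) :* (s :* s) := (q :* s) :* (p :* s) :* (p :* q)) p q s)
        (product-< (*-0< (*-0< 0<p 0<p) (*-0< 0<q 0<q)) (*-0< 0<s 0<s)
          (product-< (*-0< 0<p 0<p) (*-0< 0<q 0<q) (below e₁ h₁) (below e₅ h₅)) (below e₀ h₀))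

      0<norm-p : c₅ < 0# → 0# < p
      0<norm-p h = ≤-<-trans (0≤norm w) (0<⇒< (<-respʳ (ring 2 (λ n p → :- (n :- p) := p :- n) (norm w) p) (neg-0< h)))

      0<norm-q : c₁ < 0# → 0# < q
      0<norm-q h = ≤-<-trans (0≤norm w) (0<⇒< (<-respʳ (ring 2 (λ n q → :- (n :- q) := q :- n) (norm w) q) (neg-0< h)))

      -- Two of the pieces are defined through the first quadrant instead of the sector of angle
      -- π/3. Between the arguments π/3 and π/2 the hexagon lies inside the circle of `C 1F`, so the
      -- condition `C 1F` brings such a point back to the sector.
      right : 0# < x → 0# < q → 0# < c₁ → p < 0# → ⊥
      right 0<x 0<q h₁ p<0 = <0-absurd h₁ (0<-neg (<-respʳ
        (ring 2 (λ x y → :- (x :- y) :* (x :+ y) :+ (y :+ y) :* (κ1 :- (y :+ y)) := :- ((x :* x :+ κ3 :* (y :* y)) :- (y :+ y))) x y)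
        (+-0< (*-0< (neg-0< p<0) (*-cancel-0< 0<2 (<-respʳ (ring 2 (λ x y → x :+ x :+ (y :+ y) := κ2 :* (x :+ y)) x y) (+-0< (+-0< 0<x 0<x) 0<q))))
          (*-0< 0<q (hex 1F)))))

      -- (1 − p)² + q (p + q − 2) and its mirror image.
      lower-lens : o < 0# → q < 0# → ⊥
      lower-lens h q<0 = <0-absurd (<-respʳ
        (ring 2 (λ x y → let p = x :- y; q = y :+ y; s = x :+ y in
          (κ1 :- p) :* (κ1 :- p) :+ :- q :* ((κ1 :- s) :+ κ1) := (x :* x :+ κ3 :* (y :* y)) :+ κ1 :- (s :+ s)) x y)
        (+-0≤-0< (0≤square _) (*-0< (neg-0< q<0) (+-0< 0<s 0<1)))) h

      upper-lens : o < 0# → p < 0# → ⊥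
      upper-lens h p<0 = <0-absurd (<-respʳ
        (ring 2 (λ x y → let p = x :- y; q = y :+ y; s = x :+ y in
          (κ1 :- q) :* (κ1 :- q) :+ :- p :* ((κ1 :- s) :+ κ1) := (x :* x :+ κ3 :* (y :* y)) :+ κ1 :- (s :+ s)) x y)
        (+-0≤-0< (0≤square _) (*-0< (neg-0< p<0) (+-0< 0<s 0<1)))) h

      decide : ∀ {c} → Generic w → (slack c w < 0# → ⊥) → 0# < slack c w
      decide {c} g h = [ (λ k → k) , (λ k → ⊥-elim (h k)) ]′ (g c)

      decide⁻ : ∀ {c} → Generic w → (0# < slack c w → ⊥) → slack c w < 0#
      decide⁻ {c} g h = [ (λ k → ⊥-elim (h k)) , (λ k → k) ]′ (g c)

    -- Each definition names at most two of the three circles. The sign at the third is forced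
    -- because the three signs cannot all agree, and the sector follows from the hexagon and the
    -- circles.
    defining⇒on-piece : Generic w → ∀ k → Defining k w → OnPiece k w
    defining⇒on-piece g 0F (h₅ , h₁) = σ , h₁ , h₅ , decide {O 0F} g (not-all-inside σ h₁ h₅)
      where
      σ : Sector w
      σ = 0<norm-p h₅ , 0<norm-q h₁
    defining⇒on-piece g 1F (h₀ , h₁ , 0<x , 0<q) = σ , h₁ , decide⁻ {C 5F} g (λ h₅ → not-all-outside σ h₁ h₅ h₀) , h₀
      where
      σ : Sector w
      σ = decide {P 5F} g (right 0<x 0<q h₁) , 0<q
    defining⇒on-piece g 2F (h₀ , h₅ , 0<q , 0<p) = σ , decide⁻ {C 1F} g (λ h₁ → not-all-outside σ h₁ h₅ h₀) , h₅ , h₀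
      where
      σ : Sector w
      σ = 0<p , 0<q
    defining⇒on-piece g 3F (h₅ , h₀) = σ , decide {C 1F} g (λ h₁ → not-all-inside σ h₁ h₅ h₀) , h₅ , h₀
      where
      σ : Sector w
      σ = 0<norm-p h₅ , decide {P 1F} g (lower-lens h₀)
    defining⇒on-piece g 4F (h₀ , h₁) = σ , h₁ , decide {C 5F} g (λ h₅ → not-all-inside σ h₁ h₅ h₀) , h₀
      where
      σ : Sector w
      σ = decide {P 5F} g (upper-lens h₀) , 0<norm-q h₁
    defining⇒on-piece g 5F (h₅ , h₁ , 0<x , 0<q) = σ , h₁ , h₅ , decide⁻ {O 0F} g (not-all-outside σ h₁ h₅)
      where
      σ : Sector w
      σ = decide {P 5F} g (right 0<x 0<q h₁) , 0<q

    classify : Generic w → Sector w → ∃[ k ] OnPiece k w × Defining k w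
    classify g σ@(0<p , 0<q) = cases (g (C 1F)) (g (C 5F)) (g (O 0F))
      where
      0<x : 0# < x
      0<x = *-cancel-0< 0<2 (<-respʳ (ring 2 (λ x y → (x :- y) :+ (x :- y) :+ (y :+ y) := κ2 :* x) x y) (+-0< (+-0< 0<p 0<p) 0<q))
      cases : 0# < c₁ ⊎ c₁ < 0# → 0# < c₅ ⊎ c₅ < 0# → 0# < o ⊎ o < 0# → ∃[ k ] OnPiece k w × Defining k w
      cases (inj₁ h₁) (inj₁ h₅) (inj₁ h₀) = ⊥-elim (not-all-outside σ h₁ h₅ h₀)
      cases (inj₁ h₁) (inj₁ h₅) (inj₂ h₀) = 5F , (σ , h₁ , h₅ , h₀) , h₅ , h₁ , 0<x , 0<q
      cases (inj₁ h₁) (inj₂ h₅) (inj₁ h₀) = 1F , (σ , h₁ , h₅ , h₀) , h₀ , h₁ , 0<x , 0<q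
      cases (inj₁ h₁) (inj₂ h₅) (inj₂ h₀) = 3F , (σ , h₁ , h₅ , h₀) , h₅ , h₀
      cases (inj₂ h₁) (inj₁ h₅) (inj₁ h₀) = 2F , (σ , h₁ , h₅ , h₀) , h₀ , h₅ , 0<q , 0<p
      cases (inj₂ h₁) (inj₁ h₅) (inj₂ h₀) = 4F , (σ , h₁ , h₅ , h₀) , h₀ , h₁
      cases (inj₂ h₁) (inj₂ h₅) (inj₁ h₀) = 0F , (σ , h₁ , h₅ , h₀) , h₅ , h₁
      cases (inj₂ h₁) (inj₂ h₅) (inj₂ h₀) = ⊥-elim (not-all-inside σ h₁ h₅ h₀)

    on-piece-signs : ∀ k → OnPiece k w → ∀ c → Signed (holdsOnPiece k c) c w
    on-piece-signs k (_ , h₁ , h₅ , h₀) (H j) = hex j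
    on-piece-signs k (_ , h₁ , h₅ , h₀) (C 1F) = h₁
    on-piece-signs k (_ , h₁ , h₅ , h₀) (C 5F) = h₅
    on-piece-signs k (_ , h₁ , h₅ , h₀) (O 0F) = h₀
    on-piece-signs k ((0<p , 0<q) , _) (C 0F) = 0<-neg (<-respʳ (ring 2 (λ x y → let p = x :- y; q = y :+ y in
      (p :+ q) :* (κ1 :- (x :+ y)) :+ p :* q := :- ((x :* x :+ κ3 :* (y :* y)) :- (x :+ y))) x y) (+-0< (*-0< (+-0< 0<p 0<q) 0<s) (*-0< 0<p 0<q)))
    on-piece-signs k ((0<p , 0<q) , _) (C 2F) = <-respʳ (ring 3 (λ n x y → n :+ (x :- y) := n :- (y :- x)) (norm w) x y) (+-0≤-0< (0≤norm w) 0<p)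
    on-piece-signs k ((0<p , 0<q) , _) (C 3F) = <-respʳ (ring 3 (λ n x y → n :+ ((x :- y) :+ (y :+ y)) := n :- :- (x :+ y)) (norm w) x y) (+-0≤-0< (0≤norm w) (+-0< 0<p 0<q))
    on-piece-signs k ((0<p , 0<q) , _) (C 4F) = <-respʳ (ring 2 (λ n y → n :+ (y :+ y) := n :- :- (y :+ y)) (norm w) y) (+-0≤-0< (0≤norm w) 0<q)
    on-piece-signs k ((0<p , 0<q) , _) (O 1F) = <-respʳ (ring 2 (λ x y → let p = x :- y; q = y :+ y in
      (κ1 :- q) :* (κ1 :- q) :+ p :* (p :+ q) := (x :* x :+ κ3 :* (y :* y)) :+ κ1 :- ((y :+ y) :+ (y :+ y))) x y)
      (+-0≤-0< (0≤square _) (*-0< 0<p (+-0< 0<p 0<q)))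
    on-piece-signs k ((0<p , 0<q) , _) (O 5F) = <-respʳ (ring 2 (λ x y → let p = x :- y; q = y :+ y in
      (κ1 :- p) :* (κ1 :- p) :+ q :* (p :+ q) := (x :* x :+ κ3 :* (y :* y)) :+ κ1 :- ((x :- y) :+ (x :- y))) x y)
      (+-0≤-0< (0≤square _) (*-0< 0<q (+-0< 0<p 0<q)))
    on-piece-signs k ((0<p , 0<q) , _) (O 2F) = <-respʳ (ring 3 (λ n x y → n :+ (κ1 :+ ((x :- y) :+ (x :- y))) := n :+ κ1 :- ((y :- x) :+ (y :- x))) (norm w) x y)
      (+-0≤-0< (0≤norm w) (+-0< 0<1 (+-0< 0<p 0<p)))
    on-piece-signs k ((0<p , 0<q) , _) (O 3F) = <-respʳ (ring 3 (λ n x y → let t = (x :- y) :+ (y :+ y) in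
      n :+ (κ1 :+ (t :+ t)) := n :+ κ1 :- (:- (x :+ y) :+ :- (x :+ y))) (norm w) x y)
      (+-0≤-0< (0≤norm w) (+-0< 0<1 (+-0< (+-0< 0<p 0<q) (+-0< 0<p 0<q))))
    on-piece-signs k ((0<p , 0<q) , _) (O 4F) = <-respʳ (ring 2 (λ n y → n :+ (κ1 :+ ((y :+ y) :+ (y :+ y))) := n :+ κ1 :- (:- (y :+ y) :+ :- (y :+ y))) (norm w) y)
      (+-0≤-0< (0≤norm w) (+-0< 0<1 (+-0< 0<q 0<q)))
    on-piece-signs k ((0<p , 0<q) , _) (P 0F) = <-respʳ (ring 2 (λ x y → (x :- y) :+ (y :+ y) := x :+ y) x y) (+-0< 0<p 0<q)
    on-piece-signs k ((0<p , 0<q) , _) (P 1F) = 0<q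
    on-piece-signs k ((0<p , 0<q) , _) (P 5F) = 0<p
    on-piece-signs k ((0<p , 0<q) , _) (P 2F) = 0<-neg (<-respʳ (ring 2 (λ x y → x :- y := :- (y :- x)) x y) 0<p)
    on-piece-signs k ((0<p , 0<q) , _) (P 3F) = 0<-neg (<-respʳ (ring 2 (λ x y → (x :- y) :+ (y :+ y) := :- :- (x :+ y)) x y) (+-0< 0<p 0<q))
    on-piece-signs k ((0<p , 0<q) , _) (P 4F) = 0<-neg (<-respʳ (ring 1 (λ y → y :+ y := :- :- (y :+ y)) y) 0<q)

  Rotated : ℕ → Point → Point → Set
  Rotated n w z = ∀ c → slack c z ≈ slack (back n c) w

  holdsOn-sound : ∀ {k n w z} → InHexagon w → OnPiece k w → Rotated n w z → ∀ cs →
    IsTrue (all (λ c → holdsOnPiece k (back n c)) cs) → All (λ c → Holds c z) cs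
  holdsOn-sound h o r [] t = []
  holdsOn-sound {k} {n} {w} {z} h o r (c ∷ cs) t with Equivalence.to (T-∧ {holdsOnPiece k (back n c)}) t
  ... | u , v = <-respʳ (sym (r c)) (positive (holdsOnPiece k (back n c)) u (on-piece-signs {w} h k o (back n c))) ∷ holdsOn-sound {k} {n} {w} {z} h o r cs v
    where
    positive : ∀ b → IsTrue b → Signed b (back n c) w → 0# < slack (back n c) w
    positive true _ p = p

  holdsOn-complete : ∀ {k n w z} → InHexagon w → OnPiece k w → Rotated n w z → ∀ cs →
    All (λ c → Holds c z) cs → IsTrue (all (λ c → holdsOnPiece k (back n c)) cs)
  holdsOn-complete h o r [] [] = tt
  holdsOn-complete {k} {n} {w} {z} h o r (c ∷ cs) (p ∷ ps) = Equivalence.from (T-∧ {holdsOnPiece k (back n c)})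
    (truth (holdsOnPiece k (back n c)) (on-piece-signs {w} h k o (back n c)) , holdsOn-complete {k} {n} {w} {z} h o r cs ps)
    where
    truth : ∀ b → Signed b (back n c) w → IsTrue b
    truth true  _ = tt
    truth false q = <0-absurd (<-respʳ (r c) p) q

  rotated-hexagon : ∀ {n w z} → Rotated n w z → InHexagon z → InHexagon w
  rotated-hexagon {n} {w} {z} r h k = via (forth-H n k)
    where
    forth-H : ∀ n k → ∃[ j ] forth n (H k) ≡ H j
    forth-H zero    k = k , ≡.refl
    forth-H (suc n) k = next (proj₁ (forth-H n k)) , ≡.cong (onIndex next) (proj₂ (forth-H n k))
    via : ∃[ j ] forth n (H k) ≡ H j → 0# < slack (H k) w
    via (j , e) = <-respʳ (trans (reflexive (≡.cong (λ c → slack c z) (≡.sym e))) (trans (r (forth n (H k)))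
      (reflexive (≡.cong (λ c → slack c w) (back-forth n (H k)))))) (h j)

  rotated-generic : ∀ {n w z} → Rotated n w z → Generic z → Generic w
  rotated-generic {n} {w} {z} r g c = [ (λ p → inj₁ (<-respʳ e p)) , (λ p → inj₂ (<-respˡ e p)) ]′ (g (forth n c))
    where
    e : slack (forth n c) z ≈ slack c w
    e = trans (r (forth n c)) (reflexive (≡.cong (λ c → slack c w) (back-forth n c)))

  find-sector : ∀ {z} → Generic z →
    ∃[ ℓ ] 0# < slack (forth (toℕ {6} ℓ) (P 5F)) z × 0# < slack (forth (toℕ ℓ) (P 1F)) z
  find-sector {z@(x , y)} g = cases (g (P 1F)) (g (P 5F)) (g (P 0F))
    where
    flip : ∀ k → slack (P k) z < 0# → 0# < slack (P (opp k)) z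
    flip k h = <-respʳ (sym (functional-opp k z)) (neg-0< h)
    cases : 0# < y + y ⊎ y + y < 0# → 0# < x - y ⊎ x - y < 0# → 0# < x + y ⊎ x + y < 0# → _
    cases (inj₁ q) (inj₁ p) _        = 0F , p , q
    cases (inj₁ q) (inj₂ p) (inj₁ s) = 1F , s , flip 5F p
    cases (inj₁ q) (inj₂ p) (inj₂ s) = 2F , q , flip 0F s
    cases (inj₂ q) (inj₁ p) (inj₂ s) = 4F , flip 0F s , p
    cases (inj₂ q) (inj₁ p) (inj₁ s) = 5F , flip 1F q , s
    cases (inj₂ q) (inj₂ p) _        = 3F , flip 5F p , flip 1F q

  -- The constructive form of the statement that a point either lies on one of the curves or does
  -- not: two applications of cotransitivity for each condition, at thresholds δ and -δ. Points that
  -- are not generic thus lie within every δ of a curve.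
  generic⊎close : ∀ z δ → 0# < δ → Generic z ⊎ ∃[ c ] Within (slack c z) δ
  generic⊎close z δ 0<δ = helper (λ c → decide c)
    where
    decide : ∀ c → (0# < slack c z ⊎ slack c z < 0#) ⊎ Within (slack c z) δ
    decide c = [ (λ p → inj₁ (inj₁ p)) , (λ p → [ (λ q → inj₂ (within
        (<-respʳ (ring 2 (λ d s → s :- :- d := d :+ s) δ (slack c z)) (<⇒0< q)) (<⇒0< p))) , (λ q → inj₁ (inj₂ q)) ]′
          (<-cotrans (0<-neg (<-respʳ (ring 1 (λ d → d := :- :- d) δ) 0<δ)) (slack c z))) ]′ (<-cotrans 0<δ (slack c z))
    collect : ∀ cs → (All (λ c → 0# < slack c z ⊎ slack c z < 0#) cs) ⊎ ∃[ c ] Within (slack c z) δ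
    collect [] = inj₁ []
    collect (c ∷ cs) = [ (λ p → [ (λ ps → inj₁ (p ∷ ps)) , inj₂ ]′ (collect cs)) , (λ q → inj₂ (c , q)) ]′ (decide c)
    helper : (∀ c → (0# < slack c z ⊎ slack c z < 0#) ⊎ Within (slack c z) δ) → Generic z ⊎ ∃[ c ] Within (slack c z) δ
    helper _ = [ (λ ps → inj₁ (λ c → All.lookup ps (∈-conditions c))) , inj₂ ]′ (collect conditions)

  -- The sides containing a point of U have vanishing slack, the others positive.
  SlackOn : Bool → Carrier → Set
  SlackOn true  a = a ≈ 0#
  SlackOn false a = 0# < a

  Lies : Boundary → Point → Set
  Lies b z = ∀ k → SlackOn (on b k) (slack (H k) z)

  lies⇒closed : ∀ {b z} → Lies b z → InClosedHexagon z
  lies⇒closed {b} {z} h k = weak (on b k) (h k)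
    where
    weak : ∀ b → SlackOn b (slack (H k) z) → 0# ≤ slack (H k) z
    weak true  e = ≤-reflexive (sym e)
    weak false p = <⇒≤ p

  -- Distinct lattice translates of U are disjoint

  private
    clash : ∀ {a b} → a ≈ - b → 0# ≤ b → 0# < a → ⊥
    clash e h p = h (0<-neg (<-respʳ e p))

    -- U contains the upper horizontal side without its end points, and of the
    -- lower one nothing but the end points.
    upper-lower : ∀ {b b′ w w′} → Lies b w → Lies b′ w′ → functional 0F w′ ≈ 1# + functional 0F w →
      functional 1F w′ ≈ 2# + functional 1F w → functional 2F w′ ≈ 1# + functional 2F w → ⊥
    upper-lower {b} {b′} {w} {w′} h h′ e₀ e₁ e₂ = cases b b′ h h′
      where
      e₁′ : slack (H 1F) w′ ≈ - slack (H 4F) w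
      e₁′ = trans (+-congˡ (-‿cong e₁)) (ring 1 (λ f → κ1 :- (κ2 :+ f) := :- (κ1 :- :- f)) (functional 1F w))
      e₄ : slack (H 4F) w ≈ - slack (H 1F) w′
      e₄ = trans (ring 1 (λ a → a := :- :- a) (slack (H 4F) w)) (-‿cong (sym e₁′))
      upper-positive : 0# < slack (H 1F) w′ → ⊥
      upper-positive = clash e₁′ (lies⇒closed {b} h 4F)
      lower-positive : 0# < slack (H 4F) w → ⊥
      lower-positive = clash e₄ (lies⇒closed {b′} h′ 1F)
      ends₂ : slack (H 3F) w ≈ 0# → slack (H 4F) w ≈ 0# → slack (H 2F) w′ ≈ 0#
      ends₂ a c = trans (+-congˡ (-‿cong e₂)) (trans (ring 2 (λ x y → κ1 :- (κ1 :+ (y :- x)) := (κ1 :- :- (x :+ y)) :- (κ1 :- :- (y :+ y))) (proj₁ w) (proj₂ w))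
        (trans (+-cong a (-‿cong c)) (ring 0 (κ0 :- κ0 := κ0))))
      ends₀ : slack (H 4F) w ≈ 0# → slack (H 5F) w ≈ 0# → slack (H 0F) w′ ≈ 0#
      ends₀ a c = trans (+-congˡ (-‿cong e₀)) (trans (ring 2 (λ x y → κ1 :- (κ1 :+ (x :+ y)) := (κ1 :- (x :- y)) :- (κ1 :- :- (y :+ y))) (proj₁ w) (proj₂ w))
        (trans (+-cong c (-‿cong a)) (ring 0 (κ0 :- κ0 := κ0))))
      cases : ∀ b b′ → Lies b w → Lies b′ w′ → ⊥
      cases interior  _       h h′ = lower-positive (h 4F)
      cases edge₁   _       h h′ = lower-positive (h 4F)
      cases edge₃   _       h h′ = lower-positive (h 4F)
      cases edge₅   _       h h′ = lower-positive (h 4F)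
      cases vertex₄ edge₁   h h′ = <-irrefl (sym (ends₂ (h 3F) (h 4F))) (h′ 2F)
      cases vertex₅ edge₁   h h′ = <-irrefl (sym (ends₀ (h 4F) (h 5F))) (h′ 0F)
      cases vertex₄ interior  h h′ = upper-positive (h′ 1F)
      cases vertex₄ edge₃   h h′ = upper-positive (h′ 1F)
      cases vertex₄ edge₅   h h′ = upper-positive (h′ 1F)
      cases vertex₄ vertex₄ h h′ = upper-positive (h′ 1F)
      cases vertex₄ vertex₅ h h′ = upper-positive (h′ 1F)
      cases vertex₅ interior  h h′ = upper-positive (h′ 1F)
      cases vertex₅ edge₃   h h′ = upper-positive (h′ 1F)
      cases vertex₅ edge₅   h h′ = upper-positive (h′ 1F)
      cases vertex₅ vertex₄ h h′ = upper-positive (h′ 1F)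
      cases vertex₅ vertex₅ h h′ = upper-positive (h′ 1F)

    never-on : ∀ {b z} k → on b k ≡ false → Lies b z → slack (H k) z ≤ 0# → ⊥
    never-on {b} {z} k e h p = p (≡.subst (λ t → SlackOn t (slack (H k) z)) e (h k))

    not-0-2 : ∀ b → on b 0F ≡ false × on b 2F ≡ false
    not-0-2 interior  = ≡.refl , ≡.refl
    not-0-2 edge₁   = ≡.refl , ≡.refl
    not-0-2 edge₃   = ≡.refl , ≡.refl
    not-0-2 edge₅   = ≡.refl , ≡.refl
    not-0-2 vertex₄ = ≡.refl , ≡.refl
    not-0-2 vertex₅ = ≡.refl , ≡.refl

  -- A value of at least 3 is impossible since functionals on the closed hexagon differ by at most
  -- 2. A value 2 at j puts one point on the side j and the other on the opposite side. U contains
  -- no point of the sides 0 and 2, which settles four directions; the pair of sides 1 and 4 is left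
  -- to `upper-lower`.
  translate-unique : ∀ {A} → Place A → ∀ {b b′ w w′} → Lies b w → Lies b′ w′ → Shift A w w′ → ∀ k → A k ≡ + 0
  translate-unique {A} pl {b} {b′} {w} {w′} h h′ sh = go pl
    where
    value : ∀ k {i} → A k ≡ i → functional k w′ ≈ ⟦ i ⟧ℤ + functional k w
    value k e = trans (sh k) (+-congʳ (reflexive (≡.cong ⟦_⟧ℤ e)))
    -- Both points lie on opposite sides j and opp j.
    opposite-sides : ∀ j → A j ≡ + 2 → slack (H j) w′ ≈ - slack (H (opp j)) w
    opposite-sides j e = trans (+-congˡ (-‿cong (value j e))) (trans
      (ring 1 (λ f → κ1 :- (κ2 :+ f) := :- (κ1 :- :- f)) (functional j w))
      (-‿cong (+-congˡ (-‿cong (sym (functional-opp j w))))))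
    excluded : ∀ j → A j ≡ + 2 → on b′ j ≡ false ⊎ on b (opp j) ≡ false → ⊥
    excluded j e (inj₁ p) = never-on {b′} {w′} j p h′ (λ q → clash (opposite-sides j e) (lies⇒closed {b} h (opp j)) q)
    excluded j e (inj₂ p) = never-on {b} {w} (opp j) p h (λ q → clash
      (trans (ring 1 (λ a → a := :- :- a) (slack (H (opp j)) w)) (-‿cong (sym (opposite-sides j e)))) (lies⇒closed {b′} h′ j) q)
    go : Place A → ∀ k → A k ≡ + 0
    go (zero e) = e
    go (far k t e) = ⊥-elim (+-0≤ (0≤ℕ t) (+-0≤ (lies⇒closed {b′} h′ k)
        (≤-respʳ (+-congˡ (-‿cong (functional-opp k w))) (lies⇒closed {b} h (opp k))))
      (0<-neg (<-respʳ (trans (ring 2 (λ n f → κ1 := :- (n :+ ((κ1 :- ((κ3 :+ n) :+ f)) :+ (κ1 :- :- f)))) ⟦ + t ⟧ℤ (functional k w))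
        (-‿cong (+-congˡ (+-congʳ (+-congˡ (-‿cong (sym (trans (value k e) (+-congʳ (⟦3+⟧ t))))))))))  0<1)))
    go (near 0F e _) = ⊥-elim (excluded 0F e (inj₁ (proj₁ (not-0-2 b′))))
    go (near 2F e _) = ⊥-elim (excluded 2F e (inj₁ (proj₂ (not-0-2 b′))))
    go (near 3F e _) = ⊥-elim (excluded 3F e (inj₂ (proj₁ (not-0-2 b))))
    go (near 5F e _) = ⊥-elim (excluded 5F e (inj₂ (proj₂ (not-0-2 b))))
    go (near 1F e e′) = ⊥-elim (upper-lower {b} {b′} h h′
      (trans (functional-prev 1F w′) (trans (+-cong (value 1F e) (-‿cong (value 2F e′)))
        (trans (ring 2 (λ a b → (κ2 :+ a) :- (κ1 :+ b) := κ1 :+ (a :- b)) (functional 1F w) (functional 2F w)) (+-congˡ (sym (functional-prev 1F w))))))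
      (value 1F e) (value 2F e′))
    go (near 4F e e′) = ⊥-elim (upper-lower {b′} {b} h′ h f₀ f₁ f₂)
      where
      x = proj₁ w
      y = proj₂ w
      x′ = proj₁ w′
      y′ = proj₂ w′
      f₁ : functional 1F w ≈ 2# + functional 1F w′
      f₁ = trans (ring 1 (λ y → y :+ y := κ2 :- (κ2 :+ :- (y :+ y))) y) (trans (+-congˡ (-‿cong (sym (value 4F e))))
        (ring 1 (λ y′ → κ2 :- :- (y′ :+ y′) := κ2 :+ (y′ :+ y′)) y′))
      f₂ : functional 2F w ≈ 1# + functional 2F w′
      f₂ = trans (ring 2 (λ x y → y :- x := κ1 :- (κ1 :+ (x :- y))) x y) (trans (+-congˡ (-‿cong (sym (value 5F e′))))
        (ring 2 (λ x′ y′ → κ1 :- (x′ :- y′) := κ1 :+ (y′ :- x′)) x′ y′))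
      f₀ : functional 0F w ≈ 1# + functional 0F w′
      f₀ = trans (functional-prev 1F w) (trans (+-cong f₁ (-‿cong f₂))
        (trans (ring 2 (λ a b → (κ2 :+ a) :- (κ1 :+ b) := κ1 :+ (a :- b)) (functional 1F w′) (functional 2F w′)) (+-congˡ (sym (functional-prev 1F w′)))))

  *ₚ-assoc : ∀ u v w → (u *ₚ v) *ₚ w ≈ₚ u *ₚ (v *ₚ w)
  *ₚ-assoc (a , b) (c , d) (e , f) =
    ring 6 (λ a b c d e f → (a :* c :- κ3 :* (b :* d)) :* e :- κ3 :* ((a :* d :+ b :* c) :* f) :=
      a :* (c :* e :- κ3 :* (d :* f)) :- κ3 :* (b :* (c :* f :+ d :* e))) a b c d e f ,
    ring 6 (λ a b c d e f → (a :* c :- κ3 :* (b :* d)) :* f :+ (a :* d :+ b :* c) :* e :=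
      a :* (c :* f :+ d :* e) :+ b :* (c :* e :- κ3 :* (d :* f))) a b c d e f

  -- The numbers √3, 1/2 and 1/3, and the coordinates of complex numbers

  opaque
    unfolding ℝ-field

    -- √3, 1/3 and 1/2
    s t h : Carrier
    s = Defs.√3
    t = Defs.⅓
    h = Defs.½ℝ

    0<s : 0# < s
    0<s = Defs.0<√3

    ss≈3 : s * s ≈ 3#
    ss≈3 = RealField.√3*√3≈3#

    3t≈1 : 3# * t ≈ 1#
    3t≈1 = RealField.pointwise λ _ → ≡.refl

    hh≈1 : h + h ≈ 1#
    hh≈1 = RealField.pointwise λ _ → ≡.refl

  -- embed turns real and imaginary parts into the coordinates of a Point.

  embed : Carrier → Carrier → Point
  embed a b = a , t * s * b

  unembed-im : Carrier → Carrier
  unembed-im y = s * y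

  tss≈1 : t * s * s ≈ 1#
  tss≈1 = trans (*-assoc t s s) (trans (*-congˡ ss≈3) (trans (*-comm t 3#) 3t≈1))

  s*embed : ∀ b → s * (t * s * b) ≈ b
  s*embed b = trans (ring 3 (λ s t b → s :* (t :* s :* b) := (t :* s :* s) :* b) s t b) (trans (*-congʳ tss≈1) (*-identityˡ b))

  embed*s : ∀ y → t * s * (s * y) ≈ y
  embed*s y = trans (ring 3 (λ s t y → t :* s :* (s :* y) := (t :* s :* s) :* y) s t y) (trans (*-congʳ tss≈1) (*-identityˡ y))

  embed-cong : ∀ {a b a′ b′} → a ≈ a′ → b ≈ b′ → embed a b ≈ₚ embed a′ b′
  embed-cong e f = e , *-congˡ f

  embed-injective : ∀ {b b′} → t * s * b ≈ t * s * b′ → b ≈ b′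
  embed-injective {b} {b′} e = trans (sym (s*embed b)) (trans (*-congˡ e) (s*embed b′))

  embed-+ : ∀ a b a′ b′ → embed (a + a′) (b + b′) ≈ₚ embed a b +ₚ embed a′ b′
  embed-+ a b a′ b′ = refl , ring 3 (λ u b b′ → u :* (b :+ b′) := u :* b :+ u :* b′) (t * s) b b′

  embed-- : ∀ a b a′ b′ → embed (a - a′) (b - b′) ≈ₚ embed a b -ₚ embed a′ b′
  embed-- a b a′ b′ = refl , ring 3 (λ u b b′ → u :* (b :- b′) := u :* b :- u :* b′) (t * s) b b′

  private
    products : ∀ b b′ → b * b′ ≈ 3# * ((t * s * b) * (t * s * b′))
    products b b′ = sym (trans
      (ring 4 (λ s t b b′ → κ3 :* ((t :* s :* b) :* (t :* s :* b′)) := (κ3 :* t) :* ((t :* s :* s) :* (b :* b′))) s t b b′)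
      (trans (*-cong 3t≈1 (trans (*-congʳ tss≈1) (*-identityˡ _))) (*-identityˡ _)))

  embed-* : ∀ a b a′ b′ → embed (a * a′ - b * b′) (a * b′ + b * a′) ≈ₚ embed a b *ₚ embed a′ b′
  embed-* a b a′ b′ = +-congˡ (-‿cong (products b b′)) ,
    ring 5 (λ u a b a′ b′ → u :* (a :* b′ :+ b :* a′) := a :* (u :* b′) :+ (u :* b) :* a′) (t * s) a b a′ b′

  embed-norm : ∀ a b → a * a + b * b ≈ norm (embed a b)
  embed-norm a b = +-congˡ (products b b)

  embed-scale : ∀ r a b → embed (r * a) (r * b) ≈ₚ (r * proj₁ (embed a b) , r * proj₂ (embed a b))
  embed-scale r a b = refl , ring 3 (λ u r b → u :* (r :* b) := r :* (u :* b)) (t * s) r b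

  embed-neg : ∀ a b → embed (- a) (- b) ≈ₚ (- proj₁ (embed a b) , - proj₂ (embed a b))
  embed-neg a b = refl , ring 2 (λ u b → u :* :- b := :- (u :* b)) (t * s) b

  cross : Point → Point → Carrier
  cross (x , y) (x′ , y′) = x * y′ - y * x′

  cross-cong : ∀ {u u′ v v′} → u ≈ₚ u′ → v ≈ₚ v′ → cross u v ≈ cross u′ v′
  cross-cong (a , b) (c , d) = +-cong (*-cong a d) (-‿cong (*-cong b c))

  cross-embed : ∀ a b a′ b′ → a * b′ - b * a′ ≈ s * cross (embed a b) (embed a′ b′)
  cross-embed a b a′ b′ = sym (trans (ring 6 (λ s u a b a′ b′ → s :* (a :* (u :* b′) :- (u :* b) :* a′) :=
      a :* (s :* (u :* b′)) :- (s :* (u :* b)) :* a′) s (t * s) a b a′ b′)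
    (+-cong (*-congˡ (s*embed b′)) (-‿cong (*-congʳ (s*embed b)))))

  -- The ring solver treats h as an indeterminate, so an identity that uses h = 1/2 is proved modulo
  -- h + h - 1, with an explicit cofactor e.
  half-reduce : ∀ {a b e} → a ≈ b + (h + h - 1#) * e → a ≈ b
  half-reduce {a} {b} {e} p = trans p (trans (+-congˡ (trans (*-congʳ (trans (+-congʳ hh≈1) (ring 0 (κ1 :- κ1 := κ0))))
    (ring 1 (λ e → κ0 :* e := κ0) e))) (+-identityʳ b))

  0<h : 0# < h
  0<h = *-cancel-0< 0<2 (<-respʳ (trans (sym hh≈1) (ring 1 (λ h → h :+ h := κ2 :* h) h)) 0<1)

  vertex : ℕ → Point
  vertex 0 = 1# , 0#
  vertex 1 = h , h
  vertex 2 = - h , h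
  vertex 3 = - 1# , 0#
  vertex 4 = - h , - h
  vertex 5 = h , - h
  -- This covers index 6, the end point of the last side.
  vertex _ = 1# , 0#

  vertex-turn : ∀ n → n ℕ.≤ 5 → (h , h) *ₚ vertex n ≈ₚ vertex (suc n)
  vertex-turn 0 _ = ring 1 (λ h → h :* κ1 :- κ3 :* (h :* κ0) := h) h , ring 1 (λ h → h :* κ0 :+ h :* κ1 := h) h
  vertex-turn 1 _ = half-reduce (ring 1 (λ h → h :* h :- κ3 :* (h :* h) := :- h :+ (h :+ h :- κ1) :* (:- h)) h) ,
    half-reduce (ring 1 (λ h → h :* h :+ h :* h := h :+ (h :+ h :- κ1) :* h) h)
  vertex-turn 2 _ = half-reduce (ring 1 (λ h → h :* :- h :- κ3 :* (h :* h) := :- κ1 :+ (h :+ h :- κ1) :* (:- (h :+ h :+ κ1))) h) ,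
    ring 1 (λ h → h :* h :+ h :* :- h := κ0) h
  vertex-turn 3 _ = ring 1 (λ h → h :* :- κ1 :- κ3 :* (h :* κ0) := :- h) h , ring 1 (λ h → h :* κ0 :+ h :* :- κ1 := :- h) h
  vertex-turn 4 _ = half-reduce (ring 1 (λ h → h :* :- h :- κ3 :* (h :* :- h) := h :+ (h :+ h :- κ1) :* h) h) ,
    half-reduce (ring 1 (λ h → h :* :- h :+ h :* :- h := :- h :+ (h :+ h :- κ1) :* (:- h)) h)
  vertex-turn 5 _ = half-reduce (ring 1 (λ h → h :* h :- κ3 :* (h :* :- h) := κ1 :+ (h :+ h :- κ1) :* (h :+ h :+ κ1)) h) ,
    ring 1 (λ h → h :* :- h :+ h :* h := κ0) h
  vertex-turn (suc (suc (suc (suc (suc (suc n)))))) (ℕ.s≤s (ℕ.s≤s (ℕ.s≤s (ℕ.s≤s (ℕ.s≤s ())))))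

  side : ∀ (k : Fin 6) z → cross (vertex (suc (toℕ k)) -ₚ vertex (toℕ k)) (z -ₚ vertex (toℕ k)) ≈ h * slack (H k) z
  side 0F (x , y) = half-reduce (ring 3 (λ h x y → (h :- κ1) :* (y :- κ0) :- (h :- κ0) :* (x :- κ1) := h :* (κ1 :- (x :+ y)) :+ (h :+ h :- κ1) :* y) h x y)
  side 1F (x , y) = half-reduce (ring 3 (λ h x y → (:- h :- h) :* (y :- h) :- (h :- h) :* (x :- h) := h :* (κ1 :- (y :+ y)) :+ (h :+ h :- κ1) :* h) h x y)
  side 2F (x , y) = half-reduce (ring 3 (λ h x y → (:- κ1 :- :- h) :* (y :- h) :- (κ0 :- h) :* (x :- :- h) := h :* (κ1 :- (y :- x)) :+ (h :+ h :- κ1) :* y) h x y)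
  side 3F (x , y) = half-reduce (ring 3 (λ h x y → (:- h :- :- κ1) :* (y :- κ0) :- (:- h :- κ0) :* (x :- :- κ1) := h :* (κ1 :- :- (x :+ y)) :+ (h :+ h :- κ1) :* (:- y)) h x y)
  side 4F (x , y) = half-reduce (ring 3 (λ h x y → (h :- :- h) :* (y :- :- h) :- (:- h :- :- h) :* (x :- :- h) := h :* (κ1 :- :- (y :+ y)) :+ (h :+ h :- κ1) :* h) h x y)
  side 5F (x , y) = half-reduce (ring 3 (λ h x y → (κ1 :- h) :* (y :- :- h) :- (κ0 :- :- h) :* (x :- h) := h :* (κ1 :- (x :- y)) :+ (h :+ h :- κ1) :* (:- y)) h x y)

  turn : Point → Point
  turn w = (h , h) *ₚ w

  slack-turn : ∀ c w → slack c (turn w) ≈ slack (onIndex prev c) w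
  slack-turn c w@(x , y) = go c
    where
    functional-turn : ∀ k → functional k (turn w) ≈ functional (prev k) w
    functional-turn 0F = half-reduce (ring 3 (λ h x y → let a = h :* x :- κ3 :* (h :* y); b = h :* y :+ h :* x in a :+ b := (x :- y) :+ (h :+ h :- κ1) :* (x :- y)) h x y)
    functional-turn 1F = half-reduce (ring 3 (λ h x y → let a = h :* x :- κ3 :* (h :* y); b = h :* y :+ h :* x in b :+ b := (x :+ y) :+ (h :+ h :- κ1) :* (x :+ y)) h x y)
    functional-turn 2F = half-reduce (ring 3 (λ h x y → let a = h :* x :- κ3 :* (h :* y); b = h :* y :+ h :* x in b :- a := (y :+ y) :+ (h :+ h :- κ1) :* (y :+ y)) h x y)
    functional-turn 3F = half-reduce (ring 3 (λ h x y → let a = h :* x :- κ3 :* (h :* y); b = h :* y :+ h :* x in :- (a :+ b) := (y :- x) :+ (h :+ h :- κ1) :* (y :- x)) h x y)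
    functional-turn 4F = half-reduce (ring 3 (λ h x y → let a = h :* x :- κ3 :* (h :* y); b = h :* y :+ h :* x in :- (b :+ b) := :- (x :+ y) :+ (h :+ h :- κ1) :* :- (x :+ y)) h x y)
    functional-turn 5F = half-reduce (ring 3 (λ h x y → let a = h :* x :- κ3 :* (h :* y); b = h :* y :+ h :* x in a :- b := :- (y :+ y) :+ (h :+ h :- κ1) :* :- (y :+ y)) h x y)
    norm-turn : norm (turn w) ≈ norm w
    norm-turn = half-reduce (ring 3 (λ h x y → let a = h :* x :- κ3 :* (h :* y); b = h :* y :+ h :* x; n = x :* x :+ κ3 :* (y :* y) in
      a :* a :+ κ3 :* (b :* b) := n :+ (h :+ h :- κ1) :* ((h :+ h :+ κ1) :* n)) h x y)
    go : ∀ c → slack c (turn w) ≈ slack (onIndex prev c) w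
    go (H k) = +-congˡ (-‿cong (functional-turn k))
    go (C k) = +-cong norm-turn (-‿cong (functional-turn k))
    go (O k) = +-cong (+-congʳ norm-turn) (-‿cong (+-cong (functional-turn k) (functional-turn k)))
    go (P k) = functional-turn k

  unturn : Point → Point
  unturn w = (h , - h) *ₚ w

  turn-unturn : ∀ w → turn (unturn w) ≈ₚ w
  turn-unturn (x , y) =
    half-reduce (ring 3 (λ h x y → let a = h :* x :- κ3 :* (:- h :* y); b = h :* y :+ :- h :* x in
      h :* a :- κ3 :* (h :* b) := x :+ (h :+ h :- κ1) :* ((h :+ h :+ κ1) :* x)) h x y) ,
    half-reduce (ring 3 (λ h x y → let a = h :* x :- κ3 :* (:- h :* y); b = h :* y :+ :- h :* x in
      h :* b :+ h :* a := y :+ (h :+ h :- κ1) :* ((h :+ h :+ κ1) :* y)) h x y)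

  lattice-point : Carrier → Carrier → Point
  lattice-point M N = (3# * h , h) *ₚ (M + N * h , N * h)

  lattice-values : ∀ m n k → functional k (lattice-point ⟦ m ⟧ℤ ⟦ n ⟧ℤ) ≈ ⟦ latticeValue m n k ⟧ℤ
  lattice-values m n = values
    where
    M = ⟦ m ⟧ℤ
    N = ⟦ n ⟧ℤ
    2m+n : ⟦ m ℤ.+ m ℤ.+ n ⟧ℤ ≈ M + M + N
    2m+n = trans (+-homo (m ℤ.+ m) n) (+-congʳ (+-homo m m))
    m+2n : ⟦ m ℤ.+ (n ℤ.+ n) ⟧ℤ ≈ M + (N + N)
    m+2n = trans (+-homo m (n ℤ.+ n)) (+-congˡ (+-homo n n))
    difference : ∀ i j → ⟦ i ℤ.- j ⟧ℤ ≈ ⟦ i ⟧ℤ - ⟦ j ⟧ℤ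
    difference i j = trans (+-homo i (ℤ.- j)) (+-congˡ (neg-homo j))
    values : ∀ k → functional k (lattice-point M N) ≈ ⟦ latticeValue m n k ⟧ℤ
    values 0F = trans (half-reduce (ring 3 (λ h M N → let a = M :+ N :* h; b = N :* h; x = κ3 :* h :* a :- κ3 :* (h :* b); y = κ3 :* h :* b :+ h :* a in
      x :+ y := (M :+ M :+ N) :+ (h :+ h :- κ1) :* (M :+ M :+ (h :+ h :+ κ1) :* N)) h M N)) (sym 2m+n)
    values 1F = trans (half-reduce (ring 3 (λ h M N → let a = M :+ N :* h; b = N :* h; x = κ3 :* h :* a :- κ3 :* (h :* b); y = κ3 :* h :* b :+ h :* a in
      y :+ y := (M :+ (N :+ N)) :+ (h :+ h :- κ1) :* (M :+ (h :+ h :+ κ1) :* (N :+ N))) h M N)) (sym m+2n)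
    values 2F = trans (half-reduce (ring 3 (λ h M N → let a = M :+ N :* h; b = N :* h; x = κ3 :* h :* a :- κ3 :* (h :* b); y = κ3 :* h :* b :+ h :* a in
      y :- x := (N :- M) :+ (h :+ h :- κ1) :* ((h :+ h :+ κ1) :* N :- M)) h M N)) (sym (difference n m))
    values 3F = trans (-‿cong (values 0F)) (sym (neg-homo (m ℤ.+ m ℤ.+ n)))
    values 4F = trans (-‿cong (values 1F)) (sym (neg-homo (m ℤ.+ (n ℤ.+ n))))
    values 5F = trans (half-reduce (ring 3 (λ h M N → let a = M :+ N :* h; b = N :* h; x = κ3 :* h :* a :- κ3 :* (h :* b); y = κ3 :* h :* b :+ h :* a in
      x :- y := (M :- N) :+ (h :+ h :- κ1) :* (M :- (h :+ h :+ κ1) :* N)) h M N)) (sym (difference m n))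

  lies-cong : ∀ b {z w} → z ≈ₚ w → Lies b z → Lies b w
  lies-cong b {z} {w} e l k = go (on b k) (l k)
    where
    go : ∀ c → SlackOn c (slack (H k) z) → SlackOn c (slack (H k) w)
    go true  p = trans (sym (slack-cong (H k) e)) p
    go false p = <-respʳ (slack-cong (H k) e) p

  edge₁-lies : ∀ t → 0# < t → 0# < 1# - t → Lies edge₁ (t * h + (1# - t) * (- h) , t * h + (1# - t) * h)
  edge₁-lies t 0<t 0<1-t 0F = <-respʳ (sym (half-reduce (ring 2 (λ h t → let x = t :* h :+ (κ1 :- t) :* (:- h); y = t :* h :+ (κ1 :- t) :* h in
    κ1 :- (x :+ y) := (κ1 :- t) :+ (h :+ h :- κ1) :* (con (+ 0) :+ (:- con (+ 1)) :* t)) h t))) (0<1-t)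
  edge₁-lies t 0<t 0<1-t 1F = half-reduce (ring 2 (λ h t → let x = t :* h :+ (κ1 :- t) :* (:- h); y = t :* h :+ (κ1 :- t) :* h in
    κ1 :- (y :+ y) := κ0 :+ (h :+ h :- κ1) :* (:- con (+ 1))) h t)
  edge₁-lies t 0<t 0<1-t 2F = <-respʳ (sym (half-reduce (ring 2 (λ h t → let x = t :* h :+ (κ1 :- t) :* (:- h); y = t :* h :+ (κ1 :- t) :* h in
    κ1 :- (y :- x) := t :+ (h :+ h :- κ1) :* (:- con (+ 1) :+ (con (+ 1)) :* t)) h t))) (0<t)
  edge₁-lies t 0<t 0<1-t 3F = <-respʳ (sym (half-reduce (ring 2 (λ h t → let x = t :* h :+ (κ1 :- t) :* (:- h); y = t :* h :+ (κ1 :- t) :* h in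
    κ1 :- (:- (x :+ y)) := (κ1 :+ t) :+ (h :+ h :- κ1) :* (con (+ 0) :+ (con (+ 1)) :* t)) h t))) (+-0< 0<1 0<t)
  edge₁-lies t 0<t 0<1-t 4F = <-respʳ (sym (half-reduce (ring 2 (λ h t → let x = t :* h :+ (κ1 :- t) :* (:- h); y = t :* h :+ (κ1 :- t) :* h in
    κ1 :- (:- (y :+ y)) := κ2 :+ (h :+ h :- κ1) :* (con (+ 1))) h t))) (0<2)
  edge₁-lies t 0<t 0<1-t 5F = <-respʳ (sym (half-reduce (ring 2 (λ h t → let x = t :* h :+ (κ1 :- t) :* (:- h); y = t :* h :+ (κ1 :- t) :* h in
    κ1 :- (x :- y) := (κ1 :+ (κ1 :- t)) :+ (h :+ h :- κ1) :* (con (+ 1) :+ (:- con (+ 1)) :* t)) h t))) (+-0< 0<1 0<1-t)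

  edge₃-lies : ∀ t → 0# < t → 0# < 1# - t → Lies edge₃ (t * (- h) + (1# - t) * (- 1#) , t * (- h) + (1# - t) * 0#)
  edge₃-lies t 0<t 0<1-t 0F = <-respʳ (sym (half-reduce (ring 2 (λ h t → let x = t :* (:- h) :+ (κ1 :- t) :* (:- κ1); y = t :* (:- h) :+ (κ1 :- t) :* κ0 in
    κ1 :- (x :+ y) := κ2 :+ (h :+ h :- κ1) :* (con (+ 0) :+ (con (+ 1)) :* t)) h t))) (0<2)
  edge₃-lies t 0<t 0<1-t 1F = <-respʳ (sym (half-reduce (ring 2 (λ h t → let x = t :* (:- h) :+ (κ1 :- t) :* (:- κ1); y = t :* (:- h) :+ (κ1 :- t) :* κ0 in
    κ1 :- (y :+ y) := (κ1 :+ t) :+ (h :+ h :- κ1) :* (con (+ 0) :+ (con (+ 1)) :* t)) h t))) (+-0< 0<1 0<t)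
  edge₃-lies t 0<t 0<1-t 2F = <-respʳ (sym (half-reduce (ring 2 (λ h t → let x = t :* (:- h) :+ (κ1 :- t) :* (:- κ1); y = t :* (:- h) :+ (κ1 :- t) :* κ0 in
    κ1 :- (y :- x) := t :+ (h :+ h :- κ1) :* (con (+ 0))) h t))) (0<t)
  edge₃-lies t 0<t 0<1-t 3F = half-reduce (ring 2 (λ h t → let x = t :* (:- h) :+ (κ1 :- t) :* (:- κ1); y = t :* (:- h) :+ (κ1 :- t) :* κ0 in
    κ1 :- (:- (x :+ y)) := κ0 :+ (h :+ h :- κ1) :* (con (+ 0) :+ (:- con (+ 1)) :* t)) h t)
  edge₃-lies t 0<t 0<1-t 4F = <-respʳ (sym (half-reduce (ring 2 (λ h t → let x = t :* (:- h) :+ (κ1 :- t) :* (:- κ1); y = t :* (:- h) :+ (κ1 :- t) :* κ0 in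
    κ1 :- (:- (y :+ y)) := (κ1 :- t) :+ (h :+ h :- κ1) :* (con (+ 0) :+ (:- con (+ 1)) :* t)) h t))) (0<1-t)
  edge₃-lies t 0<t 0<1-t 5F = <-respʳ (sym (half-reduce (ring 2 (λ h t → let x = t :* (:- h) :+ (κ1 :- t) :* (:- κ1); y = t :* (:- h) :+ (κ1 :- t) :* κ0 in
    κ1 :- (x :- y) := (κ1 :+ (κ1 :- t)) :+ (h :+ h :- κ1) :* (con (+ 0))) h t))) (+-0< 0<1 0<1-t)

  edge₅-lies : ∀ t → 0# < t → 0# < 1# - t → Lies edge₅ (t * 1# + (1# - t) * h , t * 0# + (1# - t) * (- h))
  edge₅-lies t 0<t 0<1-t 0F = <-respʳ (sym (half-reduce (ring 2 (λ h t → let x = t :* κ1 :+ (κ1 :- t) :* h; y = t :* κ0 :+ (κ1 :- t) :* (:- h) in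
    κ1 :- (x :+ y) := (κ1 :- t) :+ (h :+ h :- κ1) :* (con (+ 0))) h t))) (0<1-t)
  edge₅-lies t 0<t 0<1-t 1F = <-respʳ (sym (half-reduce (ring 2 (λ h t → let x = t :* κ1 :+ (κ1 :- t) :* h; y = t :* κ0 :+ (κ1 :- t) :* (:- h) in
    κ1 :- (y :+ y) := (κ1 :+ (κ1 :- t)) :+ (h :+ h :- κ1) :* (con (+ 1) :+ (:- con (+ 1)) :* t)) h t))) (+-0< 0<1 0<1-t)
  edge₅-lies t 0<t 0<1-t 2F = <-respʳ (sym (half-reduce (ring 2 (λ h t → let x = t :* κ1 :+ (κ1 :- t) :* h; y = t :* κ0 :+ (κ1 :- t) :* (:- h) in
    κ1 :- (y :- x) := κ2 :+ (h :+ h :- κ1) :* (con (+ 1) :+ (:- con (+ 1)) :* t)) h t))) (0<2)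
  edge₅-lies t 0<t 0<1-t 3F = <-respʳ (sym (half-reduce (ring 2 (λ h t → let x = t :* κ1 :+ (κ1 :- t) :* h; y = t :* κ0 :+ (κ1 :- t) :* (:- h) in
    κ1 :- (:- (x :+ y)) := (κ1 :+ t) :+ (h :+ h :- κ1) :* (con (+ 0))) h t))) (+-0< 0<1 0<t)
  edge₅-lies t 0<t 0<1-t 4F = <-respʳ (sym (half-reduce (ring 2 (λ h t → let x = t :* κ1 :+ (κ1 :- t) :* h; y = t :* κ0 :+ (κ1 :- t) :* (:- h) in
    κ1 :- (:- (y :+ y)) := t :+ (h :+ h :- κ1) :* (:- con (+ 1) :+ (con (+ 1)) :* t)) h t))) (0<t)
  edge₅-lies t 0<t 0<1-t 5F = half-reduce (ring 2 (λ h t → let x = t :* κ1 :+ (κ1 :- t) :* h; y = t :* κ0 :+ (κ1 :- t) :* (:- h) in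
    κ1 :- (x :- y) := κ0 :+ (h :+ h :- κ1) :* (:- con (+ 1) :+ (con (+ 1)) :* t)) h t)

  vertex₄-lies : Lies vertex₄ (- h , - h)
  vertex₄-lies 0F = <-respʳ (sym (half-reduce (ring 1 (λ h → let x = :- h; y = :- h in
    κ1 :- (x :+ y) := κ2 :+ (h :+ h :- κ1) :* (con (+ 1))) h))) (0<2)
  vertex₄-lies 1F = <-respʳ (sym (half-reduce (ring 1 (λ h → let x = :- h; y = :- h in
    κ1 :- (y :+ y) := κ2 :+ (h :+ h :- κ1) :* (con (+ 1))) h))) (0<2)
  vertex₄-lies 2F = <-respʳ (sym (half-reduce (ring 1 (λ h → let x = :- h; y = :- h in
    κ1 :- (y :- x) := κ1 :+ (h :+ h :- κ1) :* (con (+ 0))) h))) (0<1)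
  vertex₄-lies 3F = half-reduce (ring 1 (λ h → let x = :- h; y = :- h in
    κ1 :- (:- (x :+ y)) := κ0 :+ (h :+ h :- κ1) :* (:- con (+ 1))) h)
  vertex₄-lies 4F = half-reduce (ring 1 (λ h → let x = :- h; y = :- h in
    κ1 :- (:- (y :+ y)) := κ0 :+ (h :+ h :- κ1) :* (:- con (+ 1))) h)
  vertex₄-lies 5F = <-respʳ (sym (half-reduce (ring 1 (λ h → let x = :- h; y = :- h in
    κ1 :- (x :- y) := κ1 :+ (h :+ h :- κ1) :* (con (+ 0))) h))) (0<1)

  vertex₅-lies : Lies vertex₅ (h , - h)
  vertex₅-lies 0F = <-respʳ (sym (half-reduce (ring 1 (λ h → let x = h; y = :- h in
    κ1 :- (x :+ y) := κ1 :+ (h :+ h :- κ1) :* (con (+ 0))) h))) (0<1)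
  vertex₅-lies 1F = <-respʳ (sym (half-reduce (ring 1 (λ h → let x = h; y = :- h in
    κ1 :- (y :+ y) := κ2 :+ (h :+ h :- κ1) :* (con (+ 1))) h))) (0<2)
  vertex₅-lies 2F = <-respʳ (sym (half-reduce (ring 1 (λ h → let x = h; y = :- h in
    κ1 :- (y :- x) := κ2 :+ (h :+ h :- κ1) :* (con (+ 1))) h))) (0<2)
  vertex₅-lies 3F = <-respʳ (sym (half-reduce (ring 1 (λ h → let x = h; y = :- h in
    κ1 :- (:- (x :+ y)) := κ1 :+ (h :+ h :- κ1) :* (con (+ 0))) h))) (0<1)
  vertex₅-lies 4F = half-reduce (ring 1 (λ h → let x = h; y = :- h in
    κ1 :- (:- (y :+ y)) := κ0 :+ (h :+ h :- κ1) :* (:- con (+ 1))) h)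
  vertex₅-lies 5F = half-reduce (ring 1 (λ h → let x = h; y = :- h in
    κ1 :- (x :- y) := κ0 :+ (h :+ h :- κ1) :* (:- con (+ 1))) h)

  -- Moving a point of a closed side away from 0 takes it out of the hexagon.
  push-out : ∀ z k → slack (H k) z ≈ 0# → ∀ ρ → 0# < ρ →
    ∃[ w ] norm (w -ₚ z) < ρ × slack (H k) w < 0#
  push-out z@(x , y) k e ρ 0<ρ = with-inverse (reciprocal 0<M)
    where
    M = norm z + 1#
    0<M : 0# < M
    0<M = +-0≤-0< (0≤norm z) 0<1
    with-inverse : ∃[ d ] 0# < d × M * d ≈ 1# → ∃[ w ] norm (w -ₚ z) < ρ × slack (H k) w < 0#
    with-inverse (d , 0<d , Md≈1) = with-small (∃-below 0<1 (*-0< 0<ρ 0<d))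
      where
      with-small : ∃[ τ ] 0# < τ × τ < 1# × τ < ρ * d → ∃[ w ] norm (w -ₚ z) < ρ × slack (H k) w < 0#
      with-small (τ , 0<τ , τ<1 , τ<ρd) = z +ₚ (τ * x , τ * y) ,
        0<⇒< (<-respʳ (trans
          (ring 5 (λ x y τ ρ d → let n = x :* x :+ κ3 :* (y :* y); a = x :+ τ :* x :- x; b = y :+ τ :* y :- y in
            (n :* (τ :* (κ1 :- τ)) :+ n :* (ρ :* d :- τ)) :+ ρ :* d := (ρ :* ((n :+ κ1) :* d)) :- (a :* a :+ κ3 :* (b :* b))) x y τ ρ d)
          (+-congʳ (trans (*-congˡ Md≈1) (*-identityʳ ρ))))
          (+-0≤-0< (+-0≤ (nonneg (*-0< 0<τ (<⇒0< τ<1))) (nonneg (<⇒0< τ<ρd))) (*-0< 0<ρ 0<d))) ,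
        0<-neg (<-respʳ (trans (sym (trans (*-congˡ unit) (*-identityʳ τ)))
          (trans (ring 2 (λ τ f → τ :* f := τ :* f :+ (f :- f)) τ (functional k z))
            (sym (trans (-‿cong (+-congˡ (-‿cong (trans (functional-+ k z (τ * x , τ * y)) (+-congˡ (scale k))))))
              (trans (ring 2 (λ τ f → :- (κ1 :- (f :+ τ :* f)) := τ :* f :+ (f :- κ1)) τ (functional k z))
                (+-congˡ (+-congˡ (-‿cong (sym unit))))))))) 0<τ)
        where
        unit : functional k z ≈ 1#
        unit = trans (ring 1 (λ f → f := κ1 :- (κ1 :- f)) (functional k z)) (trans (+-congˡ (-‿cong e)) (ring 0 (κ1 :- κ0 := κ1)))
        nonneg : ∀ {a} → 0# < a → 0# ≤ norm z * a
        nonneg {a} p = ≤-respʳ (*-comm a (norm z)) (*-0<-0≤ p (0≤norm z))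
        scale : ∀ k → functional k (τ * x , τ * y) ≈ τ * functional k z
        scale 0F = ring 3 (λ τ x y → τ :* x :+ τ :* y := τ :* (x :+ y)) τ x y
        scale 1F = ring 2 (λ τ y → τ :* y :+ τ :* y := τ :* (y :+ y)) τ y
        scale 2F = ring 3 (λ τ x y → τ :* y :- τ :* x := τ :* (y :- x)) τ x y
        scale 3F = ring 3 (λ τ x y → :- (τ :* x :+ τ :* y) := τ :* :- (x :+ y)) τ x y
        scale 4F = ring 2 (λ τ y → :- (τ :* y :+ τ :* y) := τ :* :- (y :+ y)) τ y
        scale 5F = ring 3 (λ τ x y → τ :* x :- τ :* y := τ :* (x :- y)) τ x y

  zeroˡ : ∀ x → 0# * x ≈ 0#
  zeroˡ = ring 1 (λ x → κ0 :* x := κ0)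

  neg-0 : - 0# ≈ 0#
  neg-0 = ring 0 (:- κ0 := κ0)

  neg-neg : ∀ x → - - x ≈ x
  neg-neg = ring 1 (λ x → :- :- x := x)

  shift-difference : ∀ p {v a w} → v ≈ₚ a +ₚ w → (p -ₚ a) -ₚ w ≈ₚ p -ₚ v
  shift-difference (x , y) {v} {a} {w} (e , f) =
    trans (ring 3 (λ x a w → (x :- a) :- w := x :- (a :+ w)) x (proj₁ a) (proj₁ w)) (+-congˡ (-‿cong (sym e))) ,
    trans (ring 3 (λ x a w → (x :- a) :- w := x :- (a :+ w)) y (proj₂ a) (proj₂ w)) (+-congˡ (-‿cong (sym f)))

  cancel-+ : ∀ {v a w} → v ≈ₚ a +ₚ w → v -ₚ a ≈ₚ w
  cancel-+ {v} {a} {w} (e , f) =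
    trans (+-congʳ e) (ring 2 (λ a w → (a :+ w) :- a := w) (proj₁ a) (proj₁ w)) ,
    trans (+-congʳ f) (ring 2 (λ a w → (a :+ w) :- a := w) (proj₂ a) (proj₂ w))

  restore-+ : ∀ v a → v ≈ₚ a +ₚ (v -ₚ a)
  restore-+ (x , y) (a , b) = ring 2 (λ x a → x := a :+ (x :- a)) x a , ring 2 (λ x a → x := a :+ (x :- a)) y b

  point-from-functionals : ∀ {p q} → functional 0F p ≈ functional 0F q → functional 1F p ≈ functional 1F q → p ≈ₚ q
  point-from-functionals {x , y} {x′ , y′} e f = trans (ring 2 (λ x y → x := (x :+ y) :- y) x y)
      (trans (+-cong e (-‿cong y≈y′)) (ring 2 (λ x y → (x :+ y) :- y := x) x′ y′)) , y≈y′
    where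
    y≈y′ : y ≈ y′
    y≈y′ = trans (sym (half-reduce (ring 2 (λ h y → h :* (y :+ y) := y :+ (h :+ h :- κ1) :* y) h y)))
      (trans (*-congˡ f) (half-reduce (ring 2 (λ h y → h :* (y :+ y) := y :+ (h :+ h :- κ1) :* y) h y′)))

  zero-no-reciprocal : ∀ {u v} → u ≈ₚ (0# , 0#) → u *ₚ v ≈ₚ 1ₚ → ⊥
  zero-no-reciprocal {u} {v} e f = <-irrefl refl (<-respʳ (trans (sym (norm-reciprocal u v f))
    (trans (*-congʳ (trans (norm-cong e) (ring 0 (κ0 :* κ0 :+ κ3 :* (κ0 :* κ0) := κ0)))) (zeroˡ (norm v)))) 0<1)

  self-distance : ∀ p → norm (p -ₚ p) ≈ 0#
  self-distance (x , y) = ring 2 (λ x y → (x :- x) :* (x :- x) :+ κ3 :* ((y :- y) :* (y :- y)) := κ0) x y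

  *ₚ-comm : ∀ u v → u *ₚ v ≈ₚ v *ₚ u
  *ₚ-comm (a , b) (c , d) = ring 4 (λ a b c d → a :* c :- κ3 :* (b :* d) := c :* a :- κ3 :* (d :* b)) a b c d ,
    ring 4 (λ a b c d → a :* d :+ b :* c := c :* b :+ d :* a) a b c d

  square-below : ∀ {e ρ} → 0# < e → e < 1# → e < ρ → e * e < ρ
  square-below {e} {ρ} 0<e e<1 e<ρ = 0<⇒< (<-respʳ (ring 2 (λ e ρ → e :* (κ1 :- e) :+ (ρ :- e) := ρ :- e :* e) e ρ)
    (+-0< (*-0< 0<e (<⇒0< e<1)) (<⇒0< e<ρ)))

  exchange-difference : ∀ {a w a′ w′} → a + w ≈ a′ + w′ → w′ ≈ (a - a′) + w
  exchange-difference {a} {w} {a′} {w′} e = trans (ring 2 (λ a w → w := (a :+ w) :- a) a′ w′)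
    (trans (+-congʳ (sym e)) (ring 3 (λ a w a′ → (a :+ w) :- a′ := (a :- a′) :+ w) a w a′))

  difference-zero : ∀ {a b} → a - b ≈ 0# → a ≈ b
  difference-zero {a} {b} e = trans (ring 2 (λ a b → a := (a :- b) :+ b) a b) (trans (+-congʳ e) (+-identityˡ b))

  1ₚ-identityˡ : ∀ p → 1ₚ *ₚ p ≈ₚ p
  1ₚ-identityˡ (x , y) = ring 2 (λ x y → κ1 :* x :- κ3 :* (κ0 :* y) := x) x y , ring 2 (λ x y → κ1 :* y :+ κ0 :* x := y) x y

  scale-cong₂ : ∀ {r r′ p q} → r ≈ r′ → p ≈ₚ q → (r * proj₁ p , r * proj₂ p) ≈ₚ (r′ * proj₁ q , r′ * proj₂ q)
  scale-cong₂ e (f , g) = *-cong e f , *-cong e g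

  1+√-3 : (h * (1# + 0#) , h * (0# + 1#)) ≈ₚ (h , h)
  1+√-3 = ring 1 (λ h → h :* (κ1 :+ κ0) := h) h , ring 1 (λ h → h :* (κ0 :+ κ1) := h) h

  3+√-3 : (h * (3# + 0#) , h * (0# + 1#)) ≈ₚ (3# * h , h)
  3+√-3 = ring 1 (λ h → h :* (κ3 :+ κ0) := κ3 :* h) h , ring 1 (λ h → h :* (κ0 :+ κ1) := h) h

  combination : Carrier → Point → Point → Point
  combination t (x , y) (x′ , y′) = t * x + (1# - t) * x′ , t * y + (1# - t) * y′

  turns unturns : ℕ → Point → Point
  turns zero    p = p
  turns (suc n) p = turn (turns n p)
  unturns zero    p = p
  unturns (suc n) p = unturns n (unturn p)

  turns-unturns : ∀ n p → turns n (unturns n p) ≈ₚ p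
  turns-unturns zero    p = ≈ₚ-refl
  turns-unturns (suc n) p = ≈ₚ-trans (*ₚ-cong ≈ₚ-refl (turns-unturns n (unturn p))) (turn-unturn p)

  rotated : ∀ n {z w} → z ≈ₚ turns n w → Rotated n w z
  rotated n {z} {w} e c = trans (slack-cong c e) (slack-turns n c)
    where
    slack-turns : ∀ n c → slack c (turns n w) ≈ slack (back n c) w
    slack-turns zero    c = refl
    slack-turns (suc n) c = trans (slack-turn c (turns n w)) (slack-turns n (onIndex prev c))

  slack-forth : ∀ n {z w} → z ≈ₚ turns n w → ∀ c → slack (forth n c) z ≈ slack c w
  slack-forth n {z} {w} e c = trans (rotated n e (forth n c)) (reflexive (≡.cong (λ c → slack c w) (back-forth n c)))

  extras-turns : ∀ n s → extras (turnStateBy n s) ≡ map (forth n) (extras s)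
  extras-turns zero    s = ≡.sym (map-id (extras s))
    where
    map-id : ∀ cs → map (λ c → c) cs ≡ cs
    map-id []       = ≡.refl
    map-id (c ∷ cs) = ≡.cong (c ∷_) (map-id cs)
  extras-turns (suc n) s = ≡.trans (extras-turn (turnStateBy n s))
    (≡.trans (≡.cong (map (onIndex next)) (extras-turns n s)) (map-∘ (extras s)))
    where
    map-∘ : ∀ cs → map (onIndex next) (map (forth n) cs) ≡ map (forth (suc n)) cs
    map-∘ []       = ≡.refl
    map-∘ (c ∷ cs) = ≡.cong (forth (suc n) c ∷_) (map-∘ cs)

  unrotated-hexagon : ∀ n {z w} → z ≈ₚ turns n w → InHexagon w → InHexagon z
  unrotated-hexagon n {z} {w} e h k = via n (H k) (k , ≡.refl) (rotated n e (H k))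
    where
    via : ∀ n c → ∃[ j ] c ≡ H j → slack (H k) z ≈ slack (back n c) w → 0# < slack (H k) z
    via zero    _ (j , ≡.refl) e = <-respʳ (sym e) (h j)
    via (suc n) _ (j , ≡.refl) e = via n (H (prev j)) (prev j , ≡.refl) e

  region-turns⇒ : ∀ n {z w} → z ≈ₚ turns n w → ∀ s → Region s w → Region (turnStateBy n s) z
  region-turns⇒ n {z} {w} e s (h , hs) = unrotated-hexagon n e h ,
    ≡.subst (All (λ c → Holds c z)) (≡.sym (extras-turns n s)) (go (extras s) hs)
    where
    go : ∀ cs → All (λ c → Holds c w) cs → All (λ c → Holds c z) (map (forth n) cs)
    go []       []       = []
    go (c ∷ cs) (p ∷ ps) = <-respʳ (sym (slack-forth n e c)) p ∷ go cs ps

  region-turns⇐ : ∀ n {z w} → z ≈ₚ turns n w → ∀ s → Region (turnStateBy n s) z → Region s w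
  region-turns⇐ n {z} {w} e s (h , hs) = rotated-hexagon {n} {w} {z} (rotated n e) h ,
    go (extras s) (≡.subst (All (λ c → Holds c z)) (extras-turns n s) hs)
    where
    go : ∀ cs → All (λ c → Holds c z) (map (forth n) cs) → All (λ c → Holds c w) cs
    go []       []       = []
    go (c ∷ cs) (p ∷ ps) = <-respʳ (slack-forth n e c) p ∷ go cs ps

  private
    reduce : ∀ {a b e f} → a ≈ b + (h + h - 1#) * e + (3# * t - 1#) * f → a ≈ b
    reduce {a} {b} {e} {f} p = half-reduce {e = e} (trans p (trans (+-congˡ (trans (*-congʳ (trans (+-congʳ 3t≈1) (ring 0 (κ1 :- κ1 := κ0))))
      (ring 1 (λ f → κ0 :* f := κ0) f))) (+-identityʳ _)))

  r² : t * s * (t * s) ≈ t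
  r² = trans (ring 2 (λ s t → t :* s :* (t :* s) := t :* (t :* (s :* s))) s t) (trans (*-congˡ (trans (*-congˡ ss≈3) (trans (*-comm t 3#) 3t≈1))) (*-identityʳ t))

  -- The circles of radius r about -2η/3, -η/3, 2η/3, η̄/3 and √-3/3.
  circle-O3 : ∀ z → norm (z +ₚ ((t + t) * (3# * h) , (t + t) * h)) - t ≈ slack (O 3F) z
  circle-O3 (x , y) = reduce (ring 4 (λ h t x y → let A = (t :+ t) :* (κ3 :* h); B = (t :+ t) :* h; K = κ2 :* x :+ κ2 :* y :+ A :+ κ1 :+ B in
    (x :+ A) :* (x :+ A) :+ κ3 :* ((y :+ B) :* (y :+ B)) :- t :=
    (x :* x :+ κ3 :* (y :* y)) :+ κ1 :- (:- (x :+ y) :+ :- (x :+ y)) :+ (h :+ h :- κ1) :* (κ3 :* t :* K :+ t) :+ (κ3 :* t :- κ1) :* K) h t x y)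

  circle-C3 : ∀ z → norm (z +ₚ (t * (3# * h) , t * h)) - t ≈ slack (C 3F) z
  circle-C3 (x , y) = reduce (ring 4 (λ h t x y → let A = t :* (κ3 :* h); B = t :* h; K = x :+ y :+ B :+ B in
    (x :+ A) :* (x :+ A) :+ κ3 :* ((y :+ B) :* (y :+ B)) :- t :=
    (x :* x :+ κ3 :* (y :* y)) :- :- (x :+ y) :+ (h :+ h :- κ1) :* (κ3 :* t :* K :+ t) :+ (κ3 :* t :- κ1) :* K) h t x y)

  circle-O0 : ∀ z → norm (z -ₚ ((t + t) * (3# * h) , (t + t) * h)) - t ≈ slack (O 0F) z
  circle-O0 (x , y) = reduce (ring 4 (λ h t x y → let A = (t :+ t) :* (κ3 :* h); B = (t :+ t) :* h; K = :- (κ2 :* x :+ κ2 :* y) :+ A :+ κ1 :+ B in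
    (x :- A) :* (x :- A) :+ κ3 :* ((y :- B) :* (y :- B)) :- t :=
    (x :* x :+ κ3 :* (y :* y)) :+ κ1 :- ((x :+ y) :+ (x :+ y)) :+ (h :+ h :- κ1) :* (κ3 :* t :* K :+ t) :+ (κ3 :* t :- κ1) :* K) h t x y)

  circle-C5 : ∀ z → norm (z -ₚ (t * (3# * h) , t * (- h))) - t ≈ slack (C 5F) z
  circle-C5 (x , y) = reduce (ring 4 (λ h t x y → let A = t :* (κ3 :* h); B = t :* h; K = y :- x :+ B :+ B in
    (x :- A) :* (x :- A) :+ κ3 :* ((y :- t :* :- h) :* (y :- t :* :- h)) :- t :=
    (x :* x :+ κ3 :* (y :* y)) :- (x :- y) :+ (h :+ h :- κ1) :* (κ3 :* t :* K :+ t) :+ (κ3 :* t :- κ1) :* K) h t x y)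

  circle-C1 : ∀ z → norm (z -ₚ (t * 0# , t * 1#)) - t ≈ slack (C 1F) z
  circle-C1 (x , y) = reduce (ring 4 (λ h t x y →
    (x :- t :* κ0) :* (x :- t :* κ0) :+ κ3 :* ((y :- t :* κ1) :* (y :- t :* κ1)) :- t :=
    (x :* x :+ κ3 :* (y :* y)) :- (y :+ y) :+ (h :+ h :- κ1) :* κ0 :+ (κ3 :* t :- κ1) :* (t :- (y :+ y))) h t x y)

open import Defs
open import Data.Fin.Base using (inject₁; fromℕ)
open import Data.Fin.Properties using (toℕ<n; toℕ-inject₁; toℕ-fromℕ)
open import Data.Fin.Relation.Unary.Top using (view; ‵fromℕ; ‵inject₁)
open import Data.List.Membership.Propositional.Properties using (∈-map⁺; ∈-++⁺ˡ; ∈-++⁺ʳ)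
open import Data.Vec.Base using ([]; _∷_)
open import Data.Vec.Functional using (Vector)
open import Function.Bundles using (mk⇔)
open import Relation.Binary.PropositionalEquality using (refl; sym; trans; cong; cong₂; subst)
open import Relation.Unary using (_∈_; _∩_; _≐_)
open Plane using (Point; _≈ₚ_; _,_; _+ₚ_; _-ₚ_; _*ₚ_; 1ₚ; norm; functional; slack; 0#; 1#; 3#; InHexagon; Lies; Generic; Holds; embed;
  turns; unturns; vertex; ≈ₚ-refl; ≈ₚ-sym; ≈ₚ-trans; *ₚ-cong; +ₚ-cong; -ₚ-cong; norm-cong; slack-cong;
  ring; _:=_; _:+_; _:*_; _:-_; :-_; κ0; κ1; κ2; κ3)

-- Transfer from ℝ and ℂ to coordinates

opaque
  unfolding Plane.s

  -- The identity, made opaque: it marks the border between the concrete sequences and the abstract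
  -- field, across which nothing unfolds.
  real : ℝ → Plane.Carrier
  real x = x

  unreal : Plane.Carrier → ℝ
  unreal x = x

  real-unreal : ∀ x → real (unreal x) Plane.≈ x
  real-unreal x = Plane.refl

  real-cong : ∀ {x y} → x ≈ y → real x Plane.≈ real y
  real-cong e = e

  real-injective : ∀ {x y} → real x Plane.≈ real y → x ≈ y
  real-injective e = e

  real-< : ∀ {x y} → x < y → real x Plane.< real y
  real-< h = h

  real-<⁻ : ∀ {x y} → real x Plane.< real y → x < y
  real-<⁻ h = h

  real-+ : ∀ x y → real (x + y) Plane.≈ real x Plane.+ real y
  real-+ x y = RealField.≈-refl

  real-* : ∀ x y → real (x * y) Plane.≈ real x Plane.* real y
  real-* x y = RealField.≈-refl

  real-neg : ∀ x → real (- x) Plane.≈ Plane.- real x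
  real-neg x = RealField.≈-refl

  real-0 : real 0ℝ Plane.≈ 0#
  real-0 = RealField.≈-refl

  real-1 : real 1ℝ Plane.≈ 1#
  real-1 = RealField.≈-refl

  real-√3 : real √3 Plane.≈ Plane.s
  real-√3 = RealField.≈-refl

  real-⅓ : real ⅓ Plane.≈ Plane.t
  real-⅓ = RealField.≈-refl

  real-⅔ : real ⅔ Plane.≈ Plane.t Plane.+ Plane.t
  real-⅔ = RealField.pointwise λ _ → refl

  real-½ : real ½ℝ Plane.≈ Plane.h
  real-½ = RealField.≈-refl

  real-ℤ : ∀ m → real (fromℤ m) Plane.≈ Plane.⟦ m ⟧ℤ
  real-ℤ (+ n)    = RealField.fromℤ≈ n
  real-ℤ -[1+ n ] = RealField.≈-trans {fromℤ -[1+ n ]} { - fromℤ (+ suc n)} (RealField.pointwise λ _ → refl)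
    (RealField.-‿cong (RealField.fromℤ≈ (suc n)))

real-- : ∀ x y → real (x - y) Plane.≈ real x Plane.- real y
real-- x y = Plane.trans (real-+ x (- y)) (Plane.+-congˡ (real-neg y))

opaque
  coords : ℂ → Point
  coords z = embed (real (re z)) (real (im z))

  point : Point → ℂ
  point (x , y) = mkℂ (unreal x) (unreal (Plane.unembed-im y))

  coords-point : ∀ p → coords (point p) ≈ₚ p
  coords-point (x , y) = real-unreal x , Plane.trans (Plane.*-congˡ (real-unreal (Plane.unembed-im y))) (Plane.embed*s y)

  coords-cong : ∀ {z w} → z ≈ᶜ w → coords z ≈ₚ coords w
  coords-cong (e , f) = Plane.embed-cong (real-cong e) (real-cong f)

  coords-injective : ∀ {z w} → coords z ≈ₚ coords w → z ≈ᶜ w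
  coords-injective (e , f) = real-injective e , real-injective (Plane.embed-injective f)

  coords-+ : ∀ z w → coords (z +ᶜ w) ≈ₚ coords z +ₚ coords w
  coords-+ z w = ≈ₚ-trans (Plane.embed-cong (real-+ (re z) (re w)) (real-+ (im z) (im w)))
    (Plane.embed-+ (real (re z)) (real (im z)) (real (re w)) (real (im w)))

  coords-- : ∀ z w → coords (z -ᶜ w) ≈ₚ coords z -ₚ coords w
  coords-- z w = ≈ₚ-trans (Plane.embed-cong (real-- (re z) (re w)) (real-- (im z) (im w)))
    (Plane.embed-- (real (re z)) (real (im z)) (real (re w)) (real (im w)))

  coords-* : ∀ z w → coords (z *ᶜ w) ≈ₚ coords z *ₚ coords w
  coords-* z w = ≈ₚ-trans (Plane.embed-cong
      (Plane.trans (real-- (re z * re w) (im z * im w)) (Plane.+-cong (real-* (re z) (re w)) (Plane.-‿cong (real-* (im z) (im w)))))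
      (Plane.trans (real-+ (re z * im w) (im z * re w)) (Plane.+-cong (real-* (re z) (im w)) (real-* (im z) (re w)))))
    (Plane.embed-* (real (re z)) (real (im z)) (real (re w)) (real (im w)))

  coords-• : ∀ r z → coords (r • z) ≈ₚ (real r Plane.* proj₁ (coords z) , real r Plane.* proj₂ (coords z))
  coords-• r z = ≈ₚ-trans (Plane.embed-cong (real-* r (re z)) (real-* r (im z))) (Plane.embed-scale (real r) (real (re z)) (real (im z)))

  coords-neg : ∀ z → coords (-ᶜ z) ≈ₚ (Plane.- proj₁ (coords z) , Plane.- proj₂ (coords z))
  coords-neg z = ≈ₚ-trans (Plane.embed-cong (real-neg (re z)) (real-neg (im z))) (Plane.embed-neg (real (re z)) (real (im z)))

  coords-conj : ∀ z → coords (conj z) ≈ₚ (proj₁ (coords z) , Plane.- proj₂ (coords z))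
  coords-conj z = Plane.refl , Plane.trans (Plane.*-congˡ (real-neg (im z))) (Plane.≈-second (Plane.embed-neg (real (re z)) (real (im z))))

  coords-real : ∀ x → coords (fromℝ x) ≈ₚ (real x , 0#)
  coords-real x = Plane.refl , Plane.trans (Plane.*-congˡ real-0) (Plane.trans (Plane.*-comm _ 0#) (Plane.zeroˡ _))

  coords-√-3 : coords √-3 ≈ₚ (0# , 1#)
  coords-√-3 = real-0 , Plane.trans (Plane.*-congˡ real-√3) Plane.tss≈1

  normSq-coords : ∀ z → real (normSq z) Plane.≈ norm (coords z)
  normSq-coords z = Plane.trans (real-+ (re z * re z) (im z * im z)) (Plane.trans
    (Plane.+-cong (real-* (re z) (re z)) (real-* (im z) (im z))) (Plane.embed-norm (real (re z)) (real (im z))))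

  cross-coords : ∀ u v → real (cross u v) Plane.≈ Plane.s Plane.* Plane.cross (coords u) (coords v)
  cross-coords u v = Plane.trans (real-- (re u * im v) (im u * re v)) (Plane.trans
    (Plane.+-cong (real-* (re u) (im v)) (Plane.-‿cong (real-* (im u) (re v))))
    (Plane.cross-embed (real (re u)) (real (im u)) (real (re v)) (real (im v))))

  real-re : ∀ z → real (re z) Plane.≈ proj₁ (coords z)
  real-re z = Plane.refl

  real-im : ∀ z → Plane.s Plane.* proj₂ (coords z) Plane.≈ real (im z)
  real-im z = Plane.s*embed (real (im z))

dist : ℂ → ℂ → Plane.Carrier
dist z w = norm (coords z -ₚ coords w)

normSq-dist : ∀ z w → real (normSq (z -ᶜ w)) Plane.≈ dist z w
normSq-dist z w = Plane.trans (normSq-coords (z -ᶜ w)) (norm-cong (coords-- z w))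

coords-1 : coords 1ᶜ ≈ₚ 1ₚ
coords-1 = ≈ₚ-trans (coords-real 1ℝ) (real-1 , Plane.refl)

-- The intermediate points are given because inferring them would unfold ζ and η.
scaled : ℝ → ℂ → Point
scaled r z = real r Plane.* proj₁ (coords z) , real r Plane.* proj₂ (coords z)

coords-scaled : ∀ {r z a p} → real r Plane.≈ a → coords z ≈ₚ p → coords (r • z) ≈ₚ (a Plane.* proj₁ p , a Plane.* proj₂ p)
coords-scaled {r} {z} {a} {p} e f = ≈ₚ-trans {coords (r • z)} {scaled r z} {a Plane.* proj₁ p , a Plane.* proj₂ p}
  (coords-• r z) (Plane.scale-cong₂ {real r} {a} {coords z} {p} e f)

coords-sum : ∀ {z w p q} → coords z ≈ₚ p → coords w ≈ₚ q → coords (z +ᶜ w) ≈ₚ p +ₚ q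
coords-sum {z} {w} {p} {q} e f = ≈ₚ-trans {coords (z +ᶜ w)} {coords z +ₚ coords w} {p +ₚ q} (coords-+ z w) (+ₚ-cong e f)

coords-difference : ∀ {z w p q} → coords z ≈ₚ p → coords w ≈ₚ q → coords (z -ᶜ w) ≈ₚ p -ₚ q
coords-difference {z} {w} {p} {q} e f = ≈ₚ-trans {coords (z -ᶜ w)} {coords z -ₚ coords w} {p -ₚ q} (coords-- z w) (-ₚ-cong e f)

coords-product : ∀ {z w p q} → coords z ≈ₚ p → coords w ≈ₚ q → coords (z *ᶜ w) ≈ₚ p *ₚ q
coords-product {z} {w} {p} {q} e f = ≈ₚ-trans {coords (z *ᶜ w)} {coords z *ₚ coords w} {p *ₚ q} (coords-* z w) (*ₚ-cong e f)

coords-negation : ∀ {z p} → coords z ≈ₚ p → coords (-ᶜ z) ≈ₚ (Plane.- proj₁ p , Plane.- proj₂ p)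
coords-negation {z} {p} (e , f) = ≈ₚ-trans {coords (-ᶜ z)} {Plane.- proj₁ (coords z) , Plane.- proj₂ (coords z)}
  {Plane.- proj₁ p , Plane.- proj₂ p} (coords-neg z) (Plane.-‿cong e , Plane.-‿cong f)

coords-conjugate : ∀ {z p} → coords z ≈ₚ p → coords (conj z) ≈ₚ (proj₁ p , Plane.- proj₂ p)
coords-conjugate {z} {p} (e , f) = ≈ₚ-trans {coords (conj z)} {proj₁ (coords z) , Plane.- proj₂ (coords z)}
  {proj₁ p , Plane.- proj₂ p} (coords-conj z) (e , Plane.-‿cong f)

coords-ζ : coords ζ ≈ₚ (Plane.h , Plane.h)
coords-ζ = ≈ₚ-trans {coords ζ} {Plane.h Plane.* (1# Plane.+ 0#) , Plane.h Plane.* (0# Plane.+ 1#)} {Plane.h , Plane.h}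
  (coords-scaled {½ℝ} {1ᶜ +ᶜ √-3} {Plane.h} {1ₚ +ₚ (0# , 1#)} real-½ (coords-sum {1ᶜ} {√-3} {1ₚ} {0# , 1#} coords-1 coords-√-3))
  Plane.1+√-3

coords-3 : coords (fromℝ 3ℝ) ≈ₚ (Plane.3# , 0#)
coords-3 = ≈ₚ-trans {coords (fromℝ 3ℝ)} {real 3ℝ , 0#} {Plane.3# , 0#} (coords-real 3ℝ) (real-ℤ (+ 3) , Plane.refl)

coords-η : coords η ≈ₚ (Plane.3# Plane.* Plane.h , Plane.h)
coords-η = ≈ₚ-trans {coords η} {Plane.h Plane.* (Plane.3# Plane.+ 0#) , Plane.h Plane.* (0# Plane.+ 1#)} {Plane.3# Plane.* Plane.h , Plane.h}
  (coords-scaled {½ℝ} {fromℝ 3ℝ +ᶜ √-3} {Plane.h} {(Plane.3# , 0#) +ₚ (0# , 1#)} real-½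
    (coords-sum {fromℝ 3ℝ} {√-3} {Plane.3# , 0#} {0# , 1#} coords-3 coords-√-3))
  Plane.3+√-3

-- Handed over as an equation between variables, this lets inductions on powers of ζ proceed without
-- unfolding the powers.
ζ^suc : ∀ n → ζ ^ᶜ suc n ≡ ζ *ᶜ ζ ^ᶜ n
ζ^suc n = refl

ζ^zero : ζ ^ᶜ zero ≡ 1ᶜ
ζ^zero = refl

coords-turn : ∀ u v w → v ≡ ζ *ᶜ u → coords (v *ᶜ w) ≈ₚ Plane.turn (coords (u *ᶜ w))
coords-turn u v w e = ≈ₚ-trans {coords (v *ᶜ w)} {((Plane.h , Plane.h) *ₚ coords u) *ₚ coords w} {Plane.turn (coords (u *ᶜ w))}
  (coords-product {v} {w} {(Plane.h , Plane.h) *ₚ coords u} {coords w}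
    (subst (λ v → coords v ≈ₚ (Plane.h , Plane.h) *ₚ coords u) (sym e) (coords-product {ζ} {u} {Plane.h , Plane.h} {coords u} coords-ζ ≈ₚ-refl)) ≈ₚ-refl)
  (≈ₚ-trans {((Plane.h , Plane.h) *ₚ coords u) *ₚ coords w} {(Plane.h , Plane.h) *ₚ (coords u *ₚ coords w)} {Plane.turn (coords (u *ᶜ w))}
    (Plane.*ₚ-assoc (Plane.h , Plane.h) (coords u) (coords w))
    (*ₚ-cong {Plane.h , Plane.h} {Plane.h , Plane.h} {coords u *ₚ coords w} {coords (u *ᶜ w)} ≈ₚ-refl (≈ₚ-sym (coords-* u w))))

coords-ζ^ : ∀ n w → coords (ζ ^ᶜ n *ᶜ w) ≈ₚ turns n (coords w)
coords-ζ^ zero w = base (ζ ^ᶜ zero) ζ^zero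
  where
  base : ∀ v → v ≡ 1ᶜ → coords (v *ᶜ w) ≈ₚ coords w
  base v e = ≈ₚ-trans {coords (v *ᶜ w)} {1ₚ *ₚ coords w} {coords w}
    (coords-product {v} {w} {1ₚ} {coords w} (subst (λ v → coords v ≈ₚ 1ₚ) (sym e) coords-1) ≈ₚ-refl) (Plane.1ₚ-identityˡ (coords w))
coords-ζ^ (suc n) w = advance (ζ ^ᶜ n) (ζ ^ᶜ suc n) (ζ^suc n) (coords-ζ^ n w)
  where
  advance : ∀ u v → v ≡ ζ *ᶜ u → coords (u *ᶜ w) ≈ₚ turns n (coords w) → coords (v *ᶜ w) ≈ₚ turns (suc n) (coords w)
  advance u v e h = ≈ₚ-trans {coords (v *ᶜ w)} {Plane.turn (coords (u *ᶜ w))} {Plane.turn (turns n (coords w))} (coords-turn u v w e)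
    (*ₚ-cong {Plane.h , Plane.h} {Plane.h , Plane.h} {coords (u *ᶜ w)} {turns n (coords w)} ≈ₚ-refl h)

coords-vertex : ∀ n → n ℕ.≤ 6 → coords (ζ ^ᶜ n) ≈ₚ vertex n
coords-vertex zero _ = subst (λ v → coords v ≈ₚ 1ₚ) (sym ζ^zero) coords-1
coords-vertex (suc n) (ℕ.s≤s n≤5) = advance (ζ ^ᶜ n) (ζ ^ᶜ suc n) (ζ^suc n) (coords-vertex n (ℕ.m≤n⇒m≤1+n n≤5))
  where
  advance : ∀ u v → v ≡ ζ *ᶜ u → coords u ≈ₚ vertex n → coords v ≈ₚ vertex (suc n)
  advance u v e h = ≈ₚ-trans {coords v} {(Plane.h , Plane.h) *ₚ vertex n} {vertex (suc n)}
    (subst (λ v → coords v ≈ₚ (Plane.h , Plane.h) *ₚ vertex n) (sym e) (coords-product {ζ} {u} {Plane.h , Plane.h} {vertex n} coords-ζ h))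
    (Plane.vertex-turn n n≤5)

side-coords : ∀ (k : Fin 6) p q z → coords p ≈ₚ vertex (toℕ k) → coords q ≈ₚ vertex (suc (toℕ k)) →
  real (cross (q -ᶜ p) (z -ᶜ p)) Plane.≈ Plane.s Plane.* (Plane.h Plane.* slack (H k) (coords z))
side-coords k p q z e f = Plane.trans (cross-coords (q -ᶜ p) (z -ᶜ p)) (Plane.*-congˡ (Plane.trans
  (Plane.cross-cong {coords (q -ᶜ p)} {vertex (suc (toℕ k)) -ₚ vertex (toℕ k)} {coords (z -ᶜ p)} {coords z -ₚ vertex (toℕ k)}
    (coords-difference {q} {p} f e) (coords-difference {z} {p} {coords z} ≈ₚ-refl e))
  (Plane.side k (coords z))))

hexagon-side : ∀ (k : Fin 6) z → let p = ζ ^ᶜ toℕ k; q = ζ ^ᶜ suc (toℕ k) in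
  real (cross (q -ᶜ p) (z -ᶜ p)) Plane.≈ Plane.s Plane.* (Plane.h Plane.* slack (H k) (coords z))
hexagon-side k z = side-coords k (ζ ^ᶜ toℕ k) (ζ ^ᶜ suc (toℕ k)) z
  (coords-vertex (toℕ k) (ℕ.<⇒≤ (toℕ<n k))) (coords-vertex (suc (toℕ k)) (toℕ<n k))

hexagon⇒ : ∀ z → z ∈ Hexagon → InHexagon (coords z)
hexagon⇒ z h k = Plane.*-cancel-0< Plane.0<h (Plane.*-cancel-0< Plane.0<s (Plane.<-resp-≈ real-0 (hexagon-side k z) (real-< (h k))))

hexagon⇐ : ∀ z → InHexagon (coords z) → z ∈ Hexagon
hexagon⇐ z h k = real-<⁻ (Plane.<-resp-≈ (Plane.sym real-0) (Plane.sym (hexagon-side k z)) (Plane.*-0< Plane.0<s (Plane.*-0< Plane.0<h (h k))))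

1-real : ∀ t → real (1ℝ - t) Plane.≈ 1# Plane.- real t
1-real t = Plane.trans (real-- 1ℝ t) (Plane.+-congʳ real-1)

0<1-real : ∀ t → t < 1ℝ → 0# Plane.< 1# Plane.- real t
0<1-real t h = Plane.<⇒0< (Plane.<-respʳ real-1 (real-< h))

0<real : ∀ {t} → 0ℝ < t → 0# Plane.< real t
0<real h = Plane.<-respˡ real-0 (real-< h)

segment-coords : ∀ p q z t {A B} → coords p ≈ₚ A → coords q ≈ₚ B → z ≈ᶜ t • p +ᶜ (1ℝ - t) • q →
  Plane.combination (real t) A B ≈ₚ coords z
segment-coords p q z t {A} {B} e f g = ≈ₚ-sym (≈ₚ-trans {coords z} {coords (t • p +ᶜ (1ℝ - t) • q)} {Plane.combination (real t) A B}
  (coords-cong g) (coords-sum {t • p} {(1ℝ - t) • q} (coords-scaled {t} {p} Plane.refl e) (coords-scaled {1ℝ - t} {q} (1-real t) f)))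

private
  coords-neg-conj-ζ : coords (-ᶜ conj ζ) ≈ₚ (Plane.- Plane.h , Plane.h)
  coords-neg-conj-ζ = ≈ₚ-trans {coords (-ᶜ conj ζ)} {Plane.- Plane.h , Plane.- Plane.- Plane.h} {Plane.- Plane.h , Plane.h}
    (coords-negation {conj ζ} {Plane.h , Plane.- Plane.h} (coords-conjugate {ζ} coords-ζ)) (Plane.refl , Plane.neg-neg Plane.h)

  coords-neg-ζ : coords (-ᶜ ζ) ≈ₚ (Plane.- Plane.h , Plane.- Plane.h)
  coords-neg-ζ = coords-negation {ζ} coords-ζ

  coords-conj-ζ : coords (conj ζ) ≈ₚ (Plane.h , Plane.- Plane.h)
  coords-conj-ζ = coords-conjugate {ζ} coords-ζ

  coords-neg-1 : coords (-ᶜ 1ᶜ) ≈ₚ (Plane.- 1# , 0#)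
  coords-neg-1 = ≈ₚ-trans {coords (-ᶜ 1ᶜ)} {Plane.- 1# , Plane.- 0#} {Plane.- 1# , 0#} (coords-negation {1ᶜ} coords-1) (Plane.refl , Plane.neg-0)

U⇒lies : ∀ z → z ∈ U → ∃[ b ] Lies b (coords z)
U⇒lies z (inj₁ h) = interior , hexagon⇒ z h
U⇒lies z (inj₂ (inj₁ (t , 0<t , t<1 , e))) = edge₁ ,
  Plane.lies-cong edge₁ (segment-coords ζ (-ᶜ conj ζ) z t coords-ζ coords-neg-conj-ζ e) (Plane.edge₁-lies (real t) (0<real 0<t) (0<1-real t t<1))
U⇒lies z (inj₂ (inj₂ (inj₁ (t , 0<t , t<1 , e)))) = edge₃ ,
  Plane.lies-cong edge₃ (segment-coords (-ᶜ ζ) (-ᶜ 1ᶜ) z t coords-neg-ζ coords-neg-1 e) (Plane.edge₃-lies (real t) (0<real 0<t) (0<1-real t t<1))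
U⇒lies z (inj₂ (inj₂ (inj₂ (inj₁ (t , 0<t , t<1 , e))))) = edge₅ ,
  Plane.lies-cong edge₅ (segment-coords 1ᶜ (conj ζ) z t coords-1 coords-conj-ζ e) (Plane.edge₅-lies (real t) (0<real 0<t) (0<1-real t t<1))
U⇒lies z (inj₂ (inj₂ (inj₂ (inj₂ (inj₁ e))))) = vertex₄ ,
  Plane.lies-cong vertex₄ (≈ₚ-sym (≈ₚ-trans {coords z} {coords (-ᶜ ζ)} (coords-cong e) coords-neg-ζ)) Plane.vertex₄-lies
U⇒lies z (inj₂ (inj₂ (inj₂ (inj₂ (inj₂ e))))) = vertex₅ ,
  Plane.lies-cong vertex₅ (≈ₚ-sym (≈ₚ-trans {coords z} {coords (conj ζ)} (coords-cong e) coords-conj-ζ)) Plane.vertex₅-lies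

-- Neighbourhoods, and uniqueness of the bracket and of T

infix 4 _≋_
_≋_ : ℂ → ℂ → Set
z ≋ w = coords z ≈ₚ coords w

Neighbourhood : ℂ → Region → Set
Neighbourhood z A = ∃[ ρ ] 0# Plane.< ρ × (∀ w → dist w z Plane.< ρ → w ∈ A)

interior⇒neighbourhood : ∀ {A z} → z ∈ Interior A → Neighbourhood z A
interior⇒neighbourhood {A} {z} (ε , 0<ε , f) = real ε Plane.* real ε , Plane.*-0< (0<real 0<ε) (0<real 0<ε) ,
  λ w h → f w (real-<⁻ (Plane.<-resp-≈ (Plane.sym (normSq-dist w z)) (Plane.sym (real-* ε ε)) h))

-- A neighbourhood is measured by the squared distance, so an ε with ε² ≤ ρ is wanted. Any positive
-- number below both 1 and ρ serves, and no root is taken.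
neighbourhood⇒interior : ∀ {A z} → Neighbourhood z A → z ∈ Interior A
neighbourhood⇒interior {A} {z} (ρ , 0<ρ , f) = small (Plane.∃-below Plane.0<1 0<ρ)
  where
  small : ∃[ e ] 0# Plane.< e × e Plane.< 1# × e Plane.< ρ → z ∈ Interior A
  small (e , 0<e , e<1 , e<ρ) = unreal e ,
    real-<⁻ (Plane.<-resp-≈ (Plane.sym real-0) (Plane.sym (real-unreal e)) 0<e) ,
    λ w h → f w (Plane.<-trans (Plane.<-resp-≈ (normSq-dist w z)
      (Plane.trans (real-* (unreal e) (unreal e)) (Plane.*-cong (real-unreal e) (real-unreal e))) (real-< h)) (Plane.square-below 0<e e<1 e<ρ))

near⇒neighbourhood : ∀ {Φ : Point → Set} {z} → Plane.Near (coords z) Φ → Neighbourhood z (λ w → Φ (coords w))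
near⇒neighbourhood (ρ , 0<ρ , f) = ρ , 0<ρ , λ w → f (coords w)

hexagon⇒U : ∀ z → InHexagon (coords z) → z ∈ U
hexagon⇒U z h = inj₁ (hexagon⇐ z h)

dist-self : ∀ z → dist z z Plane.≈ 0#
dist-self z = Plane.self-distance (coords z)

neighbourhood-centre : ∀ {z A} → Neighbourhood z A → z ∈ A
neighbourhood-centre {z} (ρ , 0<ρ , f) = f z (Plane.<-respˡ (Plane.sym (dist-self z)) 0<ρ)

-- A point on a side, pushed slightly away from 0, leaves the closed hexagon but stays in the
-- neighbourhood; so all slacks at the centre are positive.
neighbourhood-in-U : ∀ {A z} → (∀ w → w ∈ A → ∃[ b ] Lies b (coords w)) → Neighbourhood z A → InHexagon (coords z)
neighbourhood-in-U {A} {z} A⊆U (ρ , 0<ρ , f) k = go (A⊆U z (neighbourhood-centre (ρ , 0<ρ , f)))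
  where
  out : slack (H k) (coords z) Plane.≈ 0# → ⊥
  out e = pushed (Plane.push-out (coords z) k e ρ 0<ρ)
    where
    pushed : ∃[ p ] norm (p -ₚ coords z) Plane.< ρ × slack (H k) p Plane.< 0# → ⊥
    pushed (p , close , neg) = closed (A⊆U (point p) (f (point p)
        (Plane.<-respˡ (norm-cong (-ₚ-cong (≈ₚ-sym (coords-point p)) ≈ₚ-refl)) close)))
      where
      closed : ∃[ b ] Lies b (coords (point p)) → ⊥
      closed (b , l) = Plane.lies⇒closed {b} l k (Plane.<-respˡ (slack-cong (H k) (≈ₚ-sym (coords-point p))) neg)
  go : ∃[ b ] Lies b (coords z) → 0# Plane.< slack (H k) (coords z)
  go (b , l) = decide (on b k) (l k)
    where
    decide : ∀ c → Plane.SlackOn c (slack (H k) (coords z)) → 0# Plane.< slack (H k) (coords z)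
    decide true  e = ⊥-elim (out e)
    decide false p = p

lattice : ∀ a → a ∈ 𝒥 → ∃[ m ] ∃[ n ] ∀ k → functional k (coords a) Plane.≈ Plane.⟦ latticeValue m n k ⟧ℤ
lattice a (w , (m , n , e) , f) = m , n , λ k → Plane.trans (Plane.functional-cong k coords-a) (Plane.lattice-values m n k)
  where
  M = Plane.⟦ m ⟧ℤ
  N = Plane.⟦ n ⟧ℤ
  coords-w : coords w ≈ₚ (M Plane.+ N Plane.* Plane.h , N Plane.* Plane.h)
  coords-w = ≈ₚ-trans {coords w} {(M , 0#) +ₚ (N Plane.* Plane.h , N Plane.* Plane.h)} {M Plane.+ N Plane.* Plane.h , N Plane.* Plane.h}
    (≈ₚ-trans {coords w} {coords (fromℝ (fromℤ m) +ᶜ fromℤ n • ζ)} (coords-cong e)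
      (coords-sum {fromℝ (fromℤ m)} {fromℤ n • ζ} (≈ₚ-trans {coords (fromℝ (fromℤ m))} (coords-real (fromℤ m)) (real-ℤ m , Plane.refl))
        (coords-scaled {fromℤ n} {ζ} (real-ℤ n) coords-ζ)))
    (Plane.refl , Plane.+-identityˡ _)
  coords-a : coords a ≈ₚ Plane.lattice-point M N
  coords-a = ≈ₚ-trans {coords a} {coords (η *ᶜ w)} (coords-cong f) (coords-product {η} {w} coords-η coords-w)

translated : ∀ {v a w} → v ≈ᶜ a +ᶜ w → coords v ≈ₚ coords a +ₚ coords w
translated {v} {a} {w} e = ≈ₚ-trans {coords v} {coords (a +ᶜ w)} (coords-cong e) (coords-+ a w)

shift : ∀ {v a w A} → (∀ k → functional k (coords a) Plane.≈ Plane.⟦ A k ⟧ℤ) → coords v ≈ₚ coords a +ₚ coords w →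
  Plane.Shift A (coords w) (coords v)
shift {v} {a} {w} f e k = Plane.trans (Plane.functional-cong k e) (Plane.trans (Plane.functional-+ k (coords a) (coords w)) (Plane.+-congʳ (f k)))

-- The two remainders differ by a lattice vector, and `translate-unique` makes all its values
-- vanish.
bracket-unique : ∀ {v v′ a a′} → v ≋ v′ → [ v ]≡ a → [ v′ ]≡ a′ → a ≋ a′
bracket-unique {v} {v′} {a} {a′} v≋v′ (a∈𝒥 , w , w∈U , e) (a′∈𝒥 , w′ , w′∈U , e′) =
  compare (lattice a a∈𝒥) (lattice a′ a′∈𝒥) (U⇒lies w w∈U) (U⇒lies w′ w′∈U)
  where
  compare : ∃[ m ] ∃[ n ] (∀ k → functional k (coords a) Plane.≈ Plane.⟦ latticeValue m n k ⟧ℤ) →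
    ∃[ m ] ∃[ n ] (∀ k → functional k (coords a′) Plane.≈ Plane.⟦ latticeValue m n k ⟧ℤ) →
    ∃[ b ] Lies b (coords w) → ∃[ b ] Lies b (coords w′) → a ≋ a′
  compare (m , n , f) (m′ , n′ , f′) (b , l) (b′ , l′) = Plane.point-from-functionals (equal 0F) (equal 1F)
    where
    A = latticeValue (m ℤ.- m′) (n ℤ.- n′)
    value : ∀ k → Plane.⟦ A k ⟧ℤ Plane.≈ functional k (coords a) Plane.- functional k (coords a′)
    value k = Plane.trans (Plane.reflexive (cong Plane.⟦_⟧ℤ (latticeValue-difference m n m′ n′ k)))
      (Plane.trans (Plane.+-homo (latticeValue m n k) (ℤ.- latticeValue m′ n′ k))
        (Plane.+-cong (Plane.sym (f k)) (Plane.trans (Plane.neg-homo (latticeValue m′ n′ k)) (Plane.-‿cong (Plane.sym (f′ k))))))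
    moved : Plane.Shift A (coords w) (coords w′)
    moved k = Plane.trans (Plane.exchange-difference (Plane.trans (Plane.sym (Plane.functional-+ k (coords a) (coords w)))
        (Plane.trans (Plane.functional-cong k (≈ₚ-trans (≈ₚ-sym (translated e)) (≈ₚ-trans v≋v′ (translated e′)))) (Plane.functional-+ k (coords a′) (coords w′)))))
      (Plane.+-congʳ (Plane.sym (value k)))
    equal : ∀ k → functional k (coords a) Plane.≈ functional k (coords a′)
    equal k = Plane.difference-zero (Plane.trans (Plane.sym (value k)) (Plane.reflexive (cong Plane.⟦_⟧ℤ
      (Plane.translate-unique (LatticePlace.place (m ℤ.- m′) (n ℤ.- n′)) {b} {b′} {coords w} {coords w′} l l′ moved k))))

reciprocal-coords : ∀ {u v} → v IsReciprocalOf u → coords u *ₚ coords v ≈ₚ 1ₚ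
reciprocal-coords {u} {v} e = ≈ₚ-trans (≈ₚ-sym (coords-* u v)) (≈ₚ-trans (coords-cong e) coords-1)

coords-reciprocal : ∀ {u v} → coords u *ₚ coords v ≈ₚ 1ₚ → v IsReciprocalOf u
coords-reciprocal {u} {v} e = coords-injective (≈ₚ-trans (coords-* u v) (≈ₚ-trans e (≈ₚ-sym coords-1)))

coords-0 : ∀ {z} → z ≈ᶜ 0ᶜ → coords z ≈ₚ (0# , 0#)
coords-0 {z} e = ≈ₚ-trans {coords z} {coords 0ᶜ} (coords-cong e) (≈ₚ-trans {coords 0ᶜ} (coords-real 0ℝ) (real-0 , Plane.refl))

reciprocals-agree : ∀ {u u′ v v′} → u ≋ u′ → coords u *ₚ coords v ≈ₚ 1ₚ → coords u′ *ₚ coords v′ ≈ₚ 1ₚ → v ≋ v′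
reciprocals-agree {u} {u′} {v} {v′} e f g = Plane.reciprocal-unique (coords v) (coords v′) (coords u)
  (≈ₚ-trans (Plane.*ₚ-comm (coords v) (coords u)) f)
  (≈ₚ-trans (Plane.*ₚ-comm (coords v′) (coords u)) (≈ₚ-trans (*ₚ-cong e ≈ₚ-refl) g))

subtracted : ∀ {w v a} → w ≈ᶜ v -ᶜ a → coords w ≈ₚ coords v -ₚ coords a
subtracted {w} {v} {a} e = ≈ₚ-trans {coords w} {coords (v -ᶜ a)} (coords-cong e) (coords-- v a)

T-unique : ∀ {z z′ w w′} → z ≋ z′ → T z w → T z′ w′ → w ≋ w′
T-unique e (inj₁ (_ , f)) (inj₁ (_ , g)) = ≈ₚ-trans (coords-0 f) (≈ₚ-sym (coords-0 g))
T-unique {z} {z′} e (inj₁ (f , _)) (inj₂ (v , _ , g , _)) =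
  ⊥-elim (Plane.zero-no-reciprocal (≈ₚ-trans (≈ₚ-sym e) (coords-0 f)) (reciprocal-coords {z′} {v} g))
T-unique {z} {z′} e (inj₂ (v , _ , g , _)) (inj₁ (f , _)) =
  ⊥-elim (Plane.zero-no-reciprocal (≈ₚ-trans e (coords-0 f)) (reciprocal-coords {z} {v} g))
T-unique {z} {z′} {w} {w′} e (inj₂ (v , a , f , g , h)) (inj₂ (v′ , a′ , f′ , g′ , h′)) =
  ≈ₚ-trans (subtracted {w} {v} {a} h) (≈ₚ-trans (-ₚ-cong v≋v′ (bracket-unique {v} {v′} {a} {a′} v≋v′ g g′)) (≈ₚ-sym (subtracted {w′} {v′} {a′} h′)))
  where
  v≋v′ : v ≋ v′
  v≋v′ = reciprocals-agree {z} {z′} {v} {v′} e (reciprocal-coords {z} {v} f) (reciprocal-coords {z′} {v′} f′)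

T^-unique : ∀ n {z w w′} → T^ n z w → T^ n z w′ → w ≋ w′
T^-unique zero    f g = ≈ₚ-trans (coords-cong f) (≈ₚ-sym (coords-cong g))
T^-unique (suc n) (u , f , g) (u′ , f′ , g′) = T-unique (T^-unique n f f′) g g′

T^-resp : ∀ n {z w w′} → w ≋ w′ → T^ n z w → T^ n z w′
T^-resp zero {z} {w} {w′} e f = coords-injective (≈ₚ-trans (≈ₚ-sym e) (coords-cong f))
T^-resp (suc n) {z} {w} {w′} e (u , f , inj₁ (g , h)) = u , f , inj₁ (g , coords-injective (≈ₚ-trans (≈ₚ-sym e) (coords-cong h)))
T^-resp (suc n) {z} {w} {w′} e (u , f , inj₂ (v , a , g , h , i)) = u , f , inj₂ (v , a , g , h ,
  coords-injective (≈ₚ-trans (≈ₚ-sym e) (coords-cong i)))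

hexagon-cong : ∀ {p q} → p ≈ₚ q → InHexagon p → InHexagon q
hexagon-cong e hex k = Plane.<-respʳ (slack-cong (H k) e) (hex k)

-- Cylinders and ranges, one digit at a time

fin-cases : ∀ {n} (Φ : Fin (suc n) → Set) → Φ (fromℕ n) → (∀ i → Φ (inject₁ i)) → ∀ i → Φ i
fin-cases Φ top below i with view i
... | ‵fromℕ     = top
... | ‵inject₁ j = below j

init : ∀ {n} → Vector ℂ (suc n) → Vector ℂ n
init a i = a (inject₁ i)

final : ∀ {n} → Vector ℂ (suc n) → ℂ
final {n} a = a (fromℕ n)

opaque
  -- The last step of an orbit: u is the n-th iterate of z, v = 1/u, and w the remainder after
  -- subtracting the digit c.
  Extends : ℕ → ℂ → ℂ → ℂ → ℂ → ℂ → Set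
  Extends n c z u v w = T^ n z u × v IsReciprocalOf u × w ∈ U × v ≈ᶜ c +ᶜ w

  extending : ∀ {n c z u v w} → T^ n z u → v IsReciprocalOf u → w ∈ U → v ≈ᶜ c +ᶜ w → Extends n c z u v w
  extending f g w∈U e = f , g , w∈U , e

  orbit : ∀ {n c z u v w} → Extends n c z u v w → T^ n z u
  orbit (f , _) = f

  reciprocal : ∀ {n c z u v w} → Extends n c z u v w → v IsReciprocalOf u
  reciprocal (_ , g , _) = g

  remainder : ∀ {n c z u v w} → Extends n c z u v w → w ∈ U
  remainder (_ , _ , w∈U , _) = w∈U

  bracketed : ∀ {n c z u v w} → Extends n c z u v w → v ≈ᶜ c +ᶜ w
  bracketed (_ , _ , _ , e) = e

cylinder-init : ∀ n (a : Vector ℂ (suc n)) z → z ∈ Cylinder a → z ∈ Cylinder (init a)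
cylinder-init n a z (z∈U , bs) = z∈U , λ i → subst (λ k → b k z (a (inject₁ i))) (toℕ-inject₁ i) (bs (inject₁ i))

cylinder-extends : ∀ n (a : Vector ℂ (suc n)) z → z ∈ Cylinder a → ∃[ u ] ∃[ v ] ∃[ w ] Extends n (final a) z u v w
cylinder-extends n a z (z∈U , bs) = arrange (subst (λ k → b k z (final a)) (toℕ-fromℕ n) (bs (fromℕ n)))
  where
  arrange : b n z (final a) → ∃[ u ] ∃[ v ] ∃[ w ] Extends n (final a) z u v w
  arrange (u , v , f , g , (_ , w , w∈U , e)) = u , v , w , extending {n} {final a} {z} {u} {v} {w} f g w∈U e

cylinder-join : ∀ n (a : Vector ℂ (suc n)) z {u v w} → final a ∈ 𝒥 → z ∈ Cylinder (init a) → Extends n (final a) z u v w → z ∈ Cylinder a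
cylinder-join n a z {u} {v} {w} c∈𝒥 (z∈U , bs) x = z∈U , fin-cases (λ i → b (toℕ i) z (a i))
  (subst (λ k → b k z (final a)) (sym (toℕ-fromℕ n)) (u , v , orbit x , reciprocal x , (c∈𝒥 , w , remainder x , bracketed x)))
  (λ i → subst (λ k → b k z (a (inject₁ i))) (sym (toℕ-inject₁ i)) (bs i))

extends-T^ : ∀ n {c z u v w} → c ∈ 𝒥 → Extends n c z u v w → T^ (suc n) z w
extends-T^ n {c} {z} {u} {v} {w} c∈𝒥 x = u , orbit x , inj₂ (v , c , reciprocal x , (c∈𝒥 , w , remainder x , bracketed x) ,
  coords-injective (≈ₚ-sym (≈ₚ-trans (coords-- v c) (Plane.cancel-+ (translated {v} {c} {w} (bracketed x))))))

-- The relation w = 1/u - c without membership in U. It is a partial homeomorphism between u and w,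
-- and all topological arguments go through it.
record Follows (c u : ℂ) (v : Point) (w : ℂ) : Set where
  constructor follows
  field
    inverse  : coords u *ₚ v ≈ₚ 1ₚ
    moved-by : v ≈ₚ coords c +ₚ coords w

extends-follows : ∀ n {c z u v w w′} → c ∈ 𝒥 → Extends n c z u v w → T^ (suc n) z w′ → Follows c u (coords v) w′
extends-follows n {c} {z} {u} {v} {w} {w′} c∈𝒥 x h = follows (reciprocal-coords {u} {v} (reciprocal x))
  (≈ₚ-trans {coords v} {coords c +ₚ coords w} (translated {v} {c} {w} (bracketed x)) (+ₚ-cong {coords c} {coords c} {coords w} {coords w′} ≈ₚ-refl (T^-unique (suc n) {z} {w} {w′} (extends-T^ n c∈𝒥 x) h)))

range-resp : ∀ n (a : Vector ℂ n) {w w′} → w ≋ w′ → w ∈ Range a → w′ ∈ Range a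
range-resp n a {w} {w′} e (z , c , f) = z , c , T^-resp n {z} {w} {w′} e f

-- Ranges obey a recursion: a point of the new range lies in U and arises as 1/u - c from a point u
-- of the previous range.
range-split : ∀ n (a : Vector ℂ (suc n)) w → final a ∈ 𝒥 → w ∈ Range a →
  ∃[ u ] ∃[ v ] u ∈ Range (init a) × Follows (final a) u v w × ∃[ b ] Lies b (coords w)
range-split n a w c∈𝒥 (z , z∈ , h) = arrange (cylinder-extends n a z z∈)
  where
  arrange : ∃[ u ] ∃[ v ] ∃[ w ] Extends n (final a) z u v w →
    ∃[ u ] ∃[ v ] u ∈ Range (init a) × Follows (final a) u v w × ∃[ b ] Lies b (coords w)
  arrange (u , v , w′ , x) = u , coords v , (z , cylinder-init n a z z∈ , orbit x) , extends-follows n {final a} {z} {u} {v} {w′} {w} c∈𝒥 x h , lies (U⇒lies w′ (remainder x))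
    where
    lies : ∃[ b ] Lies b (coords w′) → ∃[ b ] Lies b (coords w)
    lies (b , l) = b , Plane.lies-cong b (T^-unique (suc n) {z} {w′} {w} (extends-T^ n c∈𝒥 x) h) l

range-lies : ∀ n (a : Vector ℂ n) → (∀ i → a i ∈ 𝒥) → ∀ w → w ∈ Range a → ∃[ b ] Lies b (coords w)
range-lies zero a J w (z , (z∈U , _) , e) = lies (U⇒lies z z∈U)
  where
  lies : ∃[ b ] Lies b (coords z) → ∃[ b ] Lies b (coords w)
  lies (b , l) = b , Plane.lies-cong b (≈ₚ-sym (coords-cong e)) l
range-lies (suc n) a J w h = pick (range-split n a w (J (fromℕ n)) h)
  where
  pick : ∃[ u ] ∃[ v ] u ∈ Range (init a) × Follows (final a) u v w × ∃[ b ] Lies b (coords w) → ∃[ b ] Lies b (coords w)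
  pick (_ , _ , _ , _ , l) = l

-- The state of a range, and the two inclusions

index : ∀ {a} → a ∈ 𝒥 → ℤ × ℤ
index (_ , (m , n , _) , _) = m , n

values : ℤ × ℤ → Fin 6 → ℤ
values (m , n) = latticeValue m n

index-values : ∀ {a} (h : a ∈ 𝒥) → ∀ k → functional k (coords a) Plane.≈ Plane.⟦ values (index h) k ⟧ℤ
index-values {a} (w , (m , n , e) , f) = proj₂ (proj₂ (lattice a (w , (m , n , e) , f)))

advance : ℤ × ℤ → Maybe State → Maybe State
advance (m , n) (just s) = step (LatticePlace.place m n) s
advance _       nothing  = nothing

-- The state is computed from the integers in the proofs of membership in `𝒥`, so no property of
-- real numbers is consulted.
rangeState : ∀ n (a : Vector ℂ n) → (∀ i → a i ∈ 𝒥) → Maybe State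
rangeState zero    a J = just whole
rangeState (suc n) a J = advance (index (J (fromℕ n))) (rangeState n (init a) (λ i → J (inject₁ i)))

follows-shift : ∀ {c u v w} (h : c ∈ 𝒥) → Follows c u v w → Plane.Shift (values (index h)) (coords w) v
follows-shift {c} {u} {v} {w} h (follows _ e) k = Plane.trans (Plane.functional-cong k e)
  (Plane.trans (Plane.functional-+ k (coords c) (coords w)) (Plane.+-congʳ (index-values h k)))

advance-⇒ : ∀ p ms {u v w} → Plane.Shift (values p) w v → u *ₚ v ≈ₚ 1ₚ → InHexagon w → Plane.RegionOf ms u → Plane.RegionOf (advance p ms) w
advance-⇒ (m , n) (just s) {u} {v} {w} sh uv hex = Plane.step-⇒ (LatticePlace.place m n) {u} {v} {w} sh uv s hex

advance-⇐ : ∀ p ms {u v w} → Plane.Shift (values p) w v → u *ₚ v ≈ₚ 1ₚ → Plane.RegionOf (advance p ms) w → Plane.RegionOf ms u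
advance-⇐ (m , n) (just s) {u} {v} {w} sh uv = Plane.step-⇐ (LatticePlace.place m n) {u} {v} {w} sh uv s

advance-weak : ∀ p ms {u v w} → Plane.Shift (values p) w v → u *ₚ v ≈ₚ 1ₚ → Plane.InClosedHexagon w →
  Plane.WeakRegionOf ms u → Plane.WeakRegionOf (advance p ms) w
advance-weak (m , n) (just s) {u} {v} {w} sh uv hex = Plane.step-weak (LatticePlace.place m n) {u} {v} {w} sh uv s hex
advance-weak (m , n) nothing _ _ _ _ = tt

advance-reciprocal : ∀ p ms {v w} → Plane.Shift (values p) w v → Plane.RegionOf (advance p ms) w → ∃[ u ] u *ₚ v ≈ₚ 1ₚ
advance-reciprocal (m , n) (just s) {v} {w} sh reg = Plane.reciprocal-exists v (Plane.0<norm-shift (LatticePlace.place m n) {v} {w} sh s reg)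

region-hexagon : ∀ ms {w} → Plane.RegionOf ms w → InHexagon w
region-hexagon (just s) = proj₁

-- The outer bound of the range. It holds for every point, including those on the sides belonging to
-- U.
range-weak : ∀ n (a : Vector ℂ n) J w → w ∈ Range a → Plane.WeakRegionOf (rangeState n a J) (coords w)
range-weak zero a J w h = closed (range-lies zero a J w h)
  where
  closed : ∃[ b ] Lies b (coords w) → Plane.WeakRegion whole (coords w)
  closed (b , l) = Plane.lies⇒closed {b} l , []
range-weak (suc n) a J w h = go (range-split n a w (J (fromℕ n)) h)
  where
  go : ∃[ u ] ∃[ v ] u ∈ Range (init a) × Follows (final a) u v w × ∃[ b ] Lies b (coords w) → Plane.WeakRegionOf (rangeState (suc n) a J) (coords w)
  go (u , v , u∈ , fol , b , l) = advance-weak (index (J (fromℕ n))) (rangeState n (init a) (λ i → J (inject₁ i)))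
    {coords u} {v} {coords w} (follows-shift {final a} {u} {v} {w} (J (fromℕ n)) fol) (Follows.inverse fol) (Plane.lies⇒closed {b} l) (range-weak n (init a) (λ i → J (inject₁ i)) u u∈)

moved-distance : ∀ {c v v′ w w′} → v ≈ₚ c +ₚ w → v′ ≈ₚ c +ₚ w′ → norm (v′ -ₚ v) Plane.≈ norm (w′ -ₚ w)
moved-distance {c} {v} {v′} e e′ = Plane.sym (norm-cong (≈ₚ-trans (-ₚ-cong (≈ₚ-sym (Plane.cancel-+ e′)) ≈ₚ-refl) (Plane.shift-difference v′ e)))

lowered : ∀ {c v w} → v ≈ₚ coords c +ₚ coords w → ∀ v′ {ρ} → norm (v′ -ₚ v) Plane.< ρ →
  ∃[ w′ ] v′ ≈ₚ coords c +ₚ coords w′ × dist w′ w Plane.< ρ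
lowered {c} {v} {w} e v′ h = point (v′ -ₚ coords c) , e′ , Plane.<-respˡ (moved-distance e e′) h
  where
  e′ : v′ ≈ₚ coords c +ₚ coords (point (v′ -ₚ coords c))
  e′ = ≈ₚ-trans (Plane.restore-+ v′ (coords c)) (+ₚ-cong ≈ₚ-refl (≈ₚ-sym (coords-point (v′ -ₚ coords c))))

follows-continuous : ∀ {c u v w} → Follows c u v w → ∀ ρ → 0# Plane.< ρ →
  Neighbourhood u (λ u′ → ∃[ v′ ] ∃[ w′ ] Follows c u′ v′ w′ × dist w′ w Plane.< ρ)
follows-continuous {c} {u} {v} {w} (follows uv e) ρ 0<ρ =
  convert (Plane.reciprocal-continuous v (coords u) (≈ₚ-trans (Plane.*ₚ-comm v (coords u)) uv) ρ 0<ρ)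
  where
  convert : Plane.Near (coords u) (λ u′ → ∃[ v′ ] v′ *ₚ u′ ≈ₚ 1ₚ × norm (v′ -ₚ v) Plane.< ρ) →
    Neighbourhood u (λ u′ → ∃[ v′ ] ∃[ w′ ] Follows c u′ v′ w′ × dist w′ w Plane.< ρ)
  convert (σ , 0<σ , f) = σ , 0<σ , λ u′ h → go u′ (f (coords u′) h)
    where
    go : ∀ u′ → ∃[ v′ ] v′ *ₚ coords u′ ≈ₚ 1ₚ × norm (v′ -ₚ v) Plane.< ρ → ∃[ v′ ] ∃[ w′ ] Follows c u′ v′ w′ × dist w′ w Plane.< ρ
    go u′ (v′ , vu , h) = v′ , finish (lowered {c} {v} {w} e v′ h)
      where
      finish : ∃[ w′ ] v′ ≈ₚ coords c +ₚ coords w′ × dist w′ w Plane.< ρ → ∃[ w′ ] Follows c u′ v′ w′ × dist w′ w Plane.< ρ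
      finish (w′ , e′ , h′) = w′ , follows (≈ₚ-trans (Plane.*ₚ-comm (coords u′) v′) vu) e′ , h′

follows-continuous⁻ : ∀ {c u v w} → Follows c u v w → ∀ ρ → 0# Plane.< ρ →
  Neighbourhood w (λ w′ → ∃[ u′ ] ∃[ v′ ] Follows c u′ v′ w′ × dist u′ u Plane.< ρ)
follows-continuous⁻ {c} {u} {v} {w} (follows uv e) ρ 0<ρ = convert (Plane.reciprocal-continuous (coords u) v uv ρ 0<ρ)
  where
  convert : Plane.Near v (λ v′ → ∃[ u′ ] u′ *ₚ v′ ≈ₚ 1ₚ × norm (u′ -ₚ coords u) Plane.< ρ) →
    Neighbourhood w (λ w′ → ∃[ u′ ] ∃[ v′ ] Follows c u′ v′ w′ × dist u′ u Plane.< ρ)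
  convert (σ , 0<σ , f) = σ , 0<σ , λ w′ h → go w′ (f (coords c +ₚ coords w′)
      (Plane.<-respˡ (Plane.sym (moved-distance {coords c} {v} {coords c +ₚ coords w′} {coords w} {coords w′} e ≈ₚ-refl)) h))
    where
    go : ∀ w′ → ∃[ u′ ] u′ *ₚ (coords c +ₚ coords w′) ≈ₚ 1ₚ × norm (u′ -ₚ coords u) Plane.< ρ → ∃[ u′ ] ∃[ v′ ] Follows c u′ v′ w′ × dist u′ u Plane.< ρ
    go w′ (u′ , uv′ , h) = point u′ , coords c +ₚ coords w′ , follows (≈ₚ-trans (*ₚ-cong (coords-point u′) ≈ₚ-refl) uv′) ≈ₚ-refl ,
      Plane.<-respˡ (norm-cong (-ₚ-cong (≈ₚ-sym (coords-point u′)) ≈ₚ-refl)) h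

follows-unique : ∀ {c u v w u′ v′ w′} → Follows c u v w → Follows c u′ v′ w′ → w ≋ w′ → u ≋ u′
follows-unique {c} {u} {v} {w} {u′} {v′} (follows uv e) (follows uv′ e′) h = Plane.reciprocal-unique (coords u) (coords u′) v uv
  (≈ₚ-trans (*ₚ-cong ≈ₚ-refl (≈ₚ-trans e (≈ₚ-trans (+ₚ-cong ≈ₚ-refl h) (≈ₚ-sym e′)))) uv′)

follows-functional : ∀ {c u v w u′ v′ w′} → Follows c u v w → Follows c u′ v′ w′ → u ≋ u′ → w ≋ w′
follows-functional {c} {u} {v} {w} {u′} {v′} (follows uv e) (follows uv′ e′) h =
  ≈ₚ-trans (≈ₚ-sym (Plane.cancel-+ e)) (≈ₚ-trans (-ₚ-cong v≈v′ ≈ₚ-refl) (Plane.cancel-+ e′))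
  where
  v≈v′ : v ≈ₚ v′
  v≈v′ = Plane.reciprocal-unique v v′ (coords u) (≈ₚ-trans (Plane.*ₚ-comm v (coords u)) uv)
    (≈ₚ-trans (Plane.*ₚ-comm v′ (coords u)) (≈ₚ-trans (*ₚ-cong h ≈ₚ-refl) uv′))

-- The induction runs through interiors. A point u′ near u is sent by 1/u′ - c to a point near w,
-- hence into the range, and injectivity puts u′ into the previous range. So u is interior there,
-- and the strict step applies.
range-interior : ∀ n (a : Vector ℂ n) J w → Neighbourhood w (Range a) → Plane.RegionOf (rangeState n a J) (coords w)
range-interior zero a J w nb = neighbourhood-in-U (range-lies zero a J) nb , []
range-interior (suc n) a J w nb@(ρ , 0<ρ , f) = go (range-split n a w (J (fromℕ n)) (neighbourhood-centre nb))
  where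
  go : ∃[ u ] ∃[ v ] u ∈ Range (init a) × Follows (final a) u v w × ∃[ b ] Lies b (coords w) → Plane.RegionOf (rangeState (suc n) a J) (coords w)
  go (u , v , u∈ , fol , _) = advance-⇒ (index (J (fromℕ n))) (rangeState n (init a) (λ i → J (inject₁ i)))
    {coords u} {v} {coords w} (follows-shift {final a} {u} {v} {w} (J (fromℕ n)) fol) (Follows.inverse fol) (neighbourhood-in-U (range-lies (suc n) a J) nb)
    (range-interior n (init a) (λ i → J (inject₁ i)) u (pulled (follows-continuous {final a} {u} {v} {w} fol ρ 0<ρ)))
    where
    pulled : Neighbourhood u (λ u′ → ∃[ v′ ] ∃[ w′ ] Follows (final a) u′ v′ w′ × dist w′ w Plane.< ρ) → Neighbourhood u (Range (init a))
    pulled (σ , 0<σ , g) = σ , 0<σ , λ u′ h → member u′ (g u′ h)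
      where
      member : ∀ u′ → ∃[ v′ ] ∃[ w′ ] Follows (final a) u′ v′ w′ × dist w′ w Plane.< ρ → u′ ∈ Range (init a)
      member u′ (v′ , w′ , fol′ , h′) = same-point (range-split n a w′ (J (fromℕ n)) (f w′ h′))
        where
        same-point : ∃[ u ] ∃[ v ] u ∈ Range (init a) × Follows (final a) u v w′ × ∃[ b ] Lies b (coords w′) → u′ ∈ Range (init a)
        same-point (u″ , v″ , u″∈ , fol″ , _) = range-resp n (init a) {u″} {u′} (follows-unique {final a} {u″} {v″} {w′} {u′} {v′} {w′} fol″ fol′ ≈ₚ-refl) u″∈

follows-extends : ∀ n {c z u v w} → T^ n z u → Follows c u v w → w ∈ U → Extends n c z u (point v) w
follows-extends n {c} {z} {u} {v} {w} f (follows uv e) w∈U = extending {n} {c} {z} {u} {point v} {w} f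
  (coords-reciprocal {u} {point v} (≈ₚ-trans (*ₚ-cong ≈ₚ-refl (coords-point v)) uv)) w∈U
  (coords-injective (≈ₚ-trans (coords-point v) (≈ₚ-trans e (≈ₚ-sym (coords-+ c w)))))

-- The inner bound. The preimage u = 1/(c + w) exists because c + w stays away from 0, and by the
-- backward step it lies in the region of the previous state.
region⇒range : ∀ n (a : Vector ℂ n) J w → Plane.RegionOf (rangeState n a J) (coords w) → w ∈ Range a
region⇒range zero a J w (hex , _) = w , (hexagon⇒U w hex , λ ()) , coords-injective ≈ₚ-refl
region⇒range (suc n) a J w reg = go (advance-reciprocal p ms {coords c +ₚ coords w} {coords w} (sh (≈ₚ-refl)) reg)
  where
  c = final a
  p = index (J (fromℕ n))
  J′ = λ i → J (inject₁ i)
  ms = rangeState n (init a) J′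
  sh : ∀ {v} → v ≈ₚ coords c +ₚ coords w → Plane.Shift (values p) (coords w) v
  sh e k = Plane.trans (Plane.functional-cong k e) (Plane.trans (Plane.functional-+ k (coords c) (coords w)) (Plane.+-congʳ (index-values (J (fromℕ n)) k)))
  go : ∃[ u ] u *ₚ (coords c +ₚ coords w) ≈ₚ 1ₚ → w ∈ Range a
  go (u , uv) = lift (region⇒range n (init a) J′ (point u) (advance-⇐ p ms {coords (point u)} {coords c +ₚ coords w} {coords w} (sh ≈ₚ-refl) (Follows.inverse fol) reg))
    where
    fol : Follows c (point u) (coords c +ₚ coords w) w
    fol = follows (≈ₚ-trans (*ₚ-cong (coords-point u) ≈ₚ-refl) uv) ≈ₚ-refl
    lift : point u ∈ Range (init a) → w ∈ Range a
    lift (z , z∈ , f) = z , cylinder-join n a z (J (fromℕ n)) z∈ x , extends-T^ n (J (fromℕ n)) x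
      where
      x : Extends n c z (point u) (point (coords c +ₚ coords w)) w
      x = follows-extends n f fol (hexagon⇒U w (region-hexagon (rangeState (suc n) a J) reg))

-- Near w an inverse branch yields only a candidate z′ close to z. That z′ has the right digits
-- stays a hypothesis, discharged later by an interior point of the cylinder.
Inverse : ∀ n → Vector ℂ n → ℂ → Plane.Carrier → ℂ → Set
Inverse n a z ρ w = ∃[ z′ ] dist z′ z Plane.< ρ × (z′ ∈ Cylinder a → T^ n z′ w)

inverse-branch : ∀ n (a : Vector ℂ n) → (∀ i → a i ∈ 𝒥) → ∀ z w → z ∈ Cylinder a → T^ n z w → ∀ ρ → 0# Plane.< ρ → Neighbourhood w (Inverse n a z ρ)
inverse-branch zero a J z w z∈ e ρ 0<ρ = ρ , 0<ρ , λ w′ h → w′ ,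
  Plane.<-respˡ (norm-cong (-ₚ-cong ≈ₚ-refl (coords-cong e))) h , λ _ → coords-injective ≈ₚ-refl
inverse-branch (suc n) a J z w z∈ f ρ 0<ρ = go (cylinder-extends n a z z∈)
  where
  c∈𝒥 = J (fromℕ n)
  go : ∃[ u ] ∃[ v ] ∃[ w ] Extends n (final a) z u v w → Neighbourhood w (Inverse (suc n) a z ρ)
  go (u , v , _ , x) = go₁ (inverse-branch n (init a) (λ i → J (inject₁ i)) z u (cylinder-init n a z z∈) (orbit x) ρ 0<ρ)
    where
    go₁ : Neighbourhood u (Inverse n (init a) z ρ) → Neighbourhood w (Inverse (suc n) a z ρ)
    go₁ (σ , 0<σ , g) = go₂ (follows-continuous⁻ {final a} {u} {coords v} {w} (extends-follows n c∈𝒥 x f) σ 0<σ)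
      where
      go₂ : Neighbourhood w (λ w′ → ∃[ u′ ] ∃[ v′ ] Follows (final a) u′ v′ w′ × dist u′ u Plane.< σ) → Neighbourhood w (Inverse (suc n) a z ρ)
      go₂ (τ , 0<τ , k) = τ , 0<τ , λ w′ h → go₃ w′ (k w′ h)
        where
        go₃ : ∀ w′ → ∃[ u′ ] ∃[ v′ ] Follows (final a) u′ v′ w′ × dist u′ u Plane.< σ → Inverse (suc n) a z ρ w′
        go₃ w′ (u′ , v′ , fol , h) = go₄ (g u′ h)
          where
          go₄ : Inverse n (init a) z ρ u′ → Inverse (suc n) a z ρ w′
          go₄ (z′ , near′ , t) = z′ , near′ , λ z′∈ → go₅ z′∈ (cylinder-extends n a z′ z′∈)
            where
            go₅ : z′ ∈ Cylinder a → ∃[ u ] ∃[ v ] ∃[ w ] Extends n (final a) z′ u v w → T^ (suc n) z′ w′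
            go₅ z′∈ (u₂ , v₂ , w₂ , y) = T^-resp (suc n) {z′} {w₂} {w′} (follows-functional {final a} {u₂} {coords v₂} {w₂} {u′} {v′} {w′}
                (extends-follows n c∈𝒥 y (extends-T^ n c∈𝒥 y)) fol (T^-unique n {z′} {u₂} {u′} (orbit y) (t (cylinder-init n a z′ z′∈))))
              (extends-T^ n c∈𝒥 y)

cylinder-T^ : ∀ n (a : Vector ℂ n) → (∀ i → a i ∈ 𝒥) → ∀ z → z ∈ Cylinder a → ∃[ w ] T^ n z w
cylinder-T^ zero a J z _ = z , coords-injective ≈ₚ-refl
cylinder-T^ (suc n) a J z z∈ = go (cylinder-extends n a z z∈)
  where
  go : ∃[ u ] ∃[ v ] ∃[ w ] Extends n (final a) z u v w → ∃[ w ] T^ (suc n) z w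
  go (u , v , w , x) = w , extends-T^ n (J (fromℕ n)) x

-- An interior point of the cylinder has an image interior to the range, since the inverse branch is
-- continuous. Hence the state of an admissible sequence is never `nothing`.
admissible⇒region : ∀ n (a : Vector ℂ n) J → Admissible a → ∃[ w ] Plane.RegionOf (rangeState n a J) (coords w)
admissible⇒region n a J (z , z∈) = go (interior⇒neighbourhood {Cylinder a} {z} z∈)
  where
  go : Neighbourhood z (Cylinder a) → ∃[ w ] Plane.RegionOf (rangeState n a J) (coords w)
  go nb@(ρ , 0<ρ , f) = go₁ (cylinder-T^ n a J z (neighbourhood-centre {z} {Cylinder a} nb))
    where
    go₁ : ∃[ w ] T^ n z w → ∃[ w ] Plane.RegionOf (rangeState n a J) (coords w)
    go₁ (w , t) = w , range-interior n a J w (covered (inverse-branch n a J z w (neighbourhood-centre {z} {Cylinder a} nb) t ρ 0<ρ))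
      where
      covered : Neighbourhood w (Inverse n a z ρ) → Neighbourhood w (Range a)
      covered (σ , 0<σ , g) = σ , 0<σ , λ w′ h → member w′ (g w′ h)
        where
        member : ∀ w′ → Inverse n a z ρ w′ → w′ ∈ Range a
        member w′ (z′ , h , t) = z′ , f z′ h , t (f z′ h)

neighbourhood-∩ : ∀ {A B z} → Neighbourhood z A → Neighbourhood z B → Neighbourhood z (λ w → w ∈ A × w ∈ B)
neighbourhood-∩ {A} {B} {z} (ρ , 0<ρ , f) (σ , 0<σ , g) = both (Plane.∃-below 0<ρ 0<σ)
  where
  both : ∃[ τ ] 0# Plane.< τ × τ Plane.< ρ × τ Plane.< σ → Neighbourhood z (λ w → w ∈ A × w ∈ B)
  both (τ , 0<τ , τ<ρ , τ<σ) = τ , 0<τ , λ w h → f w (Plane.<-trans h τ<ρ) , g w (Plane.<-trans h τ<σ)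

neighbourhood-map : ∀ {A B z} → (∀ w → w ∈ A → w ∈ B) → Neighbourhood z A → Neighbourhood z B
neighbourhood-map A⊆B (ρ , 0<ρ , f) = ρ , 0<ρ , λ w h → A⊆B w (f w h)

-- Openness and continuity are proved together: continuity of the n-th iterate keeps the next orbit
-- point inside the open hexagon, where the digit c remains the right one.
cylinder-open : ∀ n (a : Vector ℂ n) J z w → z ∈ Cylinder a → T^ n z w → Plane.RegionOf (rangeState n a J) (coords w) →
  Neighbourhood z (Cylinder a) × (∀ ρ → 0# Plane.< ρ → Neighbourhood z (λ z′ → ∃[ w′ ] T^ n z′ w′ × dist w′ w Plane.< ρ))
cylinder-open zero a J z w z∈ e (hex , _) =
  neighbourhood-map {λ z′ → InHexagon (coords z′)} {Cylinder a} {z} (λ z′ h → hexagon⇒U z′ h , λ ()) (near⇒neighbourhood {InHexagon} {z} (Plane.hexagon-open (coords z) (hexagon-cong (coords-cong e) hex))) ,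
  λ ρ 0<ρ → ρ , 0<ρ , λ z′ h → z′ , coords-injective ≈ₚ-refl , Plane.<-respˡ (norm-cong (-ₚ-cong ≈ₚ-refl (≈ₚ-sym (coords-cong e)))) h
cylinder-open (suc n) a J z w z∈ f reg = go (cylinder-extends n a z z∈)
  where
  c = final a
  c∈𝒥 = J (fromℕ n)
  J′ = λ i → J (inject₁ i)
  Result : Set
  Result = Neighbourhood z (Cylinder a) × (∀ ρ → 0# Plane.< ρ → Neighbourhood z (λ z′ → ∃[ w′ ] T^ (suc n) z′ w′ × dist w′ w Plane.< ρ))
  go : ∃[ u ] ∃[ v ] ∃[ w ] Extends n c z u v w → Result
  go (u , v , w₀ , x) = go₁ (cylinder-open n (init a) J′ z u (cylinder-init n a z z∈) (orbit x)
      (advance-⇐ (index c∈𝒥) (rangeState n (init a) J′) {coords u} {coords v} {coords w} (follows-shift {c} {u} {coords v} {w} c∈𝒥 fol) (Follows.inverse fol) reg))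
    where
    fol : Follows c u (coords v) w
    fol = extends-follows n c∈𝒥 x f
    go₁ : Neighbourhood z (Cylinder (init a)) × (∀ ρ → 0# Plane.< ρ → Neighbourhood z (λ z′ → ∃[ u′ ] T^ n z′ u′ × dist u′ u Plane.< ρ)) → Result
    go₁ (opened , continuous) = neighbourhood-map {λ z′ → z′ ∈ Cylinder (init a) × Reached 1# z′} {Cylinder a} {z} join
      (neighbourhood-∩ {Cylinder (init a)} {Reached 1#} {z} opened (reach 1# Plane.0<1)) ,
      λ ρ 0<ρ → neighbourhood-map {Reached ρ} {λ z′ → ∃[ w′ ] T^ (suc n) z′ w′ × dist w′ w Plane.< ρ} {z} (image {ρ}) (reach ρ 0<ρ)
      where
      Reached : Plane.Carrier → ℂ → Set
      Reached ρ z′ = ∃[ u′ ] ∃[ v′ ] ∃[ w′ ] Extends n c z′ u′ v′ w′ × dist w′ w Plane.< ρ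
      join : ∀ z′ → z′ ∈ Cylinder (init a) × Reached 1# z′ → z′ ∈ Cylinder a
      join z′ (z′∈ , u′ , v′ , w′ , x′ , _) = cylinder-join n a z′ {u′} {v′} {w′} c∈𝒥 z′∈ x′
      image : ∀ {ρ} z′ → Reached ρ z′ → ∃[ w′ ] T^ (suc n) z′ w′ × dist w′ w Plane.< ρ
      image {ρ} z′ (u′ , v′ , w′ , x′ , h) = w′ , extends-T^ n {c} {z′} {u′} {v′} {w′} c∈𝒥 x′ , h
      reach : ∀ ρ → 0# Plane.< ρ → Neighbourhood z (Reached ρ)
      reach ρ 0<ρ = reach₁ (near⇒neighbourhood {InHexagon} {w} (Plane.hexagon-open (coords w) (region-hexagon (rangeState (suc n) a J) reg)))
        where
        reach₁ : Neighbourhood w (λ w′ → InHexagon (coords w′)) → Neighbourhood z (Reached ρ)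
        reach₁ (σ , 0<σ , g) = reach₂ (Plane.∃-below 0<ρ 0<σ)
          where
          reach₂ : ∃[ τ ] 0# Plane.< τ × τ Plane.< ρ × τ Plane.< σ → Neighbourhood z (Reached ρ)
          reach₂ (τ , 0<τ , τ<ρ , τ<σ) = reach₃ (follows-continuous {c} {u} {coords v} {w} fol τ 0<τ)
            where
            reach₃ : Neighbourhood u (λ u′ → ∃[ v′ ] ∃[ w′ ] Follows c u′ v′ w′ × dist w′ w Plane.< τ) → Neighbourhood z (Reached ρ)
            reach₃ (υ , 0<υ , k) = neighbourhood-map {λ z′ → ∃[ u′ ] T^ n z′ u′ × dist u′ u Plane.< υ} {Reached ρ} {z} reach₄ (continuous υ 0<υ)
              where
              reach₄ : ∀ z′ → ∃[ u′ ] T^ n z′ u′ × dist u′ u Plane.< υ → Reached ρ z′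
              reach₄ z′ (u′ , t , h) = reach₅ (k u′ h)
                where
                reach₅ : ∃[ v′ ] ∃[ w′ ] Follows c u′ v′ w′ × dist w′ w Plane.< τ → Reached ρ z′
                reach₅ (v′ , w′ , fol′ , h′) = u′ , point v′ , w′ ,
                  follows-extends n {c} {z′} {u′} {v′} {w′} t fol′ (hexagon⇒U w′ (g w′ (Plane.<-trans h′ τ<σ))) , Plane.<-trans h′ τ<ρ

region⇒admissible : ∀ n (a : Vector ℂ n) J w → Plane.RegionOf (rangeState n a J) (coords w) → Admissible a
region⇒admissible n a J w reg = go (region⇒range n a J w reg)
  where
  go : w ∈ Range a → Admissible a
  go (z , z∈ , t) = z , neighbourhood⇒interior {Cylinder a} {z} (proj₁ (cylinder-open n a J z w z∈ t reg))

-- The regions of the statement as solution sets of conditions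

opaque
  Matches : Region → (Point → Set) → Set
  Matches A Φ = (∀ z → z ∈ A → Φ (coords z)) × (∀ z → Φ (coords z) → z ∈ A)

  matches : ∀ {A Φ} → (∀ z → z ∈ A → Φ (coords z)) → (∀ z → Φ (coords z) → z ∈ A) → Matches A Φ
  matches = _,_

  matches⇒ : ∀ {A Φ} → Matches A Φ → ∀ z → z ∈ A → Φ (coords z)
  matches⇒ = proj₁

  matches⇐ : ∀ {A Φ} → Matches A Φ → ∀ z → Φ (coords z) → z ∈ A
  matches⇐ = proj₂

matches-∩ : ∀ {A B Φ Ψ} → Matches A Φ → Matches B Ψ → Matches (A ∩ B) (λ p → Φ p × Ψ p)
matches-∩ α β = matches (λ z (h , k) → matches⇒ α z h , matches⇒ β z k) (λ z (h , k) → matches⇐ α z h , matches⇐ β z k)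

matches-map : ∀ {A Φ Ψ} → (∀ p → Φ p → Ψ p) → (∀ p → Ψ p → Φ p) → Matches A Φ → Matches A Ψ
matches-map f g α = matches (λ z h → f (coords z) (matches⇒ α z h)) (λ z h → matches⇐ α z (g (coords z) h))

matches-≐ : ∀ {A B Φ} → Matches A Φ → Matches B Φ → A ≐ B
matches-≐ α β = (λ {z} h → matches⇐ β z (matches⇒ α z h)) , (λ {z} h → matches⇐ α z (matches⇒ β z h))

≐-matches : ∀ {A B Φ} → A ≐ B → Matches B Φ → Matches A Φ
≐-matches (f , g) β = matches (λ z h → matches⇒ β z (f h)) (λ z h → g (matches⇐ β z h))

U₀-matches : Matches U₀ InHexagon
U₀-matches = matches
  (λ z h → neighbourhood-in-U {U} {z} U⇒lies (interior⇒neighbourhood {U} {z} h))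
  (λ z h → neighbourhood⇒interior {U} {z} (neighbourhood-map {λ w → InHexagon (coords w)} {U} {z} hexagon⇒U
    (near⇒neighbourhood {InHexagon} {z} (Plane.hexagon-open (coords z) h))))

real-r² : real (r * r) Plane.≈ Plane.t
real-r² = Plane.trans (real-* r r) (Plane.trans (Plane.*-cong real-r real-r) Plane.r²)
  where
  real-r : real r Plane.≈ Plane.t Plane.* Plane.s
  real-r = Plane.trans (real-* ⅓ √3) (Plane.*-cong real-⅓ real-√3)

opaque
  outside⇒ : ∀ w {q x} → coords w ≈ₚ q → norm q Plane.- Plane.t Plane.≈ x → ∣ w ∣> r → 0# Plane.< x
  outside⇒ w e f h = Plane.<-respʳ f (Plane.<⇒0< (Plane.<-resp-≈ real-r² (Plane.trans (normSq-coords w) (norm-cong e)) (real-< h)))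

  outside⇐ : ∀ w {q x} → coords w ≈ₚ q → norm q Plane.- Plane.t Plane.≈ x → 0# Plane.< x → ∣ w ∣> r
  outside⇐ w e f h = real-<⁻ (Plane.<-resp-≈ (Plane.sym real-r²) (Plane.sym (Plane.trans (normSq-coords w) (norm-cong e)))
    (Plane.0<⇒< (Plane.<-respʳ (Plane.sym f) h)))

  inside⇒ : ∀ w {q x} → coords w ≈ₚ q → norm q Plane.- Plane.t Plane.≈ x → ∣ w ∣< r → x Plane.< 0#
  inside⇒ w {q} e f h = Plane.<-respˡ f (Plane.0<-neg (Plane.<-respʳ (ring 2 (λ a b → a :- b := :- (b :- a)) Plane.t (norm q))
    (Plane.<⇒0< (Plane.<-resp-≈ (Plane.trans (normSq-coords w) (norm-cong e)) real-r² (real-< h)))))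

  inside⇐ : ∀ w {q x} → coords w ≈ₚ q → norm q Plane.- Plane.t Plane.≈ x → x Plane.< 0# → ∣ w ∣< r
  inside⇐ w {q} {x} e f h = real-<⁻ (Plane.<-resp-≈ (Plane.sym (Plane.trans (normSq-coords w) (norm-cong e))) (Plane.sym real-r²)
    (Plane.0<⇒< (Plane.<-respʳ (ring 2 (λ a b → :- (b :- a) := a :- b) Plane.t (norm q)) (Plane.neg-0< (Plane.<-respˡ (Plane.sym f) h)))))

scale-< : ∀ {c x y} → 0# Plane.< c → x Plane.< y → c Plane.* x Plane.< c Plane.* y
scale-< {c} {x} {y} 0<c h = Plane.0<⇒< (Plane.<-respʳ (ring 3 (λ c x y → c :* (y :- x) := c :* y :- c :* x) c x y) (Plane.*-0< 0<c (Plane.<⇒0< h)))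

unscale-< : ∀ {c x y} → 0# Plane.< c → c Plane.* x Plane.< c Plane.* y → x Plane.< y
unscale-< {c} {x} {y} 0<c h = Plane.0<⇒< (Plane.*-cancel-0< 0<c (Plane.<-respʳ (ring 3 (λ c x y → c :* y :- c :* x := c :* (y :- x)) c x y) (Plane.<⇒0< h)))

real-√3* : ∀ z → real (√3 * re z) Plane.≈ Plane.s Plane.* proj₁ (coords z)
real-√3* z = Plane.trans (real-* √3 (re z)) (Plane.*-cong real-√3 (real-re z))

Above-matches : Matches Above (Holds (P 2F))
Above-matches = matches
  (λ z h → Plane.<⇒0< (unscale-< Plane.0<s (Plane.<-resp-≈ (real-√3* z) (Plane.sym (real-im z)) (real-< h))))
  (λ z h → real-<⁻ (Plane.<-resp-≈ (Plane.sym (real-√3* z)) (real-im z) (scale-< Plane.0<s (Plane.0<⇒< h))))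

Below-matches : Matches Below (Holds (P 5F))
Below-matches = matches
  (λ z h → Plane.<⇒0< (unscale-< Plane.0<s (Plane.<-resp-≈ (Plane.sym (real-im z)) (real-√3* z) (real-< h))))
  (λ z h → real-<⁻ (Plane.<-resp-≈ (real-im z) (Plane.sym (real-√3* z)) (scale-< Plane.0<s (Plane.0<⇒< h))))

RightHalf UpperHalf : Region
RightHalf z = 0ℝ < re z
UpperHalf z = 0ℝ < im z

right-matches : Matches RightHalf (λ p → 0# Plane.< proj₁ p)
right-matches = matches (λ z h → Plane.<-resp-≈ real-0 (real-re z) (real-< h)) (λ z h → real-<⁻ (Plane.<-resp-≈ (Plane.sym real-0) (Plane.sym (real-re z)) h))

upper-matches : Matches UpperHalf (Holds (P 1F))
upper-matches = matches
  (λ z h → let k = Plane.*-cancel-0< Plane.0<s (Plane.<-resp-≈ real-0 (Plane.sym (real-im z)) (real-< h)) in Plane.+-0< k k)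
  (λ z h → real-<⁻ (Plane.<-resp-≈ (Plane.sym real-0) (real-im z) (Plane.*-0< Plane.0<s
    (Plane.*-cancel-0< Plane.0<2 (Plane.<-respʳ (ring 1 (λ y → y :+ y := κ2 :* y) (proj₂ (coords z))) h)))))

coords-⅔η : coords (⅔ • η) ≈ₚ ((Plane.t Plane.+ Plane.t) Plane.* (3# Plane.* Plane.h) , (Plane.t Plane.+ Plane.t) Plane.* Plane.h)
coords-⅔η = coords-scaled {⅔} {η} {Plane.t Plane.+ Plane.t} {3# Plane.* Plane.h , Plane.h} real-⅔ coords-η

coords-⅓η : coords (⅓ • η) ≈ₚ (Plane.t Plane.* (3# Plane.* Plane.h) , Plane.t Plane.* Plane.h)
coords-⅓η = coords-scaled {⅓} {η} {Plane.t} {3# Plane.* Plane.h , Plane.h} real-⅓ coords-η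

coords-⅓η̄ : coords (⅓ • conj η) ≈ₚ (Plane.t Plane.* (3# Plane.* Plane.h) , Plane.t Plane.* (Plane.- Plane.h))
coords-⅓η̄ = coords-scaled {⅓} {conj η} {Plane.t} {3# Plane.* Plane.h , Plane.- Plane.h} real-⅓ (coords-conjugate {η} {3# Plane.* Plane.h , Plane.h} coords-η)

coords-⅓√-3 : coords (⅓ • √-3) ≈ₚ (Plane.t Plane.* 0# , Plane.t Plane.* 1#)
coords-⅓√-3 = coords-scaled {⅓} {√-3} {Plane.t} {0# , 1#} real-⅓ coords-√-3

Beyond : ℂ → Region
Beyond c z = ∣ z +ᶜ c ∣> r

beyond-matches : ∀ c {q k} → coords c ≈ₚ q → (∀ p → norm (p +ₚ q) Plane.- Plane.t Plane.≈ slack k p) → Matches (Beyond c) (Holds k)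
beyond-matches c {q} {k} e f = matches
  (λ z → outside⇒ (z +ᶜ c) {coords z +ₚ q} (coords-sum {z} {c} {coords z} {q} ≈ₚ-refl e) (f (coords z)))
  (λ z → outside⇐ (z +ᶜ c) {coords z +ₚ q} (coords-sum {z} {c} {coords z} {q} ≈ₚ-refl e) (f (coords z)))

far-matches : ∀ c {q k} → coords c ≈ₚ q → (∀ p → norm (p -ₚ q) Plane.- Plane.t Plane.≈ slack k p) → Matches (Far c) (Holds k)
far-matches c {q} {k} e f = matches
  (λ z → outside⇒ (z -ᶜ c) {coords z -ₚ q} (coords-difference {z} {c} {coords z} {q} ≈ₚ-refl e) (f (coords z)))
  (λ z → outside⇐ (z -ᶜ c) {coords z -ₚ q} (coords-difference {z} {c} {coords z} {q} ≈ₚ-refl e) (f (coords z)))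

near-matches : ∀ c {q k} → coords c ≈ₚ q → (∀ p → norm (p -ₚ q) Plane.- Plane.t Plane.≈ slack k p) → Matches (Near c) (λ p → slack k p Plane.< 0#)
near-matches c {q} {k} e f = matches
  (λ z → inside⇒ (z -ᶜ c) {coords z -ₚ q} (coords-difference {z} {c} {coords z} {q} ≈ₚ-refl e) (f (coords z)))
  (λ z → inside⇐ (z -ᶜ c) {coords z -ₚ q} (coords-difference {z} {c} {coords z} {q} ≈ₚ-refl e) (f (coords z)))

turns-cong : ∀ n {p q} → p ≈ₚ q → turns n p ≈ₚ turns n q
turns-cong zero    e = e
turns-cong (suc n) e = *ₚ-cong ≈ₚ-refl (turns-cong n e)

unturned : ℕ → ℂ → ℂ
unturned n z = point (unturns n (coords z))

turns-unturned : ∀ n z → coords z ≈ₚ turns n (coords (unturned n z))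
turns-unturned n z = ≈ₚ-sym (≈ₚ-trans (turns-cong n (coords-point (unturns n (coords z)))) (Plane.turns-unturns n (coords z)))

rotation-matches : ∀ c n → (∀ w → coords (c *ᶜ w) ≈ₚ turns n (coords w)) → ∀ {A} s → Matches A (Plane.Region s) → Matches (c · A) (Plane.Region (turnStateBy n s))
rotation-matches c n turned {A} s α = matches forwards backwards
  where
  forwards : ∀ z → z ∈ (c · A) → Plane.Region (turnStateBy n s) (coords z)
  forwards z (w , w∈A , e) = Plane.region-turns⇒ n {coords z} {coords w} (≈ₚ-trans (coords-cong e) (turned w)) s (matches⇒ α w w∈A)
  backwards : ∀ z → Plane.Region (turnStateBy n s) (coords z) → z ∈ (c · A)
  backwards z h = unturned n z , matches⇐ α (unturned n z) (Plane.region-turns⇐ n {coords z} {coords (unturned n z)} (turns-unturned n z) s h) ,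
    coords-injective (≈ₚ-trans (turns-unturned n z) (≈ₚ-sym (turned (unturned n z))))

U-base-matches : ∀ k → Matches (U-base k) (Plane.Region (baseState k))
U-base-matches 0F = matches-map (λ p (h , k) → h , k ∷ []) (λ { p (h , k ∷ []) → h , k })
  (matches-∩ {U₀} {Beyond (⅔ • η)} {InHexagon} {Holds (O 3F)} U₀-matches (beyond-matches (⅔ • η) {_} {O 3F} coords-⅔η Plane.circle-O3))
U-base-matches 1F = matches-map (λ p (h , k) → h , k ∷ []) (λ { p (h , k ∷ []) → h , k })
  (matches-∩ {U₀} {Beyond (⅓ • η)} {InHexagon} {Holds (C 3F)} U₀-matches (beyond-matches (⅓ • η) {_} {C 3F} coords-⅓η Plane.circle-C3))
U-base-matches 2F = matches-map (λ p (h , k) → h , k ∷ []) (λ { p (h , k ∷ []) → h , k })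
  (matches-∩ {U₀} {Above} {InHexagon} {Holds (P 2F)} U₀-matches Above-matches)
U-base-matches 3F = matches-map (λ { p ((h , k ∷ []) , l) → h , l ∷ k ∷ [] }) (λ { p (h , l ∷ k ∷ []) → (h , k ∷ []) , l })
  (matches-∩ {U-base 0F} {Above} {Plane.Region (cut₁ 3F)} {Holds (P 2F)} (U-base-matches 0F) Above-matches)
U-base-matches 4F = matches-map (λ { p ((h , k ∷ []) , l) → h , l ∷ k ∷ [] }) (λ { p (h , l ∷ k ∷ []) → (h , k ∷ []) , l })
  (matches-∩ {ζ · U-base 0F} {Below} {Plane.Region (cut₁ 4F)} {Holds (P 5F)}
    (rotation-matches ζ 1 (λ w → coords-product {ζ} {w} {Plane.h , Plane.h} {coords w} coords-ζ ≈ₚ-refl) {U-base 0F} (cut₁ 3F) (U-base-matches 0F)) Below-matches)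

U-matches : ∀ k ℓ → Matches U[ k , ℓ ] (Plane.Region (stateOf k ℓ))
U-matches k ℓ = rotation-matches (ζ ^ᶜ toℕ ℓ) (toℕ ℓ) (coords-ζ^ (toℕ ℓ)) {U-base k} (baseState k) (U-base-matches k)

-- `V-base` with the factor U split off: U goes with the sides of the hexagon, the rest with strict
-- conditions.
V-cut : Fin 6 → Region
V-cut 0F = Near (⅓ • conj η) ∩ Near (⅓ • √-3)
V-cut 1F = Far (⅔ • η) ∩ Far (⅓ • √-3) ∩ RightHalf ∩ UpperHalf
V-cut 2F = Far (⅔ • η) ∩ Far (⅓ • conj η) ∩ UpperHalf ∩ Below
V-cut 3F = Near (⅓ • conj η) ∩ Near (⅔ • η)
V-cut 4F = Near (⅔ • η) ∩ Near (⅓ • √-3)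
V-cut 5F = Far (⅓ • conj η) ∩ Far (⅓ • √-3) ∩ RightHalf ∩ UpperHalf

V-cut⇒ : ∀ k z → z ∈ V-base k → z ∈ U × z ∈ V-cut k
V-cut⇒ 0F z h = h
V-cut⇒ 1F z h = h
V-cut⇒ 2F z h = h
V-cut⇒ 3F z h = h
V-cut⇒ 4F z h = h
V-cut⇒ 5F z h = h

V-cut⇐ : ∀ k z → z ∈ U → z ∈ V-cut k → z ∈ V-base k
V-cut⇐ 0F z u h = u , h
V-cut⇐ 1F z u h = u , h
V-cut⇐ 2F z u h = u , h
V-cut⇐ 3F z u h = u , h
V-cut⇐ 4F z u h = u , h
V-cut⇐ 5F z u h = u , h

Negative : Condition → Point → Set
Negative c p = slack c p Plane.< 0#

near-C5 : Matches (Near (⅓ • conj η)) (Negative (C 5F))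
near-C5 = near-matches (⅓ • conj η) {_} {C 5F} coords-⅓η̄ Plane.circle-C5
near-C1 : Matches (Near (⅓ • √-3)) (Negative (C 1F))
near-C1 = near-matches (⅓ • √-3) {_} {C 1F} coords-⅓√-3 Plane.circle-C1
near-O0 : Matches (Near (⅔ • η)) (Negative (O 0F))
near-O0 = near-matches (⅔ • η) {_} {O 0F} coords-⅔η Plane.circle-O0
far-C5 : Matches (Far (⅓ • conj η)) (Holds (C 5F))
far-C5 = far-matches (⅓ • conj η) {_} {C 5F} coords-⅓η̄ Plane.circle-C5
far-C1 : Matches (Far (⅓ • √-3)) (Holds (C 1F))
far-C1 = far-matches (⅓ • √-3) {_} {C 1F} coords-⅓√-3 Plane.circle-C1
far-O0 : Matches (Far (⅔ • η)) (Holds (O 0F))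
far-O0 = far-matches (⅔ • η) {_} {O 0F} coords-⅔η Plane.circle-O0

quadrant-matches : Matches (RightHalf ∩ UpperHalf) (λ p → 0# Plane.< proj₁ p × Holds (P 1F) p)
quadrant-matches = matches-∩ {RightHalf} {UpperHalf} right-matches upper-matches

V-matches : ∀ k → Matches (V-cut k) (Plane.Defining k)
V-matches 0F = matches-∩ {Near (⅓ • conj η)} {Near (⅓ • √-3)} near-C5 near-C1
V-matches 1F = matches-∩ {Far (⅔ • η)} {Far (⅓ • √-3) ∩ RightHalf ∩ UpperHalf} far-O0
  (matches-∩ {Far (⅓ • √-3)} {RightHalf ∩ UpperHalf} far-C1 quadrant-matches)
V-matches 2F = matches-∩ {Far (⅔ • η)} {Far (⅓ • conj η) ∩ UpperHalf ∩ Below} far-O0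
  (matches-∩ {Far (⅓ • conj η)} {UpperHalf ∩ Below} far-C5 (matches-∩ {UpperHalf} {Below} upper-matches Below-matches))
V-matches 3F = matches-∩ {Near (⅓ • conj η)} {Near (⅔ • η)} near-C5 near-O0
V-matches 4F = matches-∩ {Near (⅔ • η)} {Near (⅓ • √-3)} near-O0 near-C1
V-matches 5F = matches-∩ {Far (⅓ • conj η)} {Far (⅓ • √-3) ∩ RightHalf ∩ UpperHalf} far-C5
  (matches-∩ {Far (⅓ • √-3)} {RightHalf ∩ UpperHalf} far-C1 quadrant-matches)

-- Null sets

opaque
  boxOf : Plane.Rectangle → Box
  boxOf R = record
    { left   = unreal (Plane.x₀ R)
    ; right  = unreal (Plane.x₁ R)
    ; bottom = √3 * unreal (Plane.y₀ R)
    ; top    = √3 * unreal (Plane.y₁ R)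
    ; left≤right = λ h → Plane.<-irrefl Plane.refl (Plane.<-trans (Plane.x₀<x₁ R)
        (Plane.<-resp-≈ (real-unreal (Plane.x₁ R)) (real-unreal (Plane.x₀ R)) (real-< h)))
    ; bottom≤top = λ h → Plane.<-irrefl Plane.refl (Plane.<-trans (scale-< Plane.0<s (Plane.y₀<y₁ R))
        (Plane.<-resp-≈ (real-√3-unreal (Plane.y₁ R)) (real-√3-unreal (Plane.y₀ R)) (real-< h)))
    }
    where
    real-√3-unreal : ∀ y → real (√3 * unreal y) Plane.≈ Plane.s Plane.* y
    real-√3-unreal y = Plane.trans (real-* √3 (unreal y)) (Plane.*-cong real-√3 (real-unreal y))

  pointBox : Box
  pointBox = record
    { left = 0ℝ ; right = 0ℝ ; bottom = 0ℝ ; top = 0ℝ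
    ; left≤right = λ h → Plane.<-irrefl Plane.refl (real-< h)
    ; bottom≤top = λ h → Plane.<-irrefl Plane.refl (real-< h)
    }

  private
    real-area : ∀ B {x x′ y y′} → real (left B) Plane.≈ x → real (right B) Plane.≈ x′ → real (bottom B) Plane.≈ y → real (top B) Plane.≈ y′ →
      real (area B) Plane.≈ (x′ Plane.- x) Plane.* (y′ Plane.- y)
    real-area B e f g h = Plane.trans (real-* (right B - left B) (top B - bottom B)) (Plane.*-cong
      (Plane.trans (real-- (right B) (left B)) (Plane.+-cong f (Plane.-‿cong e)))
      (Plane.trans (real-- (top B) (bottom B)) (Plane.+-cong h (Plane.-‿cong g))))

  area-boxOf : ∀ R → real (area (boxOf R)) Plane.≈ Plane.s Plane.* Plane.extent R
  area-boxOf R = Plane.trans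
    (real-area (boxOf R) (real-unreal (Plane.x₀ R)) (real-unreal (Plane.x₁ R))
      (Plane.trans (real-* √3 (unreal (Plane.y₀ R))) (Plane.*-cong real-√3 (real-unreal (Plane.y₀ R))))
      (Plane.trans (real-* √3 (unreal (Plane.y₁ R))) (Plane.*-cong real-√3 (real-unreal (Plane.y₁ R)))))
    (ring 5 (λ s x x′ y y′ → (x′ :- x) :* (s :* y′ :- s :* y) := s :* ((x′ :- x) :* (y′ :- y)))
      Plane.s (Plane.x₀ R) (Plane.x₁ R) (Plane.y₀ R) (Plane.y₁ R))

  area-pointBox : real (area pointBox) Plane.≈ 0#
  area-pointBox = Plane.trans (real-area pointBox real-0 real-0 real-0 real-0) (ring 0 ((κ0 :- κ0) :* (κ0 :- κ0) := κ0))

  inside-boxOf : ∀ R z → Plane.Inside (coords z) R → z ∈ inside (boxOf R)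
  inside-boxOf R z ((h₁ , h₂) , (h₃ , h₄)) =
    (real-<⁻ (Plane.<-resp-≈ (Plane.sym (real-unreal (Plane.x₀ R))) (Plane.sym (real-re z)) h₁) ,
     real-<⁻ (Plane.<-resp-≈ (Plane.sym (real-re z)) (Plane.sym (real-unreal (Plane.x₁ R))) h₂)) ,
    (real-<⁻ (Plane.<-resp-≈ (Plane.sym (Plane.trans (real-* √3 (unreal (Plane.y₀ R))) (Plane.*-cong real-√3 (real-unreal (Plane.y₀ R))))) (real-im z) (scale-< Plane.0<s h₃)) ,
     real-<⁻ (Plane.<-resp-≈ (real-im z) (Plane.sym (Plane.trans (real-* √3 (unreal (Plane.y₁ R))) (Plane.*-cong real-√3 (real-unreal (Plane.y₁ R))))) (scale-< Plane.0<s h₄)))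

-- A null set asks for an infinite sequence of boxes; past the end of the list it is padded by
-- degenerate boxes of area 0.
boxes : List Plane.Rectangle → ℕ → Box
boxes []       _       = pointBox
boxes (R ∷ Rs) zero    = boxOf R
boxes (R ∷ Rs) (suc j) = boxes Rs j

boxes-cover : ∀ Rs z → Any (Plane.Inside (coords z)) Rs → ∃[ j ] z ∈ inside (boxes Rs j)
boxes-cover (R ∷ Rs) z (here h)  = 0 , inside-boxOf R z h
boxes-cover (R ∷ Rs) z (there h) = next-box (boxes-cover Rs z h)
  where
  next-box : ∃[ j ] z ∈ inside (boxes Rs j) → ∃[ j ] z ∈ inside (boxes (R ∷ Rs) j)
  next-box (j , k) = suc j , k

sum : ℕ → (ℕ → Plane.Carrier) → Plane.Carrier
sum zero    g = 0#
sum (suc n) g = sum n g Plane.+ g n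

sum-front : ∀ n g → sum (suc n) g Plane.≈ g 0 Plane.+ sum n (λ j → g (suc j))
sum-front zero g = Plane.+-comm 0# (g 0)
sum-front (suc n) g = Plane.trans (Plane.+-congʳ (sum-front n g))
  (ring 3 (λ a b c → a :+ b :+ c := a :+ (b :+ c)) (g 0) (sum n (λ j → g (suc j))) (g (suc n)))

∑<-suc : ∀ n f → ∑< (suc n) f ≡ ∑< n f + f n
∑<-suc n f = refl

real-∑ : ∀ f g → (∀ j → real (f j) Plane.≈ g j) → ∀ n → real (∑< n f) Plane.≈ sum n g
real-∑ f g e zero    = real-0
real-∑ f g e (suc n) = subst (λ x → real x Plane.≈ sum (suc n) g) (sym (∑<-suc n f))
  (Plane.trans (real-+ (∑< n f) (f n)) (Plane.+-cong (real-∑ f g e n) (e n)))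

areas : List Plane.Rectangle → ℕ → Plane.Carrier
areas []       _       = 0#
areas (R ∷ Rs) zero    = Plane.s Plane.* Plane.extent R
areas (R ∷ Rs) (suc j) = areas Rs j

area-replace : ∀ B B′ x y → B ≡ B′ → x ≡ y → real (area B′) Plane.≈ y → real (area B) Plane.≈ x
area-replace B .B x .x refl refl h = h

area-boxes : ∀ Rs j → real (area (boxes Rs j)) Plane.≈ areas Rs j
area-boxes []       j       = area-replace (boxes [] j) pointBox (areas [] j) 0# refl refl area-pointBox
area-boxes (R ∷ Rs) zero    = area-replace (boxes (R ∷ Rs) zero) (boxOf R) (areas (R ∷ Rs) zero) (Plane.s Plane.* Plane.extent R) refl refl (area-boxOf R)
area-boxes (R ∷ Rs) (suc j) = area-replace (boxes (R ∷ Rs) (suc j)) (boxes Rs j) (areas (R ∷ Rs) (suc j)) (areas Rs j) refl refl (area-boxes Rs j)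

sum-areas : ∀ Rs {size} → 0# Plane.< size → All (λ R → Plane.extent R Plane.≈ size) Rs → ∀ n →
  sum n (areas Rs) Plane.≤ (Plane.s Plane.* size) Plane.* Plane.⟦ + length Rs ⟧ℤ
sum-areas Rs 0<size es zero = Plane.*-0<-0≤ (Plane.*-0< Plane.0<s 0<size) (Plane.0≤ℕ (length Rs))
sum-areas [] 0<size [] (suc n) = Plane.≤-resp-≈ (Plane.sym (Plane.+-identityʳ (sum n (areas [])))) Plane.refl (sum-areas [] 0<size [] n)
sum-areas (R ∷ Rs) {size} 0<size (e ∷ es) (suc n) = Plane.≤-resp-≈ (Plane.sym (sum-front n (areas (R ∷ Rs))))
  (Plane.trans (ring 2 (λ a n → a :+ a :* n := a :* (κ1 :+ n)) (Plane.s Plane.* size) Plane.⟦ + length Rs ⟧ℤ)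
    (Plane.*-congˡ (Plane.sym (Plane.⟦suc⟧ (length Rs)))))
  (Plane.+-mono-≤ (Plane.≤-reflexive (Plane.*-congˡ e)) (sum-areas Rs 0<size es n))

total-area : ∀ Rs {size} → 0# Plane.< size → All (λ R → Plane.extent R Plane.≈ size) Rs → ∀ n →
  real (∑< n (λ j → area (boxes Rs j))) Plane.≤ (Plane.s Plane.* size) Plane.* Plane.⟦ + length Rs ⟧ℤ
total-area Rs 0<size es n = Plane.≤-resp-≈ (Plane.sym (real-∑ (λ j → area (boxes Rs j)) (areas Rs) (area-boxes Rs) n)) Plane.refl (sum-areas Rs 0<size es n)

0<t : 0# Plane.< Plane.t
0<t = Plane.*-cancel-0< (Plane.0<ℕ 2) (Plane.<-respʳ (Plane.sym Plane.3t≈1) Plane.0<1)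

InClosed : ℂ → Set
InClosed z = Plane.InClosedHexagon (coords z)

null-without-generic : ∀ A → (∀ z → z ∈ A → InClosed z) → (∀ z → z ∈ A → ¬ Generic (coords z)) → Null A
null-without-generic A closed special ε 0<ε = cover (Plane.curve-cover ε₁ (Plane.*-0< (Plane.*-0< 0<t Plane.0<s) (0<real 0<ε)))
  where
  -- Imaginary parts are √3 times the second coordinate, so boxes have √3 times the area of their
  -- rectangles. The rectangles get the budget ε/√3 = (√3/3)ε.
  ε₁ = (Plane.t Plane.* Plane.s) Plane.* real ε
  cover : Plane.CoverOf ε₁ → Σ[ B ∈ (ℕ → Box) ] (∀ z → z ∈ A → ∃[ j ] z ∈ inside (B j)) × (∀ n → ∑< n (λ j → area (B j)) ≤ ε)
  cover κ = boxes rectangles , covered , bounded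
    where
    open Plane.CoverOf κ
    covered : ∀ z → z ∈ A → ∃[ j ] z ∈ inside (boxes rectangles j)
    covered z z∈A = boxes-cover rectangles z ([ (λ g → ⊥-elim (special z z∈A g)) , close ]′ (Plane.generic⊎close (coords z) δ 0<δ))
      where
      close : ∃[ c ] Plane.Within (slack c (coords z)) δ → Any (Plane.Inside (coords z)) rectangles
      close (c , w) = covers (coords z) (closed z z∈A) c w
    small : (Plane.s Plane.* size) Plane.* Plane.⟦ + length rectangles ⟧ℤ Plane.< real ε
    small = Plane.<-resp-≈
      (ring 3 (λ s a n → s :* (n :* a) := s :* a :* n) Plane.s size Plane.⟦ + length rectangles ⟧ℤ)
      (Plane.trans (ring 3 (λ s t e → s :* (t :* s :* e) := t :* s :* s :* e) Plane.s Plane.t (real ε))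
        (Plane.trans (Plane.*-congʳ Plane.tss≈1) (Plane.*-identityˡ (real ε))))
      (scale-< Plane.0<s total)
    bounded : ∀ n → ∑< n (λ j → area (boxes rectangles j)) ≤ ε
    bounded n h = Plane.<-irrefl Plane.refl (Plane.<-trans (real-< h) (Plane.≤-<-trans (total-area rectangles 0<size extents n) small))

-- On generic points the sets agree, so the symmetric difference contains none and lies in every
-- cover of the curves.
almost-equal : ∀ A B → (∀ z → z ∈ A → InClosed z) → (∀ z → z ∈ B → InClosed z) →
  (∀ z → Generic (coords z) → z ∈ A → z ∈ B) → (∀ z → Generic (coords z) → z ∈ B → z ∈ A) → A ≐ᵃᵉ B
almost-equal A B closedA closedB A⊆B B⊆A = null-without-generic _
  (λ z → [ (λ (z∈A , _) → closedA z z∈A) , (λ (z∈B , _) → closedB z z∈B) ]′)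
  (λ z → [ (λ (z∈A , z∉B) g → z∉B (A⊆B z g z∈A)) , (λ (z∈B , z∉A) g → z∉A (B⊆A z g z∈B)) ]′)

-- Generic points: from weak to strict conditions, and from regions to pieces

generic-strict : ∀ {p} → Generic p → ∀ c → 0# Plane.≤ slack c p → Holds c p
generic-strict g c h = [ (λ k → k) , (λ k → ⊥-elim (h k)) ]′ (g c)

generic-region : ∀ {p} → Generic p → ∀ s → Plane.WeakRegion s p → Plane.Region s p
generic-region g s (h , hs) = (λ k → generic-strict g (H k) (h k)) , All.map (λ {c} → generic-strict g c) hs

back-H : ∀ n k → ∃[ j ] back n (H k) ≡ H j
back-H zero    k = k , refl
back-H (suc n) k = back-H n (prev k)

closed-rotated : ∀ n {z w} → coords z ≈ₚ turns n (coords w) → InClosed w → InClosed z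
closed-rotated n {z} {w} e h k = via (back-H n k)
  where
  via : ∃[ j ] back n (H k) ≡ H j → 0# Plane.≤ slack (H k) (coords z)
  via (j , f) = Plane.≤-respʳ (Plane.trans (Plane.reflexive (cong (λ c → slack c (coords w)) (sym f))) (Plane.sym (Plane.rotated n e (H k)))) (h j)

U-closed : ∀ z → z ∈ U → InClosed z
U-closed z h = closed (U⇒lies z h)
  where
  closed : ∃[ b ] Lies b (coords z) → InClosed z
  closed (b , l) = Plane.lies⇒closed {b} l

data InPiece (k ℓ : Fin 6) (z : ℂ) : Set where
  in-piece : ∀ w → InClosed w → Plane.Defining k (coords w) → coords z ≈ₚ turns (toℕ ℓ) (coords w) → InPiece k ℓ z

V⇒piece : ∀ k ℓ z → z ∈ V[ k , ℓ ] → InPiece k ℓ z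
V⇒piece k ℓ z (w , h , e) = go (V-cut⇒ k w h)
  where
  go : w ∈ U × w ∈ V-cut k → InPiece k ℓ z
  go (u , d) = in-piece w (U-closed w u) (matches⇒ (V-matches k) w d) (≈ₚ-trans (coords-cong e) (coords-ζ^ (toℕ ℓ) w))

piece⇒V : ∀ k ℓ z w → InHexagon (coords w) → Plane.Defining k (coords w) → coords z ≈ₚ turns (toℕ ℓ) (coords w) → z ∈ V[ k , ℓ ]
piece⇒V k ℓ z w h d e = w , V-cut⇐ k w (hexagon⇒U w h) (matches⇐ (V-matches k) w d) , coords-injective (≈ₚ-trans e (≈ₚ-sym (coords-ζ^ (toℕ ℓ) w)))

generic-rotated : ∀ n {z w} → coords z ≈ₚ turns n (coords w) → Generic (coords z) → Generic (coords w)
generic-rotated n {z} {w} e = Plane.rotated-generic {n} {coords w} {coords z} (Plane.rotated n e)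

-- Rotate the point into the sector of the triangle 0, 1, ζ and read off its piece from three signs.
-- As conditions have constant sign on a piece, their truth at this one point is the entry of the
-- Boolean table that selects the piece.
region⇒pieces : ∀ s z → Generic (coords z) → Plane.Region s (coords z) → z ∈ ⋃V (pieces s)
region⇒pieces s z g (hex , hs) = sector (Plane.find-sector g)
  where
  sector : ∃[ ℓ ] 0# Plane.< slack (forth (toℕ {6} ℓ) (P 5F)) (coords z) × 0# Plane.< slack (forth (toℕ ℓ) (P 1F)) (coords z) → z ∈ ⋃V (pieces s)
  sector (ℓ , h₅ , h₁) = piece (Plane.classify {coords w} hexw (generic-rotated n {z} {w} e g)
      (Plane.<-respʳ (Plane.slack-forth n e (P 5F)) h₅ , Plane.<-respʳ (Plane.slack-forth n e (P 1F)) h₁))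
    where
    n = toℕ ℓ
    w = unturned n z
    e : coords z ≈ₚ turns n (coords w)
    e = turns-unturned n z
    hexw : InHexagon (coords w)
    hexw = Plane.rotated-hexagon {n} {coords w} {coords z} (Plane.rotated n e) hex
    piece : ∃[ k ] Plane.OnPiece k (coords w) × Plane.Defining k (coords w) → z ∈ ⋃V (pieces s)
    piece (k , o , d) = lose (∈-pieces⁺ s k ℓ (Plane.holdsOn-complete {k} {n} {coords w} {coords z} hexw o (Plane.rotated n e) (extras s) hs))
      (piece⇒V k ℓ z w hexw d e)

pieces⇒region : ∀ s z → Generic (coords z) → z ∈ ⋃V (pieces s) → Plane.Region s (coords z)
pieces⇒region s z g z∈ = go (find z∈)
  where
  go : ∃[ kℓ ] kℓ ∈ˡ pieces s × z ∈ V[ proj₁ kℓ , proj₂ kℓ ] → Plane.Region s (coords z)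
  go ((k , ℓ) , kℓ∈ , h) = piece (V⇒piece k ℓ z h)
    where
    piece : InPiece k ℓ z → Plane.Region s (coords z)
    piece (in-piece w closed d e) = Plane.unrotated-hexagon (toℕ ℓ) e hexw ,
      Plane.holdsOn-sound {k} {toℕ ℓ} {coords w} {coords z} hexw (Plane.defining⇒on-piece {coords w} hexw gw k d) (Plane.rotated (toℕ ℓ) e) (extras s) (∈-pieces⁻ s k ℓ kℓ∈)
      where
      gw : Generic (coords w)
      gw = generic-rotated (toℕ ℓ) {z} {w} e g
      hexw : InHexagon (coords w)
      hexw j = generic-strict gw (H j) (closed j)

pieces-closed : ∀ s z → z ∈ ⋃V (pieces s) → InClosed z
pieces-closed s z z∈ = go (find z∈)
  where
  go : ∃[ kℓ ] kℓ ∈ˡ pieces s × z ∈ V[ proj₁ kℓ , proj₂ kℓ ] → InClosed z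
  go ((k , ℓ) , _ , h) = piece (V⇒piece k ℓ z h)
    where
    piece : InPiece k ℓ z → InClosed z
    piece (in-piece w closed d e) = closed-rotated (toℕ ℓ) {z} {w} e closed

-- The two bounds meet here: interior points satisfy the strict conditions, and the set where these
-- hold is open and contained in the range.
range-matches : ∀ n (a : Vector ℂ n) J → Matches (Interior (Range a)) (Plane.RegionOf (rangeState n a J))
range-matches n a J = matches
  (λ z h → range-interior n a J z (interior⇒neighbourhood {Range a} {z} h))
  (λ z h → neighbourhood⇒interior {Range a} {z} (neighbourhood-map {λ w → Plane.RegionOf (rangeState n a J) (coords w)} {Range a} {z}
    (region⇒range n a J) (near⇒neighbourhood {Plane.RegionOf (rangeState n a J)} {z} (open-at (rangeState n a J) (coords z) h))))
  where
  open-at : ∀ ms p → Plane.RegionOf ms p → Plane.Near p (Plane.RegionOf ms)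
  open-at (just s) p h = Plane.region-open s p h

Is : ∀ n (a : Vector ℂ n) → (∀ i → a i ∈ 𝒥) → State → Set
Is n a J s = rangeState n a J ≡ just s

admissible⇒state : ∀ n (a : Vector ℂ n) J → Admissible a → ∃[ s ] Is n a J s
admissible⇒state n a J adm = go (admissible⇒region n a J adm)
  where
  is-just : ∀ ms {p} → Plane.RegionOf ms p → ∃[ s ] ms ≡ just s
  is-just (just s) _ = s , refl
  go : ∃[ w ] Plane.RegionOf (rangeState n a J) (coords w) → ∃[ s ] Is n a J s
  go (w , h) = is-just (rangeState n a J) {coords w} h

state-matches : ∀ n (a : Vector ℂ n) J s → Is n a J s → Matches (Interior (Range a)) (Plane.Region s)
state-matches n a J s e = subst (λ ms → Matches (Interior (Range a)) (Plane.RegionOf ms)) e (range-matches n a J)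

module _ {n} (a : Vector ℂ n) (J : ∀ i → a i ∈ 𝒥) (s : State) (e : Is n a J s) where

  weak : ∀ z → z ∈ Range a → Plane.WeakRegion s (coords z)
  weak z h = subst (λ ms → Plane.WeakRegionOf ms (coords z)) e (range-weak n a J z h)

  range-closed : ∀ z → z ∈ Range a → InClosed z
  range-closed z h = proj₁ (weak z h)

  range⇒region : ∀ z → Generic (coords z) → z ∈ Range a → Plane.Region s (coords z)
  range⇒region z g h = generic-region g s (weak z h)

  region⇒member : ∀ z → Plane.Region s (coords z) → z ∈ Range a
  region⇒member z h = region⇒range n a J z (subst (λ ms → Plane.RegionOf ms (coords z)) (sym e) h)

  range-U : ∀ k ℓ → s ≡ stateOf k ℓ → Range a ≐ᵃᵉ U[ k , ℓ ]
  range-U k ℓ f = almost-equal (Range a) U[ k , ℓ ] range-closed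
    (λ z h j → Plane.<⇒≤ (proj₁ (matches⇒ (U-matches k ℓ) z h) j))
    (λ z g h → matches⇐ (U-matches k ℓ) z (subst (λ s → Plane.Region s (coords z)) f (range⇒region z g h)))
    (λ z g h → region⇒member z (subst (λ s → Plane.Region s (coords z)) (sym f) (matches⇒ (U-matches k ℓ) z h)))

  range-V : Range a ≐ᵃᵉ ⋃V (pieces s)
  range-V = almost-equal (Range a) (⋃V (pieces s)) range-closed (pieces-closed s)
    (λ z g h → region⇒pieces s z g (range⇒region z g h))
    (λ z g h → region⇒member z (pieces⇒region s z g h))

-- Applied by contraposition: a range in the state `whole` is full, so a range that is not full is
-- in one of the thirty other states.
not-full : ∀ n (a : Vector ℂ n) J → Is n a J whole → Full a
not-full n a J e = matches-≐ {Interior (Range a)} {U₀} {InHexagon}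
  (matches-map {Interior (Range a)} {Plane.Region whole} {InHexagon} (λ p → proj₁) (λ p h → h , []) (state-matches n a J whole e)) U₀-matches

-- Every state is reached by an admissible sequence

≈ᶜ-refl : ∀ z → z ≈ᶜ z
≈ᶜ-refl z = coords-injective {z} {z} ≈ₚ-refl

opaque
  realise : ∀ p → ∃[ z ] Σ[ h ∈ z ∈ 𝒥 ] index {z} h ≡ p
  realise (m , n) = build (fromℝ (fromℤ m) +ᶜ fromℤ n • ζ) (≈ᶜ-refl (fromℝ (fromℤ m) +ᶜ fromℤ n • ζ))
    (η *ᶜ (fromℝ (fromℤ m) +ᶜ fromℤ n • ζ)) (≈ᶜ-refl (η *ᶜ (fromℝ (fromℤ m) +ᶜ fromℤ n • ζ)))
    where
    build : ∀ w → w ≈ᶜ fromℝ (fromℤ m) +ᶜ fromℤ n • ζ → ∀ z → z ≈ᶜ η *ᶜ w → ∃[ z ] Σ[ h ∈ z ∈ 𝒥 ] index {z} h ≡ (m , n)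
    build w e z f = z , (w , (m , n , e) , f) , refl

element : ℤ × ℤ → ℂ
element p = proj₁ (realise p)

element-∈ : ∀ p → element p ∈ 𝒥
element-∈ p = proj₁ (proj₂ (realise p))

index-element : ∀ p → index {element p} (element-∈ p) ≡ p
index-element p = proj₂ (proj₂ (realise p))

walk : ∀ n → (Fin n → ℤ × ℤ) → Maybe State
walk zero    f = just whole
walk (suc n) f = advance (f (fromℕ n)) (walk n (λ i → f (inject₁ i)))

walk-state : ∀ n (f : Fin n → ℤ × ℤ) → rangeState n (λ i → element (f i)) (λ i → element-∈ (f i)) ≡ walk n f
walk-state zero    f = refl
walk-state (suc n) f = cong₂ advance (index-element (f (fromℕ n))) (walk-state n (λ i → f (inject₁ i)))

-- For (m , n) = unit k the points η(m + nζ) are the six lattice points nearest to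
-- 0; for distant k the point lies further out, with λ_k = 1.
unit distant : Fin 6 → ℤ × ℤ
unit 0F = + 1 , + 0
unit 1F = + 0 , + 1
unit 2F = -[1+ 0 ] , + 1
unit 3F = -[1+ 0 ] , + 0
unit 4F = + 0 , -[1+ 0 ]
unit 5F = + 1 , -[1+ 0 ]
distant 0F = + 2 , -[1+ 2 ]
distant 1F = + 3 , -[1+ 0 ]
distant 2F = + 1 , + 2
distant 3F = -[1+ 1 ] , + 3
distant 4F = -[1+ 2 ] , + 1
distant 5F = -[1+ 0 ] , -[1+ 1 ]

-- The first digit produces `cut₁ (opposite (opp k))`. Inversion sends its circle to the one that
-- the second digit, in the direction `opp k`, translates to the inner circle of `cut₂ k`. A third
-- digit then yields the half regions.
path₂ : Fin 6 → Vec (ℤ × ℤ) 2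
path₂ k = unit (opp (opposite (opp k))) ∷ unit (opp k) ∷ []

path : State → ∃[ n ] Vec (ℤ × ℤ) (suc n)
path whole     = 0 , (+ 1 , + 1) ∷ []
path (cut₁ k)  = 0 , unit (opp k) ∷ []
path (cut₂ k)  = 1 , path₂ k
path (half k)  = 2 , path₂ (opposite (opp k)) Vec.∷ʳ distant (opp k)
path (half⁺ k) = 2 , path₂ (opposite (opp k)) Vec.∷ʳ unit (next (opp k))
path (half⁻ k) = 2 , path₂ (opposite (opp k)) Vec.∷ʳ unit (prev (opp k))

walk-path : ∀ s → walk (suc (proj₁ (path s))) (Vec.lookup (proj₂ (path s))) ≡ just s
walk-path whole = refl
walk-path (cut₁ 0F) = refl
walk-path (cut₁ 1F) = refl
walk-path (cut₁ 2F) = refl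
walk-path (cut₁ 3F) = refl
walk-path (cut₁ 4F) = refl
walk-path (cut₁ 5F) = refl
walk-path (cut₂ 0F) = refl
walk-path (cut₂ 1F) = refl
walk-path (cut₂ 2F) = refl
walk-path (cut₂ 3F) = refl
walk-path (cut₂ 4F) = refl
walk-path (cut₂ 5F) = refl
walk-path (half 0F) = refl
walk-path (half 1F) = refl
walk-path (half 2F) = refl
walk-path (half 3F) = refl
walk-path (half 4F) = refl
walk-path (half 5F) = refl
walk-path (half⁺ 0F) = refl
walk-path (half⁺ 1F) = refl
walk-path (half⁺ 2F) = refl
walk-path (half⁺ 3F) = refl
walk-path (half⁺ 4F) = refl
walk-path (half⁺ 5F) = refl
walk-path (half⁻ 0F) = refl
walk-path (half⁻ 1F) = refl
walk-path (half⁻ 2F) = refl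
walk-path (half⁻ 3F) = refl
walk-path (half⁻ 4F) = refl
walk-path (half⁻ 5F) = refl

private
  reduceₜ : ∀ {a b} f → a Plane.≈ b Plane.+ (3# Plane.* Plane.t Plane.- 1#) Plane.* f → 0# Plane.< b → 0# Plane.< a
  reduceₜ {a} {b} f e = Plane.<-respʳ (Plane.sym (Plane.trans e (Plane.trans (Plane.+-congˡ (Plane.trans
    (Plane.*-congʳ (Plane.trans (Plane.+-congʳ Plane.3t≈1) (ring 0 (κ1 :- κ1 := κ0)))) (ring 1 (λ f → κ0 :* f := κ0) f))) (Plane.+-identityʳ b))))

  0<2t : 0# Plane.< Plane.t Plane.+ Plane.t
  0<2t = Plane.+-0< 0<t 0<t
  0<1+t : 0# Plane.< 1# Plane.+ Plane.t
  0<1+t = Plane.+-0< Plane.0<1 0<t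
  0<3tt : 0# Plane.< 3# Plane.* (Plane.t Plane.* Plane.t)
  0<3tt = Plane.*-0< (Plane.0<ℕ 2) (Plane.*-0< 0<t 0<t)

-- The point √-3/3 lies in the first four base regions, the point 1/3 in the fifth; rotations supply
-- the others.
upper right-point : Point
upper = 0# , Plane.t
right-point = Plane.t , 0#

upper-hexagon : InHexagon upper
upper-hexagon 0F = reduceₜ (Plane.- 1#) (ring 1 (λ t → κ1 :- (κ0 :+ t) := (t :+ t) :+ (κ3 :* t :- κ1) :* (:- κ1)) Plane.t) 0<2t
upper-hexagon 1F = reduceₜ (Plane.- 1#) (ring 1 (λ t → κ1 :- (t :+ t) := t :+ (κ3 :* t :- κ1) :* (:- κ1)) Plane.t) 0<t
upper-hexagon 2F = reduceₜ (Plane.- 1#) (ring 1 (λ t → κ1 :- (t :- κ0) := (t :+ t) :+ (κ3 :* t :- κ1) :* (:- κ1)) Plane.t) 0<2t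
upper-hexagon 3F = Plane.<-respʳ (ring 1 (λ t → κ1 :+ t := κ1 :- :- (κ0 :+ t)) Plane.t) 0<1+t
upper-hexagon 4F = Plane.<-respʳ (ring 1 (λ t → κ1 :+ t :+ t := κ1 :- :- (t :+ t)) Plane.t) (Plane.+-0< 0<1+t 0<t)
upper-hexagon 5F = Plane.<-respʳ (ring 1 (λ t → κ1 :+ t := κ1 :- (κ0 :- t)) Plane.t) 0<1+t

right-hexagon : InHexagon right-point
right-hexagon 0F = reduceₜ (Plane.- 1#) (ring 1 (λ t → κ1 :- (t :+ κ0) := (t :+ t) :+ (κ3 :* t :- κ1) :* (:- κ1)) Plane.t) 0<2t
right-hexagon 1F = Plane.<-respʳ (ring 0 (κ1 := κ1 :- (κ0 :+ κ0))) Plane.0<1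
right-hexagon 2F = Plane.<-respʳ (ring 1 (λ t → κ1 :+ t := κ1 :- (κ0 :- t)) Plane.t) 0<1+t
right-hexagon 3F = Plane.<-respʳ (ring 1 (λ t → κ1 :+ t := κ1 :- :- (t :+ κ0)) Plane.t) 0<1+t
right-hexagon 4F = Plane.<-respʳ (ring 0 (κ1 := κ1 :- :- (κ0 :+ κ0))) Plane.0<1
right-hexagon 5F = reduceₜ (Plane.- 1#) (ring 1 (λ t → κ1 :- (t :- κ0) := (t :+ t) :+ (κ3 :* t :- κ1) :* (:- κ1)) Plane.t) 0<2t

upper-P : Holds (P 2F) upper
upper-P = Plane.<-respʳ (ring 1 (λ t → t := t :- κ0) Plane.t) 0<t
upper-O : Holds (O 3F) upper
upper-O = Plane.<-respʳ (ring 1 (λ t → (κ1 :+ t :+ t) :+ κ3 :* (t :* t) := (κ0 :* κ0 :+ κ3 :* (t :* t)) :+ κ1 :- (:- (κ0 :+ t) :+ :- (κ0 :+ t))) Plane.t)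
  (Plane.+-0< (Plane.+-0< 0<1+t 0<t) 0<3tt)
upper-C : Holds (C 3F) upper
upper-C = Plane.<-respʳ (ring 1 (λ t → t :+ κ3 :* (t :* t) := (κ0 :* κ0 :+ κ3 :* (t :* t)) :- :- (κ0 :+ t)) Plane.t) (Plane.+-0< 0<t 0<3tt)
right-P : Holds (P 5F) right-point
right-P = Plane.<-respʳ (ring 1 (λ t → t := t :- κ0) Plane.t) 0<t
right-O : Holds (O 4F) right-point
right-O = Plane.<-respʳ (ring 1 (λ t → κ1 :+ t :* t := (t :* t :+ κ3 :* (κ0 :* κ0)) :+ κ1 :- (:- (κ0 :+ κ0) :+ :- (κ0 :+ κ0))) Plane.t)
  (Plane.+-0< Plane.0<1 (Plane.*-0< 0<t 0<t))

base-inhabited : ∀ k → ∃[ p ] Plane.Region (baseState k) p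
base-inhabited 0F = upper , upper-hexagon , upper-O ∷ []
base-inhabited 1F = upper , upper-hexagon , upper-C ∷ []
base-inhabited 2F = upper , upper-hexagon , upper-P ∷ []
base-inhabited 3F = upper , upper-hexagon , upper-P ∷ upper-O ∷ []
base-inhabited 4F = right-point , right-hexagon , right-P ∷ right-O ∷ []

region-inhabited : ∀ s → ∃[ p ] Plane.Region s p
region-inhabited s = cases (state-cases s)
  where
  turned : ∀ k ℓ → ∃[ p ] Plane.Region (baseState k) p → ∃[ p ] Plane.Region (stateOf k ℓ) p
  turned k ℓ (p , h) = turns (toℕ ℓ) p , Plane.region-turns⇒ (toℕ ℓ) {turns (toℕ ℓ) p} {p} ≈ₚ-refl (baseState k) h
  cases : s ≡ whole ⊎ ∃[ k ] ∃[ ℓ ] s ≡ stateOf k ℓ → ∃[ p ] Plane.Region s p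
  cases (inj₁ e)           = subst (λ s → ∃[ p ] Plane.Region s p) (sym e) (upper , upper-hexagon , [])
  cases (inj₂ (k , ℓ , e)) = subst (λ s → ∃[ p ] Plane.Region s p) (sym e) (turned k ℓ (base-inhabited k))

region-cong : ∀ s {p q} → p ≈ₚ q → Plane.Region s p → Plane.Region s q
region-cong s e (hex , hs) = hexagon-cong e hex , All.map (λ {c} → Plane.<-respʳ (slack-cong c e)) hs

-- The finite range structure

states : List State
states = whole ∷ map cut₁ indices ++ map cut₂ indices ++ map half indices ++ map half⁺ indices ++ map half⁻ indices

∈-states : ∀ s → s ∈ˡ states
∈-states whole     = here refl
∈-states (cut₁ k)  = there (∈-++⁺ˡ (∈-map⁺ cut₁ (∈-indices k)))
∈-states (cut₂ k)  = there (∈-++⁺ʳ (map cut₁ indices) (∈-++⁺ˡ (∈-map⁺ cut₂ (∈-indices k))))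
∈-states (half k)  = there (∈-++⁺ʳ (map cut₁ indices) (∈-++⁺ʳ (map cut₂ indices) (∈-++⁺ˡ (∈-map⁺ half (∈-indices k)))))
∈-states (half⁺ k) = there (∈-++⁺ʳ (map cut₁ indices) (∈-++⁺ʳ (map cut₂ indices) (∈-++⁺ʳ (map half indices) (∈-++⁺ˡ (∈-map⁺ half⁺ (∈-indices k))))))
∈-states (half⁻ k) = there (∈-++⁺ʳ (map cut₁ indices) (∈-++⁺ʳ (map cut₂ indices) (∈-++⁺ʳ (map half indices) (∈-++⁺ʳ (map half⁺ indices) (∈-map⁺ half⁻ (∈-indices k))))))

RegionIn : State → Region
RegionIn s z = Plane.Region s (coords z)

region-matches : ∀ s → Matches (RegionIn s) (Plane.Region s)
region-matches s = matches (λ z h → h) (λ z h → h)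

family⇒state : ∀ {S} → S ∈ RangeFamily → ∃[ s ] S ≐ RegionIn s
family⇒state {S} (n , a , _ , J , adm , S≐) = go (admissible⇒state n a J adm)
  where
  go : ∃[ s ] Is n a J s → ∃[ s ] S ≐ RegionIn s
  go (s , e) = s , matches-≐ {S} {RegionIn s} {Plane.Region s} (≐-matches {S} {Interior (Range a)} S≐ (state-matches n a J s e)) (region-matches s)

state⇒family : ∀ {S} s → S ≐ RegionIn s → S ∈ RangeFamily
state⇒family {S} s S≐ = n , a , ℕ.s≤s ℕ.z≤n , J , admissible (region-inhabited s) ,
  matches-≐ {S} {Interior (Range a)} {Plane.Region s} (≐-matches {S} {RegionIn s} S≐ (region-matches s)) (state-matches n a J s is)
  where
  n = suc (proj₁ (path s))
  f : Fin n → ℤ × ℤ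
  f = Vec.lookup (proj₂ (path s))
  a : Vector ℂ n
  a i = element (f i)
  J : ∀ i → a i ∈ 𝒥
  J i = element-∈ (f i)
  is : Is n a J s
  is = trans (walk-state n f) (walk-path s)
  admissible : ∃[ p ] Plane.Region s p → Admissible a
  admissible (p , h) = region⇒admissible n a J (point p)
    (subst (λ ms → Plane.RegionOf ms (coords (point p))) (sym is) (region-cong s (≈ₚ-sym (coords-point p)) h))

-- The list characterises the family by an equivalence, so it may contain only sets that occur. This
-- is why each of the 31 states is given a path and an inhabitant.
finite-family : FiniteFamily RangeFamily
finite-family = map RegionIn states , λ S → mk⇔ (λ h → listed {S} (family⇒state {S} h)) (λ h → realised {S} (Any.satisfied (Any.map⁻ {f = RegionIn} {P = S ≐_} {xs = states} h)))
  where
  listed : ∀ {S} → ∃[ s ] S ≐ RegionIn s → Any (S ≐_) (map RegionIn states)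
  listed {S} (s , e) = Any.map⁺ {f = RegionIn} {P = S ≐_} (lose (∈-states s) e)
  realised : ∀ {S} → ∃[ s ] S ≐ RegionIn s → S ∈ RangeFamily
  realised {S} (s , e) = state⇒family {S} s e

theorem2 : (∀ (n : ℕ) (a : Vector ℂ n) → 1 ℕ.≤ n → (∀ i → a i ∈ 𝒥) → Admissible a → ¬ Full a →
             (∃[ k ] ∃[ ℓ ] Range a ≐ᵃᵉ U[ k , ℓ ]) ×
             (Σ[ L ∈ List (Fin 6 × Fin 6) ] Range a ≐ᵃᵉ ⋃V L)) ×
           FiniteFamily RangeFamily
theorem2 = described , finite-family
  where
  described : ∀ (n : ℕ) (a : Vector ℂ n) → 1 ℕ.≤ n → (∀ i → a i ∈ 𝒥) → Admissible a → ¬ Full a →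
             (∃[ k ] ∃[ ℓ ] Range a ≐ᵃᵉ U[ k , ℓ ]) ×
             (Σ[ L ∈ List (Fin 6 × Fin 6) ] Range a ≐ᵃᵉ ⋃V L)
  described n a _ J adm proper = go (admissible⇒state n a J adm)
    where
    go : ∃[ s ] Is n a J s → (∃[ k ] ∃[ ℓ ] Range a ≐ᵃᵉ U[ k , ℓ ]) × (Σ[ L ∈ List (Fin 6 × Fin 6) ] Range a ≐ᵃᵉ ⋃V L)
    go (s , e) = cases (state-cases s)
      where
      cases : s ≡ whole ⊎ ∃[ k ] ∃[ ℓ ] s ≡ stateOf k ℓ →
        (∃[ k ] ∃[ ℓ ] Range a ≐ᵃᵉ U[ k , ℓ ]) × (Σ[ L ∈ List (Fin 6 × Fin 6) ] Range a ≐ᵃᵉ ⋃V L)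
      cases (inj₁ f)           = ⊥-elim (proper (not-full n a J (trans e (cong just f))))
      cases (inj₂ (k , ℓ , f)) = (k , ℓ , range-U a J s e k ℓ f) , (pieces s , range-V a J s e)
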